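{- Fix $n\ge 4$, set $M=\binom n2$, and let $d\le 2n-8$ be an integer. Put $\ell=\left\lfloor\frac{M-d}{2}\right\rfloor$. The Dyck sequences of length $n$, deficit $d$, and area at most $\ell$ are partitioned into strings \[ \mathcal S(S)=\bigl\{S,\mathrm{up}(S),\mathrm{up}^2(S),\ldots,\mathrm{up}^{\ell-\mathrm{area}(S)}(S)\bigr\}, \] where $S$ ranges over the special Dyck skeletons of length $n$, deficit $d$, and area at most $\ell$.
   Context: BASICS. Sequences are finite integer sequences indexed from $0$; $A:B$ is concatenation. A sequence is affine Dyck if $x_{i+1}\le x_i+1$ for all $i$, and reverse Dyck if $x_{i+1}\ge x_i-1$ for all $i$. A Dyck sequence is a nonempty affine Dyck sequence with first entry $0$ and nonnegative entries. For a sequence $x$ of length $n$: $\mathrm{di}(x)=\#\{i<j:x_i=x_j+1\}$, $\mathrm{area}(x)=\sum_i x_i$, $\mathrm{dinv}(x)=\#\{i<j:x_i=x_j\text{ or }x_i=x_j+1\}$; the deficit is $\mathrm{defc}(x)=\binom n2-\mathrm{area}(x)-\mathrm{dinv}(x)$. In a Dyck sequence $C=(c_0,\ldots,c_{r-1})$, index $j$ is eligible if there is exactly one $i<j$ with $c_i=c_j-1$ and, if $j+1<r$, $c_{j+1}\le c_j$. The (leftmost-)extractable element is the entry at the leftmost eligible index, if one exists; extracting it means deleting it (the remainder is again a Dyck sequence). A full Dyck skeleton is a Dyck sequence with no eligible index. Let $\omega_n=(0,\ldots,0,1)$ ($n-1$ zeros) and $\epsilon_n=(0,0,1,0,\ldots,0,1)$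 ($n-4$ zeros between the two $1$'s). A special Dyck skeleton of length $n\ge4$ is a full Dyck skeleton of length $n$ other than $\epsilon_n$. Injecting $e$ into a Dyck sequence $C$ ($1\le e\le\max(C)+1$) means inserting $e$ immediately after the first position $p$ with $C[p]=e-1$. Injecting a list from right to left means injecting its last entry first, then the next-to-last into the result, and so on. THE MAPS fw, bk. For a word $Y$, $Y|_{\{k,k+1\}}$ is the subword of entries equal to $k$ or $k+1$; the rank of an occurrence of $k+1$ in this subword is the number of $k$'s preceding it. $\mathrm{fw}$ sends a reverse Dyck word to an affine Dyck word, $\mathrm{bk}$ sends an affine Dyck word to a reverse Dyck word, as follows (translate by a common constant so all entries are in $[0,M']$, apply, translate back; the result does not depend on choices). If $M'\le1$ both are the identity. If $M'\ge2$: for $k=M'-1,\ldots,1$ in turn record $B_k=Y|_{\{k,k+1\}}$ for the current word $Y$, and delete all entries $k+1$; a word in $\{0,1\}$ remains. Then for $k=1,\ldots,M'-1$ in turn reinsert the $(k+1)$'s: for $\mathrm{fw}$, in their order in $B_k$, each at the leftmost position, to the right of previously inserted $(k+1)$'s, giving it its rank in $B_k$; for $\mathrm{bk}$, processed from right to left, each at the rightmost position, to the left of previously inserted $(k+1)$'s, giving it its rank in $B_k$. On two entries: $\mathrm{bk}(a,b)=(b,a)$ if $a>b+1$, else $(a,b)$; $\mathrm{fw}(a,b)=(b,a)$ if $b>a+1$, else $(a,b)$. THE MAP East. A multiset of seven integers is far-apart decomposable if its seven occurrences can be partitioned into three pairs and a singleton with $|a-b|\ge2$ for each pair $\{a,b\}$.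 Let $x=(x_{ -3},x_{ -2},x_{ -1},x_0,x_1,x_2,x_3)$ have non-far-apart-decomposable multiset of entries, with $(x_{ -3},x_{ -2},x_{ -1},x_0)$ affine Dyck and $(x_1,x_2,x_3)$ reverse Dyck. $\mathrm{East}(x)$ is given by the first applicable case. Case 1: if $x_0\le x_1+1$, $\mathrm{East}(x)=x$. Case 2: otherwise let $(y_{ -1},y_0)=\mathrm{bk}(x_{ -1},x_0)$. 2a: if $x_{ -1}>x_1+1$ and $y_0\le x_2+1$, $\mathrm{East}(x)=(x_{ -3},x_{ -2},x_1,y_{ -1},y_0,x_2,x_3)$. 2b: else if $x_{ -1}\le x_1+1$ and $x_{ -1}\le x_2+1$, $\mathrm{East}(x)=(x_{ -3},x_{ -2},x_1,x_0,x_{ -1},x_2,x_3)$. Case 3: else if $\min(x_{ -2},x_{ -1},x_0)>\max(x_1,x_2)+1$, put $(u_{ -2},u_{ -1})=\mathrm{fw}(x_1,x_2)$, $(u_0,u_1,u_2)=\mathrm{bk}(x_{ -2},x_{ -1},x_0)$ and $\mathrm{East}(x)=(x_{ -3},u_{ -2},u_{ -1},u_0,u_1,u_2,x_3)$. Case 4: else translate all entries so that $\max(x_1,x_2)=2$, keep $x_{ -3},x_3$, replace the middle five entries $[x_{ -2},x_{ -1},x_0,x_1,x_2]$ by the following table, and translate back: $[3,3,4,1,2]\mapsto[1,2,4,3,3]$; $[3,4,4,1,2]\mapsto[1,2,4,3,4]$; $[4,3,4,1,2]\mapsto[1,2,4,4,3]$; $[2,3,4,1,2]\mapsto[1,2,4,3,2]$;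 $[3,3,4,2,1]\mapsto[2,1,4,3,3]$; $[3,4,4,2,1]\mapsto[2,1,4,3,4]$; $[4,3,4,2,1]\mapsto[2,1,4,4,3]$; $[2,3,4,2,1]\mapsto[2,1,4,3,2]$; $[3,4,4,2,2]\mapsto[2,2,4,4,3]$; $[3,4,5,2,2]\mapsto[2,2,5,4,3]$; and for $o\le0$: $[3,3,4,o,2]\mapsto[2,o,4,3,3]$; $[3,4,4,o,2]\mapsto[2,o,4,3,4]$; $[4,3,4,o,2]\mapsto[2,o,4,4,3]$; $[2,3,4,o,2]\mapsto[2,o,2,4,3]$; $[3,4,2,o,2]\mapsto[2,o,4,3,2]$. $\mathrm{East}_3$ on $(u_{ -1},u_0,u_1)$ succeeds, returning the same window, exactly when $u_0\le u_1+1$. $\mathrm{East}_5$ (used only after the $\mathrm{East}_3$ test failed) acts on $(x_{ -2},x_{ -1},x_0,x_1,x_2)$ by the middle part of Cases 2a and 2b: under the condition of 2a it returns $(x_{ -2},x_1,y_{ -1},y_0,x_2)$, else under that of 2b it returns $(x_{ -2},x_1,x_0,x_{ -1},x_2)$, and otherwise it is undefined (does not succeed). $\mathrm{East}_7=\mathrm{East}$. THE MAP up. For a Dyck sequence $x$ of length $n\ge4$, $\mathrm{up}(x)$ is given by the following cases, checked in order; it is undefined if a required extraction, local move or injection is undefined (failure of $\mathrm{East}_3$ or $\mathrm{East}_5$ only passes to the next stage). (1) If $x=\omega_n$, $\mathrm{up}(x)=\epsilon_n$. (2) If $x$ is a full Dyck skeleton and $x\ne\omega_n$, remove the final entry $x_{n-1}$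 and inject $x_{n-1}+1$ into $(x_0,\ldots,x_{n-2})$, immediately after the first occurrence of $x_{n-1}$. (3) Otherwise extract the extractable element $e_1$ of $x$, leaving $C_1$, and form $\sigma_1=C_1:(e_1-1)$. If $\mathrm{East}_3$ succeeds on the final three entries of $\sigma_1$, remove the final two entries of $\sigma_1$, add $1$ to each, and inject them from right to left into the remaining prefix. (4) Otherwise extract the extractable element $e_2$ of $C_1$, leaving $C_2$, and form $\sigma_2=C_2:(e_1-1):(e_2-1)$. If $\mathrm{East}_5$ succeeds on the final five entries, replace them by its output, remove the final three entries, add $1$ to each, and inject them from right to left into the remaining prefix. (5) Otherwise extract the extractable element $e_3$ of $C_2$, leaving $C_3$, and form $\sigma_3=C_3:(e_1-1):(e_2-1):(e_3-1)$. Replace the final seven entries by their image under $\mathrm{East}_7$, remove the final four entries, add $1$ to each, and inject them from right to left into the remaining prefix. -}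

module Defs where

open import Agda.Builtin.FromNat using (Number; fromNat)
open import Data.Bool.Base using (if_then_else_)
open import Data.Fin.Base using (Fin; toℕ)
import Data.Fin.Properties as Fin
open import Data.Integer.Base using (ℤ; +_; _+_; _-_; _≤_; _⊔_; _⊓_; ∣_∣)
import Data.Integer.Literals as ℤ
open import Data.Integer.Properties using (_≟_; _≤?_; _<?_; ≤-totalOrder)
open import Data.List.Base
  using (List; []; _∷_; _++_; [_]; map; filter; foldl; foldr; length; lookup;
         take; drop; head; last; upTo; allFin; removeAt; replicate)
open import Data.List.Extrema ≤-totalOrder using (min; max)
import Data.List.Properties as List
open import Data.List.Relation.Unary.All as All using (All)
open import Data.List.Relation.Unary.Linked using (Linked; linked?)
open import Data.Maybe.Base as Maybe using (Maybe; just; nothing; maybe′; _>>=_)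
import Data.Maybe.Properties as Maybe using (≡-dec)
import Data.Maybe.Relation.Unary.All as Maybe using (All; dec)
open import Data.Nat.Base as ℕ using (ℕ; zero; suc; _∸_)
open import Data.Nat.Combinatorics using (_C_)
import Data.Nat.Literals as ℕ
import Data.Nat.Properties as ℕ
open import Data.Product.Base using (∃; ∃-syntax; _×_; _,_; proj₂)
open import Data.Unit.Base using (⊤; tt)
open import Data.Vec.Base as Vec using (Vec; []; _∷_)
open import Function.Base using (_∘_)
open import Level using (0ℓ)
open import Relation.Binary.Definitions using (DecidableEquality)
open import Relation.Binary.PropositionalEquality.Core using (_≡_; _≢_)
open import Relation.Nullary.Decidable using (yes; does; ¬?; _×-dec_; _⊎-dec_)
open import Relation.Nullary.Negation.Core using (¬_)
open import Relation.Unary using (Pred; Decidable; Satisfiable; _⊆_)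

private
  instance
    number-ℕ : Number ℕ
    number-ℕ = ℕ.number

    number-ℤ : Number ℤ
    number-ℤ = ℤ.number

  variable
    A : Set

_≟ᴸ_ : DecidableEquality (List ℤ)
_≟ᴸ_ = List.≡-dec _≟_

count : {P : Pred A 0ℓ} → Decidable P → List A → ℕ
count P? = length ∘ filter P?

------------------------------------------------------------------------
-- Dyck sequences and their statistics

AffineDyck : Pred (List ℤ) 0ℓ
AffineDyck = Linked (λ a b → b ≤ a + 1)

ReverseDyck : Pred (List ℤ) 0ℓ
ReverseDyck = Linked (λ a b → a - 1 ≤ b)

-- The condition on the head also excludes the empty sequence.
Dyck : Pred (List ℤ) 0ℓ
Dyck x = head x ≡ just 0 × AffineDyck x × All (0 ≤_) x

affineDyck? : Decidable AffineDyck
affineDyck? = linked? (λ a b → b ≤? a + 1)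

reverseDyck? : Decidable ReverseDyck
reverseDyck? = linked? (λ a b → a - 1 ≤? b)

dyck? : Decidable Dyck
dyck? x =
  Maybe.≡-dec _≟_ (head x) (just 0) ×-dec affineDyck? x ×-dec All.all? (0 ≤?_) x

area : List ℤ → ℤ
area = foldr _+_ 0

dinv : List ℤ → ℕ
dinv []       = 0
dinv (a ∷ as) = count (λ b → (a ≟ b) ⊎-dec (a ≟ b + 1)) as ℕ.+ dinv as

defc : List ℤ → ℤ
defc x = + (length x C 2) - area x - + dinv x

------------------------------------------------------------------------
-- Extraction, skeletons, injection

Eligible : (c : List ℤ) → Pred (Fin (length c)) 0ℓ
Eligible c j =
    count (_≟ lookup c j - 1) (take (toℕ j) c) ≡ 1
  × Maybe.All (_≤ lookup c j) (head (drop (suc (toℕ j)) c))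

eligible? : (c : List ℤ) → Decidable (Eligible c)
eligible? c j =
    (count (_≟ lookup c j - 1) (take (toℕ j) c) ℕ.≟ 1)
  ×-dec Maybe.dec (_≤? lookup c j) (head (drop (suc (toℕ j)) c))

-- The leftmost-extractable element together with the remaining sequence.
extract : List ℤ → Maybe (ℤ × List ℤ)
extract c =
  Maybe.map (λ j → lookup c j , removeAt c j)
            (head (filter (eligible? c) (allFin (length c))))

FullSkeleton : Pred (List ℤ) 0ℓ
FullSkeleton c = Dyck c × ¬ ∃ (Eligible c)

fullSkeleton? : Decidable FullSkeleton
fullSkeleton? c = dyck? c ×-dec ¬? (Fin.any? (eligible? c))

-- ω and ε are used only for n ≥ 4, so ∸ is never truncated.
ω : ℕ → List ℤ
ω n = replicate (n ∸ 1) 0 ++ [ 1 ]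

ε : ℕ → List ℤ
ε n = 0 ∷ 0 ∷ 1 ∷ replicate (n ∸ 4) 0 ++ [ 1 ]

SpecialSkeleton : ℕ → Pred (List ℤ) 0ℓ
SpecialSkeleton n s = FullSkeleton s × length s ≡ n × s ≢ ε n

insertAfterFirst : ℤ → ℤ → List ℤ → List ℤ
insertAfterFirst a e []       = []
insertAfterFirst a e (c ∷ cs) =
  if does (c ≟ a) then c ∷ e ∷ cs else c ∷ insertAfterFirst a e cs

-- On a Dyck sequence, max 0 c is the largest entry, and e - 1 occurs in c
-- whenever 1 ≤ e ≤ max 0 c + 1.
inject : ℤ → List ℤ → Maybe (List ℤ)
inject e c =
  if does (dyck? c ×-dec (1 ≤? e) ×-dec (e ≤? max 0 c + 1))
  then just (insertAfterFirst (e - 1) e c)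
  else nothing

injectRightToLeft : List ℤ → List ℤ → Maybe (List ℤ)
injectRightToLeft es c = foldr (λ e c′ → c′ >>= inject e) (just c) es

------------------------------------------------------------------------
-- The maps fw and bk

occurrences : ℕ → List ℕ → ℕ
occurrences k = count (ℕ._≟ k)

restrict : ℕ → List ℕ → List ℕ
restrict k = filter (λ a → (a ℕ.≟ k) ⊎-dec (a ℕ.≟ suc k))

-- The ranks of the occurrences of k + 1 in a word over {k, k + 1}, from left
-- to right; the first argument counts the k's already passed.
ranksFrom : ℕ → ℕ → List ℕ → List ℕ
ranksFrom r k []       = []
ranksFrom r k (b ∷ bs) =
  if does (b ℕ.≟ k) then ranksFrom (suc r) k bs else r ∷ ranksFrom r k bs

ranks : ℕ → List ℕ → List ℕ
ranks = ranksFrom 0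

-- The default is used only if there is no position to insert at, which does
-- not happen for the ranks recorded by rebuild below.
insertAtPosition : ℕ → Maybe ℕ → List ℕ → List ℕ
insertAtPosition v p y = maybe′ (λ i → take i y ++ v ∷ drop i y) y p

-- Insert k + 1 with r k's before it, at the leftmost position to the right of
-- every k + 1 already present.
insertLeftmost : ℕ → List ℕ → ℕ → List ℕ
insertLeftmost k y r = insertAtPosition (suc k) (head positions) y
  where
  positions = filter
    (λ i →     (occurrences k (take i y) ℕ.≟ r)
         ×-dec (occurrences (suc k) (drop i y) ℕ.≟ 0))
    (upTo (suc (length y)))

-- Insert k + 1 with r k's before it, at the rightmost position to the left of
-- every k + 1 already present.
insertRightmost : ℕ → ℕ → List ℕ → List ℕ
insertRightmost k r y = insertAtPosition (suc k) (last positions) y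
  where
  positions = filter
    (λ i →     (occurrences k (take i y) ℕ.≟ r)
         ×-dec (occurrences (suc k) (take i y) ℕ.≟ 0))
    (upTo (suc (length y)))

-- reinsert k rs y puts the letters k + 1, with ranks rs, back into y.  The
-- recursion records B_k and deletes the k + 1's on the way down, and reinserts
-- them on the way up, so rebuild _ (M′ ∸ 1) runs through k = M′ - 1, …, 1 and
-- then k = 1, …, M′ - 1.
rebuild : (reinsert : ℕ → List ℕ → List ℕ → List ℕ) → ℕ → List ℕ → List ℕ
rebuild reinsert zero    y = y
rebuild reinsert (suc j) y =
  reinsert k (ranks k (restrict k y))
    (rebuild reinsert j (filter (λ a → ¬? (a ℕ.≟ suc k)) y))
  where k = suc j

-- Apply a map of words over ℕ after translating the minimum entry to 0.
translated : (List ℕ → List ℕ) → List ℤ → List ℤ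
translated f []         = []
translated f x@(a ∷ as) = map (λ b → + b + m) (f (map (λ b → ∣ b - m ∣) x))
  where m = min a as

maximum : List ℕ → ℕ
maximum = foldr ℕ._⊔_ 0

fw : List ℤ → List ℤ
fw = translated λ y →
  rebuild (λ k rs z → foldl (insertLeftmost k) z rs) (maximum y ∸ 1) y

bk : List ℤ → List ℤ
bk = translated λ y →
  rebuild (λ k rs z → foldr (insertRightmost k) z rs) (maximum y ∸ 1) y

------------------------------------------------------------------------
-- The map East

-- A partition of the 2m occurrences into m pairs at distance ≥ 2: the first
-- occurrence is paired with some other one, and so on for the rest.
FarApartPairs : ∀ m → Vec ℤ (m ℕ.* 2) → Set
FarApartPairs zero    _        = ⊤
FarApartPairs (suc m) (a ∷ as) =
  ∃[ j ] (2 ℕ.≤ ∣ a - Vec.lookup as j ∣ × FarApartPairs m (Vec.removeAt as j))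

FarApartDecomposable : Pred (Vec ℤ 7) 0ℓ
FarApartDecomposable x = ∃ λ (i : Fin 7) → FarApartPairs 3 (Vec.removeAt x i)

farApartPairs? : ∀ m → Decidable (FarApartPairs m)
farApartPairs? zero    _        = yes tt
farApartPairs? (suc m) (a ∷ as) = Fin.any? λ j →
  (2 ℕ.≤? ∣ a - Vec.lookup as j ∣) ×-dec farApartPairs? m (Vec.removeAt as j)

farApartDecomposable? : Decidable FarApartDecomposable
farApartDecomposable? x = Fin.any? λ i → farApartPairs? 3 (Vec.removeAt x i)

East₃ : List ℤ → Maybe (List ℤ)
East₃ (u₋₁ ∷ u₀ ∷ u₁ ∷ []) =
  if does (u₀ ≤? u₁ + 1) then just (u₋₁ ∷ u₀ ∷ u₁ ∷ []) else nothing
East₃ _ = nothing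

-- bk preserves length, so the second alternative of the with does not arise.
East₅ : List ℤ → Maybe (List ℤ)
East₅ (x₋₂ ∷ x₋₁ ∷ x₀ ∷ x₁ ∷ x₂ ∷ []) with bk (x₋₁ ∷ x₀ ∷ [])
... | y₋₁ ∷ y₀ ∷ [] =
  if does ((x₁ + 1 <? x₋₁) ×-dec (y₀ ≤? x₂ + 1))
  then just (x₋₂ ∷ x₁ ∷ y₋₁ ∷ y₀ ∷ x₂ ∷ [])
  else if does ((x₋₁ ≤? x₁ + 1) ×-dec (x₋₁ ≤? x₂ + 1))
  then just (x₋₂ ∷ x₁ ∷ x₀ ∷ x₋₁ ∷ x₂ ∷ [])
  else nothing
... | _ = nothing
East₅ _ = nothing

five : (a b c d e : ℤ) → List ℤ
five a b c d e = a ∷ b ∷ c ∷ d ∷ e ∷ []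

-- The rows depending on a parameter o ≤ 0 have o as the fourth entry of the
-- left-hand side, so the table is instantiated at that entry.
table : (o : ℤ) → List (List ℤ × List ℤ)
table o =
    (five 3 3 4 1 2 , five 1 2 4 3 3)
  ∷ (five 3 4 4 1 2 , five 1 2 4 3 4)
  ∷ (five 4 3 4 1 2 , five 1 2 4 4 3)
  ∷ (five 2 3 4 1 2 , five 1 2 4 3 2)
  ∷ (five 3 3 4 2 1 , five 2 1 4 3 3)
  ∷ (five 3 4 4 2 1 , five 2 1 4 3 4)
  ∷ (five 4 3 4 2 1 , five 2 1 4 4 3)
  ∷ (five 2 3 4 2 1 , five 2 1 4 3 2)
  ∷ (five 3 4 4 2 2 , five 2 2 4 4 3)
  ∷ (five 3 4 5 2 2 , five 2 2 5 4 3)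
  ∷ (if does (o ≤? 0)
     then (five 3 3 4 o 2 , five 2 o 4 3 3)
        ∷ (five 3 4 4 o 2 , five 2 o 4 3 4)
        ∷ (five 4 3 4 o 2 , five 2 o 4 4 3)
        ∷ (five 2 3 4 o 2 , five 2 o 2 4 3)
        ∷ (five 3 4 2 o 2 , five 2 o 4 3 2)
        ∷ []
     else [])

lookupTable : (a b c d e : ℤ) → Maybe (List ℤ)
lookupTable a b c d e =
  Maybe.map proj₂ (head (filter (λ (l , _) → five a b c d e ≟ᴸ l) (table d)))

EastDomain : Pred (Vec ℤ 7) 0ℓ
EastDomain x = ¬ FarApartDecomposable x
             × AffineDyck  (take 4 (Vec.toList x))
             × ReverseDyck (drop 4 (Vec.toList x))

eastDomain? : Decidable EastDomain
eastDomain? x = ¬? (farApartDecomposable? x)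
          ×-dec affineDyck?  (take 4 (Vec.toList x))
          ×-dec reverseDyck? (drop 4 (Vec.toList x))

-- The translation by - t makes the maximum of x₁ and x₂ equal to 2.
eastMiddle₃₋₄ : (x₋₂ x₋₁ x₀ x₁ x₂ : ℤ) → Maybe (List ℤ)
eastMiddle₃₋₄ x₋₂ x₋₁ x₀ x₁ x₂ =
  if does ((x₁ ⊔ x₂) + 1 <? x₋₂ ⊓ x₋₁ ⊓ x₀)
  then just (fw (x₁ ∷ x₂ ∷ []) ++ bk (x₋₂ ∷ x₋₁ ∷ x₀ ∷ []))
  else Maybe.map (map (_+ t))
         (lookupTable (x₋₂ - t) (x₋₁ - t) (x₀ - t) (x₁ - t) (x₂ - t))
  where t = (x₁ ⊔ x₂) - 2

eastMiddle : (x₋₂ x₋₁ x₀ x₁ x₂ : ℤ) → Maybe (List ℤ)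
eastMiddle x₋₂ x₋₁ x₀ x₁ x₂ =
  if does (x₀ ≤? x₁ + 1)
  then just (five x₋₂ x₋₁ x₀ x₁ x₂)
  else maybe′ just (eastMiddle₃₋₄ x₋₂ x₋₁ x₀ x₁ x₂)
                   (East₅ (five x₋₂ x₋₁ x₀ x₁ x₂))

East : List ℤ → Maybe (List ℤ)
East (x₋₃ ∷ x₋₂ ∷ x₋₁ ∷ x₀ ∷ x₁ ∷ x₂ ∷ x₃ ∷ []) =
  if does (eastDomain? (x₋₃ ∷ x₋₂ ∷ x₋₁ ∷ x₀ ∷ x₁ ∷ x₂ ∷ x₃ ∷ []))
  then Maybe.map (λ w → x₋₃ ∷ w ++ x₃ ∷ []) (eastMiddle x₋₂ x₋₁ x₀ x₁ x₂)
  else nothing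
East _ = nothing

------------------------------------------------------------------------
-- The map up

-- If x has fewer than k entries, then so has the window, and f, being one of
-- the local moves, is undefined on it.
onFinal : ℕ → (List ℤ → Maybe (List ℤ)) → List ℤ → Maybe (List ℤ)
onFinal k f x =
  Maybe.map (take (length x ∸ k) x ++_) (f (drop (length x ∸ k) x))

reinjectFinal : ℕ → List ℤ → Maybe (List ℤ)
reinjectFinal k x =
  injectRightToLeft (map (_+ 1) (drop (length x ∸ k) x)) (take (length x ∸ k) x)

-- Intended for Dyck sequences of length at least 4; nothing means undefined.
up : List ℤ → Maybe (List ℤ)
up x =
  if does (x ≟ᴸ ω (length x)) then just (ε (length x))
  else if does (fullSkeleton? x) then reinjectFinal 1 x
  else (extract x >>= λ (e₁ , c₁) →
    let σ₁ = c₁ ++ (e₁ - 1) ∷ [] in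
    maybe′ (reinjectFinal 2)
      (extract c₁ >>= λ (e₂ , c₂) →
        let σ₂ = c₂ ++ (e₁ - 1) ∷ (e₂ - 1) ∷ [] in
        maybe′ (reinjectFinal 3)
          (extract c₂ >>= λ (e₃ , c₃) →
            let σ₃ = c₃ ++ (e₁ - 1) ∷ (e₂ - 1) ∷ (e₃ - 1) ∷ [] in
            onFinal 7 East σ₃ >>= reinjectFinal 4)
          (onFinal 5 East₅ σ₂))
      (onFinal 3 East₃ σ₁))

up^ : ℕ → List ℤ → Maybe (List ℤ)
up^ zero    x = just x
up^ (suc i) x = up^ i x >>= up

------------------------------------------------------------------------
-- Strings

Bounded : (n : ℕ) (d ℓ : ℤ) → Pred (List ℤ) 0ℓ
Bounded n d ℓ x = Dyck x × length x ≡ n × defc x ≡ d × area x ≤ ℓ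

BoundedSpecial : (n : ℕ) (d ℓ : ℤ) → Pred (List ℤ) 0ℓ
BoundedSpecial n d ℓ s = SpecialSkeleton n s × defc s ≡ d × area s ≤ ℓ

-- Every term s, up s, …, up^(ℓ - area s) s is defined.
StringDefined : ℤ → Pred (List ℤ) 0ℓ
StringDefined ℓ s = ∀ i → + i ≤ ℓ - area s → ∃[ x ] up^ i s ≡ just x

String : ℤ → List ℤ → Pred (List ℤ) 0ℓ
String ℓ s x = ∃[ i ] (+ i ≤ ℓ - area s × up^ i s ≡ just x)

-- The blocks b s, for s ranging over I, form a partition of P, with distinct
-- indices giving disjoint blocks.
record IsPartition {X J : Set} (P : Pred X 0ℓ) (I : Pred J 0ℓ)
                   (b : J → Pred X 0ℓ) : Set where
  field
    nonempty : ∀ {s} → I s → Satisfiable (b s)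
    within   : ∀ {s} → I s → b s ⊆ P
    covers   : ∀ {x} → P x → ∃[ s ] (I s × b s x)
    disjoint : ∀ {s t x} → I s → I t → b s x → b t x → s ≡ t

{-# OPTIONS --safe #-}
-- Moving the extracted entries of x behind the remaining Dyck sequence, as in
-- σ = C : (e₁ - 1) : …, changes the number of bad pairs (those that dinv does not
-- count) and the sum of the entries by the number of extracted entries, and East
-- preserves both.  So up raises the area by 1 and keeps the deficit, and it can be
-- inverted window by window, since extracting w + 1 from a sequence into which
-- u + 1 was injected last is possible exactly when u ≤ w + 1.  What remains is that
-- in the given range no step fails: either the deficit or the number of bad pairs
-- would be too large.  This rests on the shape of a Dyck sequence, which is either a
-- skeleton or a skeleton followed by a run m, m + 1, …, e and by a rest that starts
-- with an entry at most e.  For windows of seven letters, five of which must lie in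
-- {k, k + 1}, the finitely many inequalities are decided by computation, and the
-- lengths below 10 are settled by enumeration.
module Submission where

open import Data.Bool.Base using (Bool; true; false)
open import Data.Empty using (⊥; ⊥-elim)
open import Data.Fin.Base using (Fin; zero; suc)
open import Data.Fin.Patterns
open import Data.Integer.Base using (ℤ; +_; +[1+_]; -[1+_]; _+_; _-_; -_; _*_; _≤_; 0ℤ; 1ℤ; +≤+)
import Data.Integer.Properties as ℤ
open import Data.Integer.Properties using (_≤?_; _≟_)
open import Data.Integer.Tactic.RingSolver using (solve-∀)
open import Data.List.Base using (List; []; _∷_; _++_; _∷ʳ_; [_]; length)
import Data.List.Properties as List
open import Data.List.Relation.Unary.All as All using (All; []; _∷_)
open import Data.Maybe.Base as Maybe using (Maybe; just; nothing)
open import Data.Nat.Base as ℕ using (ℕ; zero; suc)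
import Data.Nat.Properties as ℕ
open import Data.Product.Base using (∃; ∃-syntax; _×_; _,_) renaming (proj₁ to fst; proj₂ to snd)
open import Data.Sum.Base using (_⊎_) renaming (inj₁ to inl; inj₂ to inr)
open import Data.Unit.Base using (⊤; tt)
open import Data.Vec.Base as Vec using (Vec; []; _∷_)
open import Relation.Binary.PropositionalEquality hiding ([_])
open import Relation.Nullary using (yes; no; does; Dec; ¬_)

module Lia where

 open import Data.Bool.Base using (if_then_else_; _∧_; T)
 open import Data.Integer.Base using (_<_)
 open import Data.Product.Base using (_,_)
 open import Data.Sum.Base using (_⊎_)
 open import Data.Vec.Base using (lookup; removeAt; replicate)
 open import Relation.Nullary.Decidable using (dec-true; dec-false)

 pattern 10F = suc 9F
 pattern 11F = suc 10F
 pattern 12F = suc 11F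
 pattern 13F = suc 12F
 pattern 14F = suc 13F
 pattern 15F = suc 14F
 pattern 16F = suc 15F
 pattern 17F = suc 16F
 pattern 18F = suc 17F
 pattern 19F = suc 18F

 infixl 6 _+'_ _-'_
 infixl 7 _*'_
 infix 5.1 _<=_ _==_
 infix 5.5 _<=?_ _≤χ_

 χ : Bool → ℤ
 χ b = if b then 1ℤ else 0ℤ

 _≤χ_ : ℤ → ℤ → ℤ
 a ≤χ b = χ (does (a ≤? b))

 data Ex (n : ℕ) : Set where
   con     : ℤ → Ex n
   var     : Fin n → Ex n
   _+'_ _-'_ : Ex n → Ex n → Ex n
   _*'_     : ℤ → Ex n → Ex n
   _<=?_   : Ex n → Ex n → Ex n

 -- Notation for reified expressions.
 infixr 5 _&_
 pattern _&_ x xs = x ∷ xs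
 pattern #0 = var 0F
 pattern #1 = var 1F
 pattern #2 = var 2F
 pattern #3 = var 3F
 pattern #4 = var 4F
 pattern #5 = var 5F
 pattern #6 = var 6F
 pattern #7 = var 7F
 pattern #8 = var 8F
 pattern #9 = var 9F
 pattern #10 = var 10F
 pattern #11 = var 11F
 pattern #12 = var 12F
 pattern #13 = var 13F
 pattern #14 = var 14F
 pattern #15 = var 15F
 pattern #16 = var 16F
 pattern #17 = var 17F
 pattern #18 = var 18F
 pattern #19 = var 19F
 pattern !-4 = con -[1+ 3 ]
 pattern !-3 = con -[1+ 2 ]
 pattern !-2 = con -[1+ 1 ]
 pattern !-1 = con -[1+ 0 ]
 pattern !0 = con (+ 0)
 pattern !1 = con (+ 1)
 pattern !2 = con (+ 2)
 pattern !3 = con (+ 3)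
 pattern !4 = con (+ 4)
 pattern !5 = con (+ 5)
 pattern !6 = con (+ 6)
 pattern !7 = con (+ 7)
 pattern !8 = con (+ 8)
 pattern !9 = con (+ 9)
 pattern !10 = con (+ 10)
 pattern !11 = con (+ 11)
 pattern !12 = con (+ 12)
 pattern !14 = con (+ 14)
 pattern !15 = con (+ 15)
 pattern !16 = con (+ 16)
 pattern !17 = con (+ 17)
 pattern !19 = con (+ 19)
 pattern !21 = con (+ 21)
 pattern !22 = con (+ 22)
 pattern !25 = con (+ 25)
 pattern !36 = con (+ 36)
 pattern !72 = con (+ 72)
 pattern !84 = con (+ 84)

 data Rel (n : ℕ) : Set where
   _<=_ _==_ : Ex n → Ex n → Rel n

 ⟦_⟧ : ∀ {n} → Ex n → Vec ℤ n → ℤ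
 ⟦ con k ⟧ ρ = k
 ⟦ var i ⟧ ρ = lookup ρ i
 ⟦ a +' b ⟧ ρ = ⟦ a ⟧ ρ + ⟦ b ⟧ ρ
 ⟦ a -' b ⟧ ρ = ⟦ a ⟧ ρ - ⟦ b ⟧ ρ
 ⟦ k *' a ⟧ ρ = k * ⟦ a ⟧ ρ
 ⟦ a <=? b ⟧ ρ = ⟦ a ⟧ ρ ≤χ ⟦ b ⟧ ρ

 ⟦_⟧ᴿ : ∀ {n} → Rel n → Vec ℤ n → Set
 ⟦ a <= b ⟧ᴿ ρ = ⟦ a ⟧ ρ ≤ ⟦ b ⟧ ρ
 ⟦ a == b ⟧ᴿ ρ = ⟦ a ⟧ ρ ≡ ⟦ b ⟧ ρ

 ⟦_⟧ᴴ : ∀ {n} → List (Rel n) → Vec ℤ n → Set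
 ⟦ [] ⟧ᴴ ρ     = ⊤
 ⟦ h ∷ hs ⟧ᴴ ρ = ⟦ h ⟧ᴿ ρ × ⟦ hs ⟧ᴴ ρ

 Lin : ℕ → Set
 Lin n = ℤ × Vec ℤ n

 dot : ∀ {n} → Vec ℤ n → Vec ℤ n → ℤ
 dot []       []       = 0ℤ
 dot (c ∷ cs) (x ∷ xs) = c * x + dot cs xs

 ⟦_⟧ᴸ : ∀ {n} → Lin n → Vec ℤ n → ℤ
 ⟦ k , cs ⟧ᴸ ρ = k + dot cs ρ

 combine : ∀ {n} → ℤ → Vec ℤ n → ℤ → Vec ℤ n → Vec ℤ n
 combine s []       t []       = []
 combine s (a ∷ as) t (b ∷ bs) = s * a + t * b ∷ combine s as t bs

 dot-combine : ∀ {n} s as t bs (ρ : Vec ℤ n) →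
   dot (combine s as t bs) ρ ≡ s * dot as ρ + t * dot bs ρ
 dot-combine s []       t []       []      = lemma s t
   where
   lemma : ∀ s t → 0ℤ ≡ s * 0ℤ + t * 0ℤ
   lemma = solve-∀
 dot-combine s (a ∷ as) t (b ∷ bs) (x ∷ ρ) =
   trans (cong (λ z → (s * a + t * b) * x + z) (dot-combine s as t bs ρ))
         (lemma s a t b x (dot as ρ) (dot bs ρ))
   where
   lemma : ∀ s a t b x A B →
     (s * a + t * b) * x + (s * A + t * B) ≡ s * (a * x + A) + t * (b * x + B)
   lemma = solve-∀

 combineᴸ : ∀ {n} → ℤ → Lin n → ℤ → Lin n → Lin n
 combineᴸ s (k , as) t (l , bs) = s * k + t * l , combine s as t bs

 combineᴸ-eval : ∀ {n} s (a : Lin n) t b ρ →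
   ⟦ combineᴸ s a t b ⟧ᴸ ρ ≡ s * ⟦ a ⟧ᴸ ρ + t * ⟦ b ⟧ᴸ ρ
 combineᴸ-eval s (k , as) t (l , bs) ρ =
   trans (cong (λ z → s * k + t * l + z) (dot-combine s as t bs ρ))
         (lemma s k t l (dot as ρ) (dot bs ρ))
   where
   lemma : ∀ s k t l A B →
     s * k + t * l + (s * A + t * B) ≡ s * (k + A) + t * (l + B)
   lemma = solve-∀

 zeros : ∀ {n} → Vec ℤ n
 zeros {zero}  = []
 zeros {suc n} = 0ℤ ∷ zeros

 dot-zeros : ∀ {n} (ρ : Vec ℤ n) → dot zeros ρ ≡ 0ℤ
 dot-zeros []      = refl
 dot-zeros (x ∷ ρ) = trans (cong (λ z → 0ℤ * x + z) (dot-zeros ρ)) (lemma x)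
   where
   lemma : ∀ x → 0ℤ * x + 0ℤ ≡ 0ℤ
   lemma = solve-∀

 unit : ∀ {n} → Fin n → Vec ℤ n
 unit zero    = 1ℤ ∷ zeros
 unit (suc i) = 0ℤ ∷ unit i

 dot-unit : ∀ {n} i (ρ : Vec ℤ n) → dot (unit i) ρ ≡ lookup ρ i
 dot-unit zero    (x ∷ ρ) = trans (cong (λ z → 1ℤ * x + z) (dot-zeros ρ)) (lemma x)
   where
   lemma : ∀ x → 1ℤ * x + 0ℤ ≡ x
   lemma = solve-∀
 dot-unit (suc i) (x ∷ ρ) = trans (cong (λ z → 0ℤ * x + z) (dot-unit i ρ)) (lemma x (lookup ρ i))
   where
   lemma : ∀ x y → 0ℤ * x + y ≡ y
   lemma = solve-∀

 -- Truth values assumed for the comparisons 0 ≤ d occurring under an indicator.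
 Known : ℕ → Set
 Known n = List (Lin n × Bool)

 Consistent : ∀ {n} → Vec ℤ n → Known n → Set
 Consistent ρ = All (λ (d , t) → does (0ℤ ≤? ⟦ d ⟧ᴸ ρ) ≡ t)

 _≟ⱽ_ : ∀ {n} → (as bs : Vec ℤ n) → Maybe (as ≡ bs)
 []       ≟ⱽ []       = just refl
 (a ∷ as) ≟ⱽ (b ∷ bs) with a ≟ b | as ≟ⱽ bs
 ... | yes refl | just refl = just refl
 ... | _        | _         = nothing

 _≟ˡ_ : ∀ {n} → (a b : Lin n) → Maybe (a ≡ b)
 (k , as) ≟ˡ (l , bs) with k ≟ l | as ≟ⱽ bs
 ... | yes refl | just refl = just refl
 ... | _        | _         = nothing

 find : ∀ {n} (Γ : Known n) (d : Lin n) → Maybe Bool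
 find []            d = nothing
 find ((c , t) ∷ Γ) d with d ≟ˡ c
 ... | just _  = just t
 ... | nothing = find Γ d

 find-sound : ∀ {n ρ} (Γ : Known n) d {t} → Consistent ρ Γ → find Γ d ≡ just t →
   does (0ℤ ≤? ⟦ d ⟧ᴸ ρ) ≡ t
 find-sound ((c , u) ∷ Γ) d (p ∷ ps) eq with d ≟ˡ c
 find-sound ((c , u) ∷ Γ) d (p ∷ ps) refl | just refl = p
 ... | nothing = find-sound Γ d ps eq

 subtract : ∀ {n} → Lin n → Lin n → Lin n
 subtract a b = combineᴸ 1ℤ a (- 1ℤ) b

 subtract-eval : ∀ {n} (a b : Lin n) ρ → ⟦ subtract a b ⟧ᴸ ρ ≡ ⟦ a ⟧ᴸ ρ - ⟦ b ⟧ᴸ ρ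
 subtract-eval a b ρ = trans (combineᴸ-eval 1ℤ a (- 1ℤ) b ρ) (lemma (⟦ a ⟧ᴸ ρ) (⟦ b ⟧ᴸ ρ))
   where
   lemma : ∀ x y → 1ℤ * x + (- 1ℤ) * y ≡ x - y
   lemma = solve-∀

 -- The left alternative is a comparison whose truth value is still unknown.
 Open : ℕ → Set
 Open n = Lin n ⊎ Lin n

 map₂ : ∀ {n} → (Lin n → Lin n → Open n) → Open n → Open n → Open n
 map₂ f (inl u) _        = inl u
 map₂ f (inr a) (inl u) = inl u
 map₂ f (inr a) (inr b) = f a b

 decide : ∀ {n} → Lin n → Maybe Bool → Open n
 decide u nothing  = inl u
 decide u (just t) = inr (χ t , zeros)

 decideIn : ∀ {n} → Known n → Lin n → Open n
 decideIn Γ d = decide d (find Γ d)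

 normalise : ∀ {n} → Known n → Ex n → Open n
 normalise Γ (con k)   = inr (k , zeros)
 normalise Γ (var i)   = inr (0ℤ , unit i)
 normalise Γ (a +' b)   = map₂ (λ p q → inr (combineᴸ 1ℤ p 1ℤ q)) (normalise Γ a) (normalise Γ b)
 normalise Γ (a -' b)   = map₂ (λ p q → inr (subtract p q)) (normalise Γ a) (normalise Γ b)
 normalise Γ (k *' a)   = map₂ (λ p q → inr (combineᴸ k p 0ℤ p)) (normalise Γ a) (inr (0ℤ , zeros))
 normalise Γ (a <=? b) = map₂ (λ p q → decideIn Γ (subtract q p)) (normalise Γ a) (normalise Γ b)

 map₂-inv : ∀ {n} f (p q : Open n) {r} → map₂ f p q ≡ inr r →
   ∃ λ a → ∃ λ b → p ≡ inr a × q ≡ inr b × f a b ≡ inr r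
 map₂-inv f (inr a) (inr b) eq = a , b , refl , refl , eq

 does-≤-shift : ∀ x y → does (x ≤? y) ≡ does (0ℤ ≤? y - x)
 does-≤-shift x y with x ≤? y | 0ℤ ≤? y - x
 ... | yes p | yes q = refl
 ... | no ¬p | no ¬q = refl
 ... | yes p | no ¬q = ⊥-elim (¬q (ℤ.i≤j⇒0≤j-i p))
 ... | no ¬p | yes q = ⊥-elim (¬p (ℤ.0≤i-j⇒j≤i q))

 decide-inv : ∀ {n} (d : Lin n) m {r} → decide d m ≡ inr r →
   ∃ λ t → m ≡ just t × r ≡ (χ t , zeros)
 decide-inv d (just t) refl = t , refl , refl

 normalise-sound : ∀ {n ρ} (Γ : Known n) → Consistent ρ Γ → ∀ e {l} →
   normalise Γ e ≡ inr l → ⟦ e ⟧ ρ ≡ ⟦ l ⟧ᴸ ρ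
 normalise-sound {ρ = ρ} Γ ok (con k) refl =
   sym (trans (cong (_+_ k) (dot-zeros ρ)) (ℤ.+-identityʳ k))
 normalise-sound {ρ = ρ} Γ ok (var i) refl =
   sym (trans (ℤ.+-identityˡ _) (dot-unit i ρ))
 normalise-sound {ρ = ρ} Γ ok (a +' b) eq with map₂-inv _ (normalise Γ a) (normalise Γ b) eq
 ... | p , q , eq₁ , eq₂ , refl =
   trans (cong₂ _+_ (normalise-sound Γ ok a eq₁) (normalise-sound Γ ok b eq₂))
         (trans (lemma (⟦ p ⟧ᴸ ρ) (⟦ q ⟧ᴸ ρ)) (sym (combineᴸ-eval 1ℤ p 1ℤ q ρ)))
   where
   lemma : ∀ x y → x + y ≡ 1ℤ * x + 1ℤ * y
   lemma = solve-∀
 normalise-sound {ρ = ρ} Γ ok (a -' b) eq with map₂-inv _ (normalise Γ a) (normalise Γ b) eq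
 ... | p , q , eq₁ , eq₂ , refl =
   trans (cong₂ _-_ (normalise-sound Γ ok a eq₁) (normalise-sound Γ ok b eq₂))
         (sym (subtract-eval p q ρ))
 normalise-sound {ρ = ρ} Γ ok (k *' a) eq with map₂-inv _ (normalise Γ a) (inr (0ℤ , zeros)) eq
 ... | p , q , eq₁ , eq₂ , refl =
   trans (cong (_*_ k) (normalise-sound Γ ok a eq₁))
         (trans (lemma k (⟦ p ⟧ᴸ ρ)) (sym (combineᴸ-eval k p 0ℤ p ρ)))
   where
   lemma : ∀ k x → k * x ≡ k * x + 0ℤ * x
   lemma = solve-∀
 normalise-sound {ρ = ρ} Γ ok (a <=? b) eq with map₂-inv _ (normalise Γ a) (normalise Γ b) eq
 ... | p , q , eq₁ , eq₂ , eq₃ with decide-inv (subtract q p) (find Γ (subtract q p)) eq₃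
 ...   | t , eq₄ , refl =
   trans (cong₂ _≤χ_ (normalise-sound Γ ok a eq₁) (normalise-sound Γ ok b eq₂))
     (trans (cong χ (trans (does-≤-shift (⟦ p ⟧ᴸ ρ) (⟦ q ⟧ᴸ ρ))
              (trans (cong (λ z → does (0ℤ ≤? z)) (sym (subtract-eval q p ρ)))
                     (find-sound Γ (subtract q p) ok eq₄))))
       (sym (trans (cong (_+_ (χ t)) (dot-zeros ρ)) (ℤ.+-identityʳ (χ t)))))

 -- Fourier–Motzkin elimination of the first variable.
 Nonneg : ∀ {n} → Vec ℤ n → Lin n → Set
 Nonneg ρ l = 0ℤ ≤ ⟦ l ⟧ᴸ ρ

 record Sorted (n : ℕ) : Set where
   constructor sorted
   field
     free : List (Lin n)
     pos neg : List (ℕ × Lin n)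

 insert : ∀ {n} → ℤ → ℤ → Vec ℤ n → Sorted n → Sorted n
 insert k (+ zero) cs (sorted f p q) = sorted ((k , cs) ∷ f) p q
 insert k +[1+ c ] cs (sorted f p q) = sorted f ((c , k , cs) ∷ p) q
 insert k -[1+ c ] cs (sorted f p q) = sorted f p ((c , k , cs) ∷ q)

 sort : ∀ {n} → Fin (suc n) → List (Lin (suc n)) → Sorted n
 sort j []              = sorted [] [] []
 sort j ((k , cs) ∷ ls) = insert k (lookup cs j) (removeAt cs j) (sort j ls)

 -- The variable whose elimination produces the fewest constraints.
 tally : ∀ {n} → Vec ℤ n → Vec (ℕ × ℕ) n → Vec (ℕ × ℕ) n
 tally []               []             = []
 tally (+ zero ∷ cs)    (pq ∷ ts)      = pq ∷ tally cs ts
 tally (+[1+ _ ] ∷ cs)  ((p , q) ∷ ts) = (suc p , q) ∷ tally cs ts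
 tally (-[1+ _ ] ∷ cs)  ((p , q) ∷ ts) = (p , suc q) ∷ tally cs ts

 tallies : ∀ {n} → List (Lin n) → Vec (ℕ × ℕ) n
 tallies []              = replicate _ (0 , 0)
 tallies ((_ , cs) ∷ ls) = tally cs (tallies ls)

 cheapest : ∀ {n} → Vec (ℕ × ℕ) (suc n) → ℕ × Fin (suc n)
 cheaper  : ∀ {n} → ℕ → ℕ × Fin (suc n) → ℕ × Fin (suc (suc n))
 cheapest {zero}  ((p , q) ∷ ts) = p ℕ.* q , zero
 cheapest {suc n} ((p , q) ∷ ts) = cheaper (p ℕ.* q) (cheapest ts)
 cheaper c (d , j) = if c ℕ.≤ᵇ d then (c , zero) else (d , suc j)

 cross₁ : ∀ {n} → ℕ × Lin n → List (ℕ × Lin n) → List (Lin n) → List (Lin n)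
 cross₁ (p , a) []             acc = acc
 cross₁ (p , a) ((q , b) ∷ ns) acc = combineᴸ +[1+ q ] a +[1+ p ] b ∷ cross₁ (p , a) ns acc

 cross₂ : ∀ {n} → List (ℕ × Lin n) → List (ℕ × Lin n) → List (Lin n) → List (Lin n)
 cross₂ []       ns acc = acc
 cross₂ (p ∷ ps) ns acc = cross₁ p ns (cross₂ ps ns acc)

 negative : ℤ → Bool
 negative (+ _)    = false
 negative -[1+ _ ] = true

 anyNegative : List (Lin 0) → Bool
 anyNegative []             = false
 anyNegative ((k , _) ∷ ls) = if negative k then true else anyNegative ls

 refute  : ∀ n → List (Lin n) → Bool
 refuteˢ : ∀ n → Sorted n → Bool
 refute zero    ls = anyNegative ls
 refute (suc n) ls = refuteˢ n (sort (snd (cheapest (tallies ls))) ls)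

 refuteˢ n (sorted f p q) = refute n (cross₂ p q f)

 dot-removeAt : ∀ {n} j (cs ρ : Vec ℤ (suc n)) →
   dot cs ρ ≡ lookup cs j * lookup ρ j + dot (removeAt cs j) (removeAt ρ j)
 dot-removeAt zero (c ∷ cs) (x ∷ ρ) = refl
 dot-removeAt (suc j) (c ∷ cs@(_ ∷ _)) (x ∷ ρ@(_ ∷ _)) =
   trans (cong (λ z → c * x + z) (dot-removeAt j cs ρ))
         (lemma (c * x) (lookup cs j * lookup ρ j) (dot (removeAt cs j) (removeAt ρ j)))
   where
   lemma : ∀ a b d → a + (b + d) ≡ b + (a + d)
   lemma = solve-∀

 module _ {n} (x : ℤ) (ρ : Vec ℤ n) where

   OkPos OkNeg : ℕ × Lin n → Set
   OkPos (p , l) = 0ℤ ≤ ⟦ l ⟧ᴸ ρ + +[1+ p ] * x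
   OkNeg (p , l) = 0ℤ ≤ ⟦ l ⟧ᴸ ρ + -[1+ p ] * x

   reassoc : ∀ c k cs → 0ℤ ≤ k + (c * x + dot cs ρ) → 0ℤ ≤ ⟦ k , cs ⟧ᴸ ρ + c * x
   reassoc c k cs = subst (0ℤ ≤_) (lemma k (c * x) (dot cs ρ))
     where
     lemma : ∀ k y A → k + (y + A) ≡ k + A + y
     lemma = solve-∀

   OkSorted : Sorted n → Set
   OkSorted (sorted f p q) = All (Nonneg ρ) f × All OkPos p × All OkNeg q

   insert-sound : ∀ k c cs s → 0ℤ ≤ k + (c * x + dot cs ρ) → OkSorted s → OkSorted (insert k c cs s)
   insert-sound k (+ zero) cs (sorted f p q) h (fs , ps , qs) =
     subst (0ℤ ≤_) (lemma k x (dot cs ρ)) h ∷ fs , ps , qs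
     where
     lemma : ∀ k x A → k + (0ℤ * x + A) ≡ k + A
     lemma = solve-∀
   insert-sound k +[1+ c ] cs (sorted f p q) h (fs , ps , qs) = fs , reassoc +[1+ c ] k cs h ∷ ps , qs
   insert-sound k -[1+ c ] cs (sorted f p q) h (fs , ps , qs) = fs , ps , reassoc -[1+ c ] k cs h ∷ qs

   resolve : ∀ {p a q b} → OkPos (p , a) → OkNeg (q , b) →
     Nonneg ρ (combineᴸ +[1+ q ] a +[1+ p ] b)
   resolve {p} {a} {q} {b} h₁ h₂ =
     subst (0ℤ ≤_)
       (trans (lemma +[1+ p ] +[1+ q ] x (⟦ a ⟧ᴸ ρ) (⟦ b ⟧ᴸ ρ))
              (sym (combineᴸ-eval +[1+ q ] a +[1+ p ] b ρ)))
       (ℤ.+-mono-≤ (scale q h₁) (scale p h₂))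
     where
     scale : ∀ c {y} → 0ℤ ≤ y → 0ℤ ≤ +[1+ c ] * y
     scale c {y} h = subst (_≤ +[1+ c ] * y) (ℤ.*-zeroʳ +[1+ c ]) (ℤ.*-monoˡ-≤-nonNeg +[1+ c ] h)
     lemma : ∀ p q x A B → q * (A + p * x) + p * (B + (- q) * x) ≡ q * A + p * B
     lemma = solve-∀

   cross₁-sound : ∀ p ns acc → OkPos p → All OkNeg ns → All (Nonneg ρ) acc →
     All (Nonneg ρ) (cross₁ p ns acc)
   cross₁-sound p []       acc h []       hs = hs
   cross₁-sound p (q ∷ ns) acc h (k ∷ ks) hs =
     resolve {fst p} {snd p} {fst q} {snd q} h k ∷ cross₁-sound p ns acc h ks hs

   cross₂-sound : ∀ ps ns acc → All OkPos ps → All OkNeg ns → All (Nonneg ρ) acc →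
     All (Nonneg ρ) (cross₂ ps ns acc)
   cross₂-sound []       ns acc []       ks hs = hs
   cross₂-sound (p ∷ ps) ns acc (g ∷ gs) ks hs =
     cross₁-sound p ns _ g ks (cross₂-sound ps ns acc gs ks hs)

 sort-sound : ∀ {n} (ρ : Vec ℤ (suc n)) j ls → All (Nonneg ρ) ls →
   OkSorted (lookup ρ j) (removeAt ρ j) (sort j ls)
 sort-sound ρ j []              []       = [] , [] , []
 sort-sound ρ j ((k , cs) ∷ ls) (h ∷ hs) =
   insert-sound (lookup ρ j) (removeAt ρ j) k (lookup cs j) (removeAt cs j) (sort j ls)
     (subst (λ z → 0ℤ ≤ k + z) (dot-removeAt j cs ρ) h) (sort-sound ρ j ls hs)

 refute-sound : ∀ n ρ ls → refute n ls ≡ true → All (Nonneg ρ) ls → ⊥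
 refute-sound zero [] ((-[1+ k ] , []) ∷ ls) eq (h ∷ hs) with subst (0ℤ ≤_) (ℤ.+-identityʳ -[1+ k ]) h
 ... | ()
 refute-sound zero [] ((+ k , []) ∷ ls) eq (h ∷ hs) = refute-sound zero [] ls eq hs
 refute-sound (suc n) ρ ls eq hs with snd (cheapest (tallies ls))
 ... | j with sort j ls | sort-sound ρ j ls hs
 ...   | sorted f p q | fs , ps , qs =
   refute-sound n (removeAt ρ j) _ eq (cross₂-sound (lookup ρ j) (removeAt ρ j) p q f ps qs fs)

 -- Decide the indicators one after the other, giving up on a branch as soon as
 -- the constraints collected so far are contradictory.
 search : ∀ {n} → ℕ → Known n → List (Lin n) → List (Ex n) → Bool
 branch : ∀ {n} → ℕ → Known n → List (Lin n) → List (Ex n) → Bool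

 search {n} fuel Γ cs [] = refute n cs
 search {n} zero Γ cs (e ∷ es) = false
 search {n} (suc fuel) Γ cs (e ∷ es) with normalise Γ e
 ... | inr l = search fuel Γ (l ∷ cs) es
 ... | inl d = branch fuel ((d , true) ∷ Γ) (d ∷ cs) (e ∷ es)
              ∧ branch fuel ((d , false) ∷ Γ) (subtract (- 1ℤ , zeros) d ∷ cs) (e ∷ es)
 branch {n} fuel Γ cs es = if refute n cs then true else search fuel Γ cs es

 ∧-split : ∀ {a b} → a ∧ b ≡ true → a ≡ true × b ≡ true
 ∧-split {true} eq = refl , eq

 Nonnegᴱ : ∀ {n} → Vec ℤ n → Ex n → Set
 Nonnegᴱ ρ e = 0ℤ ≤ ⟦ e ⟧ ρ

 search-sound : ∀ {n} fuel ρ (Γ : Known n) cs es → search fuel Γ cs es ≡ true →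
   Consistent ρ Γ → All (Nonneg ρ) cs → All (Nonnegᴱ ρ) es → ⊥
 branch-sound : ∀ {n} fuel ρ (Γ : Known n) cs es → branch fuel Γ cs es ≡ true →
   Consistent ρ Γ → All (Nonneg ρ) cs → All (Nonnegᴱ ρ) es → ⊥

 search-sound fuel ρ Γ cs [] eq ok hs [] = refute-sound _ ρ cs eq hs
 search-sound (suc fuel) ρ Γ cs (e ∷ es) eq ok hs (k ∷ ks) with normalise Γ e in eqn
 ... | inr l = search-sound fuel ρ Γ (l ∷ cs) es eq ok
                  (subst (0ℤ ≤_) (normalise-sound Γ ok e eqn) k ∷ hs) ks
 ... | inl d with 0ℤ ≤? ⟦ d ⟧ᴸ ρ | ∧-split eq
 ...   | yes p | eq₁ , eq₂ =
         branch-sound fuel ρ _ _ (e ∷ es) eq₁ (dec-true (_ ≤? _) p ∷ ok) (p ∷ hs) (k ∷ ks)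
 ...   | no ¬p | eq₁ , eq₂ =
         branch-sound fuel ρ _ _ (e ∷ es) eq₂ (dec-false (_ ≤? _) ¬p ∷ ok)
           (subst (0ℤ ≤_) (sym (trans (subtract-eval (- 1ℤ , zeros) d ρ)
               (cong (λ z → - 1ℤ + z - ⟦ d ⟧ᴸ ρ) (dot-zeros ρ))))
             (subst (0ℤ ≤_) (lemma (⟦ d ⟧ᴸ ρ)) (ℤ.i≤j⇒0≤j-i (ℤ.i<j⇒suc[i]≤j (ℤ.≰⇒> ¬p)))) ∷ hs)
           (k ∷ ks)
         where
         lemma : ∀ x → 0ℤ - (1ℤ + x) ≡ - 1ℤ + 0ℤ - x
         lemma = solve-∀

 branch-sound {n} fuel ρ Γ cs es eq ok hs ks with refute n cs in eqr
 ... | true  = refute-sound n ρ cs eqr hs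
 ... | false = search-sound fuel ρ Γ cs es eq ok hs ks

 constraints : ∀ {n} → List (Rel n) → List (Ex n)
 constraints []              = []
 constraints ((a <= b) ∷ hs) = b -' a ∷ constraints hs
 constraints ((a == b) ∷ hs) = b -' a ∷ a -' b ∷ constraints hs

 constraints-sound : ∀ {n} ρ (hs : List (Rel n)) → ⟦ hs ⟧ᴴ ρ → All (Nonnegᴱ ρ) (constraints hs)
 constraints-sound ρ []              tt       = []
 constraints-sound ρ ((a <= b) ∷ hs) (h , ks) = ℤ.i≤j⇒0≤j-i h ∷ constraints-sound ρ hs ks
 constraints-sound ρ ((a == b) ∷ hs) (h , ks) =
   ℤ.i≤j⇒0≤j-i (ℤ.≤-reflexive h) ∷ ℤ.i≤j⇒0≤j-i (ℤ.≤-reflexive (sym h)) ∷ constraints-sound ρ hs ks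

 entails≤ : ∀ {n} → List (Rel n) → Ex n → Ex n → Bool
 entails≤ hs a b = search 1000 [] [] (constraints hs ++ (a -' b -' con 1ℤ) ∷ [])

 entails : ∀ {n} → List (Rel n) → Rel n → Bool
 entails hs (a <= b) = entails≤ hs a b
 entails hs (a == b) = entails≤ hs a b ∧ entails≤ hs b a

 entails≤-sound : ∀ {n} ρ (hs : List (Rel n)) a b → entails≤ hs a b ≡ true → ⟦ hs ⟧ᴴ ρ →
   ⟦ a ⟧ ρ ≤ ⟦ b ⟧ ρ
 entails≤-sound ρ hs a b eq ks with ⟦ a ⟧ ρ ≤? ⟦ b ⟧ ρ
 ... | yes p = p
 ... | no ¬p = ⊥-elim (search-sound 1000 ρ [] [] _ eq [] []
     (Data.List.Relation.Unary.All.Properties.++⁺ (constraints-sound ρ hs ks)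
       (subst (0ℤ ≤_) (lemma (⟦ a ⟧ ρ) (⟦ b ⟧ ρ)) (ℤ.i≤j⇒0≤j-i (ℤ.i<j⇒suc[i]≤j (ℤ.≰⇒> ¬p))) ∷ [])))
   where
   import Data.List.Relation.Unary.All.Properties
   lemma : ∀ x y → x - (1ℤ + y) ≡ x - y - 1ℤ
   lemma = solve-∀

 -- Unfolding these proofs during type checking would be expensive.
 abstract
   lia : ∀ {n} (ρ : Vec ℤ n) (hs : List (Rel n)) (g : Rel n) → ⟦ hs ⟧ᴴ ρ →
     {eq : T (entails hs g)} → ⟦ g ⟧ᴿ ρ
   lia ρ hs (a <= b) ks {eq} with entails≤ hs a b in e
   ... | true = entails≤-sound ρ hs a b e ks
   lia ρ hs (a == b) ks {eq} with entails≤ hs a b in e₁ | entails≤ hs b a in e₂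
   ... | true | true = ℤ.≤-antisym (entails≤-sound ρ hs a b e₁ ks) (entails≤-sound ρ hs b a e₂ ks)

module Dbm where

 open Lia using (χ; _≤χ_)
 open import Data.Bool.Base using (if_then_else_; _∧_; _∨_; not; T)
 import Data.Fin.Properties as Fin
 open import Data.Integer.Base using (_<_; _≤ᵇ_)
 import Data.Bool.Properties as Bool
 open import Data.Product.Base using (_,_)
 open import Data.Vec.Base using (lookup; map; zipWith; tabulate)
 open import Data.Vec.Properties using (lookup-map; lookup-zipWith; lookup∘tabulate)
 open import Function.Base using (_∘_)
 open import Data.Sum.Base using (_⊎_)
 open import Relation.Nullary using (proof; _because_; Reflects; invert)
 open import Relation.Nullary.Reflects using (_×-reflects_; _⊎-reflects_; _→-reflects_; ¬-reflects; T-reflects)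
 open import Relation.Nullary.Decidable using (dec-true; dec-false)

 -- Boolean combinations and counts of difference constraints x i + c ≤ x j.
 data Form (n : ℕ) : Set where
   atom    : Fin n → ℤ → Fin n → Form n
   truth   : Bool → Form n
   _and_   : Form n → Form n → Form n
   _or_    : Form n → Form n → Form n
   _imp_   : Form n → Form n → Form n
   neg     : Form n → Form n
   atLeast : ℤ → List (Form n) → Form n

 infixr 6 _and_
 infixr 5 _or_
 infixr 4 _imp_

 eval : ∀ {n} → Form n → Vec ℤ n → Bool
 sumχ : ∀ {n} → List (Form n) → Vec ℤ n → ℤ

 eval (atom i c j)   ρ = does (lookup ρ i + c ≤? lookup ρ j)
 eval (truth b)      ρ = b
 eval (f and g)      ρ = eval f ρ ∧ eval g ρ
 eval (f or g)       ρ = eval f ρ ∨ eval g ρ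
 eval (f imp g)      ρ = not (eval f ρ) ∨ eval g ρ
 eval (neg f)        ρ = not (eval f ρ)
 eval (atLeast k fs) ρ = does (k ≤? sumχ fs ρ)

 sumχ []       ρ = 0ℤ
 sumχ (f ∷ fs) ρ = χ (eval f ρ) + sumχ fs ρ

 -- The entry at i, j bounds x i - x j from above.
 Bounds : ℕ → Set
 Bounds n = Vec (Vec (Maybe ℤ) n) n

 Below : ℤ → Maybe ℤ → Set
 Below x nothing  = ⊤
 Below x (just b) = x ≤ b

 Sound : ∀ {n} → Vec ℤ n → Bounds n → Set
 Sound ρ D = ∀ i j → Below (lookup ρ i - lookup ρ j) (lookup (lookup D i) j)

 unbounded : ∀ {n} → Bounds n
 unbounded = tabulate λ i → tabulate λ j → if does (i Fin.≟ j) then just 0ℤ else nothing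

 unbounded-sound : ∀ {n} (ρ : Vec ℤ n) → Sound ρ unbounded
 unbounded-sound ρ i j
   rewrite lookup∘tabulate (λ i → tabulate λ j → if does (i Fin.≟ j) then just 0ℤ else nothing) i
         | lookup∘tabulate (λ j → if does (i Fin.≟ j) then just 0ℤ else nothing) j
   with i Fin.≟ j
 ... | yes refl = ℤ.≤-reflexive (ℤ.+-inverseʳ (lookup ρ i))
 ... | no _     = tt

 smaller : ℤ → ℤ → Maybe ℤ
 smaller b b′ = if b ≤ᵇ b′ then just b else just b′

 relax : ℤ → Maybe ℤ → Maybe ℤ → Maybe ℤ
 relax c b        nothing  = b
 relax c nothing  (just e) = just (c + e)
 relax c (just b) (just e) = smaller b (c + e)

 relaxRow : ∀ {n} → Maybe ℤ → Vec (Maybe ℤ) n → Vec (Maybe ℤ) n → Vec (Maybe ℤ) n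
 relaxRow nothing  target row = row
 relaxRow (just c) target row = zipWith (relax c) row target

 assume : ∀ {n} → Fin n → ℤ → Fin n → Bounds n → Bounds n
 assume i c j D = map (λ row → relaxRow (Maybe.map (_- c) (lookup row i)) (lookup D j) row) D

 relax-sound : ∀ {x y c} b e → x - y ≤ c → Below x b → Below y e → Below x (relax c b e)
 relax-sound b        nothing  h p q = p
 relax-sound {x} {y} nothing  (just e) h p q =
   subst (_≤ _) (lemma x y) (ℤ.+-mono-≤ h q)
   where
   lemma : ∀ x y → x - y + y ≡ x
   lemma = solve-∀
 relax-sound {x} {y} {c} (just b) (just e) h p q with b ≤ᵇ c + e
 ... | true  = p
 ... | false = relax-sound {x} {y} nothing (just e) h tt q

 relaxRow-sound : ∀ {n} (ρ : Vec ℤ n) z c s x y target row → x + c ≤ y → Below (z - x) s →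
   (∀ b → Below (y - lookup ρ b) (lookup target b)) →
   (∀ b → Below (z - lookup ρ b) (lookup row b)) →
   ∀ b → Below (z - lookup ρ b) (lookup (relaxRow (Maybe.map (_- c) s) target row) b)
 relaxRow-sound ρ z c nothing  x y target row h p q r b = r b
 relaxRow-sound ρ z c (just s) x y target row h p q r b
   rewrite lookup-zipWith (relax (s - c)) b row target =
   relax-sound {z - lookup ρ b} {y - lookup ρ b} (lookup row b) (lookup target b) bound (r b) (q b)
   where
   lemma₁ : ∀ z x c y w → (z - x) + (x + c - y) - c ≡ (z - w) - (y - w)
   lemma₁ = solve-∀
   lemma₂ : ∀ s c → s + 0ℤ - c ≡ s - c
   lemma₂ = solve-∀
   bound : (z - lookup ρ b) - (y - lookup ρ b) ≤ s - c
   bound = subst₂ _≤_ (lemma₁ z x c y (lookup ρ b)) (lemma₂ s c)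
     (ℤ.+-monoˡ-≤ (- c) (ℤ.+-mono-≤ p (ℤ.i≤j⇒i-j≤0 h)))

 assume-sound : ∀ {n} (ρ : Vec ℤ n) i c j D → lookup ρ i + c ≤ lookup ρ j → Sound ρ D →
   Sound ρ (assume i c j D)
 assume-sound ρ i c j D h ok a b
   rewrite lookup-map a (λ row → relaxRow (Maybe.map (_- c) (lookup row i)) (lookup D j) row) D =
   relaxRow-sound ρ (lookup ρ a) c (lookup (lookup D a) i) (lookup ρ i) (lookup ρ j)
     (lookup D j) (lookup D a) h (ok a i) (ok j) (ok a) b

 within : Maybe ℤ → ℤ → Bool
 within nothing  c = false
 within (just b) c = b ≤ᵇ c

 within-sound : ∀ {x} b c → Below x b → within b c ≡ true → x ≤ c
 within-sound (just b) c h eq = ℤ.≤-trans h (ℤ.≤ᵇ⇒≤ (subst T (sym eq) tt))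

 data Status : Set where
   holds fails unknown : Status

 status : ∀ {n} → Bounds n → Fin n → ℤ → Fin n → Status
 status D i c j =
   if within (lookup (lookup D i) j) (- c) then holds
   else if within (lookup (lookup D j) i) (c - 1ℤ) then fails
   else unknown

 constant : ∀ {n} → Form n → Maybe Bool
 constant (truth b) = just b
 constant _         = nothing

 constant-sound : ∀ {n} (f : Form n) {b} ρ → constant f ≡ just b → eval f ρ ≡ b
 constant-sound (truth b) ρ refl = refl

 andˢ orˢ : ∀ {n} → Form n → Form n → Form n
 andˢ f g with constant f | constant g
 ... | just true  | _          = g
 ... | just false | _          = truth false
 ... | nothing    | just true  = f
 ... | nothing    | just false = truth false
 ... | nothing    | nothing    = f and g
 orˢ f g with constant f | constant g
 ... | just false | _          = g
 ... | just true  | _          = truth true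
 ... | nothing    | just false = f
 ... | nothing    | just true  = truth true
 ... | nothing    | nothing    = f or g

 negˢ : ∀ {n} → Form n → Form n
 negˢ f with constant f
 ... | just b  = truth (not b)
 ... | nothing = neg f

 consˢ : ∀ {n} → Form n → ℤ × List (Form n) → ℤ × List (Form n)
 consˢ f (t , fs) with constant f
 ... | just true  = 1ℤ + t , fs
 ... | just false = t , fs
 ... | nothing    = t , f ∷ fs

 lengthℤ : ∀ {n} → List (Form n) → ℤ
 lengthℤ []       = 0ℤ
 lengthℤ (f ∷ fs) = 1ℤ + lengthℤ fs

 atLeastˢ : ∀ {n} → ℤ → ℤ × List (Form n) → Form n
 atLeastˢ k (t , fs) =
   if k ≤ᵇ t then truth true
   else if k ≤ᵇ t + lengthℤ fs then atLeast (k - t) fs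
   else truth false

 ofStatus : ∀ {n} → Fin n → ℤ → Fin n → Status → Form n
 ofStatus i c j holds   = truth true
 ofStatus i c j fails   = truth false
 ofStatus i c j unknown = atom i c j

 simplify  : ∀ {n} → Bounds n → Form n → Form n
 simplifyᶜ : ∀ {n} → Bounds n → List (Form n) → ℤ × List (Form n)
 andˡ orˡ impˡ : ∀ {n} → Bounds n → Form n → Form n → Form n
 andᵗ orᵗ impᵗ : ∀ {n} → Bounds n → Form n → Maybe Bool → Form n → Form n

 simplify D (atom i c j)   = ofStatus i c j (status D i c j)
 simplify D (truth b)      = truth b
 simplify D (f and g)      = andˡ D (simplify D f) g
 simplify D (f or g)       = orˡ D (simplify D f) g
 simplify D (f imp g)      = impˡ D (simplify D f) g
 simplify D (neg f)        = negˢ (simplify D f)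
 simplify D (atLeast k fs) = atLeastˢ k (simplifyᶜ D fs)

 -- These detours through a variable keep the evaluator from simplifying f twice.
 andˡ D f g = andᵗ D f (constant f) g
 orˡ D f g  = orᵗ D f (constant f) g
 impˡ D f g = impᵗ D f (constant f) g

 andᵗ D f (just false) g = truth false
 andᵗ D f _            g = andˢ f (simplify D g)
 orᵗ D f (just true) g = truth true
 orᵗ D f _           g = orˢ f (simplify D g)

 -- The conclusion is left alone until the hypothesis is decided.
 impᵗ D f (just true)  g = simplify D g
 impᵗ D f (just false) g = truth true
 impᵗ D f nothing      g = f imp g

 simplifyᶜ D []       = 0ℤ , []
 simplifyᶜ D (f ∷ fs) = consˢ (simplify D f) (simplifyᶜ D fs)

 module _ {n} (ρ : Vec ℤ n) where

   andˢ-eval : ∀ f g → eval (andˢ f g) ρ ≡ eval f ρ ∧ eval g ρ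
   andˢ-eval f g with constant f in p | constant g in q
   ... | just true  | _          rewrite constant-sound f ρ p = refl
   ... | just false | _          rewrite constant-sound f ρ p = refl
   ... | nothing    | just true  rewrite constant-sound g ρ q = sym (Bool.∧-identityʳ _)
   ... | nothing    | just false rewrite constant-sound g ρ q = sym (Bool.∧-zeroʳ _)
   ... | nothing    | nothing    = refl

   orˢ-eval : ∀ f g → eval (orˢ f g) ρ ≡ eval f ρ ∨ eval g ρ
   orˢ-eval f g with constant f in p | constant g in q
   ... | just false | _          rewrite constant-sound f ρ p = refl
   ... | just true  | _          rewrite constant-sound f ρ p = refl
   ... | nothing    | just false rewrite constant-sound g ρ q = sym (Bool.∨-identityʳ _)
   ... | nothing    | just true  rewrite constant-sound g ρ q = sym (Bool.∨-zeroʳ _)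
   ... | nothing    | nothing    = refl

   negˢ-eval : ∀ f → eval (negˢ f) ρ ≡ not (eval f ρ)
   negˢ-eval f with constant f in p
   ... | just b  rewrite constant-sound f ρ p = refl
   ... | nothing = refl

   total : ℤ × List (Form n) → ℤ
   total (t , fs) = t + sumχ fs ρ

   consˢ-eval : ∀ f tfs → total (consˢ f tfs) ≡ χ (eval f ρ) + total tfs
   consˢ-eval f (t , fs) with constant f in p
   ... | just true  rewrite constant-sound f ρ p = ℤ.+-assoc 1ℤ t _
   ... | just false rewrite constant-sound f ρ p = sym (ℤ.+-identityˡ _)
   ... | nothing    = lemma t (χ (eval f ρ)) (sumχ fs ρ)
     where
     lemma : ∀ t x s → t + (x + s) ≡ x + (t + s)
     lemma = solve-∀

   χ-bounds : ∀ b → 0ℤ ≤ χ b × χ b ≤ 1ℤ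
   χ-bounds true  = +≤+ ℕ.z≤n , ℤ.≤-refl
   χ-bounds false = ℤ.≤-refl , +≤+ ℕ.z≤n

   sumχ-bounds : ∀ fs → 0ℤ ≤ sumχ fs ρ × sumχ fs ρ ≤ lengthℤ fs
   sumχ-bounds []       = ℤ.≤-refl , ℤ.≤-refl
   sumχ-bounds (f ∷ fs) =
     ℤ.+-mono-≤ (fst (χ-bounds (eval f ρ))) (fst (sumχ-bounds fs)) ,
     ℤ.+-mono-≤ (snd (χ-bounds (eval f ρ))) (snd (sumχ-bounds fs))

   ≤ᵇ-false : ∀ {x y} → (x ≤ᵇ y) ≡ false → ¬ x ≤ y
   ≤ᵇ-false eq p = subst T eq (ℤ.≤⇒≤ᵇ p)

   atLeastˢ-eval : ∀ k tfs → eval (atLeastˢ k tfs) ρ ≡ does (k ≤? total tfs)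
   atLeastˢ-eval k (t , fs) with k ≤ᵇ t in p
   ... | true = sym (dec-true (_ ≤? _)
         (ℤ.≤-trans {k} (ℤ.≤ᵇ⇒≤ (subst T (sym p) tt)) (subst (_≤ t + sumχ fs ρ) (ℤ.+-identityʳ t)
           (ℤ.+-monoʳ-≤ t (fst (sumχ-bounds fs))))))
   ... | false with k ≤ᵇ t + lengthℤ fs in q
   ...   | false = sym (dec-false (_ ≤? _) λ h →
           ≤ᵇ-false {k} q (ℤ.≤-trans {k} h (ℤ.+-monoʳ-≤ t (snd (sumχ-bounds fs)))))
   ...   | true with k ≤? t + sumχ fs ρ
   ...     | yes h = dec-true (_ ≤? _) (subst₂ _≤_ refl (lemma t (sumχ fs ρ)) (ℤ.+-monoˡ-≤ (- t) h))
     where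
     lemma : ∀ t s → t + s - t ≡ s
     lemma = solve-∀
   ...     | no ¬h = dec-false (_ ≤? _) λ h →
             ¬h (subst₂ _≤_ (lemma k t) refl (ℤ.+-monoʳ-≤ t h))
     where
     lemma : ∀ k t → t + (k - t) ≡ k
     lemma = solve-∀

   module _ (D : Bounds n) (ok : Sound ρ D) where

     status-sound : ∀ i c j → eval (ofStatus i c j (status D i c j)) ρ ≡ eval (atom i c j) ρ
     status-sound i c j with within (lookup (lookup D i) j) (- c) in p
     ... | true = sym (dec-true (_ ≤? _) (subst₂ _≤_ (lemma₁ (lookup ρ i) (lookup ρ j) c) (lemma₂ (lookup ρ j) c)
           (ℤ.+-monoˡ-≤ (lookup ρ j + c) (within-sound (lookup (lookup D i) j) (- c) (ok i j) p))))
       where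
       lemma₁ : ∀ x y c → (x - y) + (y + c) ≡ x + c
       lemma₁ = solve-∀
       lemma₂ : ∀ y c → - c + (y + c) ≡ y
       lemma₂ = solve-∀
     ... | false with within (lookup (lookup D j) i) (c - 1ℤ) in q
     ...   | false = refl
     ...   | true = sym (dec-false (_ ≤? _) λ h → ℤ.<-irrefl refl
           (ℤ.<-≤-trans (ℤ.<-≤-trans (ℤ.i≤pred[j]⇒i<j {i = lookup ρ j} {j = lookup ρ i + c}
              (subst₂ _≤_ (lemma₁ (lookup ρ j) (lookup ρ i)) (lemma₂ (lookup ρ i) c)
                (ℤ.+-monoˡ-≤ (lookup ρ i) (within-sound (lookup (lookup D j) i) (c - 1ℤ) (ok j i) q)))) h)
             ℤ.≤-refl))
       where
       lemma₁ : ∀ y x → (y - x) + x ≡ y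
       lemma₁ = solve-∀
       lemma₂ : ∀ x c → (c - 1ℤ) + x ≡ - 1ℤ + (x + c)
       lemma₂ = solve-∀

     simplify-eval  : ∀ f → eval (simplify D f) ρ ≡ eval f ρ
     simplifyᶜ-eval : ∀ fs → total (simplifyᶜ D fs) ≡ sumχ fs ρ
     andᵗ-eval : ∀ f b g → constant f ≡ b → eval (andᵗ D f b g) ρ ≡ eval f ρ ∧ eval g ρ
     orᵗ-eval  : ∀ f b g → constant f ≡ b → eval (orᵗ D f b g) ρ ≡ eval f ρ ∨ eval g ρ

     impᵗ-eval : ∀ f b g → constant f ≡ b → eval (impᵗ D f b g) ρ ≡ not (eval f ρ) ∨ eval g ρ

     simplify-eval (atom i c j) = status-sound i c j
     simplify-eval (truth b)    = refl
     simplify-eval (f and g)    =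
       trans (andᵗ-eval (simplify D f) _ g refl) (cong (_∧ eval g ρ) (simplify-eval f))
     simplify-eval (f or g)     =
       trans (orᵗ-eval (simplify D f) _ g refl) (cong (_∨ eval g ρ) (simplify-eval f))
     simplify-eval (f imp g)    =
       trans (impᵗ-eval (simplify D f) _ g refl) (cong (λ b → not b ∨ eval g ρ) (simplify-eval f))
     simplify-eval (neg f)      = trans (negˢ-eval (simplify D f)) (cong not (simplify-eval f))
     simplify-eval (atLeast k fs) =
       trans (atLeastˢ-eval k (simplifyᶜ D fs)) (cong (λ s → does (k ≤? s)) (simplifyᶜ-eval fs))

     simplifyᶜ-eval []       = refl
     simplifyᶜ-eval (f ∷ fs) =
       trans (consˢ-eval (simplify D f) (simplifyᶜ D fs))
             (cong₂ (λ b s → χ b + s) (simplify-eval f) (simplifyᶜ-eval fs))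

     andᵗ-eval f (just false) g p rewrite constant-sound f ρ p = refl
     andᵗ-eval f (just true)  g p = trans (andˢ-eval f _) (cong (eval f ρ ∧_) (simplify-eval g))
     andᵗ-eval f nothing      g p = trans (andˢ-eval f _) (cong (eval f ρ ∧_) (simplify-eval g))
     orᵗ-eval f (just true)  g p rewrite constant-sound f ρ p = refl
     orᵗ-eval f (just false) g p = trans (orˢ-eval f _) (cong (eval f ρ ∨_) (simplify-eval g))
     orᵗ-eval f nothing      g p = trans (orˢ-eval f _) (cong (eval f ρ ∨_) (simplify-eval g))
     impᵗ-eval f (just true)  g p rewrite constant-sound f ρ p = simplify-eval g
     impᵗ-eval f (just false) g p rewrite constant-sound f ρ p = refl
     impᵗ-eval f nothing      g p = refl

 firstAtom : ∀ {n} → Form n → Maybe (Fin n × ℤ × Fin n)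
 firstAtom (atom i c j)         = just (i , c , j)
 firstAtom (truth b)            = nothing
 firstAtom (f and g)            = firstAtom f
 firstAtom (f or g)             = firstAtom f
 firstAtom (f imp g)            = firstAtom f
 firstAtom (neg f)              = firstAtom f
 firstAtom (atLeast k [])       = nothing
 firstAtom (atLeast k (f ∷ fs)) = firstAtom f

 unsat : ∀ {n} → ℕ → Bounds n → Form n → Bool
 unsatˡ : ∀ {n} → ℕ → Bounds n → Form n → Bool
 unsat′ : ∀ {n} → ℕ → Bounds n → Form n → Maybe Bool → Maybe (Fin n × ℤ × Fin n) → Bool
 unsat zero D f = false
 unsat (suc fuel) D f = unsatˡ fuel D (simplify D f)

 unsatˡ fuel D f = unsat′ fuel D f (constant f) (firstAtom f)

 unsat′ fuel D f (just b) _                  = not b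
 unsat′ fuel D f nothing  nothing            = false
 unsat′ fuel D f nothing  (just (i , c , j)) =
   unsat fuel (assume i c j D) f ∧ unsat fuel (assume j (1ℤ - c) i D) f

 unsat-sound : ∀ {n} (ρ : Vec ℤ n) fuel D f → Sound ρ D → unsat fuel D f ≡ true → eval f ρ ≡ false
 unsat′-sound : ∀ {n} (ρ : Vec ℤ n) fuel D f b a → constant f ≡ b → Sound ρ D →
   unsat′ fuel D f b a ≡ true → eval f ρ ≡ false

 unsat-sound ρ (suc fuel) D f ok eq =
   trans (sym (simplify-eval ρ D ok f)) (unsat′-sound ρ fuel D (simplify D f) _ _ refl ok eq)

 unsat′-sound ρ fuel D f (just false) a p ok eq = constant-sound f ρ p
 unsat′-sound ρ fuel D f nothing (just (i , c , j)) p ok eq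
   with unsat fuel (assume i c j D) f in eq₁ | lookup ρ i + c ≤? lookup ρ j
 ... | true | yes h = unsat-sound ρ fuel _ f (assume-sound ρ i c j D h ok) eq₁
 ... | true | no ¬h = unsat-sound ρ fuel _ f (assume-sound ρ j (1ℤ - c) i D
         (subst₂ _≤_ (lemma (lookup ρ j) c) (lemma′ (lookup ρ i) c)
           (ℤ.+-monoˡ-≤ (- c) (ℤ.i<j⇒suc[i]≤j (ℤ.≰⇒> ¬h)))) ok) eq
   where
   lemma : ∀ y c → (1ℤ + y) - c ≡ y + (1ℤ - c)
   lemma = solve-∀
   lemma′ : ∀ x c → x + c - c ≡ x
   lemma′ = solve-∀

 valid : ∀ {n} → Form n → Bool
 valid f = unsat 1000 unbounded (neg f)

 valid-sound : ∀ {n} (f : Form n) → valid f ≡ true → ∀ ρ → eval f ρ ≡ true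
 valid-sound f eq ρ = trans (sym (Bool.not-involutive _))
   (cong not (unsat-sound ρ 1000 unbounded (neg f) (unbounded-sound ρ) eq))

 prop : ∀ {n} → Form n → Vec ℤ n → Set
 prop (atom i c j)   ρ = lookup ρ i + c ≤ lookup ρ j
 prop (truth b)      ρ = T b
 prop (f and g)      ρ = prop f ρ × prop g ρ
 prop (f or g)       ρ = prop f ρ ⊎ prop g ρ
 prop (f imp g)      ρ = prop f ρ → prop g ρ
 prop (neg f)        ρ = ¬ prop f ρ
 prop (atLeast k fs) ρ = k ≤ sumχ fs ρ

 reflects : ∀ {n} (f : Form n) ρ → Reflects (prop f ρ) (eval f ρ)
 reflects (atom i c j)   ρ = proof (_ ≤? _)
 reflects (truth b)      ρ = T-reflects b
 reflects (f and g)      ρ = reflects f ρ ×-reflects reflects g ρ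
 reflects (f or g)       ρ = reflects f ρ ⊎-reflects reflects g ρ
 reflects (f imp g)      ρ = reflects f ρ →-reflects reflects g ρ
 reflects (neg f)        ρ = ¬-reflects (reflects f ρ)
 reflects (atLeast k fs) ρ = proof (_ ≤? _)

 decideForm : ∀ {n} (f : Form n) ρ → Dec (prop f ρ)
 decideForm f ρ = eval f ρ because reflects f ρ

 prove : ∀ {n} (f : Form n) → valid f ≡ true → ∀ ρ → prop f ρ
 prove f eq ρ = invert (subst (Reflects (prop f ρ)) (valid-sound f eq ρ) (reflects f ρ))

module Stats where

 open Lia
 open import Data.Integer.Base using (_<_)
 open import Data.Product.Base using (_,_)
 open import Data.Sum.Base using (_⊎_)

 split : ∀ x y → x ≤ y ⊎ y + + 1 ≤ x
 split x y with x ≤? y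
 ... | yes p = inl p
 ... | no ¬p = inr (subst (_≤ x) (ℤ.+-comm (+ 1) y) (ℤ.i<j⇒suc[i]≤j (ℤ.≰⇒> ¬p)))

 ≤-drop : ∀ {x y} → x + + 1 ≤ y → x ≤ y
 ≤-drop {x} {y} h = (lia (x & y & []) (#0 +' !1 <= #1 & []) (#0 <= #1) (h , tt))

 sumBy : (ℤ → ℤ) → List ℤ → ℤ
 sumBy f []       = 0ℤ
 sumBy f (x ∷ xs) = f x + sumBy f xs

 sumBy-++ : ∀ f xs ys → sumBy f (xs ++ ys) ≡ sumBy f xs + sumBy f ys
 sumBy-++ f []       ys = sym (ℤ.+-identityˡ _)
 sumBy-++ f (x ∷ xs) ys = trans (cong (_+_ (f x)) (sumBy-++ f xs ys)) (sym (ℤ.+-assoc (f x) _ _))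

 sumBy-∷ʳ : ∀ f xs y → sumBy f (xs ∷ʳ y) ≡ sumBy f xs + f y
 sumBy-∷ʳ f xs y = trans (sumBy-++ f xs [ y ]) (cong (_+_ (sumBy f xs)) (ℤ.+-identityʳ (f y)))

 sumBy-+ : ∀ f g xs → sumBy (λ u → f u + g u) xs ≡ sumBy f xs + sumBy g xs
 sumBy-+ f g []       = refl
 sumBy-+ f g (x ∷ xs) with sumBy (λ u → f u + g u) xs | sumBy-+ f g xs
 ... | s | eq = (lia (s & (sumBy f xs) & (sumBy g xs) & (f x) & (g x) & []) (#0 == #1 +' #2 & []) ((#3 +' #4) +' #0 == (#3 +' #1) +' (#4 +' #2)) (eq , tt))

 sumBy-cong : ∀ {f g} xs → (∀ u → f u ≡ g u) → sumBy f xs ≡ sumBy g xs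
 sumBy-cong []       h = refl
 sumBy-cong (x ∷ xs) h = cong₂ _+_ (h x) (sumBy-cong xs h)

 total : List ℤ → ℤ
 total = sumBy (λ u → u)

 lenᶻ : List ℤ → ℤ
 lenᶻ xs = + length xs

 lenᶻ-++ : ∀ xs ys → lenᶻ (xs ++ ys) ≡ lenᶻ xs + lenᶻ ys
 lenᶻ-++ xs ys = cong +_ (List.length-++ xs)

 lenᶻ-∷ʳ : ∀ xs y → lenᶻ (xs ∷ʳ y) ≡ lenᶻ xs + + 1
 lenᶻ-∷ʳ xs y = lenᶻ-++ xs [ y ]

 -- The indicator of a pair, u before v, that does not count towards dinv.
 bd : ℤ → ℤ → ℤ
 bd u v = (v + + 2 ≤χ u) + (u + + 1 ≤χ v)

 cross : List ℤ → List ℤ → ℤ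
 cross xs ys = sumBy (λ u → sumBy (bd u) ys) xs

 bad : List ℤ → ℤ
 bad []       = 0ℤ
 bad (x ∷ xs) = sumBy (bd x) xs + bad xs

 cross-[] : ∀ xs → cross xs [] ≡ + 0
 cross-[] []       = refl
 cross-[] (x ∷ xs) = trans (ℤ.+-identityˡ _) (cross-[] xs)

 cross-∷ : ∀ xs y ys → cross xs (y ∷ ys) ≡ sumBy (λ u → bd u y) xs + cross xs ys
 cross-∷ xs y ys = sumBy-+ (λ u → bd u y) (λ u → sumBy (bd u) ys) xs

 bad-++ : ∀ xs ys → bad (xs ++ ys) ≡ bad xs + cross xs ys + bad ys
 bad-++ []       ys = sym (ℤ.+-identityˡ _)
 bad-++ (x ∷ xs) ys with sumBy (bd x) (xs ++ ys) | sumBy-++ (bd x) xs ys | bad (xs ++ ys) | bad-++ xs ys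
 ... | s | eq | b | eq′ =
   (lia (s & (sumBy (bd x) xs) & (sumBy (bd x) ys) & b & (bad xs) & (cross xs ys) & (bad ys) & []) (#0 == #1 +' #2 & #3 == #4 +' #5 +' #6 & []) (#0 +' #3 == #1 +' #4 +' (#2 +' #5) +' #6) (eq , eq′ , tt))

 -- The number of entries that are at least p.
 G : ℤ → List ℤ → ℤ
 G p = sumBy (λ u → p ≤χ u)

 before : ℤ → List ℤ → ℤ
 before v = sumBy (λ u → bd u v)

 before-G : ∀ v xs → before v xs ≡ lenᶻ xs - G v xs + G (v + + 2) xs
 before-G v []       = refl
 before-G v (x ∷ xs) with before v xs | before-G v xs
 ... | b | eq = (lia (b & (lenᶻ xs) & (G v xs) & (G (v + + 2) xs) & v & x & []) (#0 == #1 -' #2 +' #3 & []) (((#4 +' !2 <=? #5) +' (#5 +' !1 <=? #4)) +' #0 == (!1 +' #1) -' ((#4 <=? #5) +' #2) +' ((#4 +' !2 <=? #5) +' #3)) (eq , tt))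

 G-∷ʳ : ∀ p xs y → G p (xs ∷ʳ y) ≡ G p xs + (p ≤χ y)
 G-∷ʳ p = sumBy-∷ʳ (λ u → p ≤χ u)

 G-mono : ∀ {p q} xs → p ≤ q → G q xs ≤ G p xs
 G-mono          []       h = ℤ.≤-refl
 G-mono {p} {q} (x ∷ xs) h = (lia (p & q & (G q xs) & (G p xs) & x & []) (#0 <= #1 & #2 <= #3 & []) ((#1 <=? #4) +' #2 <= (#0 <=? #4) +' #3) (h , (G-mono xs h) , tt))

 0≤G : ∀ p xs → + 0 ≤ G p xs
 0≤G p []       = ℤ.≤-refl
 0≤G p (x ∷ xs) = (lia ((G p xs) & p & x & []) (!0 <= #0 & []) (!0 <= (#1 <=? #2) +' #0) ((0≤G p xs) , tt))

 G≤length : ∀ p xs → G p xs ≤ lenᶻ xs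
 G≤length p []       = ℤ.≤-refl
 G≤length p (x ∷ xs) = (lia ((G p xs) & (lenᶻ xs) & p & x & []) (#0 <= #1 & []) ((#2 <=? #3) +' #0 <= !1 +' #1) ((G≤length p xs) , tt))

 G-low : ∀ {p} xs → All (p ≤_) xs → G p xs ≡ lenᶻ xs
 G-low         []       []       = refl
 G-low {p} (x ∷ xs) (h ∷ hs) = (lia (p & x & (G p xs) & (lenᶻ xs) & []) (#0 <= #1 & #2 == #3 & []) ((#0 <=? #1) +' #2 == !1 +' #3) (h , (G-low xs hs) , tt))

 G-high : ∀ {p} xs → All (λ u → u + + 1 ≤ p) xs → G p xs ≡ + 0
 G-high         []       []       = refl
 G-high {p} (x ∷ xs) (h ∷ hs) = (lia (x & p & (G p xs) & []) (#0 +' !1 <= #1 & #2 == !0 & []) ((#1 <=? #0) +' #2 == !0) (h , (G-high xs hs) , tt))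

 bad-∷ʳ : ∀ xs y → bad (xs ∷ʳ y) ≡ bad xs + (lenᶻ xs - G y xs + G (y + + 2) xs)
 bad-∷ʳ xs y =
   (lia ((bad (xs ∷ʳ y)) & (bad xs) & (cross xs [ y ]) & (before y xs) & (cross xs []) & (lenᶻ xs) & (G y xs) & (G (y + + 2) xs) & []) (#0 == #1 +' #2 +' (!0 +' !0) & #2 == #3 +' #4 & #4 == !0 & #3 == #5 -' #6 +' #7 & []) (#0 == #1 +' (#5 -' #6 +' #7)) ((bad-++ xs [ y ]) , (cross-∷ xs y []) , (cross-[] xs) , (before-G y xs) , tt))

 -- A word in which every new maximum exceeds the previous one, m, by one.
 data Chain : List ℤ → ℤ → Set where
   start : Chain [ + 0 ] (+ 0)
   new   : ∀ {E m} → Chain E m → Chain (E ∷ʳ (m + + 1)) (m + + 1)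
   old   : ∀ {E m v} → Chain E m → + 0 ≤ v → v ≤ m → Chain (E ∷ʳ v) m

 module _ where

   0≤max : ∀ {E m} → Chain E m → + 0 ≤ m
   0≤max start       = ℤ.≤-refl
   0≤max {m = m} (new {m = m′} c) = (lia (m′ & []) (!0 <= #0 & []) (!0 <= #0 +' !1) ((0≤max c) , tt))
   0≤max (old c _ _) = 0≤max c

   ∷ʳ⁺ : ∀ {P : ℤ → Set} {xs y} → All P xs → P y → All P (xs ∷ʳ y)
   ∷ʳ⁺ []       q = q ∷ []
   ∷ʳ⁺ (p ∷ ps) q = p ∷ ∷ʳ⁺ ps q

   chain-nonneg : ∀ {E m} → Chain E m → All (+ 0 ≤_) E
   chain-nonneg start          = ℤ.≤-refl ∷ []
   chain-nonneg (new {m = m} c) = ∷ʳ⁺ (chain-nonneg c) (lia (m & []) (!0 <= #0 & []) (!0 <= #0 +' !1) ((0≤max c) , tt))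
   chain-nonneg (old c h _)    = ∷ʳ⁺ (chain-nonneg c) h

   chain-max : ∀ {E m} → Chain E m → All (_≤ m) E
   chain-max start          = ℤ.≤-refl ∷ []
   chain-max (new {m = m} c) = ∷ʳ⁺ (All.map (λ {u} h → (lia (u & m & []) (#0 <= #1 & []) (#0 <= #1 +' !1) (h , tt))) (chain-max c)) ℤ.≤-refl
   chain-max (old c _ h)    = ∷ʳ⁺ (chain-max c) h

   chain-G : ∀ {E m p q} → Chain E m → + 0 ≤ p → p ≤ q → q ≤ m + + 1 → q - p ≤ G p E - G q E
   chain-G {p = p} {q} start h₁ h₂ h₃ =
     (lia (p & q & []) (!0 <= #0 & #0 <= #1 & #1 <= !1 & []) (#1 -' #0 <= ((#0 <=? !0) +' !0) -' ((#1 <=? !0) +' !0)) (h₁ , h₂ , h₃ , tt))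
   chain-G {p = p} {q} (new {E} {m} c) h₁ h₂ h₃ rewrite G-∷ʳ p E (m + + 1) | G-∷ʳ q E (m + + 1)
     with split q (m + + 1) | split p (m + + 1)
   ... | inl h | _ = (lia (q & p & (G p E) & (G q E) & m & []) (#0 -' #1 <= #2 -' #3 & #1 <= #0 & #0 <= #4 +' !1 & []) (#0 -' #1 <= (#2 +' (#1 <=? #4 +' !1)) -' (#3 +' (#0 <=? #4 +' !1))) ((chain-G c h₁ h₂ h) , h₂ , h , tt))
   ... | inr h | inr h′ = (lia (m & p & q & (G q E) & (G p E) & []) (#0 +' !1 +' !1 <= #1 & #2 <= #0 +' !1 +' !1 & #1 <= #2 & #3 <= #4 & []) (#2 -' #1 <= (#4 +' (#1 <=? #0 +' !1)) -' (#3 +' (#2 <=? #0 +' !1))) (h′ , h₃ , h₂ , (G-mono E h₂) , tt))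
   ... | inr h | inl h′ = (lia (m & p & (G p E) & (G (m + + 1) E) & q & (G q E) & []) (#0 +' !1 -' #1 <= #2 -' #3 & #0 +' !1 +' !1 <= #4 & #4 <= #0 +' !1 +' !1 & #1 <= #4 & #1 <= #0 +' !1 & #5 <= #3 & []) (#4 -' #1 <= (#2 +' (#1 <=? #0 +' !1)) -' (#5 +' (#4 <=? #0 +' !1))) ((chain-G c h₁ h′ ℤ.≤-refl) , h , h₃ , h₂ , h′ , (G-mono {m + + 1} {q} E (≤-drop h)) , tt))
   chain-G {p = p} {q} (old {E} {m} {v} c _ _) h₁ h₂ h₃ rewrite G-∷ʳ p E v | G-∷ʳ q E v =
     (lia (q & p & (G p E) & (G q E) & v & []) (#0 -' #1 <= #2 -' #3 & #1 <= #0 & []) (#0 -' #1 <= (#2 +' (#1 <=? #4)) -' (#3 +' (#0 <=? #4))) ((chain-G c h₁ h₂ h₃) , h₂ , tt))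

   chain-length : ∀ {E m} → Chain E m → m + + 1 ≤ lenᶻ E
   chain-length {E} {m} c with chain-G {p = + 0} {m + + 1} c ℤ.≤-refl (ℤ.≤-trans (0≤max c) (lia (m & []) ([]) (#0 <= #0 +' !1) (tt))) ℤ.≤-refl
   ... | h = (lia (m & (G (+ 0) E) & (G (m + + 1) E) & (lenᶻ E) & []) (#0 +' !1 -' !0 <= #1 -' #2 & !0 <= #2 & #1 <= #3 & []) (#0 +' !1 <= #3) (h , (0≤G (m + + 1) E) , (G≤length (+ 0) E) , tt))

   chain-G-above : ∀ {E m} p → Chain E m → m + + 1 ≤ p → G p E ≡ + 0
   chain-G-above {E} {m} p c h = G-high E (All.map (λ {u} k → (lia (u & m & p & []) (#0 <= #1 & #1 +' !1 <= #2 & []) (#0 +' !1 <= #2) (k , h , tt))) (chain-max c))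

   chain-G-zero : ∀ {E m} → Chain E m → G (+ 0) E ≡ lenᶻ E
   chain-G-zero {E} c = G-low E (chain-nonneg c)

   chain-below : ∀ {E m v} → Chain E m → + 0 ≤ v → v ≤ m + + 1 → v ≤ lenᶻ E - G v E
   chain-below {E} {m} {v} c h k =
     (lia (v & (G (+ 0) E) & (G v E) & (lenᶻ E) & []) (#0 -' !0 <= #1 -' #2 & #1 == #3 & []) (#0 <= #3 -' #2) ((chain-G c ℤ.≤-refl h k) , (chain-G-zero c) , tt))

   total-∷ʳ : ∀ xs y → total (xs ∷ʳ y) ≡ total xs + y
   total-∷ʳ = sumBy-∷ʳ (λ u → u)

   chain-total≤bad : ∀ {E m} → Chain E m → total E ≤ bad E
   chain-total≤bad start = ℤ.≤-refl
   chain-total≤bad (new {E} {m} c) =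
     (lia ((total (E ∷ʳ (m + + 1))) & (total E) & m & (bad (E ∷ʳ (m + + 1))) & (bad E) & (lenᶻ E) & (G (m + + 1) E) & (G (m + + 1 + + 2) E) & []) (#0 == #1 +' (#2 +' !1) & #3 == #4 +' (#5 -' #6 +' #7) & #1 <= #4 & #2 +' !1 <= #5 & #6 == !0 & !0 <= #7 & []) (#0 <= #3) ((total-∷ʳ E (m + + 1)) , (bad-∷ʳ E (m + + 1)) , (chain-total≤bad c) , (chain-length c) , (chain-G-above (m + + 1) c ℤ.≤-refl) , (0≤G (m + + 1 + + 2) E) , tt))
   chain-total≤bad (old {E} {m} {v} c h k) =
     (lia ((total (E ∷ʳ v)) & (total E) & v & (bad (E ∷ʳ v)) & (bad E) & (lenᶻ E) & (G v E) & (G (v + + 2) E) & []) (#0 == #1 +' #2 & #3 == #4 +' (#5 -' #6 +' #7) & #1 <= #4 & #2 <= #5 -' #6 & !0 <= #7 & []) (#0 <= #3) ((total-∷ʳ E v) , (bad-∷ʳ E v) , (chain-total≤bad c) , (chain-below c h (ℤ.≤-trans k (lia (m & []) ([]) (#0 <= #0 +' !1) (tt)))) , (0≤G (v + + 2) E) , tt))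

   chain-above : ∀ {E m v} → Chain E m → + 0 ≤ v → v ≤ m → m - + 1 - v + (m ≤χ v) ≤ G (v + + 2) E
   chain-above {E} {m} {v} c h k with split m v | split (v + + 2) (m + + 1)
   ... | inl g | _ = (lia (m & v & (G (v + + 2) E) & []) (#0 <= #1 & #1 <= #0 & !0 <= #2 & []) (#0 -' !1 -' #1 +' (#0 <=? #1) <= #2) (g , k , (0≤G (v + + 2) E) , tt))
   ... | inr g | inr g′ = (lia (v & m & (G (v + + 2) E) & []) (#0 +' !1 <= #1 & #1 +' !1 +' !1 <= #0 +' !2 & []) (#1 -' !1 -' #0 +' (#1 <=? #0) <= #2) (g , g′ , tt))
   ... | inr g | inl g′ =
     (lia (m & v & (G (v + + 2) E) & (G (m + + 1) E) & []) (#0 +' !1 -' (#1 +' !2) <= #2 -' #3 & #1 +' !1 <= #0 & !0 <= #3 & []) (#0 -' !1 -' #1 +' (#0 <=? #1) <= #2) ((chain-G c (lia (v & []) (!0 <= #0 & []) (!0 <= #0 +' !2) (h , tt)) g′ ℤ.≤-refl) , g , (0≤G (m + + 1) E) , tt))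

   -- With T = |E| - m - 1 this reads m (m + 1) + 2 (m - 1) T + 2 (G m E - 1) ≤ 2 bad E:
   -- each of the T entries that are not a first occurrence forms m - 1 bad pairs,
   -- or m if it equals m, with the m + 1 first occurrences.
   chain-bad : ∀ {E m} → Chain E m →
     + 2 * (m * lenᶻ E) + + 2 * G m E + m - m * m - + 2 * lenᶻ E ≤ + 2 * bad E
   chain-bad start = ℤ.≤-refl
   chain-bad (new {E} {m} c) =
     (lia ((bad (E ∷ʳ (m + + 1))) & (bad E) & (lenᶻ E) & (G (m + + 1) E) & (G (m + + 1 + + 2) E) & (lenᶻ (E ∷ʳ (m + + 1))) & (G (m + + 1) (E ∷ʳ (m + + 1))) & m & (m * lenᶻ E) & (G m E) & (m * m) & ((m + + 1) * lenᶻ (E ∷ʳ (m + + 1))) & ((m + + 1) * (lenᶻ E + + 1)) & ((m + + 1) * (m + + 1)) & []) (#0 == #1 +' (#2 -' #3 +' #4) & #5 == #2 +' !1 & #6 == #3 +' (#7 +' !1 <=? #7 +' !1) & #3 == !0 & !0 <= #4 & + 2 *' #8 +' + 2 *' #9 +' #7 -' #10 -' + 2 *' #2 <= + 2 *' #1 & #7 +' !1 -' #7 <= #9 -' #3 & #11 == #12 & #12 == #8 +' #7 +' #2 +' !1 & #13 == #10 +' + 2 *' #7 +' !1 & []) (+ 2 *' #11 +' + 2 *' #6 +' (#7 +' !1) -' #13 -' + 2 *' #5 <= + 2 *' #0) ((bad-∷ʳ E (m + + 1)) , (lenᶻ-∷ʳ E (m + + 1)) , (G-∷ʳ (m + + 1)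 E (m + + 1)) , (chain-G-above (m + + 1) c ℤ.≤-refl) , (0≤G (m + + 1 + + 2) E) , (chain-bad c) , (chain-G c (0≤max c) (lia (m & []) ([]) (#0 <= #0 +' !1) (tt)) ℤ.≤-refl) , (cong (λ l → (m + + 1) * l) (lenᶻ-∷ʳ E (m + + 1))) , (expand m (lenᶻ E)) , (square m) , tt))
     where
     expand : ∀ m l → (m + + 1) * (l + + 1) ≡ m * l + m + l + + 1
     expand = solve-∀
     square : ∀ m → (m + + 1) * (m + + 1) ≡ m * m + + 2 * m + + 1
     square = solve-∀
   chain-bad (old {E} {m} {v} c h k) =
     (lia ((bad (E ∷ʳ v)) & (bad E) & (lenᶻ E) & (G v E) & (G (v + + 2) E) & (lenᶻ (E ∷ʳ v)) & (G m (E ∷ʳ v)) & (G m E) & m & v & (m * lenᶻ E) & (m * m) & (m * lenᶻ (E ∷ʳ v)) & (m * (lenᶻ E + + 1)) & []) (#0 == #1 +' (#2 -' #3 +' #4) & #5 == #2 +' !1 & #6 == #7 +' (#8 <=? #9) & + 2 *' #10 +' + 2 *' #7 +' #8 -' #11 -' + 2 *' #2 <= + 2 *' #1 & #9 <= #2 -' #3 & #8 -' !1 -' #9 +' (#8 <=? #9) <= #4 & #12 == #13 & #13 == #10 +' #8 & []) (+ 2 *' #12 +' + 2 *' #6 +' #8 -' #11 -' + 2 *' #5 <= + 2 *' #0) ((bad-∷ʳ E v) , (lenᶻ-∷ʳ E v) , (G-∷ʳ m E v) , (chain-bad c) , (chain-below c h (ℤ.≤-trans k (lia (m & []) ([]) (#0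 <= #0 +' !1) (tt)))) , (chain-above c h k) , (cong (λ l → m * l) (lenᶻ-∷ʳ E v)) , (expand m (lenᶻ E)) , tt))
     where
     expand : ∀ m l → m * (l + + 1) ≡ m * l + m
     expand = solve-∀

   -- The entries other than first occurrences contribute nonnegative amounts.
   chain-potential : ∀ (h Φ : ℤ → ℤ) → Φ (+ 0) ≤ h (+ 0) → (∀ m → + 0 ≤ m → Φ (m + + 1) ≤ Φ m + h (m + + 1)) →
     ∀ {E m} → Chain E m → (∀ u → + 0 ≤ u → u ≤ m → + 0 ≤ h u) → Φ m ≤ sumBy h E
   chain-potential h Φ base step start ok = (lia ((Φ (+ 0)) & (h (+ 0)) & []) (#0 <= #1 & []) (#0 <= #1 +' !0) (base , tt))
   chain-potential h Φ base step (new {E} {m} c) ok =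
     (lia ((Φ m) & (sumBy h E) & (Φ (m + + 1)) & (h (m + + 1)) & (sumBy h (E ∷ʳ (m + + 1))) & []) (#0 <= #1 & #2 <= #0 +' #3 & #4 == #1 +' #3 & []) (#2 <= #4) ((chain-potential h Φ base step c (λ u p q → ok u p (lia (u & m & []) (#0 <= #1 & []) (#0 <= #1 +' !1) (q , tt)))) , (step m (0≤max c)) , (sumBy-∷ʳ h E (m + + 1)) , tt))
   chain-potential h Φ base step (old {E} {m} {v} c p q) ok =
     (lia ((Φ m) & (sumBy h E) & (h v) & (sumBy h (E ∷ʳ v)) & []) (#0 <= #1 & !0 <= #2 & #3 == #1 +' #2 & []) (#0 <= #3) ((chain-potential h Φ base step c ok) , (ok v p q) , (sumBy-∷ʳ h E v) , tt))

 -- Each level below p occurs at least twice.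
 Doubled : ℤ → List ℤ → Set
 Doubled p E = ∀ v → + 0 ≤ v → v + + 1 ≤ p → + 2 ≤ G v E - G (v + + 1) E

 -- A skeleton: each entry is preceded by at least two entries of each lower level.
 data Sk : List ℤ → Set where
   nil  : Sk []
   snoc : ∀ {E a} → Sk E → + 0 ≤ a → Doubled a E → Sk (E ∷ʳ a)

 ≤⇒≡+ : ∀ {p q} → p ≤ q → ∃ λ k → q ≡ p + + k
 ≤⇒≡+ {p} {q} h with q - p in eq | ℤ.i≤j⇒0≤j-i h
 ... | + k | _ = k , trans (sym (lemma q p)) (cong (_+_ p) eq)
   where
   lemma : ∀ q p → p + (q - p) ≡ q
   lemma = solve-∀

 doubled-G : ∀ E {p q} → Doubled q E → + 0 ≤ p → p ≤ q → + 2 * (q - p) ≤ G p E - G q E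
 doubled-G E {p} d h k with ≤⇒≡+ k
 ... | n , refl = go n p d h
   where
   go : ∀ n p → Doubled (p + + n) E → + 0 ≤ p → + 2 * (p + + n - p) ≤ G p E - G (p + + n) E
   go zero p d h rewrite ℤ.+-identityʳ p = (lia (p & (G p E) & []) ([]) (+ 2 *' (#0 -' #0) <= #1 -' #1) (tt))
   go (suc n) p d h with go n (p + + 1) (subst (λ q → Doubled q E) (shift p (+ n)) d) (lia (p & []) (!0 <= #0 & []) (!0 <= #0 +' !1) (h , tt))
     where
     shift : ∀ p n → p + (+ 1 + n) ≡ p + + 1 + n
     shift = solve-∀
   ... | ih rewrite ℤ.+-assoc p (+ 1) (+ n) =
     (lia (p & (+ n) & (G (p + + 1) E) & (G (p + + suc n) E) & (G p E) & []) (+ 2 *' (#0 +' (!1 +' #1) -' (#0 +' !1)) <= #2 -' #3 & !2 <= #4 -' #2 & []) (+ 2 *' (#0 +' (!1 +' #1) -' #0) <= #4 -' #3) (ih , (d p h (lia ((+ n) & p & []) (!0 <= #0 & []) (#1 +' !1 <= #1 +' (!1 +' #0)) ((0≤n n) , tt))) , tt))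
     where
     0≤n : ∀ n → + 0 ≤ + n
     0≤n n = +≤+ ℕ.z≤n

 Sk-nonneg : ∀ {E} → Sk E → All (+ 0 ≤_) E
 Sk-nonneg nil          = []
 Sk-nonneg (snoc s h _) = ∷ʳ⁺ (Sk-nonneg s) h

 doubled-below : ∀ E {a} → All (+ 0 ≤_) E → + 0 ≤ a → Doubled a E → + 2 * a ≤ lenᶻ E - G a E
 doubled-below E {a} nn h d =
   (lia (a & (G (+ 0) E) & (G a E) & (lenᶻ E) & []) (+ 2 *' (#0 -' !0) <= #1 -' #2 & #1 == #3 & []) (+ 2 *' #0 <= #3 -' #2) ((doubled-G E d ℤ.≤-refl h) , (G-low E nn) , tt))

 Sk-bad : ∀ {E} → Sk E → + 2 * total E ≤ bad E
 Sk-bad nil = ℤ.≤-refl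
 Sk-bad (snoc {E} {a} s h d) =
   (lia ((total E) & (bad E) & (total (E ∷ʳ a)) & a & (bad (E ∷ʳ a)) & (lenᶻ E) & (G a E) & (G (a + + 2) E) & []) (+ 2 *' #0 <= #1 & #2 == #0 +' #3 & #4 == #1 +' (#5 -' #6 +' #7) & + 2 *' #3 <= #5 -' #6 & !0 <= #7 & []) (+ 2 *' #2 <= #4) ((Sk-bad s) , (total-∷ʳ E a) , (bad-∷ʳ E a) , (doubled-below E (Sk-nonneg s) h d) , (0≤G (a + + 2) E) , tt))

 G₁+G₂≤total : ∀ {E} → All (+ 0 ≤_) E → G (+ 1) E + G (+ 2) E ≤ total E
 G₁+G₂≤total []                  = ℤ.≤-refl
 G₁+G₂≤total {u ∷ E} (h ∷ hs) =
   (lia (u & (G (+ 1) E) & (G (+ 2) E) & (total E) & []) (!0 <= #0 & #1 +' #2 <= #3 & []) (((!1 <=? #0) +' #1) +' ((!2 <=? #0) +' #2) <= #0 +' #3) (h , (G₁+G₂≤total hs) , tt))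

module Words where

 open Lia
 open Stats
 open import Defs hiding (maximum)
 open import Data.Integer.Base using (_<_)
 open import Data.List.Base using (head)
 import Data.List.Relation.Unary.All.Properties as All
 open import Data.List.Relation.Unary.Linked using (Linked; []; [-]; _∷_)
 open import Data.Product.Base using (_,_)
 open import Data.Sum.Base using (_⊎_)

 1≰0 : ∀ {A : Set} → + 1 ≤ + 0 → A
 1≰0 (+≤+ ())

 -- Path E a: the word E followed by a is a Dyck sequence.
 data Path : List ℤ → ℤ → Set where
   start : Path [] (+ 0)
   step  : ∀ {E a b} → Path E a → + 0 ≤ b → b ≤ a + + 1 → Path (E ∷ʳ a) b

 ++-∷ʳ-assoc : ∀ {A : Set} (E : List A) a ys → (E ∷ʳ a) ++ ys ≡ E ++ a ∷ ys
 ++-∷ʳ-assoc E a ys = List.++-assoc E [ a ] ys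

 path-extend : ∀ {E a} ys → Path E a → AffineDyck (a ∷ ys) → All (+ 0 ≤_) ys →
   ∃[ E′ ] ∃[ b ] (E ++ a ∷ ys ≡ E′ ∷ʳ b × Path E′ b)
 path-extend [] p _ _ = _ , _ , refl , p
 path-extend {E} {a} (y ∷ ys) p (h ∷ hs) (k ∷ ks) with path-extend ys (step p k h) hs ks
 ... | E′ , b , eq , q = E′ , b , trans (sym (++-∷ʳ-assoc E a (y ∷ ys))) eq , q

 toPath : ∀ {x} → Dyck x → ∃[ E ] ∃[ a ] (x ≡ E ∷ʳ a × Path E a)
 toPath {_ ∷ ys} (refl , h , _ ∷ ks) = path-extend ys start h ks

 linked-∷ʳ : ∀ {R : ℤ → ℤ → Set} E {a b} → Linked R (E ∷ʳ a) → R a b → Linked R (E ∷ʳ a ∷ʳ b)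
 linked-∷ʳ []           [-]      r = r ∷ [-]
 linked-∷ʳ (x ∷ [])     (h ∷ hs) r = h ∷ linked-∷ʳ [] hs r
 linked-∷ʳ (x ∷ y ∷ E) (h ∷ hs) r = h ∷ linked-∷ʳ (y ∷ E) hs r

 head-++ : ∀ (E : List ℤ) {a b ys} → head (E ∷ʳ a) ≡ just b → head ((E ∷ʳ a) ++ ys) ≡ just b
 head-++ []      eq = eq
 head-++ (x ∷ E) eq = eq

 fromPath : ∀ {E a} → Path E a → Dyck (E ∷ʳ a)
 fromPath start = refl , [-] , ℤ.≤-refl ∷ []
 fromPath (step {E} p h k) with fromPath p
 ... | eq , l , nn = head-++ E eq , linked-∷ʳ E l k , ∷ʳ⁺ nn h

 path-chain : ∀ {E a} → Path E a → ∃[ m ] (Chain (E ∷ʳ a) m × a ≤ m)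
 path-chain start = + 0 , start , ℤ.≤-refl
 path-chain (step {E} {a} {b} p h k) with path-chain p
 ... | m , c , a≤m with split b m
 ...   | inl b≤m = m , old c h b≤m , b≤m
 ...   | inr m<b with ℤ.≤-antisym (ℤ.≤-trans k (ℤ.+-monoˡ-≤ (+ 1) a≤m)) m<b
 ...     | refl = m + + 1 , new c , ℤ.≤-refl

 cntAt : ℤ → List ℤ → ℤ
 cntAt v E = G v E - G (v + + 1) E

 0≤cntAt : ∀ v E → + 0 ≤ cntAt v E
 0≤cntAt v E = (lia ((G (v + + 1) E) & (G v E) & []) (#0 <= #1 & []) (!0 <= #1 -' #0) ((G-mono {v} {v + + 1} E (lia (v & []) ([]) (#0 <= #0 +' !1) (tt))) , tt))

 cntAt-∷ʳ : ∀ v E y → cntAt v (E ∷ʳ y) ≡ cntAt v E + ((v ≤χ y) - (v + + 1 ≤χ y))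
 cntAt-∷ʳ v E y = (lia ((G v (E ∷ʳ y)) & (G v E) & v & y & (G (v + + 1) (E ∷ʳ y)) & (G (v + + 1) E) & []) (#0 == #1 +' (#2 <=? #3) & #4 == #5 +' (#2 +' !1 <=? #3) & []) (#0 -' #4 == #1 -' #5 +' ((#2 <=? #3) -' (#2 +' !1 <=? #3))) ((G-∷ʳ v E y) , (G-∷ʳ (v + + 1) E y) , tt))

 doubled-∷ʳ : ∀ {p} E y → Doubled p E → Doubled p (E ∷ʳ y)
 doubled-∷ʳ E y d v h k =
   (lia ((cntAt v (E ∷ʳ y)) & (cntAt v E) & v & y & []) (#0 == #1 +' ((#2 <=? #3) -' (#2 +' !1 <=? #3)) & !2 <= #1 & []) (!2 <= #0) ((cntAt-∷ʳ v E y) , (d v h k) , tt))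

 doubled-weaken : ∀ {p q E} → Doubled q E → p ≤ q → Doubled p E
 doubled-weaken d h v k l = d v k (ℤ.≤-trans l h)

 Sk-init′ : ∀ {X} E a → Sk X → X ≡ E ∷ʳ a → Sk E × + 0 ≤ a × Doubled a E
 Sk-init′ E a nil eq with List.++-conicalʳ E [ a ] (sym eq)
 ... | ()
 Sk-init′ E a (snoc {E′} {a′} s h d) eq with List.∷ʳ-injective E′ E eq
 ... | refl , refl = s , h , d

 Sk-init : ∀ E {a} → Sk (E ∷ʳ a) → Sk E × + 0 ≤ a × Doubled a E
 Sk-init E {a} s = Sk-init′ E a s refl

 -- m, m + 1, …, m + k
 run : ℤ → ℕ → List ℤ
 run m zero    = [ m ]
 run m (suc k) = run m k ∷ʳ (m + + suc k)

 Head≤ : ℤ → List ℤ → Set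
 Head≤ e []      = ⊤
 Head≤ e (r ∷ R) = r ≤ e

 data Shape (X : List ℤ) : Set where
   skeleton : ∀ m → Sk X → Chain X m → Doubled m X → Shape X
   running  : ∀ S m k R → Sk S → + 0 ≤ m → Doubled m S → All (λ u → u + + 1 ≤ m) S →
              Head≤ (m + + suc k) R → X ≡ (S ++ run m (suc k)) ++ R → Shape X

 shape : ∀ {E a} → Path E a → Shape (E ∷ʳ a)
 shape start = skeleton (+ 0) (snoc nil ℤ.≤-refl λ v h k → ⊥-elim (absurd h k)) start
   (λ v h k → ⊥-elim (absurd h k))
   where
   absurd : ∀ {v} → + 0 ≤ v → v + + 1 ≤ + 0 → ⊥
   absurd {v} h k = 1≰0 (lia (v & []) (!0 <= #0 & #0 +' !1 <= !0 & []) (!1 <= !0) (h , k , tt))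
 shape (step {E} {a} {b} p 0≤b b≤a+1) with shape p
 ... | running S m k [] s h d lt _ eq with split b (m + + suc k)
 ...   | inl b≤e = running S m k [ b ] s h d lt b≤e
           (trans (cong (_∷ʳ b) eq) (cong (_++ [ b ]) (List.++-identityʳ (S ++ run m (suc k)))))
 ...   | inr e<b = running S m (suc k) [] s h d lt tt
           (trans (cong₂ _∷ʳ_ (trans eq (List.++-identityʳ _)) b≡e+1)
             (trans (List.++-assoc S (run m (suc k)) _) (sym (List.++-identityʳ _))))
   where
   a≡e : a ≡ m + + suc k
   a≡e = snd (List.∷ʳ-injective E (S ++ run m k)
     (trans eq (trans (List.++-identityʳ _) (sym (List.++-assoc S (run m k) _)))))
   b≡e+1 : b ≡ m + + suc (suc k)
   b≡e+1 = (lia (m & (+ k) & b & a & []) (#0 +' (!1 +' #1) +' !1 <= #2 & #2 <= #3 +' !1 & #3 == #0 +' (!1 +' #1) & []) (#2 == #0 +' (!1 +' (!1 +' #1))) (e<b , b≤a+1 , a≡e , tt))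
 shape (step {E} {a} {b} p 0≤b b≤a+1) | running S m k (r ∷ R) s h d lt r≤e eq =
   running S m k (r ∷ R ∷ʳ b) s h d lt r≤e
     (trans (cong (_∷ʳ b) eq) (List.++-assoc (S ++ run m (suc k)) (r ∷ R) [ b ]))
 shape (step {E} {a} {b} p 0≤b b≤a+1) | skeleton m s c d with split b m
 ... | inl b≤m = skeleton m (snoc s 0≤b (doubled-weaken {E = E ∷ʳ a} d b≤m)) (old c 0≤b b≤m) (doubled-∷ʳ (E ∷ʳ a) b d)
 ... | inr m<b with split (+ 2) (cntAt m (E ∷ʳ a))
 ...   | inl two = subst (λ z → Shape (E ∷ʳ a ∷ʳ z)) (sym b≡m+1)
           (skeleton (m + + 1) (snoc s (lia (m & []) (!0 <= #0 & []) (!0 <= #0 +' !1) ((0≤max c) , tt)) d′) (new c) (doubled-∷ʳ (E ∷ʳ a) (m + + 1) d′))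
   where
   a≤m : a ≤ m
   a≤m with All.++⁻ʳ E (chain-max c)
   ... | h ∷ [] = h
   b≡m+1 : b ≡ m + + 1
   b≡m+1 = (lia (m & b & a & []) (#0 +' !1 <= #1 & #1 <= #2 +' !1 & #2 <= #0 & []) (#1 == #0 +' !1) (m<b , b≤a+1 , a≤m , tt))
   d′ : Doubled (m + + 1) (E ∷ʳ a)
   d′ v h k with split v (m - + 1)
   ... | inl l = d v h (lia (v & m & []) (#0 <= #1 -' !1 & []) (#0 +' !1 <= #1) (l , tt))
   ... | inr l = subst (λ z → + 2 ≤ cntAt z (E ∷ʳ a)) (sym v≡m) two
     where
     v≡m : v ≡ m
     v≡m = (lia (m & v & []) (#0 -' !1 +' !1 <= #1 & #1 +' !1 <= #0 +' !1 & []) (#1 == #0) (l , k , tt))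
 ...   | inr one = running E m 0 [] (fst init) (0≤max c) (subst (λ z → Doubled z E) a≡m (snd (snd init))) below tt
           (trans (cong₂ (λ y z → E ∷ʳ y ∷ʳ z) a≡m b≡m+1)
             (trans (List.++-assoc E [ m ] [ m + + 1 ]) (sym (List.++-identityʳ _))))
   where
   init = Sk-init E s
   a≤m : a ≤ m
   a≤m with All.++⁻ʳ E (chain-max c)
   ... | h ∷ [] = h
   a≡m : a ≡ m
   a≡m = (lia (m & b & a & []) (#0 +' !1 <= #1 & #1 <= #2 +' !1 & #2 <= #0 & []) (#2 == #0) (m<b , b≤a+1 , a≤m , tt))
   b≡m+1 : b ≡ m + + 1
   b≡m+1 = (lia (m & b & a & []) (#0 +' !1 <= #1 & #1 <= #2 +' !1 & #2 <= #0 & []) (#1 == #0 +' !1) (m<b , b≤a+1 , a≤m , tt))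
   none : G m E ≤ + 0
   none = (lia ((cntAt m (E ∷ʳ a)) & (G m E) & (G (m + + 1) E) & m & a & []) (#0 +' !1 <= !2 & #0 == #1 -' #2 +' ((#3 <=? #4) -' (#3 +' !1 <=? #4)) & #4 == #3 & #2 == !0 & []) (#1 <= !0) (one , (cntAt-∷ʳ m E a) , a≡m , (G-high E (All.map (λ {u} h → (lia (u & m & []) (#0 <= #1 & []) (#0 +' !1 <= #1 +' !1) (h , tt))) (All.++⁻ˡ E (chain-max c)))) , tt))
   G-none : ∀ xs → G m xs ≤ + 0 → All (λ u → u + + 1 ≤ m) xs
   G-none [] _ = []
   G-none (u ∷ xs) h =
     (lia (m & u & (G m xs) & []) ((#0 <=? #1) +' #2 <= !0 & !0 <= #2 & []) (#1 +' !1 <= #0) (h , (0≤G m xs) , tt)) ∷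
     G-none xs (lia (m & u & (G m xs) & []) ((#0 <=? #1) +' #2 <= !0 & []) (#2 <= !0) (h , tt))
   below : All (λ u → u + + 1 ≤ m) E
   below = G-none E none

 -- No entry of P is eligible in a word that starts with P followed by z.
 data Blocked : List ℤ → ℤ → Set where
   nil  : ∀ {z} → Blocked [] z
   snoc : ∀ {P a z} → Blocked P a → cntAt (a - + 1) P ≢ + 1 ⊎ a + + 1 ≤ z → Blocked (P ∷ʳ a) z

 Sk-blocked : ∀ {S} z → Sk S → Blocked S z
 Sk-blocked z nil = nil
 Sk-blocked z (snoc {E} {a} s h d) = snoc (Sk-blocked a s) (inl unequal)
   where
   all-above : ∀ p → p ≤ + 0 → G p E ≡ lenᶻ E
   all-above p h = G-low E (All.map (ℤ.≤-trans h) (Sk-nonneg s))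
   unequal : cntAt (a - + 1) E ≢ + 1
   unequal eq = 1≰0 (conclude (split a (+ 0)))
     where
     conclude : a ≤ + 0 ⊎ + 0 + + 1 ≤ a → + 1 ≤ + 0
     conclude (inl a≤0) = (lia ((cntAt (a - + 1) E) & (G (a - + 1) E) & (lenᶻ E) & (G (a - + 1 + + 1) E) & []) (#0 == !1 & #1 == #2 & #3 == #2 & #0 == #1 -' #3 & []) (!1 <= !0) (eq , (all-above (a - + 1) (lia (a & []) (#0 <= !0 & []) (#0 -' !1 <= !0) (a≤0 , tt))) , (all-above (a - + 1 + + 1) (lia (a & []) (#0 <= !0 & []) (#0 -' !1 +' !1 <= !0) (a≤0 , tt))) , refl , tt))
     conclude (inr 0<a) = (lia ((cntAt (a - + 1) E) & []) (#0 == !1 & !2 <= #0 & []) (!1 <= !0) (eq , (d (a - + 1) (lia (a & []) (!0 +' !1 <= #0 & []) (!0 <= #0 -' !1) (0<a , tt)) (lia (a & []) ([]) (#0 -' !1 +' !1 <= #0) (tt))) , tt))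

 -- The word x arises from C by inserting w + 1 after the first w, and w + 1 is
 -- the leftmost eligible entry of x provided that C is a Dyck sequence.
 record Ins (w : ℤ) (C x : List ℤ) : Set where
   constructor ins
   field
     P R     : List ℤ
     C≡      : C ≡ P ++ w ∷ R
     x≡      : x ≡ P ++ w ∷ w + + 1 ∷ R
     below   : All (λ u → u + + 1 ≤ w) P
     blocked : Blocked P w
     0≤w     : + 0 ≤ w

 run-blocked : ∀ {S m} k z → Sk S → m + + suc k ≤ z → Blocked (S ++ run m k) z
 run-blocked {S} {m} zero    z s h = snoc (Sk-blocked m s) (inr h)
 run-blocked {S} {m} (suc k) z s h rewrite sym (List.++-assoc S (run m k) [ m + + suc k ]) =
   snoc (run-blocked k (m + + suc k) s ℤ.≤-refl) (inr (lia (m & (+ k) & z & []) (#0 +' (!1 +' (!1 +' #1)) <= #2 & []) (#0 +' (!1 +' #1) +' !1 <= #2) (h , tt)))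

 run-below : ∀ {S m} k → All (λ u → u + + 1 ≤ m) S → All (λ u → u + + 1 ≤ m + + suc k) (S ++ run m k)
 run-below {S} {m} zero    h = All.++⁺ (All.map (λ {u} l → (lia (u & m & []) (#0 +' !1 <= #1 & []) (#0 +' !1 <= #1 +' !1) (l , tt))) h) (ℤ.≤-refl ∷ [])
 run-below {S} {m} (suc k) h rewrite sym (List.++-assoc S (run m k) [ m + + suc k ]) =
   ∷ʳ⁺ (All.map (λ {u} l → (lia (u & m & (+ k) & []) (#0 +' !1 <= #1 +' (!1 +' #2) & []) (#0 +' !1 <= #1 +' (!1 +' (!1 +' #2))) (l , tt))) (run-below k h))
       (lia (m & (+ k) & []) ([]) (#0 +' (!1 +' #1) +' !1 <= #0 +' (!1 +' (!1 +' #1))) (tt))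

 run-ins : ∀ {S m} k R → Sk S → + 0 ≤ m → All (λ u → u + + 1 ≤ m) S →
   Ins (m + + k) ((S ++ run m k) ++ R) ((S ++ run m (suc k)) ++ R)
 run-ins {S} {m} zero R s h lt rewrite ℤ.+-identityʳ m = record
   { P = S ; R = R ; C≡ = ++-∷ʳ-assoc S m R
   ; x≡ = List.++-assoc S (m ∷ m + + 1 ∷ []) R
   ; below = lt ; blocked = Sk-blocked m s ; 0≤w = h }
 run-ins {S} {m} (suc k) R s h lt = record
   { P = S ++ run m k ; R = R
   ; C≡ = trans (cong (_++ R) (sym (List.++-assoc S (run m k) _))) (++-∷ʳ-assoc (S ++ run m k) (m + + suc k) R)
   ; x≡ = trans (cong (_++ R) (trans (sym (List.++-assoc S (run m (suc k)) _)) (cong (_∷ʳ (m + + suc (suc k))) (sym (List.++-assoc S (run m k) _)))))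
          (trans (++-∷ʳ-assoc ((S ++ run m k) ∷ʳ (m + + suc k)) _ R)
          (trans (++-∷ʳ-assoc (S ++ run m k) (m + + suc k) _) (cong (λ z → (S ++ run m k) ++ m + + suc k ∷ z ∷ R) bump)))
   ; below = run-below k lt ; blocked = run-blocked k (m + + suc k) s ℤ.≤-refl
   ; 0≤w = (lia (m & (+ k) & []) (!0 <= #0 & !0 <= #1 & []) (!0 <= #0 +' (!1 +' #1)) (h , (+≤+ ℕ.z≤n) , tt)) }
   where
   bump : m + + suc (suc k) ≡ m + + suc k + + 1
   bump = (lia (m & (+ k) & []) ([]) (#0 +' (!1 +' (!1 +' #1)) == #0 +' (!1 +' #1) +' !1) (tt))

module Extract where

 open Lia
 open Stats
 open Words
 open import Defs hiding (maximum)
 open import Data.Fin.Base using (toℕ)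
 open import Data.Integer.Base using (_<_)
 open import Data.List.Base using (head; take; drop; lookup; removeAt; filter; allFin; tabulate; initLast; _∷ʳ′_)
 import Data.List.Relation.Unary.All.Properties as All
 open import Data.List.Relation.Unary.Linked using ([]; [-]; _∷_)
 import Data.Maybe.Relation.Unary.All as MAll
 open import Data.Product.Base using (_,_)
 open import Data.Sum.Base using (_⊎_)
 open import Function.Base using (_∘_; id)
 open import Level using (0ℓ)
 open import Relation.Unary using (Pred; Decidable)

 count-cntAt : ∀ v xs → + count (_≟ v) xs ≡ cntAt v xs
 count-cntAt v []       = refl
 count-cntAt v (x ∷ xs) with x ≟ v
 ... | yes refl = (lia ((+ count (_≟ v) xs) & (cntAt v xs) & (G v xs) & (G (v + + 1) xs) & v & []) (#0 == #1 & #1 == #2 -' #3 & []) (!1 +' #0 == ((#4 <=? #4) +' #2) -' ((#4 +' !1 <=? #4) +' #3)) ((count-cntAt v xs) , refl , tt))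
 ... | no ¬p with split x v | split v x
 ...   | inr h | _ = (lia ((+ count (_≟ v) xs) & (G v xs) & (G (v + + 1) xs) & v & x & []) (#0 == #1 -' #2 & #3 +' !1 <= #4 & []) (#0 == ((#3 <=? #4) +' #1) -' ((#3 +' !1 <=? #4) +' #2)) ((count-cntAt v xs) , h , tt))
 ...   | inl h | inr k = (lia ((+ count (_≟ v) xs) & (G v xs) & (G (v + + 1) xs) & x & v & []) (#0 == #1 -' #2 & #3 +' !1 <= #4 & []) (#0 == ((#4 <=? #3) +' #1) -' ((#4 +' !1 <=? #3) +' #2)) ((count-cntAt v xs) , k , tt))
 ...   | inl h | inl k = ⊥-elim (¬p (ℤ.≤-antisym h k))

 mid : ∀ (A : List ℤ) e R → Fin (length (A ++ e ∷ R))
 mid []      e R = zero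
 mid (x ∷ A) e R = suc (mid A e R)

 module _ (e : ℤ) (R : List ℤ) where

   lookup-mid : ∀ A → lookup (A ++ e ∷ R) (mid A e R) ≡ e
   lookup-mid []      = refl
   lookup-mid (x ∷ A) = lookup-mid A

   removeAt-mid : ∀ A → removeAt (A ++ e ∷ R) (mid A e R) ≡ A ++ R
   removeAt-mid []      = refl
   removeAt-mid (x ∷ A) = cong (x ∷_) (removeAt-mid A)

   take-mid : ∀ A → take (toℕ (mid A e R)) (A ++ e ∷ R) ≡ A
   take-mid []      = refl
   take-mid (x ∷ A) = cong (x ∷_) (take-mid A)

   drop-mid : ∀ A → drop (suc (toℕ (mid A e R))) (A ++ e ∷ R) ≡ R
   drop-mid []      = refl
   drop-mid (x ∷ A) = drop-mid A

   earlier-split : ∀ A (i : Fin (length (A ++ e ∷ R))) → toℕ i ℕ.< toℕ (mid A e R) → ∃[ B ]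
     (A ≡ take (toℕ i) (A ++ e ∷ R) ++ lookup (A ++ e ∷ R) i ∷ B × drop (suc (toℕ i)) (A ++ e ∷ R) ≡ B ++ e ∷ R)
   earlier-split (x ∷ A) zero    h         = A , refl , refl
   earlier-split (x ∷ A) (suc i) (ℕ.s≤s h) with earlier-split A i h
   ... | B , eq , eq′ = B , cong (x ∷_) eq , eq′

 index-split : ∀ (c : List ℤ) (i : Fin (length c)) → c ≡ take (toℕ i) c ++ lookup c i ∷ drop (suc (toℕ i)) c
 index-split (x ∷ c) zero    = refl
 index-split (x ∷ c) (suc i) = cong (x ∷_) (index-split c i)

 snoc-split : ∀ {A : Set} (P : List A) a X b B → P ∷ʳ a ≡ X ++ b ∷ B →
   (P ≡ X × a ≡ b × B ≡ []) ⊎ ∃[ B′ ] (P ≡ X ++ b ∷ B′ × B ≡ B′ ∷ʳ a)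
 snoc-split P a X b B eq with initLast B
 ... | []       with List.∷ʳ-injective P X eq
 ...   | refl , refl = inl (refl , refl , refl)
 snoc-split P a X b .(B′ ∷ʳ z) eq | B′ ∷ʳ′ z with List.∷ʳ-injective P (X ++ b ∷ B′) (trans eq (sym (List.++-assoc X (b ∷ B′) _)))
 ... | refl , refl = inr (B′ , refl , refl)

 blocked-at : ∀ {P z} → Blocked P z → ∀ X b B R → P ≡ X ++ b ∷ B → cntAt (b - + 1) X ≡ + 1 →
   MAll.All (_≤ b) (head (B ++ z ∷ R)) → ⊥
 blocked-at nil [] b B R () _ _
 blocked-at nil (x ∷ X) b B R () _ _
 blocked-at {z = z} (snoc {P} {a} p h) X b B R eq one le with snoc-split P a X b B eq
 ... | inr (B′ , eq₁ , refl) = blocked-at p X b B′ (z ∷ R) eq₁ one (subst (λ l → MAll.All (_≤ b) (head l)) (List.++-assoc B′ [ a ] (z ∷ R)) le)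
 blocked-at {z = z} (snoc {P} {a} p (inl ne)) X b B R eq one le | inl (refl , refl , refl) = ne one
 blocked-at {z = z} (snoc {P} {a} p (inr lt)) X b B R eq one (MAll.just le) | inl (refl , refl , refl) =
   1≰0 (lia (a & z & []) (#0 +' !1 <= #1 & #1 <= #0 & []) (!1 <= !0) (lt , le , tt))

 blocked-prefix : ∀ {P z} → Blocked P z → ∀ X b B → P ≡ X ++ b ∷ B → Blocked X b
 blocked-prefix nil [] b B ()
 blocked-prefix nil (x ∷ X) b B ()
 blocked-prefix (snoc {P} {a} p _) X b B eq with snoc-split P a X b B eq
 ... | inl (refl , refl , _)  = p
 ... | inr (B′ , eq₁ , refl) = blocked-prefix p X b B′ eq₁

 head-filter-tabulate : ∀ {A : Set} {P : Pred A 0ℓ} (P? : Decidable P) {n} (f : Fin n → A) j → P (f j) →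
   (∀ i → toℕ i ℕ.< toℕ j → ¬ P (f i)) → head (filter P? (tabulate f)) ≡ just (f j)
 head-filter-tabulate P? {suc n} f j p q with P? (f zero)
 head-filter-tabulate P? {suc n} f zero    p q | yes _ = refl
 head-filter-tabulate P? {suc n} f (suc j) p q | yes r = ⊥-elim (q zero (ℕ.s≤s ℕ.z≤n) r)
 head-filter-tabulate P? {suc n} f zero    p q | no ¬r = ⊥-elim (¬r p)
 head-filter-tabulate P? {suc n} f (suc j) p q | no ¬r =
   head-filter-tabulate P? (f ∘ suc) j p (λ i h → q (suc i) (ℕ.s≤s h))

 extract-mid : ∀ c j → Eligible c j → (∀ i → toℕ i ℕ.< toℕ j → ¬ Eligible c i) →
   extract c ≡ just (lookup c j , removeAt c j)
 extract-mid c j p q = cong (Maybe.map λ j → lookup c j , removeAt c j) (head-filter-tabulate (eligible? c) id j p q)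

 extract-none : ∀ c → ¬ ∃ (Eligible c) → extract c ≡ nothing
 extract-none c h = cong (λ js → Maybe.map (λ j → lookup c j , removeAt c j) (head js))
   (List.filter-none (eligible? c) {allFin (length c)} (All.tabulate⁺ (λ i p → h (i , p))))

 affine-join : ∀ P {w R} → AffineDyck (P ∷ʳ w) → AffineDyck (w ∷ R) → AffineDyck (P ++ w ∷ R)
 affine-join []          l r       = r
 affine-join (x ∷ [])    (h ∷ l) r = h ∷ r
 affine-join (x ∷ y ∷ P) (h ∷ l) r = h ∷ affine-join (y ∷ P) l r

 affine-left : ∀ P {w R} → AffineDyck (P ++ w ∷ R) → AffineDyck (P ∷ʳ w)
 affine-left []          l       = [-]
 affine-left (x ∷ [])    (h ∷ l) = h ∷ [-]
 affine-left (x ∷ y ∷ P) (h ∷ l) = h ∷ affine-left (y ∷ P) l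

 affine-right : ∀ P {w R} → AffineDyck (P ++ w ∷ R) → AffineDyck (w ∷ R)
 affine-right []          l       = l
 affine-right (x ∷ [])    (h ∷ l) = l
 affine-right (x ∷ y ∷ P) (h ∷ l) = affine-right (y ∷ P) l

 affine-head : ∀ {w R} → AffineDyck (w ∷ R) → Head≤ (w + + 1) R
 affine-head [-]     = tt
 affine-head (h ∷ _) = h

 affine-cons : ∀ {w} R → Head≤ (w + + 1) R → AffineDyck R → AffineDyck (w ∷ R)
 affine-cons []      _ _ = [-]
 affine-cons (r ∷ R) h l = h ∷ l

 affine-tail : ∀ {w R} → AffineDyck (w ∷ R) → AffineDyck R
 affine-tail [-]     = []
 affine-tail (_ ∷ l) = l

 Head≤-≤ : ∀ {a b} R → a ≤ b → Head≤ a R → Head≤ b R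
 Head≤-≤ []      h k = tt
 Head≤-≤ (r ∷ R) h k = ℤ.≤-trans k h

 head-swap : ∀ (P : List ℤ) {w A B} → head (P ++ w ∷ A) ≡ head (P ++ w ∷ B)
 head-swap []      = refl
 head-swap (x ∷ P) = refl

 -- Dyck sequences P ++ w ∷ R and P ++ w ∷ w + 1 ∷ R determine each other.
 dyck-insert : ∀ P {w R} → + 0 ≤ w → Dyck (P ++ w ∷ R) → Dyck (P ++ w ∷ w + + 1 ∷ R)
 dyck-insert P {w} {R} h (eq , l , nn) =
   trans (head-swap P) eq ,
   affine-join P (affine-left P l) (ℤ.≤-refl ∷ affine-cons R (Head≤-≤ R (lia (w & []) ([]) (#0 +' !1 <= #0 +' !1 +' !1) (tt)) (affine-head (affine-right P l))) (affine-tail (affine-right P l))) ,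
   All.++⁺ (All.++⁻ˡ P nn) (h ∷ (lia (w & []) (!0 <= #0 & []) (!0 <= #0 +' !1) (h , tt)) ∷ All.tail (All.++⁻ʳ P nn))

 dyck-delete : ∀ P {w R} → Head≤ (w + + 1) R → Dyck (P ++ w ∷ w + + 1 ∷ R) → Dyck (P ++ w ∷ R)
 dyck-delete P {w} {R} h (eq , l , nn) =
   trans (head-swap P) eq ,
   affine-join P (affine-left P l) (affine-cons R h (affine-tail (affine-tail (affine-right P l)))) ,
   All.++⁺ (All.++⁻ˡ P nn) (All.head (All.++⁻ʳ P nn) ∷ All.tail (All.tail (All.++⁻ʳ P nn)))

 ins-dyck : ∀ {w C x} → Ins w C x → Dyck C → Dyck x
 ins-dyck (ins P R refl refl _ _ h) d = dyck-insert P h d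

 cntAt-below : ∀ {v} xs → All (λ u → u + + 1 ≤ v) xs → cntAt v xs ≡ + 0
 cntAt-below {v} xs h = (lia ((G v xs) & (G (v + + 1) xs) & []) (#0 == !0 & #1 == !0 & []) (#0 -' #1 == !0) ((G-high xs h) , (G-high xs (All.map (λ {u} k → (lia (u & v & []) (#0 +' !1 <= #1 & []) (#0 +' !1 <= #1 +' !1) (k , tt))) h)) , tt))

 Head≤⇒MAll : ∀ {e} R → Head≤ e R → MAll.All (_≤ e) (head R)
 Head≤⇒MAll []      _ = MAll.nothing
 Head≤⇒MAll (r ∷ R) h = MAll.just h

 extract-ins : ∀ {w C x} → Ins w C x → Dyck C → extract x ≡ just (w + + 1 , C)
 extract-ins {w} (ins P R refl refl lt bl h) (_ , l , _)
   rewrite sym (++-∷ʳ-assoc P w (w + + 1 ∷ R)) =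
   trans (extract-mid c (mid A e R) elig early)
     (cong₂ (λ y z → just (y , z)) (lookup-mid e R A) (trans (removeAt-mid e R A) (++-∷ʳ-assoc P w R)))
   where
   A = P ∷ʳ w
   e = w + + 1
   c = A ++ e ∷ R
   one : cntAt (e - + 1) A ≡ + 1
   one = (lia ((cntAt (e - + 1) A) & (cntAt (e - + 1) P) & w & []) (#0 == #1 +' ((#2 +' !1 -' !1 <=? #2) -' (#2 +' !1 -' !1 +' !1 <=? #2)) & #1 == !0 & []) (#0 == !1) ((cntAt-∷ʳ (e - + 1) P w) , (cntAt-below P (All.map (λ {u} k → (lia (u & w & []) (#0 +' !1 <= #1 & []) (#0 +' !1 <= #1 +' !1 -' !1) (k , tt))) lt)) , tt))
   elig : Eligible c (mid A e R)
   elig rewrite lookup-mid e R A | take-mid e R A | drop-mid e R A =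
     ℤ.+-injective (trans (count-cntAt (e - + 1) A) one) , Head≤⇒MAll R (affine-head (affine-right P l))
   early : ∀ i → toℕ i ℕ.< toℕ (mid A e R) → ¬ Eligible c i
   early i i<j (cnt , le) with earlier-split e R A i i<j
   ... | B , eq , eq′ rewrite eq′ =
     blocked-at {z = e} (snoc {a = w} bl (inr ℤ.≤-refl)) (take (toℕ i) c) (lookup c i) B R eq
       (trans (sym (count-cntAt (lookup c i - + 1) (take (toℕ i) c))) (cong +_ cnt)) le

 Sk-none : ∀ {x} → Sk x → ¬ ∃ (Eligible x)
 Sk-none {x} s (i , cnt , le) =
   blocked-at {z = lookup x i} (Sk-blocked (lookup x i) s) (take (toℕ i) x) (lookup x i) (drop (suc (toℕ i)) x) []
     (index-split x i) (trans (sym (count-cntAt (lookup x i - + 1) (take (toℕ i) x))) (cong +_ cnt))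
     (extend (drop (suc (toℕ i)) x) le)
   where
   extend : ∀ Q → MAll.All (_≤ lookup x i) (head Q) → MAll.All (_≤ lookup x i) (head (Q ++ lookup x i ∷ []))
   extend []      _ = MAll.just ℤ.≤-refl
   extend (q ∷ Q) h = h

 -- Every Dyck sequence is a skeleton or has an extractable entry.
 data Peel (x : List ℤ) : Set where
   skeleton : Sk x → Peel x
   peeled   : ∀ {w C} → Ins w C x → Dyck C → Peel x

 run-init : ∀ S m k → ∃[ P ] (S ++ run m k ≡ P ∷ʳ (m + + k))
 run-init S m zero    = S , cong (S ∷ʳ_) (sym (ℤ.+-identityʳ m))
 run-init S m (suc k) = S ++ run m k , sym (List.++-assoc S (run m k) _)

 running-dyck : ∀ {S m} k R → Head≤ (m + + suc k) R → Dyck ((S ++ run m (suc k)) ++ R) → Dyck ((S ++ run m k) ++ R)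
 running-dyck {S} {m} k R h d with run-init S m k
 ... | P , eq = subst Dyck (sym left) (dyck-delete P (subst (λ e → Head≤ e R) bump h) (subst Dyck right d))
   where
   bump : m + + suc k ≡ m + + k + + 1
   bump = (lia (m & (+ k) & []) ([]) (#0 +' (!1 +' #1) == #0 +' #1 +' !1) (tt))
   left : (S ++ run m k) ++ R ≡ P ++ (m + + k) ∷ R
   left = trans (cong (_++ R) eq) (++-∷ʳ-assoc P _ R)
   right : (S ++ run m (suc k)) ++ R ≡ P ++ (m + + k) ∷ (m + + k + + 1) ∷ R
   right = trans (cong (_++ R) (trans (sym (List.++-assoc S (run m k) _)) (cong (_∷ʳ (m + + suc k)) eq)))
     (trans (++-∷ʳ-assoc (P ∷ʳ (m + + k)) _ R) (trans (++-∷ʳ-assoc P _ _) (cong (λ z → P ++ (m + + k) ∷ z ∷ R) bump)))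

 peel : ∀ {x} → Dyck x → Peel x
 peel d with toPath d
 ... | E , a , refl , p with shape p
 ...   | skeleton m s c dd = skeleton s
 ...   | running S m k R s h dd lt le eq = peeled (subst (Ins (m + + k) _) (sym eq) (run-ins k R s h lt))
           (running-dyck k R le (subst Dyck eq d))

 Sk⇒full : ∀ {x} → Dyck x → Sk x → FullSkeleton x
 Sk⇒full d s = d , Sk-none s

 ins-not-Sk : ∀ {w C x} → Ins w C x → Dyck C → ¬ FullSkeleton x
 ins-not-Sk i dC (_ , none) with trans (sym (extract-none _ none)) (extract-ins i dC)
 ... | ()

 -- The first occurrence of w in C is preceded by no eligible entry, so w + 1
 -- may be inserted there.
 record Adm (w : ℤ) (C : List ℤ) : Set where
   constructor adm
   field
     P R     : List ℤ
     C≡      : C ≡ P ++ w ∷ R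
     below   : All (λ u → u + + 1 ≤ w) P
     blocked : Blocked P w
     0≤w     : + 0 ≤ w

 ins⇒adm : ∀ {w C x} → Ins w C x → Adm w C
 ins⇒adm (ins P R C≡ _ lt bl h) = adm P R C≡ lt bl h

 adm⇒ins : ∀ {w C} → Adm w C → ∃[ x ] Ins w C x
 adm⇒ins {w} (adm P R C≡ lt bl h) = P ++ w ∷ w + + 1 ∷ R , ins P R C≡ refl lt bl h

 adm-++ : ∀ {w C} V → Adm w C → Adm w (C ++ V)
 adm-++ {w} V (adm P R refl lt bl h) = adm P (R ++ V) (List.++-assoc P (w ∷ R) V) lt bl h

 first-occurrence : ∀ {E m} → Chain E m → ∀ v → + 0 ≤ v → v ≤ m →
   ∃[ X ] ∃[ B ] (E ≡ X ++ v ∷ B × All (λ u → u + + 1 ≤ v) X)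
 first-occurrence start v h k = [] , [] , cong [_] (ℤ.≤-antisym h k) , []
 first-occurrence (old {v = y} c _ _) v h k with first-occurrence c v h k
 ... | X , B , refl , lt = X , B ∷ʳ y , List.++-assoc X (v ∷ B) [ y ] , lt
 first-occurrence (new {E} {m} c) v h k with split v m
 ... | inl v≤m with first-occurrence c v h v≤m
 ...   | X , B , refl , lt = X , B ∷ʳ (m + + 1) , List.++-assoc X (v ∷ B) [ m + + 1 ] , lt
 first-occurrence (new {E} {m} c) v h k | inr m<v =
   E , [] , cong (E ∷ʳ_) (ℤ.≤-antisym m<v k) , All.map (λ {u} l → (lia (u & m & v & []) (#0 <= #1 & #1 +' !1 <= #2 & []) (#0 +' !1 <= #2) (l , m<v , tt))) (chain-max c)

 dyck-prefix : ∀ P {w R} → Dyck (P ++ w ∷ R) → Dyck (P ∷ʳ w)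
 dyck-prefix P (eq , l , nn) = trans (head-swap P) eq , affine-left P l , ∷ʳ⁺ (All.++⁻ˡ P nn) (All.head (All.++⁻ʳ P nn))

 dyck-path : ∀ P {w} → Dyck (P ∷ʳ w) → Path P w
 dyck-path P d with toPath d
 ... | E , a , eq , p with List.∷ʳ-injective P E eq
 ...   | refl , refl = p

 -- Injecting w + 1 and then u + 1 is undone by extracting u + 1 and then w + 1
 -- if and only if u ≤ w + 1.
 adm-push : ∀ {w C x u} → Dyck C → Ins w C x → + 0 ≤ u → u ≤ w + + 1 → Adm u x
 adm-push {w} {C} {x} {u} dC (ins P R refl refl lt bl h) hu k with split u w
 ... | inr w<u = adm (P ∷ʳ w) R (trans (cong (λ z → P ++ w ∷ z ∷ R) (ℤ.≤-antisym w<u k)) (sym (++-∷ʳ-assoc P w (u ∷ R))))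
        (∷ʳ⁺ (All.map (λ {y} l → (lia (y & w & u & []) (#0 +' !1 <= #1 & #1 +' !1 <= #2 & []) (#0 +' !1 <= #2) (l , w<u , tt))) lt) w<u) (snoc bl (inr w<u)) hu
 ... | inl u≤w with split w u
 ...   | inl w≤u = subst (λ z → Adm z _) (ℤ.≤-antisym w≤u u≤w) (adm P (w + + 1 ∷ R) refl lt bl h)
 ...   | inr u<w with path-chain (dyck-path P (dyck-prefix P dC))
 ...     | m , c , w≤m with first-occurrence c u hu (ℤ.≤-trans u≤w w≤m)
 ...       | X , B , eq , lt′ with snoc-split P w X u B eq
 ...         | inl (_ , refl , _) = 1≰0 (lia (w & []) (#0 +' !1 <= #0 & []) (!1 <= !0) (u<w , tt))
 ...         | inr (B′ , refl , _) = adm X (B′ ++ w ∷ w + + 1 ∷ R) (List.++-assoc X (u ∷ B′) _) lt′ (blocked-prefix bl X u B′ refl) hu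

 ++-overlap : ∀ {A : Set} (P : List A) {a b R} X {u B} → P ++ a ∷ b ∷ R ≡ X ++ u ∷ B →
   (∃[ Y ] P ≡ X ++ u ∷ Y) ⊎ u ≡ a ⊎ u ≡ b ⊎ ∃[ Y ] (X ≡ P ++ a ∷ b ∷ Y × R ≡ Y ++ u ∷ B)
 ++-overlap []      []          refl = inr (inl refl)
 ++-overlap []      (x ∷ [])    refl = inr (inr (inl refl))
 ++-overlap []      (x ∷ y ∷ X) refl = inr (inr (inr (X , refl , refl)))
 ++-overlap (p ∷ P) []          refl = inl (P , refl)
 ++-overlap (p ∷ P) (x ∷ X)     eq with List.∷-injective eq
 ... | refl , eq′ with ++-overlap P X eq′
 ...   | inl (Y , refl)                       = inl (Y , refl)
 ...   | inr (inl q)                         = inr (inl q)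
 ...   | inr (inr (inl q))                  = inr (inr (inl q))
 ...   | inr (inr (inr (Y , refl , q)))     = inr (inr (inr (Y , refl , q)))

 adm-pop : ∀ {w C x u} → Dyck C → Ins w C x → Adm u x → u ≤ w + + 1
 adm-pop {w} {C} {x} {u} (_ , l , _) (ins P R refl refl lt bl h) (adm P′ R′ eq lt′ bl′ h′) with split u (w + + 1)
 ... | inl k = k
 ... | inr k with ++-overlap P P′ eq
 ...   | inl (Y , refl) = ⊥-elim (1≰0 (lia (u & w & []) (#0 +' !1 <= #1 & #1 +' !1 +' !1 <= #0 & []) (!1 <= !0) ((All.head (All.++⁻ʳ P′ lt)) , k , tt)))
 ...   | inr (inl refl) = ⊥-elim (1≰0 (lia (u & []) (#0 +' !1 +' !1 <= #0 & []) (!1 <= !0) (k , tt)))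
 ...   | inr (inr (inl refl)) = ⊥-elim (1≰0 (lia (w & []) (#0 +' !1 +' !1 <= #0 +' !1 & []) (!1 <= !0) (k , tt)))
 ...   | inr (inr (inr (Y , refl , refl))) =
   ⊥-elim (blocked-at bl′ (P ∷ʳ w) (w + + 1) Y [] (sym (++-∷ʳ-assoc P w (w + + 1 ∷ Y))) one (follow Y (affine-head (affine-right P l))))
   where
   one : cntAt (w + + 1 - + 1) (P ∷ʳ w) ≡ + 1
   one = (lia ((cntAt (w + + 1 - + 1) (P ∷ʳ w)) & (cntAt (w + + 1 - + 1) P) & w & []) (#0 == #1 +' ((#2 +' !1 -' !1 <=? #2) -' (#2 +' !1 -' !1 +' !1 <=? #2)) & #1 == !0 & []) (#0 == !1) ((cntAt-∷ʳ (w + + 1 - + 1) P w) , (cntAt-below P (All.map (λ {y} k → (lia (y & w & []) (#0 +' !1 <= #1 & []) (#0 +' !1 <= #1 +' !1 -' !1) (k , tt))) lt)) , tt))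
   follow : ∀ Y → Head≤ (w + + 1) (Y ++ u ∷ R′) → MAll.All (_≤ w + + 1) (head (Y ++ u ∷ []))
   follow []      le = MAll.just le
   follow (y ∷ Y) le = MAll.just le

module Moves where

 open Lia
 open Stats
 open Words
 open Extract
 open import Defs hiding (maximum)
 open import Data.Integer.Base using (_<_)
 open import Data.List.Base using (head; take; drop)
 import Data.List.Relation.Unary.All.Properties as All
 open import Data.List.Relation.Unary.Linked using ([]; _∷_)
 open import Data.List.Extrema ℤ.≤-totalOrder using (max; xs≤max)
 open import Data.List.Base using (map)
 open import Data.Bool.Base using (if_then_else_)
 open import Relation.Nullary.Decidable using (_×-dec_; _⊎-dec_)
 open import Data.Nat.Combinatorics using (nC1≡n; nCk+nC[k+1]≡[n+1]C[k+1]) renaming (_C_ to _choose_)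
 open import Data.Product.Base using (_,_)
 open import Data.Sum.Base using (_⊎_)
 open import Relation.Nullary.Decidable using (dec-true; dec-false)

 +1-1 : ∀ w → w + + 1 - + 1 ≡ w
 +1-1 w = (lia (w & []) ([]) (#0 +' !1 -' !1 == #0) (tt))

 if-false : ∀ {A : Set} {b} {p q : A} → b ≡ false → (if b then p else q) ≡ q
 if-false refl = refl

 if-true : ∀ {A : Set} {b} {p q : A} → b ≡ true → (if b then p else q) ≡ p
 if-true refl = refl

 insertAfterFirst-first : ∀ P {w e R} → All (λ u → u + + 1 ≤ w) P → insertAfterFirst w e (P ++ w ∷ R) ≡ P ++ w ∷ e ∷ R
 insertAfterFirst-first [] {w} [] rewrite dec-true (w ≟ w) refl = refl
 insertAfterFirst-first (x ∷ P) {w} {e} {R} (h ∷ hs) =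
   trans (if-false (dec-false (x ≟ w) λ eq → 1≰0 (lia (x & w & []) (#0 +' !1 <= #1 & #0 == #1 & []) (!1 <= !0) (h , eq , tt))))
         (cong (x ∷_) (insertAfterFirst-first P hs))

 inject-ins : ∀ {w C x} → Ins w C x → Dyck C → inject (w + + 1) C ≡ just x
 inject-ins {w} (ins P R refl refl lt _ h) d
   rewrite dec-true (dyck? (P ++ w ∷ R) ×-dec (+ 1 ≤? w + + 1) ×-dec (w + + 1 ≤? max (+ 0) (P ++ w ∷ R) + + 1))
             (d , (lia (w & []) (!0 <= #0 & []) (!1 <= #0 +' !1) (h , tt)) , ℤ.+-monoˡ-≤ (+ 1) (All.head (All.++⁻ʳ P (xs≤max (+ 0) (P ++ w ∷ R)))))
         | +1-1 w = cong just (insertAfterFirst-first P lt)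

 -- Inserted us D y: injecting us, with 1 added to each entry, from right to left
 -- into D gives y.
 data Inserted : List ℤ → List ℤ → List ℤ → Set where
   []  : ∀ {D} → Dyck D → Inserted [] D D
   _∷_ : ∀ {u us D z y} → Ins u z y → Inserted us D z → Inserted (u ∷ us) D y

 inserted-dyck : ∀ {us D y} → Inserted us D y → Dyck y
 inserted-dyck ([] d)  = d
 inserted-dyck (i ∷ r) = ins-dyck i (inserted-dyck r)

 inserted-base : ∀ {us D y} → Inserted us D y → Dyck D
 inserted-base ([] d)  = d
 inserted-base (i ∷ r) = inserted-base r

 inserted-inject : ∀ {us D y} → Inserted us D y → injectRightToLeft (map (_+ + 1) us) D ≡ just y
 inserted-inject ([] d) = refl
 inserted-inject (i ∷ r) rewrite inserted-inject r = inject-ins i (inserted-dyck r)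

 take-final : ∀ (D us : List ℤ) → take (length (D ++ us) ℕ.∸ length us) (D ++ us) ≡ D
 take-final D us rewrite List.length-++ D {us} | ℕ.m+n∸n≡m (length D) (length us) = go D
   where
   go : ∀ D → take (length D) (D ++ us) ≡ D
   go []      = refl
   go (x ∷ D) = cong (x ∷_) (go D)

 drop-final : ∀ (D us : List ℤ) → drop (length (D ++ us) ℕ.∸ length us) (D ++ us) ≡ us
 drop-final D us rewrite List.length-++ D {us} | ℕ.m+n∸n≡m (length D) (length us) = go D
   where
   go : ∀ D → drop (length D) (D ++ us) ≡ us
   go []      = refl
   go (x ∷ D) = go D

 reinject-inserted : ∀ {us D y} → Inserted us D y → reinjectFinal (length us) (D ++ us) ≡ just y
 reinject-inserted {us} {D} r rewrite take-final D us | drop-final D us = inserted-inject r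

 onFinal-++ : ∀ (f : List ℤ → Maybe (List ℤ)) D us → onFinal (length us) f (D ++ us) ≡ Maybe.map (D ++_) (f us)
 onFinal-++ f D us rewrite take-final D us | drop-final D us = refl

 inserted-total : ∀ {us D y} → Inserted us D y → total y ≡ total (D ++ us) + lenᶻ us
 inserted-length : ∀ {us D y} → Inserted us D y → lenᶻ y ≡ lenᶻ (D ++ us)
 inserted-bad : ∀ {us D y} V → Inserted us D y → bad (y ++ V) ≡ bad (D ++ V ++ us) + lenᶻ us

 total-++ : ∀ xs ys → total (xs ++ ys) ≡ total xs + total ys
 total-++ = sumBy-++ (λ u → u)

 ins-total : ∀ {w C x} → Ins w C x → total x ≡ total C + w + + 1
 ins-total {w} (ins P R refl refl _ _ _) =
   (lia ((total (P ++ w ∷ w + + 1 ∷ R)) & (total P) & w & (total R) & (total (P ++ w ∷ R)) & []) (#0 == #1 +' (#2 +' (#2 +' !1 +' #3)) & #4 == #1 +' (#2 +' #3) & []) (#0 == #4 +' #2 +' !1) ((total-++ P (w ∷ w + + 1 ∷ R)) , (total-++ P (w ∷ R)) , tt))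

 ins-length : ∀ {w C x} → Ins w C x → lenᶻ x ≡ lenᶻ C + + 1
 ins-length {w} (ins P R refl refl _ _ _) =
   (lia ((lenᶻ (P ++ w ∷ w + + 1 ∷ R)) & (lenᶻ P) & (lenᶻ R) & (lenᶻ (P ++ w ∷ R)) & []) (#0 == #1 +' (!1 +' (!1 +' #2)) & #3 == #1 +' (!1 +' #2) & []) (#0 == #3 +' !1) ((lenᶻ-++ P (w ∷ w + + 1 ∷ R)) , (lenᶻ-++ P (w ∷ R)) , tt))

 inserted-total ([] {D} _) = (lia ((total (D ++ [])) & (total D) & []) (#0 == #1 & []) (#1 == #0 +' !0) ((cong total (List.++-identityʳ D)) , tt))
 inserted-total {u ∷ us} {D} {y} (_∷_ {z = z} i r) =
   (lia ((total y) & (total z) & u & (total (D ++ us)) & (lenᶻ us) & (total D) & (total us) & (total (D ++ u ∷ us)) & []) (#0 == #1 +' #2 +' !1 & #1 == #3 +' #4 & #3 == #5 +' #6 & #7 == #5 +' (#2 +' #6) & []) (#0 == #7 +' (!1 +' #4)) ((ins-total i) , (inserted-total r) , (total-++ D us) , (total-++ D (u ∷ us)) , tt))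

 inserted-length ([] {D} _) = cong lenᶻ (sym (List.++-identityʳ D))
 inserted-length {u ∷ us} {D} {y} (_∷_ {z = z} i r) =
   (lia ((lenᶻ y) & (lenᶻ z) & (lenᶻ (D ++ us)) & (lenᶻ D) & (lenᶻ us) & (lenᶻ (D ++ u ∷ us)) & []) (#0 == #1 +' !1 & #1 == #2 & #2 == #3 +' #4 & #5 == #3 +' (!1 +' #4) & []) (#0 == #5) ((ins-length i) , (inserted-length r) , (lenᶻ-++ D us) , (lenᶻ-++ D (u ∷ us)) , tt))

 sumBy-insert : ∀ f A e B → sumBy f (A ++ e ∷ B) ≡ sumBy f (A ++ B) + f e
 sumBy-insert f A e B = (lia ((sumBy f (A ++ e ∷ B)) & (sumBy f A) & (f e) & (sumBy f B) & (sumBy f (A ++ B)) & []) (#0 == #1 +' (#2 +' #3) & #4 == #1 +' #3 & []) (#0 == #4 +' #2) ((sumBy-++ f A (e ∷ B)) , (sumBy-++ f A B) , tt))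

 bad-insert : ∀ A e B → bad (A ++ e ∷ B) ≡ bad (A ++ B) + before e A + sumBy (bd e) B
 bad-insert [] e B = (lia ((sumBy (bd e) B) & (bad B) & []) ([]) (#0 +' #1 == #1 +' !0 +' #0) (tt))
 bad-insert (x ∷ A) e B =
   (lia ((sumBy (bd x) (A ++ e ∷ B)) & (sumBy (bd x) (A ++ B)) & (bd x e) & (bad (A ++ e ∷ B)) & (bad (A ++ B)) & (before e A) & (sumBy (bd e) B) & []) (#0 == #1 +' #2 & #3 == #4 +' #5 +' #6 & []) (#0 +' #3 == (#1 +' #4) +' (#2 +' #5) +' #6) ((sumBy-insert (bd x) A e B) , (bad-insert A e B) , tt))

 -- Moving w + 1 from its place after the first w to the end, as w, turns exactly
 -- one bad pair into a good one.
 ins-bad : ∀ {w C x} V → Ins w C x → bad (x ++ V) ≡ bad ((C ++ V) ∷ʳ w) + + 1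
 ins-bad {w} V (ins P R refl refl lt _ _) rewrite List.++-assoc P (w ∷ w + + 1 ∷ R) V | List.++-assoc P (w ∷ R) V
   | sym (++-∷ʳ-assoc P w (w + + 1 ∷ R ++ V)) =
   (lia ((bad ((P ∷ʳ w) ++ w + + 1 ∷ R ++ V)) & (bad ((P ∷ʳ w) ++ R ++ V)) & (before (w + + 1) (P ∷ʳ w)) & (sumBy (bd (w + + 1)) (R ++ V)) & (bad (P ++ w ∷ R ++ V)) & (bad ((P ++ w ∷ R ++ V) ∷ʳ w)) & (before w (P ++ w ∷ R ++ V)) & (before (w + + 1) P) & w & (before w P) & (before w (R ++ V)) & []) (#0 == #1 +' #2 +' #3 & #1 == #4 & #5 == #4 +' #6 +' !0 & #2 == #7 +' ((#8 +' !1 +' !2 <=? #8) +' (#8 +' !1 <=? #8 +' !1)) & #6 == #9 +' (((#8 +' !2 <=? #8) +' (#8 +' !1 <=? #8)) +' #10) & #7 == #9 & #3 == #10 & []) (#0 == #5 +' !1) ((bad-insert (P ∷ʳ w) (w + + 1) (R ++ V)) , (cong bad (++-∷ʳ-assoc P w (R ++ V))) , (trans (bad-insert (P ++ w ∷ R ++ V) w []) (cong (λ l → bad l + before w (P ++ w ∷ R ++ V) + + 0) (List.++-identityʳ (P ++ w ∷ R ++ V)))) , (sumBy-∷ʳ (λ u → bd u (w + + 1)) P w) , (sumBy-++ (λ u → bd u w) P (w ∷ R ++ V)) , (prefix P lt) , (suffix (R ++ V)) , tt))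
   where
   prefix : ∀ P → All (λ u → u + + 1 ≤ w) P → before (w + + 1) P ≡ before w P
   prefix [] [] = refl
   prefix (u ∷ P) (h ∷ hs) = (lia (u & w & (before (w + + 1) P) & (before w P) & []) (#0 +' !1 <= #1 & #2 == #3 & []) (((#1 +' !1 +' !2 <=? #0) +' (#0 +' !1 <=? #1 +' !1)) +' #2 == ((#1 +' !2 <=? #0) +' (#0 +' !1 <=? #1)) +' #3) (h , (prefix P hs) , tt))
   suffix : ∀ Q → sumBy (bd (w + + 1)) Q ≡ before w Q
   suffix [] = refl
   suffix (u ∷ Q) = (lia ((sumBy (bd (w + + 1)) Q) & (before w Q) & u & w & []) (#0 == #1 & []) (((#2 +' !2 <=? #3 +' !1) +' (#3 +' !1 +' !1 <=? #2)) +' #0 == ((#3 +' !2 <=? #2) +' (#2 +' !1 <=? #3)) +' #1) ((suffix Q) , tt))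

 inserted-bad V ([] {D} _) rewrite List.++-identityʳ V = sym (ℤ.+-identityʳ _)
 inserted-bad {u ∷ us} {D} {y} V (_∷_ {z = z} i r) =
   (lia ((bad (y ++ V)) & (bad ((z ++ V) ∷ʳ u)) & (bad (z ++ (V ∷ʳ u))) & (bad (D ++ (V ∷ʳ u) ++ us)) & (lenᶻ us) & (bad (D ++ V ++ u ∷ us)) & []) (#0 == #1 +' !1 & #1 == #2 & #2 == #3 +' #4 & #3 == #5 & []) (#0 == #5 +' (!1 +' #4)) ((ins-bad V i) , (cong bad (List.++-assoc z V [ u ])) , (inserted-bad (V ∷ʳ u) r) , (cong (λ l → bad (D ++ l)) (++-∷ʳ-assoc V u us)) , tt))

 inserted-bad₀ : ∀ {us D y} → Inserted us D y → bad y ≡ bad (D ++ us) + lenᶻ us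
 inserted-bad₀ {y = y} r = trans (cong bad (sym (List.++-identityʳ y))) (inserted-bad [] r)

 -- dinv counts the pairs that are not bad.
 dinv-bad : ∀ x → + dinv x + bad x ≡ + (length x choose 2)
 dinv-bad [] = refl
 dinv-bad (a ∷ as) =
   (lia ((+ dinv as) & (bad as) & (+ (length as choose 2)) & (+ count (λ b → (a ≟ b) ⊎-dec (a ≟ b + + 1)) as) & (sumBy (bd a) as) & (lenᶻ as) & (+ (suc (length as) choose 2)) & []) (#0 +' #1 == #2 & #3 +' #4 == #5 & #6 == #5 +' #2 & []) ((#3 +' #0) +' (#4 +' #1) == #6) ((dinv-bad as) , (pairs as) , (cong +_ (pascal (length as))) , tt))
   where
   pascal : ∀ n → suc n choose 2 ≡ n ℕ.+ n choose 2
   pascal n = trans (sym (nCk+nC[k+1]≡[n+1]C[k+1] n 1)) (cong (ℕ._+ n choose 2) (nC1≡n n))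
   pairs : ∀ bs → + count (λ b → (a ≟ b) ⊎-dec (a ≟ b + + 1)) bs + sumBy (bd a) bs ≡ lenᶻ bs
   pairs [] = refl
   pairs (b ∷ bs) with a ≟ b | a ≟ b + + 1
   ... | yes p | q = (lia (a & b & (+ count (λ b → (a ≟ b) ⊎-dec (a ≟ b + + 1)) bs) & (sumBy (bd a) bs) & (lenᶻ bs) & []) (#0 == #1 & #2 +' #3 == #4 & []) ((!1 +' #2) +' (((#1 +' !2 <=? #0) +' (#0 +' !1 <=? #1)) +' #3) == !1 +' #4) (p , (pairs bs) , tt))
   ... | no ¬p | yes q = (lia (a & b & (+ count (λ b → (a ≟ b) ⊎-dec (a ≟ b + + 1)) bs) & (sumBy (bd a) bs) & (lenᶻ bs) & []) (#0 == #1 +' !1 & #2 +' #3 == #4 & []) ((!1 +' #2) +' (((#1 +' !2 <=? #0) +' (#0 +' !1 <=? #1)) +' #3) == !1 +' #4) (q , (pairs bs) , tt))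
   ... | no ¬p | no ¬q with split b a | split (a + + 1) (b + + 1) | split (b + + 2) a
   ...   | inr l | _ | _ = (lia (a & b & (+ count (λ b → (a ≟ b) ⊎-dec (a ≟ b + + 1)) bs) & (sumBy (bd a) bs) & (lenᶻ bs) & []) (#0 +' !1 <= #1 & #2 +' #3 == #4 & []) (#2 +' (((#1 +' !2 <=? #0) +' (#0 +' !1 <=? #1)) +' #3) == !1 +' #4) (l , (pairs bs) , tt))
   ...   | inl l | inl k | _ = ⊥-elim (¬p (ℤ.≤-antisym (lia (a & b & []) (#0 +' !1 <= #1 +' !1 & []) (#0 <= #1) (k , tt)) l))
   ...   | inl l | inr k | inl j = (lia (b & a & (+ count (λ b → (a ≟ b) ⊎-dec (a ≟ b + + 1)) bs) & (sumBy (bd a) bs) & (lenᶻ bs) & []) (#0 +' !2 <= #1 & #2 +' #3 == #4 & []) (#2 +' (((#0 +' !2 <=? #1) +' (#1 +' !1 <=? #0)) +' #3) == !1 +' #4) (j , (pairs bs) , tt))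
   ...   | inl l | inr k | inr j = ⊥-elim (¬q (lia (b & a & []) (#0 +' !1 +' !1 <= #1 +' !1 & #1 +' !1 <= #0 +' !2 & []) (#1 == #0 +' !1) (k , j , tt)))

 area-total : ∀ x → area x ≡ total x
 area-total []      = refl
 area-total (a ∷ x) = cong (_+_ a) (area-total x)

 defc-bad : ∀ x → defc x ≡ bad x - total x
 defc-bad x = (lia ((+ dinv x) & (bad x) & (+ (length x choose 2)) & (area x) & (total x) & []) (#0 +' #1 == #2 & #3 == #4 & []) (#2 -' #3 -' #0 == #1 -' #4) ((dinv-bad x) , (area-total x) , tt))

module Facts where

 open Lia
 open Stats
 open Words
 open import Data.Integer.Base using (_<_)
 import Data.List.Relation.Unary.All.Properties as All
 open import Data.Product.Base using (_,_)
 open import Data.Sum.Base using (_⊎_)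

 LowDeficit : List ℤ → Set
 LowDeficit σ = bad σ - total σ ≤ + 2 * lenᶻ σ - + 8

 cross-before : ∀ E W → cross E W ≡ sumBy (λ v → before v E) W
 cross-before E []      = cross-[] E
 cross-before E (v ∷ W) = trans (cross-∷ E v W) (cong (_+_ (before v E)) (cross-before E W))

 -- The contribution of a letter v after E to the deficit.
 κ : List ℤ → ℤ → ℤ
 κ E v = lenᶻ E - G v E + G (v + + 2) E - v

 deficit-split : ∀ E W → LowDeficit (E ++ W) →
   (bad E - total E) + sumBy (κ E) W + bad W ≤ + 2 * (lenᶻ E + lenᶻ W) - + 8
 deficit-split E W h =
   (lia ((bad (E ++ W)) & (total (E ++ W)) & (lenᶻ (E ++ W)) & (bad E) & (cross E W) & (bad W) & (total E) & (total W) & (lenᶻ E) & (lenᶻ W) & (sumBy (λ v → before v E) W) & (sumBy (κ E) W) & []) (#0 -' #1 <= + 2 *' #2 -' !8 & #0 == #3 +' #4 +' #5 & #1 == #6 +' #7 & #2 == #8 +' #9 & #4 == #10 & #11 == #10 -' #7 & []) ((#3 -' #6) +' #11 +' #5 <= + 2 *' (#8 +' #9) -' !8) (h , (bad-++ E W) , (sumBy-++ (λ u → u) E W) , (lenᶻ-++ E W) , (cross-before E W) , (minus W) , tt))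
   where
   minus : ∀ W → sumBy (κ E) W ≡ sumBy (λ v → before v E) W - total W
   minus []      = refl
   minus (v ∷ W) = (lia ((sumBy (κ E) W) & (sumBy (λ v → before v E) W) & (total W) & (before v E) & (lenᶻ E) & (G v E) & (G (v + + 2) E) & v & []) (#0 == #1 -' #2 & #3 == #4 -' #5 +' #6 & []) ((#4 -' #5 +' #6 -' #7) +' #0 == (#3 +' #1) -' (#7 +' #2)) ((minus W) , (before-G v E) , tt))

 0≤bd : ∀ a b → + 0 ≤ bd a b
 0≤bd a b = (lia (b & a & []) ([]) (!0 <= (#0 +' !2 <=? #1) +' (#1 +' !1 <=? #0)) (tt))

 Sk-excess : ∀ {E} → Sk E → G (+ 1) E + G (+ 2) E ≤ bad E - total E
 Sk-excess {E} s = (lia ((total E) & (bad E) & (G (+ 1) E) & (G (+ 2) E) & []) (+ 2 *' #0 <= #1 & #2 +' #3 <= #0 & []) (#2 +' #3 <= #1 -' #0) ((Sk-bad s) , (G₁+G₂≤total (Sk-nonneg s)) , tt))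

 -- A skeleton with a letter that is at least 2 forms a bad pair of every 0 and
 -- that letter, whatever their order.
 Sk-excess₂ : ∀ {E} → Sk E → + 1 ≤ G (+ 2) E → G (+ 2) E + lenᶻ E - + 2 ≤ bad E - total E
 Sk-excess₂ {E} s h = (lia ((total E) & (lenᶻ E) & (G (+ 1) E) & (bad E) & (G (+ 2) E) & []) (+ 2 *' #0 +' #1 -' #2 -' !2 <= #3 & #2 +' #4 <= #0 & []) (#4 +' #1 -' !2 <= #3 -' #0) ((strong s h) , (G₁+G₂≤total (Sk-nonneg s)) , tt))
   where
   strong : ∀ {E} → Sk E → + 1 ≤ G (+ 2) E → + 2 * total E + lenᶻ E - G (+ 1) E - + 2 ≤ bad E
   strong nil (+≤+ ())
   strong (snoc {E} {a} s h d) two with split (+ 1) (G (+ 2) E)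
   ... | inl k =
     (lia ((total E) & (lenᶻ E) & (G (+ 1) E) & (bad E) & (total (E ∷ʳ a)) & a & (bad (E ∷ʳ a)) & (G a E) & (G (a + + 2) E) & (lenᶻ (E ∷ʳ a)) & (G (+ 1) (E ∷ʳ a)) & []) (+ 2 *' #0 +' #1 -' #2 -' !2 <= #3 & #4 == #0 +' #5 & #6 == #3 +' (#1 -' #7 +' #8) & #9 == #1 +' !1 & #10 == #2 +' (!1 <=? #5) & + 2 *' #5 <= #1 -' #7 & !1 -' (!1 <=? #5) <= #8 & !0 <= #5 & []) (+ 2 *' #4 +' #9 -' #10 -' !2 <= #6) ((strong s k) , (total-∷ʳ E a) , (bad-∷ʳ E a) , (lenᶻ-∷ʳ E a) , (G-∷ʳ (+ 1) E a) , (doubled-below E (Sk-nonneg s) h d) , (zero-case) , h , tt))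
     where
     zero-case : + 1 - (+ 1 ≤χ a) ≤ G (a + + 2) E
     zero-case with split a (+ 0)
     ... | inl a≤0 = (lia ((G (+ 2) E) & (G (a + + 2) E) & a & []) (#0 <= #1 & !1 <= #0 & []) (!1 -' (!1 <=? #2) <= #1) ((G-mono {a + + 2} {+ 2} E (lia (a & []) (#0 <= !0 & []) (#0 +' !2 <= !2) (a≤0 , tt))) , k , tt))
     ... | inr 0<a = (lia (a & (G (a + + 2) E) & []) (!0 +' !1 <= #0 & !0 <= #1 & []) (!1 -' (!1 <=? #0) <= #1) (0<a , (0≤G (a + + 2) E) , tt))
   ... | inr k =
     (lia ((total E) & (bad E) & (total (E ∷ʳ a)) & a & (bad (E ∷ʳ a)) & (lenᶻ E) & (G a E) & (G (a + + 2) E) & (lenᶻ (E ∷ʳ a)) & (G (+ 1) (E ∷ʳ a)) & (G (+ 1) E) & (G (+ 2) E) & []) (+ 2 *' #0 <= #1 & #2 == #0 +' #3 & #4 == #1 +' (#5 -' #6 +' #7) & #8 == #5 +' !1 & #9 == #10 +' (!1 <=? #3) & #3 == !2 & #11 <= !0 & #6 <= #11 & !0 <= #7 & !2 <= #10 -' #11 & []) (+ 2 *' #2 +' #8 -' #9 -' !2 <= #4) ((Sk-bad s) , (total-∷ʳ E a) , (bad-∷ʳ E a) , (lenᶻ-∷ʳ E a) , (G-∷ʳ (+ 1) E a) , a≡2 , G≤0 , (G-mono {+ 2} {a} E 2≤a) , (0≤G (a + + 2) E) , (d (+ 1) (+≤+ ℕ.z≤n) 2≤a) , tt))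
     where
     G≤0 : G (+ 2) E ≤ + 0
     G≤0 = (lia ((G (+ 2) E) & []) (#0 +' !1 <= !1 & []) (#0 <= !0) (k , tt))
     2≤a : + 2 ≤ a
     2≤a = (lia ((G (+ 2) (E ∷ʳ a)) & (G (+ 2) E) & a & []) (!1 <= #0 & #0 == #1 +' (!2 <=? #2) & #1 <= !0 & []) (!2 <= #2) (two , (G-∷ʳ (+ 2) E a) , G≤0 , tt))
     a≤2 : a ≤ + 2
     a≤2 with split a (+ 2)
     ... | inl q = q
     ... | inr q = 1≰0 (lia ((G (+ 2) E) & (G (+ 3) E) & []) (!2 <= #0 -' #1 & #0 <= !0 & !0 <= #1 & []) (!1 <= !0) ((d (+ 2) (+≤+ ℕ.z≤n) q) , G≤0 , (0≤G (+ 3) E) , tt))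
     a≡2 : a ≡ + 2
     a≡2 = ℤ.≤-antisym a≤2 2≤a

 module SkeletonFacts {E : List ℤ} {m : ℤ} (s : Sk E) (c : Chain E m) (d : Doubled m E) where

   D₀ = bad E - total E
   L = lenᶻ E

   drop : ∀ {p q} → + 0 ≤ p → p ≤ q → q ≤ m → + 2 * (q - p) ≤ G p E - G q E
   drop h k l = doubled-G E (doubled-weaken {E = E} d l) h k

   0≤g : ∀ p → + 0 ≤ G p E
   0≤g p = 0≤G p E

   one : + 1 ≤ m → + 2 ≤ L - G (+ 1) E
   one h = (lia ((G (+ 0) E) & (G (+ 1) E) & L & []) (+ 2 *' (!1 -' !0) <= #0 -' #1 & #0 == #2 & []) (!2 <= #2 -' #1) ((drop ℤ.≤-refl (+≤+ ℕ.z≤n) h) , (chain-G-zero c) , tt))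

   below : ∀ {v} → + 0 ≤ v → v ≤ m → + 2 * v ≤ L - G v E
   below {v} h k = (lia (v & (G (+ 0) E) & (G v E) & L & []) (+ 2 *' (#0 -' !0) <= #1 -' #2 & #1 == #3 & []) (+ 2 *' #0 <= #3 -' #2) ((drop ℤ.≤-refl h k) , (chain-G-zero c) , tt))

   top : + 1 ≤ G m E
   top = (lia (m & (G m E) & (G (m + + 1) E) & []) (#0 +' !1 -' #0 <= #1 -' #2 & !0 <= #2 & []) (!1 <= #1) ((chain-G c (0≤max c) (lia (m & []) ([]) (#0 <= #0 +' !1) (tt)) ℤ.≤-refl) , (0≤g (m + + 1)) , tt))

   -- If levels p, …, m are present then G p exceeds twice the number of levels
   -- p, …, m - 1 by the multiplicity of the top level.
   toTop : ∀ {p v} → + 0 ≤ p → p ≤ m → v ≤ m + + 2 → p ≤ v → + 2 * (v - p) - + 3 ≤ G p E - G v E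
   toTop {p} {v} h k l q with split v m
   ... | inl v≤m = (lia (v & p & (G p E) & (G v E) & []) (+ 2 *' (#0 -' #1) <= #2 -' #3 & []) (+ 2 *' (#0 -' #1) -' !3 <= #2 -' #3) ((drop h q v≤m) , tt))
   ... | inr m<v = (lia (m & p & (G p E) & (G m E) & (G v E) & v & []) (+ 2 *' (#0 -' #1) <= #2 -' #3 & #4 == !0 & !1 <= #3 & #5 <= #0 +' !2 & []) (+ 2 *' (#5 -' #1) -' !3 <= #2 -' #4) ((drop h k ℤ.≤-refl) , (chain-G-above v c m<v) , top , l , tt))

   toTop₁ : ∀ {p v} → + 0 ≤ p → p ≤ m → v ≤ m + + 1 → p ≤ v → + 2 * (v - p) - + 1 ≤ G p E - G v E
   toTop₁ {p} {v} h k l q with split v m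
   ... | inl v≤m = (lia (v & p & (G p E) & (G v E) & []) (+ 2 *' (#0 -' #1) <= #2 -' #3 & []) (+ 2 *' (#0 -' #1) -' !1 <= #2 -' #3) ((drop h q v≤m) , tt))
   ... | inr m<v = (lia (m & p & (G p E) & (G m E) & (G v E) & v & []) (+ 2 *' (#0 -' #1) <= #2 -' #3 & #4 == !0 & !1 <= #3 & #5 <= #0 +' !1 & []) (+ 2 *' (#5 -' #1) -' !1 <= #2 -' #4) ((drop h k ℤ.≤-refl) , (chain-G-above v c m<v) , top , l , tt))

   two-letters : ∀ {u₀ u₁} → + 2 ≤ u₀ → u₀ ≤ u₁ + + 1 → u₁ ≤ m → LowDeficit (E ++ u₀ ∷ u₁ ∷ []) → ⊥
   two-letters {u₀} {u₁} h k l low = 1≰0 (conclude (split u₀ m) (split (+ 2) m))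
     where
     1≤u₁ : + 1 ≤ u₁
     1≤u₁ = (lia (u₀ & u₁ & []) (!2 <= #0 & #0 <= #1 +' !1 & []) (!1 <= #1) (h , k , tt))
     conclude : u₀ ≤ m ⊎ m + + 1 ≤ u₀ → + 2 ≤ m ⊎ m + + 1 ≤ + 2 → + 1 ≤ + 0
     conclude (inl q) _ = (lia (D₀ & L & (G u₀ E) & (G (u₀ + + 2) E) & u₀ & (G u₁ E) & (G (u₁ + + 2) E) & u₁ & (bd u₀ u₁) & (G (+ 1) E) & (G (+ 2) E) & []) (#0 +' (#1 -' #2 +' #3 -' #4 +' (#1 -' #5 +' #6 -' #7 +' !0)) +' (#8 +' !0 +' (!0 +' !0)) <= + 2 *' (#1 +' !2) -' !8 & !0 <= #8 & !0 <= #3 & !0 <= #6 & #9 +' #10 <= #0 & + 2 *' (#7 -' !1) <= #9 -' #5 & + 2 *' (#4 -' !2) <= #10 -' #2 & !2 <= #4 & !1 <= #7 & []) (!1 <= !0) ((deficit-split E (u₀ ∷ u₁ ∷ []) low) , (0≤bd u₀ u₁) , (0≤g (u₀ + + 2)) , (0≤g (u₁ + + 2)) , (Sk-excess s) , (drop (+≤+ ℕ.z≤n) 1≤u₁ l) , (drop (+≤+ ℕ.z≤n) h q) , h , 1≤u₁ , tt))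
     conclude (inr q) (inl r) = (lia (D₀ & L & (G u₀ E) & (G (u₀ + + 2) E) & u₀ & (G u₁ E) & (G (u₁ + + 2) E) & u₁ & (bd u₀ u₁) & (G (+ 1) E) & (G (+ 2) E) & m & []) (#0 +' (#1 -' #2 +' #3 -' #4 +' (#1 -' #5 +' #6 -' #7 +' !0)) +' (#8 +' !0 +' (!0 +' !0)) <= + 2 *' (#1 +' !2) -' !8 & !0 <= #8 & !0 <= #3 & !0 <= #6 & #9 +' #10 <= #0 & + 2 *' (#7 -' !1) <= #9 -' #5 & + 2 *' (#4 -' !2) -' !1 <= #10 -' #2 & #11 +' !1 <= #4 & !2 <= #11 & #4 <= #7 +' !1 & []) (!1 <= !0) ((deficit-split E (u₀ ∷ u₁ ∷ []) low) , (0≤bd u₀ u₁) , (0≤g (u₀ + + 2)) , (0≤g (u₁ + + 2)) , (Sk-excess s) , (drop (+≤+ ℕ.z≤n) 1≤u₁ l) , (toTop₁ (+≤+ ℕ.z≤n) r (lia (u₀ & u₁ & m & []) (#0 <= #1 +' !1 & #1 <= #2 & []) (#0 <= #2 +' !1) (k , l , tt)) h) , q , r , k , tt))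
     conclude (inr q) (inr r) = (lia (D₀ & L & (G u₀ E) & (G (u₀ + + 2) E) & u₀ & (G u₁ E) & (G (u₁ + + 2) E) & u₁ & (bd u₀ u₁) & (G (+ 1) E) & (G (+ 2) E) & m & []) (#0 +' (#1 -' #2 +' #3 -' #4 +' (#1 -' #5 +' #6 -' #7 +' !0)) +' (#8 +' !0 +' (!0 +' !0)) <= + 2 *' (#1 +' !2) -' !8 & !0 <= #8 & !0 <= #3 & !0 <= #6 & #9 +' #10 <= #0 & + 2 *' (#7 -' !1) <= #9 -' #5 & #2 == !0 & !0 <= #10 & #4 <= #7 +' !1 & #7 <= #11 & #11 +' !1 <= !2 & []) (!1 <= !0) ((deficit-split E (u₀ ∷ u₁ ∷ []) low) , (0≤bd u₀ u₁) , (0≤g (u₀ + + 2)) , (0≤g (u₁ + + 2)) , (Sk-excess s) , (drop (+≤+ ℕ.z≤n) 1≤u₁ l) , (chain-G-above u₀ c q) , (0≤g (+ 2)) , k , l , r , tt))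

   three-letters : ∀ {u₀ u₁ u₂} → + 4 ≤ L → + 2 ≤ u₀ → + 2 ≤ u₁ → u₀ ≤ u₁ + + 1 → u₁ ≤ u₂ + + 1 → u₂ ≤ m →
     LowDeficit (E ++ u₀ ∷ u₁ ∷ u₂ ∷ []) → ⊥
   three-letters {u₀} {u₁} {u₂} len h₀ h₁ k₀ k₁ l low = 1≰0 (conclude (split (+ 2) m) (split u₁ m) (split u₀ (m + + 1)))
     where
     0≤u₂ : + 0 ≤ u₂
     0≤u₂ = (lia (u₁ & u₂ & []) (!2 <= #0 & #0 <= #1 +' !1 & []) (!0 <= #1) (h₁ , k₁ , tt))
     1≤u₁ : + 1 ≤ u₁
     1≤u₁ = (lia (u₁ & []) (!2 <= #0 & []) (!1 <= #0) (h₁ , tt))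
     1≤2 : + 1 ≤ + 2
     1≤2 = +≤+ (ℕ.s≤s ℕ.z≤n)
     u₁≤ : u₁ ≤ m + + 1
     u₁≤ = (lia (u₁ & u₂ & m & []) (#0 <= #1 +' !1 & #1 <= #2 & []) (#0 <= #2 +' !1) (k₁ , l , tt))
     u₀≤ : u₀ ≤ m + + 2
     u₀≤ = (lia (u₀ & u₁ & m & []) (#0 <= #1 +' !1 & #1 <= #2 +' !1 & []) (#0 <= #2 +' !2) (k₀ , u₁≤ , tt))
     conclude : + 2 ≤ m ⊎ m + + 1 ≤ + 2 → u₁ ≤ m ⊎ m + + 1 ≤ u₁ → u₀ ≤ m + + 1 ⊎ m + + 1 + + 1 ≤ u₀ → + 1 ≤ + 0
     conclude (inl r) (inl q) _ with split u₀ m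
     ... | inl q′ = (lia (D₀ & L & (G u₀ E) & (G (u₀ + + 2) E) & u₀ & (G u₁ E) & (G (u₁ + + 2) E) & u₁ & (G u₂ E) & (G (u₂ + + 2) E) & u₂ & (bd u₀ u₁) & (bd u₁ u₂) & (G (+ 1) E) & (G (+ 2) E) & m & []) (#0 +' (#1 -' #2 +' #3 -' #4 +' (#1 -' #5 +' #6 -' #7 +' (#1 -' #8 +' #9 -' #10 +' !0))) +' ((#11 +' (((#10 +' !2 <=? #4) +' (#4 +' !1 <=? #10)) +' !0)) +' ((#12 +' !0) +' (!0 +' !0))) <= + 2 *' (#1 +' !3) -' !8 & !0 <= #11 & !0 <= #12 & !0 <= #3 & !0 <= #6 & !0 <= #9 & #13 +' #14 <= #0 & !2 <= #4 & !2 <= #7 & #4 <= #7 +' !1 & #7 <= #10 +' !1 & #10 <= #15 & + 2 *' #10 <= #1 -' #8 & + 2 *' (#7 -' !1) <= #13 -' #5 & + 2 *' (#4 -' !2) <= #14 -' #2 & []) (!1 <= !0) ((deficit-split E (u₀ ∷ u₁ ∷ u₂ ∷ []) low) , (0≤bd u₀ u₁) , (0≤bd u₁ u₂) , (0≤g (u₀ + + 2)) , (0≤g (u₁ + + 2)) , (0≤g (u₂ + + 2)) , (Sk-excess s) , h₀ , h₁ , k₀ , k₁ , l , (below 0≤u₂ l) , (drop (+≤+ ℕ.z≤n) 1≤u₁ q) , (drop (+≤+ ℕ.z≤n) h₀ q′) , tt))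
     ... | inr q′ = (lia (D₀ & L & (G u₀ E) & (G (u₀ + + 2) E) & u₀ & (G u₁ E) & (G (u₁ + + 2) E) & u₁ & (G u₂ E) & (G (u₂ + + 2) E) & u₂ & (bd u₀ u₁) & (bd u₁ u₂) & (G (+ 1) E) & (G (+ 2) E) & m & []) (#0 +' (#1 -' #2 +' #3 -' #4 +' (#1 -' #5 +' #6 -' #7 +' (#1 -' #8 +' #9 -' #10 +' !0))) +' ((#11 +' (((#10 +' !2 <=? #4) +' (#4 +' !1 <=? #10)) +' !0)) +' ((#12 +' !0) +' (!0 +' !0))) <= + 2 *' (#1 +' !3) -' !8 & !0 <= #11 & !0 <= #12 & !0 <= #3 & !0 <= #6 & !0 <= #9 & #13 +' #14 <= #0 & !2 <= #4 & !2 <= #7 & #4 <= #7 +' !1 & #7 <= #10 +' !1 & #10 <= #15 & + 2 *' #10 <= #1 -' #8 & + 2 *' (#7 -' !1) <= #13 -' #5 & + 2 *' (#4 -' !2) -' !1 <= #14 -' #2 & #15 +' !1 <= #4 & !2 <= #15 & []) (!1 <= !0) ((deficit-split E (u₀ ∷ u₁ ∷ u₂ ∷ []) low) , (0≤bd u₀ u₁) , (0≤bd u₁ u₂) , (0≤g (u₀ + + 2)) , (0≤g (u₁ + + 2)) , (0≤g (u₂ + + 2)) , (Sk-excess s) , h₀ , h₁ , k₀ , k₁ , l , (below 0≤u₂ l) , (drop (+≤+ ℕ.z≤n) 1≤u₁ q) , (toTop₁ (+≤+ ℕ.z≤n) r (lia (u₁ & m & u₀ & []) (#0 <= #1 & #2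 <= #0 +' !1 & []) (#2 <= #1 +' !1) (q , k₀ , tt)) h₀) , q′ , r , tt))
     conclude (inl r) (inr q) (inl q′) = (lia (D₀ & L & (G u₀ E) & (G (u₀ + + 2) E) & u₀ & (G u₁ E) & (G (u₁ + + 2) E) & u₁ & (G u₂ E) & (G (u₂ + + 2) E) & u₂ & (bd u₀ u₁) & (bd u₁ u₂) & (G (+ 1) E) & (G (+ 2) E) & m & []) (#0 +' (#1 -' #2 +' #3 -' #4 +' (#1 -' #5 +' #6 -' #7 +' (#1 -' #8 +' #9 -' #10 +' !0))) +' ((#11 +' (((#10 +' !2 <=? #4) +' (#4 +' !1 <=? #10)) +' !0)) +' ((#12 +' !0) +' (!0 +' !0))) <= + 2 *' (#1 +' !3) -' !8 & !0 <= #11 & !0 <= #12 & !0 <= #3 & !0 <= #6 & !0 <= #9 & #13 +' #14 <= #0 & !2 <= #4 & !2 <= #7 & #4 <= #7 +' !1 & #7 <= #10 +' !1 & #10 <= #15 & + 2 *' #10 <= #1 -' #8 & + 2 *' (#7 -' !1) -' !1 <= #13 -' #5 & + 2 *' (#4 -' !2) -' !1 <= #14 -' #2 & #15 +' !1 <= #7 & !2 <= #15 & []) (!1 <= !0) ((deficit-split E (u₀ ∷ u₁ ∷ u₂ ∷ []) low) , (0≤bd u₀ u₁) , (0≤bd u₁ u₂) , (0≤g (u₀ + + 2)) , (0≤g (u₁ + + 2)) , (0≤g (u₂ + + 2)) , (Sk-excess s) , h₀ , h₁ , k₀ , k₁ , l , (below 0≤u₂ l) , (toTop₁ (+≤+ ℕ.z≤n)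 (ℤ.≤-trans 1≤2 r) u₁≤ 1≤u₁) , (toTop₁ (+≤+ ℕ.z≤n) r q′ h₀) , q , r , tt))
     conclude (inl r) (inr q) (inr q′) = (lia (D₀ & L & (G u₀ E) & (G (u₀ + + 2) E) & u₀ & (G u₁ E) & (G (u₁ + + 2) E) & u₁ & (G u₂ E) & (G (u₂ + + 2) E) & u₂ & (bd u₀ u₁) & (bd u₁ u₂) & (G (+ 1) E) & (G (+ 2) E) & m & []) (#0 +' (#1 -' #2 +' #3 -' #4 +' (#1 -' #5 +' #6 -' #7 +' (#1 -' #8 +' #9 -' #10 +' !0))) +' ((#11 +' (((#10 +' !2 <=? #4) +' (#4 +' !1 <=? #10)) +' !0)) +' ((#12 +' !0) +' (!0 +' !0))) <= + 2 *' (#1 +' !3) -' !8 & !0 <= #11 & !0 <= #12 & !0 <= #3 & !0 <= #6 & !0 <= #9 & #13 +' #14 <= #0 & !2 <= #4 & !2 <= #7 & #4 <= #7 +' !1 & #7 <= #10 +' !1 & #10 <= #15 & + 2 *' #10 <= #1 -' #8 & + 2 *' (#7 -' !1) -' !1 <= #13 -' #5 & + 2 *' (#4 -' !2) -' !3 <= #14 -' #2 & #15 +' !1 <= #7 & #15 +' !1 +' !1 <= #4 & !2 <= #15 & []) (!1 <= !0) ((deficit-split E (u₀ ∷ u₁ ∷ u₂ ∷ []) low) , (0≤bd u₀ u₁) , (0≤bd u₁ u₂) , (0≤g (u₀ + + 2)) , (0≤g (u₁ + + 2)) , (0≤g (u₂ + + 2)) , (Sk-excess s) , h₀ , h₁ ,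 k₀ , k₁ , l , (below 0≤u₂ l) , (toTop₁ (+≤+ ℕ.z≤n) (ℤ.≤-trans 1≤2 r) u₁≤ 1≤u₁) , (toTop (+≤+ ℕ.z≤n) r u₀≤ h₀) , q , q′ , r , tt))
     conclude (inr r) q _ = (lia (D₀ & L & (G u₀ E) & (G (u₀ + + 2) E) & u₀ & (G u₁ E) & (G (u₁ + + 2) E) & u₁ & (G u₂ E) & (G (u₂ + + 2) E) & u₂ & (bd u₀ u₁) & (bd u₁ u₂) & (G (+ 1) E) & (G (+ 2) E) & m & []) (#0 +' (#1 -' #2 +' #3 -' #4 +' (#1 -' #5 +' #6 -' #7 +' (#1 -' #8 +' #9 -' #10 +' !0))) +' ((#11 +' (((#10 +' !2 <=? #4) +' (#4 +' !1 <=? #10)) +' !0)) +' ((#12 +' !0) +' (!0 +' !0))) <= + 2 *' (#1 +' !3) -' !8 & !0 <= #11 & !0 <= #12 & !0 <= #3 & !0 <= #6 & !0 <= #9 & #13 +' #14 <= #0 & !2 <= #4 & !2 <= #7 & #4 <= #7 +' !1 & #7 <= #10 +' !1 & #10 <= #15 & #8 <= #13 & !4 <= #1 & #5 == !0 & #2 == !0 & !0 <= #14 & #15 +' !1 <= !2 & []) (!1 <= !0) ((deficit-split E (u₀ ∷ u₁ ∷ u₂ ∷ []) low) , (0≤bd u₀ u₁) , (0≤bd u₁ u₂) , (0≤g (u₀ + + 2)) , (0≤g (u₁ + + 2)) , (0≤g (u₂ + + 2)) , (Sk-excess s) , h₀ , h₁ , k₀ , k₁ , l , (G-mono E (lia (u₁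 & u₂ & []) (#0 <= #1 +' !1 & !2 <= #0 & []) (!1 <= #1) (k₁ , h₁ , tt))) , len , (chain-G-above u₁ c (lia (m & u₁ & []) (#0 +' !1 <= !2 & !2 <= #1 & []) (#0 +' !1 <= #1) (r , h₁ , tt))) , (chain-G-above u₀ c (lia (m & u₀ & []) (#0 +' !1 <= !2 & !2 <= #1 & []) (#0 +' !1 <= #1) (r , h₀ , tt))) , (0≤g (+ 2)) , r , tt))

   -- A letter u₀ that exceeds the last letter of the skeleton by at least 2.
   one-letter : ∀ {u₀} → + 2 ≤ u₀ → u₀ ≤ m → LowDeficit (E ++ u₀ ∷ []) → ⊥
   one-letter {u₀} h k low = 1≰0
     (lia (D₀ & L & (G u₀ E) & (G (u₀ + + 2) E) & u₀ & (G (+ 2) E) & []) (#0 +' (#1 -' #2 +' #3 -' #4 +' !0) +' (!0 +' !0) <= + 2 *' (#1 +' !1) -' !8 & #5 +' #1 -' !2 <= #0 & + 2 *' (#4 -' !2) <= #5 -' #2 & !0 <= #3 & !2 <= #4 & []) (!1 <= !0) ((deficit-split E (u₀ ∷ []) low) , (Sk-excess₂ s (lia ((G m E) & (G (+ 2) E) & []) (!1 <= #0 & #0 <= #1 & []) (!1 <= #1) (top , (G-mono E (ℤ.≤-trans h k)) , tt))) , (drop (+≤+ ℕ.z≤n) h k) , (0≤g (u₀ + + 2)) , h , tt))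

   new-maximum : + 1 ≤ m → LowDeficit (E ++ m ∷ m + + 1 ∷ []) → ⊥
   new-maximum h low = 1≰0
     (lia (D₀ & L & (G m E) & (G (m + + 2) E) & m & (G (m + + 1) E) & (G (m + + 1 + + 2) E) & (G (+ 1) E) & (G (+ 2) E) & []) (#0 +' (#1 -' #2 +' #3 -' #4 +' (#1 -' #5 +' #6 -' (#4 +' !1) +' !0)) +' (((#4 +' !1 +' !2 <=? #4) +' (#4 +' !1 <=? #4 +' !1)) +' !0 +' (!0 +' !0)) <= + 2 *' (#1 +' !2) -' !8 & #7 +' #8 <= #0 & + 2 *' (#4 -' !1) <= #7 -' #2 & !0 <= #3 & !0 <= #6 & #5 == !0 & !0 <= #8 & []) (!1 <= !0) ((deficit-split E (m ∷ m + + 1 ∷ []) low) , (Sk-excess s) , (drop (+≤+ ℕ.z≤n) h ℤ.≤-refl) , (0≤g (m + + 2)) , (0≤g (m + + 1 + + 2)) , (chain-G-above (m + + 1) c ℤ.≤-refl) , (0≤g (+ 2)) , tt))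

 -- The last letters y and u of a skeleton, followed by w with a drop from u to w.
 drop-after-skeleton : ∀ {E y u w} → Sk (E ∷ʳ y ∷ʳ u) → u ≤ y + + 1 → + 0 ≤ w → w + + 2 ≤ u →
   LowDeficit (E ++ y ∷ u ∷ w ∷ []) → ⊥
 drop-after-skeleton {E} {y} {u} {w} sk k 0≤w h low = 1≰0 (conclude (split w (+ 0)))
   where
   i₁ = Sk-init (E ∷ʳ y) sk
   i₂ = Sk-init E (fst i₁)
   sE = fst i₂
   dy = snd (snd i₂)
   1≤y : + 1 ≤ y
   1≤y = (lia (u & y & w & []) (#0 <= #1 +' !1 & #2 +' !2 <= #0 & !0 <= #2 & []) (!1 <= #1) (k , h , 0≤w , tt))
   2≤u : + 2 ≤ u
   2≤u = (lia (w & u & []) (#0 +' !2 <= #1 & !0 <= #0 & []) (!2 <= #1) (h , 0≤w , tt))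
   low-part : ∀ {v} → + 0 ≤ v → v ≤ y → + 2 * v ≤ lenᶻ E - G v E
   low-part {v} p q = doubled-below E (Sk-nonneg sE) p (doubled-weaken {E = E} dy q)
   conclude : w ≤ + 0 ⊎ + 0 + + 1 ≤ w → + 1 ≤ + 0
   conclude (inr 1≤w) = (lia ((bad E - total E) & (lenᶻ E) & (G y E) & (G (y + + 2) E) & y & (G u E) & (G (u + + 2) E) & u & (G w E) & (G (w + + 2) E) & w & (bd y u) & (G (+ 1) E) & (G (+ 2) E) & []) (#0 +' (#1 -' #2 +' #3 -' #4 +' (#1 -' #5 +' #6 -' #7 +' (#1 -' #8 +' #9 -' #10 +' !0))) +' ((#11 +' (((#10 +' !2 <=? #4) +' (#4 +' !1 <=? #10)) +' !0)) +' ((((#10 +' !2 <=? #7) +' (#7 +' !1 <=? #10)) +' !0) +' (!0 +' !0))) <= + 2 *' (#1 +' !3) -' !8 & !0 <= #11 & !0 <= #3 & !0 <= #6 & #12 +' #13 <= #0 & !0 <= #13 & #7 <= #4 +' !1 & #10 +' !2 <= #7 & !0 <= #10 & + 2 *' (#4 -' !1) <= #12 -' #2 & #5 <= #9 & !0 +' !1 <= #10 & + 2 *' #10 <= #1 -' #8 & []) (!1 <= !0) ((deficit-split E (y ∷ u ∷ w ∷ []) low) , (0≤bd y u) , (0≤G (y + + 2) E) , (0≤G (u + + 2) E) , (Sk-excess sE) , (0≤G (+ 2) E) , k , h , 0≤w , (doubled-G E dy (+≤+ ℕ.z≤n) 1≤y) , (G-mono {w + + 2} {u} E h) , 1≤w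 , (low-part 0≤w (lia (u & y & w & []) (#0 <= #1 +' !1 & #2 +' !2 <= #0 & []) (#2 <= #1) (k , h , tt))) , tt))
   conclude (inl w≤0) with split (+ 2) y
   ... | inr y≤1 = (lia ((bad E - total E) & (lenᶻ E) & (G y E) & (G (y + + 2) E) & y & (G u E) & (G (u + + 2) E) & u & (G w E) & (G (w + + 2) E) & w & (bd y u) & (G (+ 1) E) & (G (+ 2) E) & []) (#0 +' (#1 -' #2 +' #3 -' #4 +' (#1 -' #5 +' #6 -' #7 +' (#1 -' #8 +' #9 -' #10 +' !0))) +' ((#11 +' (((#10 +' !2 <=? #4) +' (#4 +' !1 <=? #10)) +' !0)) +' ((((#10 +' !2 <=? #7) +' (#7 +' !1 <=? #10)) +' !0) +' (!0 +' !0))) <= + 2 *' (#1 +' !3) -' !8 & !0 <= #11 & !0 <= #3 & !0 <= #6 & #12 +' #13 <= #0 & !0 <= #13 & #7 <= #4 +' !1 & #10 +' !2 <= #7 & !0 <= #10 & + 2 *' (#4 -' !1) <= #12 -' #2 & #10 <= !0 & #4 +' !1 <= !2 & #8 <= #1 & #13 <= #9 & #5 <= #13 & !1 -' (#7 <=? #4) <= #11 & []) (!1 <= !0) ((deficit-split E (y ∷ u ∷ w ∷ []) low) , (0≤bd y u) , (0≤G (y + + 2) E) , (0≤G (u + + 2) E) , (Sk-excess sE) , (0≤G (+ 2) E) , k , h , 0≤w , (doubled-G E dy (+≤+ ℕ.z≤n) 1≤y) , w≤0 , y≤1 , (G≤length w E) , (G-mono {w + + 2} {+ 2} E (lia (w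 & []) (#0 <= !0 & []) (#0 +' !2 <= !2) (w≤0 , tt))) , (G-mono {+ 2} {u} E 2≤u) , (bound-y) , tt))
       where
       bound-y : + 1 - (u ≤χ y) ≤ bd y u
       bound-y = (lia (u & y & []) ([]) (!1 -' (#0 <=? #1) <= (#0 +' !2 <=? #1) +' (#1 +' !1 <=? #0)) (tt))
   ... | inl 2≤y with split y u
   ...   | inl y≤u = (lia ((bad E - total E) & (lenᶻ E) & (G y E) & (G (y + + 2) E) & y & (G u E) & (G (u + + 2) E) & u & (G w E) & (G (w + + 2) E) & w & (bd y u) & (G (+ 1) E) & (G (+ 2) E) & []) (#0 +' (#1 -' #2 +' #3 -' #4 +' (#1 -' #5 +' #6 -' #7 +' (#1 -' #8 +' #9 -' #10 +' !0))) +' ((#11 +' (((#10 +' !2 <=? #4) +' (#4 +' !1 <=? #10)) +' !0)) +' ((((#10 +' !2 <=? #7) +' (#7 +' !1 <=? #10)) +' !0) +' (!0 +' !0))) <= + 2 *' (#1 +' !3) -' !8 & !0 <= #11 & !0 <= #3 & !0 <= #6 & #12 +' #13 <= #0 & !0 <= #13 & #7 <= #4 +' !1 & #10 +' !2 <= #7 & !0 <= #10 & + 2 *' (#4 -' !1) <= #12 -' #2 & #10 <= !0 & !2 <= #4 & #8 <= #1 & #13 <= #9 & #5 <= #2 & + 2 *' (#4 -' !2) <= #13 -' #2 & []) (!1 <= !0) ((deficit-split E (y ∷ u ∷ w ∷ []) low) , (0≤bd y u) , (0≤G (y + + 2) E) , (0≤G (u + + 2) E) , (Sk-excess sE) ,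 (0≤G (+ 2) E) , k , h , 0≤w , (doubled-G E dy (+≤+ ℕ.z≤n) 1≤y) , w≤0 , 2≤y , (G≤length w E) , (G-mono {w + + 2} {+ 2} E (lia (w & []) (#0 <= !0 & []) (#0 +' !2 <= !2) (w≤0 , tt))) , (G-mono {y} {u} E y≤u) , (doubled-G E dy (+≤+ ℕ.z≤n) 2≤y) , tt))
   ...   | inr u<y = (lia ((bad E - total E) & (lenᶻ E) & (G y E) & (G (y + + 2) E) & y & (G u E) & (G (u + + 2) E) & u & (G w E) & (G (w + + 2) E) & w & (bd y u) & (G (+ 1) E) & (G (+ 2) E) & []) (#0 +' (#1 -' #2 +' #3 -' #4 +' (#1 -' #5 +' #6 -' #7 +' (#1 -' #8 +' #9 -' #10 +' !0))) +' ((#11 +' (((#10 +' !2 <=? #4) +' (#4 +' !1 <=? #10)) +' !0)) +' ((((#10 +' !2 <=? #7) +' (#7 +' !1 <=? #10)) +' !0) +' (!0 +' !0))) <= + 2 *' (#1 +' !3) -' !8 & !0 <= #11 & !0 <= #3 & !0 <= #6 & #12 +' #13 <= #0 & !0 <= #13 & #7 <= #4 +' !1 & #10 +' !2 <= #7 & !0 <= #10 & + 2 *' (#4 -' !1) <= #12 -' #2 & #10 <= !0 & !2 <= #4 & #8 <= #1 & #7 +' !1 <= #4 & #13 <= #9 & + 2 *' (#7 -' !2) <= #13 -' #5 & []) (!1 <= !0) ((deficit-split E (y ∷ u ∷ w ∷ []) low) , (0≤bd y u) , (0≤G (y + + 2) E) , (0≤G (u + + 2) E) , (Sk-excess sE)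 , (0≤G (+ 2) E) , k , h , 0≤w , (doubled-G E dy (+≤+ ℕ.z≤n) 1≤y) , w≤0 , 2≤y , (G≤length w E) , u<y , (G-mono {w + + 2} {+ 2} E (lia (w & []) (#0 <= !0 & []) (#0 +' !2 <= !2) (w≤0 , tt))) , (doubled-G E (doubled-weaken {E = E} dy (lia (u & y & []) (#0 +' !1 <= #1 & []) (#0 <= #1) (u<y , tt))) (+≤+ ℕ.z≤n) 2≤u) , tt))

 -- The last letters b and c of a skeleton, followed by d and e, with two
 -- disjoint far-apart pairs among the four letters.
 stuck-after-skeleton : ∀ {E b c d e} → Sk (E ∷ʳ b ∷ʳ c) → c ≤ b + + 1 → + 0 ≤ d → + 0 ≤ e → d + + 2 ≤ c →
   (b ≤ c + + 1 × e + + 2 ≤ c × d + + 2 ≤ b) ⊎ (c + + 2 ≤ b × e + + 2 ≤ b) ⊎ (b ≡ e + + 2 × c ≡ e + + 3 × d ≡ e + + 1) →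
   LowDeficit (E ++ b ∷ c ∷ d ∷ e ∷ []) → ⊥
 stuck-after-skeleton {E} {b} {c} {d} {e} sk k 0≤d 0≤e dc cases low = 1≰0 (conclude cases)
   where
   i₁ = Sk-init (E ∷ʳ b) sk
   i₂ = Sk-init E (fst i₁)
   sE = fst i₂
   nn = Sk-nonneg sE
   db = snd (snd i₂)
   2≤c : + 2 ≤ c
   2≤c = (lia (d & c & []) (#0 +' !2 <= #1 & !0 <= #0 & []) (!2 <= #1) (dc , 0≤d , tt))
   1≤b : + 1 ≤ b
   1≤b = (lia (c & b & []) (!2 <= #0 & #0 <= #1 +' !1 & []) (!1 <= #1) (2≤c , k , tt))
   2≤b : + 2 ≤ b
   2≤b = from cases
     where
     from : (b ≤ c + + 1 × e + + 2 ≤ c × d + + 2 ≤ b) ⊎ (c + + 2 ≤ b × e + + 2 ≤ b) ⊎ (b ≡ e + + 2 × c ≡ e + + 3 × d ≡ e + + 1) → + 2 ≤ b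
     from (inl (_ , _ , p))       = (lia (d & b & []) (#0 +' !2 <= #1 & !0 <= #0 & []) (!2 <= #1) (p , 0≤d , tt))
     from (inr (inl (_ , p)))    = (lia (e & b & []) (#0 +' !2 <= #1 & !0 <= #0 & []) (!2 <= #1) (p , 0≤e , tt))
     from (inr (inr (p , _ , _))) = (lia (b & e & []) (#0 == #1 +' !2 & !0 <= #1 & []) (!2 <= #0) (p , 0≤e , tt))
   two : + 2 ≤ bad E - total E
   two = (lia ((G (+ 1) E) & (G (+ 2) E) & (bad E - total E) & []) (#0 +' #1 <= #2 & !2 <= #0 -' #1 & !0 <= #1 & []) (!2 <= #2) ((Sk-excess sE) , (db (+ 1) (+≤+ ℕ.z≤n) 2≤b) , (0≤G (+ 2) E) , tt))
   d≤b : d ≤ b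
   d≤b = (lia (d & c & b & []) (#0 +' !2 <= #1 & #1 <= #2 +' !1 & []) (#0 <= #2) (dc , k , tt))
   dd : Doubled d E
   dd = doubled-weaken {E = E} db d≤b
   pair-b : ∀ {v} → + 0 ≤ v → v + + 2 ≤ b → + 2 * (b - (v + + 2)) ≤ G (v + + 2) E - G b E
   pair-b {v} p q = doubled-G E db (lia (v & []) (!0 <= #0 & []) (!0 <= #0 +' !2) (p , tt)) q
   pair-c : ∀ {v} → + 0 ≤ v → v + + 2 ≤ c → + 2 * (c - (v + + 2)) ≤ G (v + + 2) E + (v + + 2 ≤χ b) - (G c E + (c ≤χ b))
   pair-c {v} p q = (lia (c & v & (G (v + + 2) (E ∷ʳ b)) & (G c (E ∷ʳ b)) & (G (v + + 2) E) & b & (G c E) & []) (+ 2 *' (#0 -' (#1 +' !2)) <= #2 -' #3 & #2 == #4 +' (#1 +' !2 <=? #5) & #3 == #6 +' (#0 <=? #5) & []) (+ 2 *' (#0 -' (#1 +' !2)) <= #4 +' (#1 +' !2 <=? #5) -' (#6 +' (#0 <=? #5))) ((doubled-G (E ∷ʳ b) (snd (snd i₁)) (lia (v & []) (!0 <= #0 & []) (!0 <= #0 +' !2) (p , tt)) q) , (G-∷ʳ (v + + 2) E b) , (G-∷ʳ c E b) , tt))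
   far-bad : ∀ x y → y + + 2 ≤ x → bd x y ≡ + 1
   far-bad x y h = (lia (y & x & []) (#0 +' !2 <= #1 & []) ((#0 +' !2 <=? #1) +' (#1 +' !1 <=? #0) == !1) (h , tt))
   up-bad : + 1 - (c ≤χ b) ≤ bd b c
   up-bad = (lia (c & b & []) ([]) (!1 -' (#0 <=? #1) <= (#0 +' !2 <=? #1) +' (#1 +' !1 <=? #0)) (tt))
   conclude : (b ≤ c + + 1 × e + + 2 ≤ c × d + + 2 ≤ b) ⊎ (c + + 2 ≤ b × e + + 2 ≤ b) ⊎ (b ≡ e + + 2 × c ≡ e + + 3 × d ≡ e + + 1) → + 1 ≤ + 0
   conclude (inl (p , q , r)) =
     (lia ((bad E - total E) & (lenᶻ E) & (G b E) & (G (b + + 2) E) & b & (G c E) & (G (c + + 2) E) & c & (G d E) & (G (d + + 2) E) & d & (G e E) & (G (e + + 2) E) & e & (bd b c) & (bd b d) & (bd b e) & (bd c d) & (bd c e) & (bd d e) & []) (#0 +' (#1 -' #2 +' #3 -' #4 +' (#1 -' #5 +' #6 -' #7 +' (#1 -' #8 +' #9 -' #10 +' (#1 -' #11 +' #12 -' #13 +' !0)))) +' ((#14 +' (#15 +' (#16 +' !0))) +' ((#17 +' (#18 +' !0)) +' ((#19 +' !0) +' (!0 +' !0)))) <= + 2 *' (#1 +' !4) -' !8 & !0 <= #19 & !0 <= #3 & !0 <= #6 & !2 <= #0 & + 2 *' #10 <= #1 -' #8 & + 2 *' #13 <= #1 -' #11 & + 2 *' (#4 -' (#10 +' !2)) <=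 #9 -' #2 & + 2 *' (#7 -' (#13 +' !2)) <= #12 +' (#13 +' !2 <=? #4) -' (#5 +' (#7 <=? #4)) & !1 -' (#7 <=? #4) <= #14 & #15 == !1 & !0 <= #16 & #17 == !1 & #18 == !1 & #10 +' !2 <= #4 & #13 +' !2 <= #7 & []) (!1 <= !0) ((deficit-split E (b ∷ c ∷ d ∷ e ∷ []) low) , (0≤bd d e) , (0≤G (b + + 2) E) , (0≤G (c + + 2) E) , two , (doubled-below E nn 0≤d dd) , (doubled-below E nn 0≤e de) , (pair-b 0≤d r) , (pair-c 0≤e q) , up-bad , (far-bad b d r) , (0≤bd b e) , (far-bad c d dc) , (far-bad c e q) , r , q , tt))
     where
     de : Doubled e E
     de = doubled-weaken {E = E} db (lia (e & c & b & []) (#0 +' !2 <= #1 & #1 <= #2 +' !1 & []) (#0 <= #2) (q , k , tt))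
   conclude (inr (inl (p , q))) =
     (lia ((bad E - total E) & (lenᶻ E) & (G b E) & (G (b + + 2) E) & b & (G c E) & (G (c + + 2) E) & c & (G d E) & (G (d + + 2) E) & d & (G e E) & (G (e + + 2) E) & e & (bd b c) & (bd b d) & (bd b e) & (bd c d) & (bd c e) & (bd d e) & []) (#0 +' (#1 -' #2 +' #3 -' #4 +' (#1 -' #5 +' #6 -' #7 +' (#1 -' #8 +' #9 -' #10 +' (#1 -' #11 +' #12 -' #13 +' !0)))) +' ((#14 +' (#15 +' (#16 +' !0))) +' ((#17 +' (#18 +' !0)) +' ((#19 +' !0) +' (!0 +' !0)))) <= + 2 *' (#1 +' !4) -' !8 & !0 <= #19 & !0 <= #3 & !0 <= #6 & !2 <= #0 & + 2 *' #10 <= #1 -' #8 & + 2 *' #13 <= #1 -' #11 & + 2 *' (#4 -' (#13 +' !2)) <= #12 -' #2 & + 2 *' (#7 -' (#10 +' !2)) <= #9 +' (#10 +' !2 <=? #4) -' (#5 +' (#7 <=? #4)) & !1 -' (#7 <=? #4) <= #14 & #15 == !1 & #16 == !1 & #17 == !1 & !0 <= #18 & #7 +' !2 <= #4 & #13 +' !2 <= #4 & #10 +' !2 <= #7 & []) (!1 <= !0) ((deficit-split E (b ∷ c ∷ d ∷ e ∷ []) low) , (0≤bd d e) , (0≤G (b + + 2) E) , (0≤G (c + + 2) E) , two , (doubled-below E nn 0≤d dd) , (doubled-below E nn 0≤e de) , (pair-b 0≤e q) , (pair-c 0≤d dc) , up-bad , (far-bad b d (lia (c & b & d & []) (#0 +'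 !2 <= #1 & #2 +' !2 <= #0 & []) (#2 +' !2 <= #1) (p , dc , tt))) , (far-bad b e q) , (far-bad c d dc) , (0≤bd c e) , p , q , dc , tt))
     where
     de : Doubled e E
     de = doubled-weaken {E = E} db (lia (e & b & []) (#0 +' !2 <= #1 & []) (#0 <= #1) (q , tt))
   conclude (inr (inr (p , q , r))) =
     (lia ((bad E - total E) & (lenᶻ E) & (G b E) & (G (b + + 2) E) & b & (G c E) & (G (c + + 2) E) & c & (G d E) & (G (d + + 2) E) & d & (G e E) & (G (e + + 2) E) & e & (bd b c) & (bd b d) & (bd b e) & (bd c d) & (bd c e) & (bd d e) & []) (#0 +' (#1 -' #2 +' #3 -' #4 +' (#1 -' #5 +' #6 -' #7 +' (#1 -' #8 +' #9 -' #10 +' (#1 -' #11 +' #12 -' #13 +' !0)))) +' ((#14 +' (#15 +' (#16 +' !0))) +' ((#17 +' (#18 +' !0)) +' ((#19 +' !0) +' (!0 +' !0)))) <= + 2 *' (#1 +' !4) -' !8 & !0 <= #19 & !0 <= #3 & !0 <= #6 & !2 <= #0 & + 2 *' #10 <= #1 -' #8 & + 2 *' #13 <= #1 -' #11 & + 2 *' (#4 -' (#13 +' !2)) <= #12 -' #2 & + 2 *' (#7 -' (#10 +' !2)) <= #9 +' (#10 +' !2 <=? #4) -' (#5 +' (#7 <=? #4)) & !1 -' (#7 <=? #4) <= #14 & !0 <= #15 & #16 == !1 & #17 == !1 & #18 == !1 & #4 == #13 +' !2 & #7 == #13 +' !3 & #10 == #13 +' !1 & []) (!1 <= !0) ((deficit-split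 E (b ∷ c ∷ d ∷ e ∷ []) low) , (0≤bd d e) , (0≤G (b + + 2) E) , (0≤G (c + + 2) E) , two , (doubled-below E nn 0≤d dd) , (doubled-below E nn 0≤e de) , (pair-b 0≤e (lia (b & e & []) (#0 == #1 +' !2 & []) (#1 +' !2 <= #0) (p , tt))) , (pair-c 0≤d dc) , up-bad , (0≤bd b d) , (far-bad b e (lia (b & e & []) (#0 == #1 +' !2 & []) (#1 +' !2 <= #0) (p , tt))) , (far-bad c d dc) , (far-bad c e (lia (c & e & []) (#0 == #1 +' !3 & []) (#1 +' !2 <= #0) (q , tt))) , p , q , r , tt))
     where
     de : Doubled e E
     de = doubled-weaken {E = E} db (lia (b & e & []) (#0 == #1 +' !2 & []) (#1 <= #0) (p , tt))

 -- A skeleton followed by a strictly increasing run m, …, e.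
 module RunFacts {S : List ℤ} {m : ℤ} (s : Sk S) (0≤m : + 0 ≤ m) (d : Doubled m S) (lt : All (λ u → u + + 1 ≤ m) S) where

   T = lenᶻ S - m

   m≤T : m ≤ T
   m≤T = (lia (m & (lenᶻ S) & (G m S) & []) (+ 2 *' #0 <= #1 -' #2 & #2 == !0 & []) (#0 <= #1 -' #0) ((doubled-below S (Sk-nonneg s) 0≤m d) , (G-high S lt) , tt))

   excess-S : + 2 * m - + 2 ≤ bad S - total S
   excess-S with split (+ 1) m
   ... | inl h = (lia ((G (+ 1) S) & (G (+ 2) S) & (bad S - total S) & m & (G m S) & []) (#0 +' #1 <= #2 & !0 <= #1 & + 2 *' (#3 -' !1) <= #0 -' #4 & #4 == !0 & []) (+ 2 *' #3 -' !2 <= #2) ((Sk-excess s) , (0≤G (+ 2) S) , (doubled-G S d (+≤+ ℕ.z≤n) h) , (G-high S lt) , tt))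
   ... | inr h = (lia ((G (+ 1) S) & (G (+ 2) S) & (bad S - total S) & m & []) (#0 +' #1 <= #2 & !0 <= #1 & !0 <= #0 & #3 +' !1 <= !1 & []) (+ 2 *' #3 -' !2 <= #2) ((Sk-excess s) , (0≤G (+ 2) S) , (0≤G (+ 1) S) , h , tt))

   run-length : ∀ k → lenᶻ (S ++ run m k) ≡ lenᶻ S + + suc k
   run-length zero    = lenᶻ-∷ʳ S m
   run-length (suc k) rewrite sym (List.++-assoc S (run m k) [ m + + suc k ]) =
     (lia ((lenᶻ ((S ++ run m k) ∷ʳ (m + + suc k))) & (lenᶻ (S ++ run m k)) & (lenᶻ S) & (+ k) & []) (#0 == #1 +' !1 & #1 == #2 +' (!1 +' #3) & []) (#0 == #2 +' (!1 +' (!1 +' #3))) ((lenᶻ-∷ʳ (S ++ run m k) (m + + suc k)) , (run-length k) , tt))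

   run-excess : ∀ k → bad (S ++ run m k) - total (S ++ run m k) ≡ bad S - total S + + k * T + T
   run-excess zero =
     (lia ((bad (S ∷ʳ m)) & (bad S) & (lenᶻ S) & (G m S) & (G (m + + 2) S) & (total (S ∷ʳ m)) & (total S) & m & (+ 0 * T) & []) (#0 == #1 +' (#2 -' #3 +' #4) & #5 == #6 +' #7 & #3 == !0 & #4 == !0 & #8 == !0 & []) (#0 -' #5 == #1 -' #6 +' #8 +' (#2 -' #7)) ((bad-∷ʳ S m) , (total-∷ʳ S m) , (G-high S lt) , (G-high S (All.map (λ {u} h → (lia (u & m & []) (#0 +' !1 <= #1 & []) (#0 +' !1 <= #1 +' !2) (h , tt))) lt)) , (ℤ.*-zeroˡ T) , tt))
   run-excess (suc k) rewrite sym (List.++-assoc S (run m k) [ m + + suc k ]) =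
     (lia ((bad (X ∷ʳ v)) & (bad X) & (lenᶻ X) & (G v X) & (G (v + + 2) X) & (total (X ∷ʳ v)) & (total X) & m & (+ k) & (lenᶻ S) & (bad S) & (total S) & (+ k * T) & (+ suc k * T) & []) (#0 == #1 +' (#2 -' #3 +' #4) & #5 == #6 +' (#7 +' (!1 +' #8)) & #3 == !0 & #4 == !0 & #2 == #9 +' (!1 +' #8) & #1 -' #6 == #10 -' #11 +' #12 +' (#9 -' #7) & #13 == #12 +' (#9 -' #7) & []) (#0 -' #5 == #10 -' #11 +' #13 +' (#9 -' #7)) ((bad-∷ʳ X v) , (total-∷ʳ X v) , (G-high X (run-below k lt)) , (G-high X (All.map (λ {u} h → (lia (u & v & []) (#0 +' !1 <= #1 & []) (#0 +' !1 <= #1 +' !2) (h , tt))) (run-below k lt))) , (run-length k) , (run-excess k) , (distrib (+ k) T) , tt))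
     where
     X = S ++ run m k
     v = m + + suc k
     distrib : ∀ k T → (+ 1 + k) * T ≡ k * T + T
     distrib = solve-∀

   module _ (k : ℕ) (2≤T : + 2 ≤ T) where

     scaled : + 2 * + k ≤ + k * T
     scaled = subst (_≤ + k * T) (ℤ.*-comm (+ k) (+ 2)) (ℤ.*-monoˡ-≤-nonNeg (+ k) 2≤T)

     -- The deficit of S ++ run m (suc k) exceeds 2 T + 2 k + 2 m - 2.
     excess : + 2 * T + + 2 * + k + + 2 * m - + 2 ≤ bad (S ++ run m (suc k)) - total (S ++ run m (suc k))
     excess = (lia ((bad (S ++ run m (suc k)) - total (S ++ run m (suc k))) & (bad S - total S) & (+ suc k * T) & T & m & (+ k * T) & (+ k) & []) (#0 == #1 +' #2 +' #3 & + 2 *' #4 -' !2 <= #1 & #2 == #5 +' #3 & + 2 *' #6 <= #5 & []) (+ 2 *' #3 +' + 2 *' #6 +' + 2 *' #4 -' !2 <= #0) ((run-excess (suc k)) , excess-S , (distrib (+ k) T) , scaled , tt))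
       where
       distrib : ∀ k T → (+ 1 + k) * T ≡ k * T + T
       distrib = solve-∀

     -- Hence the letters after the run contribute little.
     after-run : ∀ W → LowDeficit ((S ++ run m (suc k)) ++ W) →
       sumBy (κ (S ++ run m (suc k))) W + bad W ≤ + 2 * lenᶻ W - + 2
     after-run W low =
       (lia ((bad X - total X) & (sumBy (κ X) W) & (bad W) & (lenᶻ X) & (lenᶻ W) & (lenᶻ S) & m & (+ k) & []) (#0 +' #1 +' #2 <= + 2 *' (#3 +' #4) -' !8 & + 2 *' (#5 -' #6) +' + 2 *' #7 +' + 2 *' #6 -' !2 <= #0 & #3 == #5 +' (!1 +' (!1 +' #7)) & []) (#1 +' #2 <= + 2 *' #4 -' !2) ((deficit-split X W low) , excess , (run-length (suc k)) , tt))
       where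
       X = S ++ run m (suc k)

 module ChainFacts {E : List ℤ} {e : ℤ} (c : Chain E e) where

   private
     L = lenᶻ E

   κ-low : ∀ {v} → + 0 ≤ v → v ≤ e → e - + 1 - v + (e ≤χ v) ≤ κ E v
   κ-low {v} h k = (lia (v & L & (G v E) & e & (G (v + + 2) E) & []) (#0 <= #1 -' #2 & #3 -' !1 -' #0 +' (#3 <=? #0) <= #4 & []) (#3 -' !1 -' #0 +' (#3 <=? #0) <= #1 -' #2 +' #4 -' #0) ((chain-below c h (ℤ.≤-trans k (lia (e & []) ([]) (#0 <= #0 +' !1) (tt)))) , (chain-above c h k) , tt))

   κ-high : ∀ {v} → e + + 1 ≤ v → L - v ≤ κ E v
   κ-high {v} h = (lia ((G v E) & (G (v + + 2) E) & L & v & []) (#0 == !0 & !0 <= #1 & []) (#2 -' #3 <= #2 -' #0 +' #1 -' #3) ((chain-G-above v c h) , (0≤G (v + + 2) E) , tt))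

   κ-far : ∀ {a b} → + 0 ≤ b → b + + 2 ≤ a → a ≤ e + + 1 → L - + 2 - b ≤ κ E a + κ E b
   κ-far {a} {b} h k l =
     (lia (a & b & (G (b + + 2) E) & (G a E) & (G (a + + 2) E) & L & (G b E) & []) (#0 -' (#1 +' !2) <= #2 -' #3 & !0 <= #4 & #1 <= #5 -' #6 & []) (#5 -' !2 -' #1 <= (#5 -' #3 +' #4 -' #0) +' (#5 -' #6 +' #2 -' #1)) ((chain-G c (lia (b & []) (!0 <= #0 & []) (!0 <= #0 +' !2) (h , tt)) k l) , (0≤G (a + + 2) E) , (chain-below c h (lia (b & a & e & []) (#0 +' !2 <= #1 & #1 <= #2 +' !1 & []) (#0 <= #2 +' !1) (k , l , tt))) , tt))

   before-low : ∀ {v} → + 0 ≤ v → e - + 1 ≤ before v E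
   before-low {v} h with split v e
   ... | inl k = (lia ((before v E) & L & (G v E) & (G (v + + 2) E) & e & v & []) (#0 == #1 -' #2 +' #3 & #4 -' !1 -' #5 +' (#4 <=? #5) <= #1 -' #2 +' #3 -' #5 & []) (#4 -' !1 <= #0) ((before-G v E) , (κ-low h k) , tt))
   ... | inr k = (lia ((before v E) & L & (G v E) & (G (v + + 2) E) & v & e & []) (#0 == #1 -' #2 +' #3 & #1 -' #4 <= #1 -' #2 +' #3 -' #4 & #5 +' !1 <= #1 & []) (#5 -' !1 <= #0) ((before-G v E) , (κ-high k) , (chain-length c) , tt))

   before-all : ∀ W → All (+ 0 ≤_) W → lenᶻ W * (e - + 1) ≤ sumBy (λ v → before v E) W
   before-all []      []       = ℤ.≤-refl
   before-all (v ∷ W) (h ∷ hs) =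
     (lia ((lenᶻ W * (e - + 1)) & (sumBy (λ v → before v E) W) & e & (before v E) & (lenᶻ (v ∷ W) * (e - + 1)) & []) (#0 <= #1 & #2 -' !1 <= #3 & #4 == #0 +' (#2 -' !1) & []) (#4 <= #3 +' #1) ((before-all W hs) , (before-low h) , (distrib (lenᶻ W) (e - + 1)) , tt))
     where
     distrib : ∀ q x → (+ 1 + q) * x ≡ q * x + x
     distrib = solve-∀

 0≤bad : ∀ W → + 0 ≤ bad W
 0≤bad []      = ℤ.≤-refl
 0≤bad (v ∷ W) = (lia ((sumBy (bd v) W) & (bad W) & []) (!0 <= #0 & !0 <= #1 & []) (!0 <= #0 +' #1) ((0≤sum W) , (0≤bad W) , tt))
   where
   0≤sum : ∀ W → + 0 ≤ sumBy (bd v) W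
   0≤sum []      = ℤ.≤-refl
   0≤sum (u ∷ W) = (lia ((bd v u) & (sumBy (bd v) W) & []) (!0 <= #0 & !0 <= #1 & []) (!0 <= #0 +' #1) ((0≤bd v u) , (0≤sum W) , tt))

 -- The inequality area ≤ dinv, combined with the bound on the deficit.
 FewBad : ℤ → List ℤ → Set
 FewBad j σ = + 4 * bad σ + + 4 * j ≤ lenᶻ σ * lenᶻ σ + + 3 * lenᶻ σ - + 16

module Tiny where

 open Facts
 open Lia
 open Stats
 open Words
 open import Data.Integer.Base using (_<_)
 import Data.List.Relation.Unary.All.Properties as All
 open import Data.Product.Base using (_,_)

 -- With s = e², the bounds on B = bad (E ++ W), b = bad E and w = bad W for words
 -- of lengths e + u and q.
 Core : (u q j₀ w₀ : ℤ) → Set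
 Core u q j₀ w₀ = ∀ B j s e b w → + 4 * B + + 4 * j ≤ s + (+ 2 * (u + q)) * e + (u + q) * (u + q) + + 3 * (e + (u + q)) - + 16 → b + q * (e - + 1) + w ≤ B →
   + 2 * (s + u * e) + + 2 + e - s - + 2 * (e + u) ≤ + 2 * b → + 10 - (u + q) ≤ e → + 4 * e ≤ s → j₀ ≤ j → w₀ ≤ w → + 1 ≤ + 0

 least-j least-w : ℕ → ℤ
 least-j 4 = + 3
 least-j _ = + 0
 least-w 4 = + 1
 least-w _ = + 0

 core : ∀ t q → t ℕ.≤ 1 → q ℕ.≤ 4 → Core (+ suc t) (+ q) (least-j q) (least-w q)
 core 0 0 _ _ B j s e b w h₁ h₂ h₃ h₄ h₅ h₆ h₇ = (lia (B & j & s & e & b & w & []) (+ 4 *' #0 +' + 4 *' #1 <= #2 +' + 2 *' #3 +' !1 +' + 3 *' (#3 +' !1) -' !16 & #4 +' + 0 *' (#3 -' !1) +' #5 <= #0 & + 2 *' (#2 +' + 1 *' #3) +' !2 +' #3 -' #2 -' + 2 *' (#3 +' !1) <= + 2 *' #4 & !9 <= #3 & + 4 *' #3 <= #2 & !0 <= #1 & !0 <= #5 & []) (!1 <= !0) (h₁ , h₂ , h₃ , h₄ , h₅ , h₆ , h₇ , tt))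
 core 0 1 _ _ B j s e b w h₁ h₂ h₃ h₄ h₅ h₆ h₇ = (lia (B & j & s & e & b & w & []) (+ 4 *' #0 +' + 4 *' #1 <= #2 +' + 4 *' #3 +' !4 +' + 3 *' (#3 +' !2) -' !16 & #4 +' + 1 *' (#3 -' !1) +' #5 <= #0 & + 2 *' (#2 +' + 1 *' #3) +' !2 +' #3 -' #2 -' + 2 *' (#3 +' !1) <= + 2 *' #4 & !8 <= #3 & + 4 *' #3 <= #2 & !0 <= #1 & !0 <= #5 & []) (!1 <= !0) (h₁ , h₂ , h₃ , h₄ , h₅ , h₆ , h₇ , tt))
 core 0 2 _ _ B j s e b w h₁ h₂ h₃ h₄ h₅ h₆ h₇ = (lia (B & j & s & e & b & w & []) (+ 4 *' #0 +' + 4 *' #1 <= #2 +' + 6 *' #3 +' !9 +' + 3 *' (#3 +' !3) -' !16 & #4 +' + 2 *' (#3 -' !1) +' #5 <= #0 & + 2 *' (#2 +' + 1 *' #3) +' !2 +' #3 -' #2 -' + 2 *' (#3 +' !1) <= + 2 *' #4 & !7 <= #3 & + 4 *' #3 <= #2 & !0 <= #1 & !0 <= #5 & []) (!1 <= !0) (h₁ , h₂ , h₃ , h₄ , h₅ , h₆ , h₇ , tt))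
 core 0 3 _ _ B j s e b w h₁ h₂ h₃ h₄ h₅ h₆ h₇ = (lia (B & j & s & e & b & w & []) (+ 4 *' #0 +' + 4 *' #1 <= #2 +' + 8 *' #3 +' !16 +' + 3 *' (#3 +' !4) -' !16 & #4 +' + 3 *' (#3 -' !1) +' #5 <= #0 & + 2 *' (#2 +' + 1 *' #3) +' !2 +' #3 -' #2 -' + 2 *' (#3 +' !1) <= + 2 *' #4 & !6 <= #3 & + 4 *' #3 <= #2 & !0 <= #1 & !0 <= #5 & []) (!1 <= !0) (h₁ , h₂ , h₃ , h₄ , h₅ , h₆ , h₇ , tt))
 core 0 4 _ _ B j s e b w h₁ h₂ h₃ h₄ h₅ h₆ h₇ = (lia (B & j & s & e & b & w & []) (+ 4 *' #0 +' + 4 *' #1 <= #2 +' + 10 *' #3 +' !25 +' + 3 *' (#3 +' !5) -' !16 & #4 +' + 4 *' (#3 -' !1) +' #5 <= #0 & + 2 *' (#2 +' + 1 *' #3) +' !2 +' #3 -' #2 -' + 2 *' (#3 +' !1) <= + 2 *' #4 & !5 <= #3 & + 4 *' #3 <= #2 & !3 <= #1 & !1 <= #5 & []) (!1 <= !0) (h₁ , h₂ , h₃ , h₄ , h₅ , h₆ , h₇ , tt))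
 core 1 0 _ _ B j s e b w h₁ h₂ h₃ h₄ h₅ h₆ h₇ = (lia (B & j & s & e & b & w & []) (+ 4 *' #0 +' + 4 *' #1 <= #2 +' + 4 *' #3 +' !4 +' + 3 *' (#3 +' !2) -' !16 & #4 +' + 0 *' (#3 -' !1) +' #5 <= #0 & + 2 *' (#2 +' + 2 *' #3) +' !2 +' #3 -' #2 -' + 2 *' (#3 +' !2) <= + 2 *' #4 & !8 <= #3 & + 4 *' #3 <= #2 & !0 <= #1 & !0 <= #5 & []) (!1 <= !0) (h₁ , h₂ , h₃ , h₄ , h₅ , h₆ , h₇ , tt))
 core 1 1 _ _ B j s e b w h₁ h₂ h₃ h₄ h₅ h₆ h₇ = (lia (B & j & s & e & b & w & []) (+ 4 *' #0 +' + 4 *' #1 <= #2 +' + 6 *' #3 +' !9 +' + 3 *' (#3 +' !3) -' !16 & #4 +' + 1 *' (#3 -' !1) +' #5 <= #0 & + 2 *' (#2 +' + 2 *' #3) +' !2 +' #3 -' #2 -' + 2 *' (#3 +' !2) <= + 2 *' #4 & !7 <= #3 & + 4 *' #3 <= #2 & !0 <= #1 & !0 <= #5 & []) (!1 <= !0) (h₁ , h₂ , h₃ , h₄ , h₅ , h₆ , h₇ , tt))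
 core 1 2 _ _ B j s e b w h₁ h₂ h₃ h₄ h₅ h₆ h₇ = (lia (B & j & s & e & b & w & []) (+ 4 *' #0 +' + 4 *' #1 <= #2 +' + 8 *' #3 +' !16 +' + 3 *' (#3 +' !4) -' !16 & #4 +' + 2 *' (#3 -' !1) +' #5 <= #0 & + 2 *' (#2 +' + 2 *' #3) +' !2 +' #3 -' #2 -' + 2 *' (#3 +' !2) <= + 2 *' #4 & !6 <= #3 & + 4 *' #3 <= #2 & !0 <= #1 & !0 <= #5 & []) (!1 <= !0) (h₁ , h₂ , h₃ , h₄ , h₅ , h₆ , h₇ , tt))
 core 1 3 _ _ B j s e b w h₁ h₂ h₃ h₄ h₅ h₆ h₇ = (lia (B & j & s & e & b & w & []) (+ 4 *' #0 +' + 4 *' #1 <= #2 +' + 10 *' #3 +' !25 +' + 3 *' (#3 +' !5) -' !16 & #4 +' + 3 *' (#3 -' !1) +' #5 <= #0 & + 2 *' (#2 +' + 2 *' #3) +' !2 +' #3 -' #2 -' + 2 *' (#3 +' !2) <= + 2 *' #4 & !5 <= #3 & + 4 *' #3 <= #2 & !0 <= #1 & !0 <= #5 & []) (!1 <= !0) (h₁ , h₂ , h₃ , h₄ , h₅ , h₆ , h₇ , tt))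
 core 1 4 _ _ B j s e b w h₁ h₂ h₃ h₄ h₅ h₆ h₇ = (lia (B & j & s & e & b & w & []) (+ 4 *' #0 +' + 4 *' #1 <= #2 +' + 12 *' #3 +' !36 +' + 3 *' (#3 +' !6) -' !16 & #4 +' + 4 *' (#3 -' !1) +' #5 <= #0 & + 2 *' (#2 +' + 2 *' #3) +' !2 +' #3 -' #2 -' + 2 *' (#3 +' !2) <= + 2 *' #4 & !4 <= #3 & + 4 *' #3 <= #2 & !3 <= #1 & !1 <= #5 & []) (!1 <= !0) (h₁ , h₂ , h₃ , h₄ , h₅ , h₆ , h₇ , tt))
 core (suc (suc t)) q (ℕ.s≤s ()) _
 core t (suc (suc (suc (suc (suc q))))) _ (ℕ.s≤s (ℕ.s≤s (ℕ.s≤s (ℕ.s≤s ()))))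

 -- Almost all entries of a word E ++ W are first occurrences 0, …, e: then it has
 -- too many bad pairs.
 module Tiny {E : List ℤ} {e : ℤ} (c : Chain E e) (W : List ℤ) (nn : All (+ 0 ≤_) W) where

   open ChainFacts c

   top : + 1 ≤ G e E
   top = (lia (e & (G e E) & (G (e + + 1) E) & []) (#0 +' !1 -' #0 <= #1 -' #2 & !0 <= #2 & []) (!1 <= #1) ((chain-G c (0≤max c) (lia (e & []) ([]) (#0 <= #0 +' !1) (tt)) ℤ.≤-refl) , (0≤G (e + + 1) E) , tt))

   four : + 4 ≤ e → + 4 * e ≤ e * e
   four h = ℤ.*-monoʳ-≤-nonNeg e {{Data.Integer.Base.nonNegative (0≤max c)}} h

   square : ∀ e c → (e + c) * (e + c) + + 3 * (e + c) - + 16 ≡ e * e + (+ 2 * c) * e + c * c + + 3 * (e + c) - + 16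
   square = solve-∀

   expand : ∀ e c → e * (e + c) ≡ e * e + c * e
   expand = solve-∀

   spread : + 0 ≤ bad W → bad E + lenᶻ W * (e - + 1) + bad W ≤ bad (E ++ W)
   spread _ = (lia ((bad (E ++ W)) & (bad E) & (cross E W) & (bad W) & (sumBy (λ v → before v E) W) & (lenᶻ W * (e - + 1)) & []) (#0 == #1 +' #2 +' #3 & #2 == #4 & #5 <= #4 & []) (#1 +' #5 +' #3 <= #0) ((bad-++ E W) , (cross-before E W) , (before-all W nn) , tt))

   least : ∀ q {j} → + 0 ≤ j → (q ≡ 4 → + 3 ≤ j × + 1 ≤ bad W) → least-j q ≤ j × least-w q ≤ bad W
   least 0 h f = h , 0≤bad W
   least 1 h f = h , 0≤bad W
   least 2 h f = h , 0≤bad W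
   least 3 h f = h , 0≤bad W
   least 4 h f = f refl
   least (suc (suc (suc (suc (suc q))))) h f = h , 0≤bad W

   tiny : ∀ t q → t ℕ.≤ 1 → q ℕ.≤ 4 → lenᶻ E ≡ e + + suc t → length W ≡ q → + 10 ≤ lenᶻ (E ++ W) →
     ∀ j → + 0 ≤ j → (q ≡ 4 → + 3 ≤ j × + 1 ≤ bad W) → FewBad j (E ++ W) → ⊥
   tiny t q t≤1 q≤4 L≡ q≡ big j 0≤j x few =
     1≰0 (core t q t≤1 q≤4 (bad (E ++ W)) j (e * e) e (bad E) (bad W) few′ spread′ base lo (four 4≤e) (fst (least q 0≤j x)) (snd (least q 0≤j x)))
     where
     n≡ : lenᶻ (E ++ W) ≡ e + (+ suc t + + q)
     n≡ = trans (lenᶻ-++ E W) (trans (cong₂ (λ a b → a + + b) L≡ q≡) (ℤ.+-assoc e (+ suc t) (+ q)))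
     lo : + 10 - (+ suc t + + q) ≤ e
     lo = (lia ((lenᶻ (E ++ W)) & e & (+ suc t) & (+ q) & []) (#0 == #1 +' (#2 +' #3) & !10 <= #0 & []) (!10 -' (#2 +' #3) <= #1) (n≡ , big , tt))
     4≤e : + 4 ≤ e
     4≤e = (lia ((+ suc t) & (+ q) & e & []) (!10 -' (#0 +' #1) <= #2 & #0 <= !2 & #1 <= !4 & []) (!4 <= #2) (lo , (+≤+ (ℕ.s≤s t≤1)) , (+≤+ q≤4) , tt))
     few′ : + 4 * bad (E ++ W) + + 4 * j ≤ e * e + (+ 2 * (+ suc t + + q)) * e + (+ suc t + + q) * (+ suc t + + q) + + 3 * (e + (+ suc t + + q)) - + 16
     few′ = subst (+ 4 * bad (E ++ W) + + 4 * j ≤_) (trans (cong (λ n → n * n + + 3 * n - + 16) n≡) (square e (+ suc t + + q))) few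
     spread′ : bad E + + q * (e - + 1) + bad W ≤ bad (E ++ W)
     spread′ = subst (λ q → bad E + + q * (e - + 1) + bad W ≤ bad (E ++ W)) q≡ (spread (0≤bad W))
     base : + 2 * (e * e + + suc t * e) + + 2 + e - e * e - + 2 * (e + + suc t) ≤ + 2 * bad E
     base = (lia ((e * (e + + suc t)) & (G e E) & e & (e * e) & (+ suc t) & (bad E) & (+ suc t * e) & []) (+ 2 *' #0 +' + 2 *' #1 +' #2 -' #3 -' + 2 *' (#2 +' #4) <= + 2 *' #5 & #0 == #3 +' #6 & !1 <= #1 & []) (+ 2 *' (#3 +' #6) +' !2 +' #2 -' #3 -' + 2 *' (#2 +' #4) <= + 2 *' #5) ((subst (λ l → + 2 * (e * l) + + 2 * G e E + e - e * e - + 2 * l ≤ + 2 * bad E) L≡ (chain-bad c)) , (expand e (+ suc t)) , top , tt))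

module Small where

 open import Defs
 open Moves using (+1-1)
 open import Data.List.Base using (map; concatMap; filter; upTo)
 open import Data.List.Membership.Propositional using (_∈_; find)
 import Data.List.Membership.DecPropositional as DecMembership
 open import Data.List.Membership.Propositional.Properties using (∈-map⁺; ∈-map⁻; ∈-concatMap⁺; ∈-upTo⁺; ∈-filter⁺; ∈-filter⁻)
 open import Data.List.Relation.Unary.AllPairs as AllPairs using (AllPairs; []; _∷_)
 open import Data.List.Relation.Unary.Any as Any using (Any; here; there)
 open import Data.List.Relation.Unary.Linked using ([]; _∷_)
 import Data.Maybe.Properties as Maybe
 open import Data.Product.Base using (_,_)
 open import Data.Sum.Base using (_⊎_)
 open import Level using (0ℓ)
 open import Relation.Binary.Definitions using (DecidableEquality)
 open import Relation.Nullary.Decidable using (_×-dec_; _⊎-dec_; ¬?; map′)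
 open import Relation.Unary using (Pred; Decidable)
 open import Data.Nat.Combinatorics using () renaming (_C_ to _choose_)

 -- The Dyck sequences in question; the area bound is 2 area x + 2 j ≤ M - defc x.
 record Domain (n : ℕ) (j : ℤ) (x : List ℤ) : Set where
   constructor domain
   field
     dyck   : Dyck x
     size   : length x ≡ n
     defect : defc x ≤ + (2 ℕ.* n) - + 8
     low    : area x + area x + (j + j) + defc x ≤ + (n choose 2)

 -- What up has to satisfy for its orbits to be strings.
 record StringLike (n : ℕ) : Set where
   field
     rises     : ∀ {x} → Domain n (+ 1) x → ∃[ y ] (up x ≡ just y × Dyck y × length y ≡ n × defc y ≡ defc x × area y ≡ area x + + 1)
     injective : ∀ {x x′ y} → Domain n (+ 1) x → Domain n (+ 1) x′ → up x ≡ just y → up x′ ≡ just y → x ≡ x′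
     nonspecial : ∀ {x y} → Domain n (+ 1) x → up x ≡ just y → ¬ SpecialSkeleton n y
     reached   : ∀ {y} → Domain n (+ 0) y → SpecialSkeleton n y ⊎ ∃[ x ] (Domain n (+ 1) x × up x ≡ just y)

 extensions : ℕ → ℕ → List (List ℤ)
 extensions a zero    = [] ∷ []
 extensions a (suc n) = concatMap (λ b → map (+ b ∷_) (extensions b n)) (upTo (2 ℕ.+ a))

 dyckWords : ℕ → List (List ℤ)
 dyckWords zero    = []
 dyckWords (suc n) = map (+ 0 ∷_) (extensions 0 n)

 extensions-complete : ∀ a x → AffineDyck (+ a ∷ x) → All (+ 0 ≤_) x → x ∈ extensions a (length x)
 extensions-complete a []       _       _        = here refl
 extensions-complete a (+ b ∷ x) (h ∷ l) (_ ∷ nn) =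
   ∈-concatMap⁺ (λ b → map (+ b ∷_) (extensions b (length x))) (Any.map (λ { refl → ∈-map⁺ (+ b ∷_) (extensions-complete b x l nn) })
     (∈-upTo⁺ (ℕ.s≤s (ℕ.≤-trans (ℤ.drop‿+≤+ h) (ℕ.≤-reflexive (ℕ.+-comm a 1))))))

 dyckWords-complete : ∀ x → Dyck x → x ∈ dyckWords (length x)
 dyckWords-complete (_ ∷ x) (refl , l , _ ∷ nn) = ∈-map⁺ (+ 0 ∷_) (extensions-complete 0 x l nn)

 _≟ᴹ_ : DecidableEquality (Maybe (List ℤ))
 _≟ᴹ_ = Maybe.≡-dec _≟ᴸ_

 open DecMembership _≟ᴹ_ using () renaming (_∈?_ to _∈ᴹ?_)
 open DecMembership ℤ._≟_ using () renaming (_∈?_ to _∈ᶻ?_)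

 -- On lists from which the remaining conditions of Domain are known.
 Within : ℕ → ℤ → Pred (List ℤ) 0ℓ
 Within n j x = defc x ≤ + (2 ℕ.* n) - + 8 × area x + area x + (j + j) + defc x ≤ + (n choose 2)

 within? : ∀ n j → Decidable (Within n j)
 within? n j x = (_ ≤? _) ×-dec (_ ≤? _)

 special? : ∀ n → Decidable (SpecialSkeleton n)
 special? n s = fullSkeleton? s ×-dec (length s ℕ.≟ n) ×-dec ¬? (s ≟ᴸ ε n)

 Image : ℕ → List ℤ → List ℤ → Set
 Image n x y = Dyck y × length y ≡ n × defc y ≡ defc x × area y ≡ area x + + 1 × ¬ SpecialSkeleton n y

 data Rises (n : ℕ) (x : List ℤ) : Maybe (List ℤ) → Set where
   just : ∀ {y} → Image n x y → Rises n x (just y)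

 rises? : ∀ n x y → Dec (Rises n x y)
 rises? n x nothing  = no λ ()
 rises? n x (just y) = map′ just (λ { (just p) → p })
   (dyck? y ×-dec (length y ℕ.≟ n) ×-dec (defc y ≟ defc x) ×-dec (area y ≟ area x + + 1) ×-dec ¬? (special? n y))

 targets sources : ℕ → List (List ℤ)
 targets n = filter (within? n (+ 0)) (dyckWords n)
 sources n = filter (within? n (+ 1)) (dyckWords n)

 ofArea : List (List ℤ) → ℤ → ℤ × List (Maybe (List ℤ))
 ofArea xs a = a , map up (filter (λ x → area x ≟ a) xs)

 Reaches : List ℤ → ℤ × List (Maybe (List ℤ)) → Set
 Reaches y (a , us) = a + + 1 ≡ area y × just y ∈ us

 Sound : ℕ → List (List ℤ) → List ℤ → Set
 Sound n xs as = All (λ x → area x ∈ as × Rises n x (up x)) xs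

 Separated : ℕ → List (List ℤ) → List (ℤ × List (Maybe (List ℤ))) → Set
 Separated n ys gs = All (λ g → AllPairs _≢_ (snd g)) gs × All (λ y → SpecialSkeleton n y ⊎ Any (Reaches y) gs) ys

 separated? : ∀ n ys gs → Dec (Separated n ys gs)
 separated? n ys gs = All.all? (λ g → AllPairs.allPairs? (λ u v → ¬? (u ≟ᴹ v)) (snd g)) gs
   ×-dec All.all? (λ y → special? n y ⊎-dec Any.any? (λ g → (fst g + + 1 ≟ area y) ×-dec (just y ∈ᴹ? snd g)) gs) ys

 Checked : ℕ → List (List ℤ) → List ℤ → Set
 Checked n xs as = Sound n xs as × Separated n (targets n) (map (ofArea xs) as)

 sound? : ∀ n xs as → Dec (Sound n xs as)
 sound? n xs as = All.all? (λ x → (area x ∈ᶻ? as) ×-dec rises? n x (up x)) xs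

 unique-injective : ∀ {A B : Set} (f : A → B) {xs x x′} → AllPairs _≢_ (map f xs) → x ∈ xs → x′ ∈ xs → f x ≡ f x′ → x ≡ x′
 unique-injective f (h ∷ u) (here refl) (here refl) eq = refl
 unique-injective f (h ∷ u) (here refl) (there q)   eq = ⊥-elim (All.lookup h (∈-map⁺ f q) eq)
 unique-injective f (h ∷ u) (there p)   (here refl) eq = ⊥-elim (All.lookup h (∈-map⁺ f p) (sym eq))
 unique-injective f (h ∷ u) (there p)   (there q)   eq = unique-injective f u p q eq

 rises-image : ∀ {n x m} → Rises n x m → ∃[ y ] (m ≡ just y × Image n x y)
 rises-image (just p) = _ , refl , p

 module FromCheck (n : ℕ) (as : List ℤ) (ok : Checked n (sources n) as) where

   member : ∀ {j x} → Domain n j x → x ∈ filter (within? n j) (dyckWords n)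
   member {j} {x} (domain d s df l) = ∈-filter⁺ (within? n j) (subst (λ k → x ∈ dyckWords k) s (dyckWords-complete x d)) (df , l)

   found : ∀ {j x} → x ∈ filter (within? n j) (dyckWords n) → Dyck x → length x ≡ n → Domain n j x
   found {j} p d s with ∈-filter⁻ (within? n j) {xs = dyckWords n} p
   ... | _ , df , l = domain d s df l

   image : ∀ {x} → Domain n (+ 1) x → ∃[ y ] (up x ≡ just y × Image n x y)
   image p = rises-image (snd (All.lookup (fst ok) (member p)))

   same-area : ∀ {x x′ y} → Domain n (+ 1) x → Domain n (+ 1) x′ → up x ≡ just y → up x′ ≡ just y → area x ≡ area x′
   same-area p q e f with image p | image q
   ... | y , e′ , _ , _ , _ , ay , _ | y′ , f′ , _ , _ , _ , ay′ , _ =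
     trans (sym (+1-1 _)) (trans (cong (_- + 1) (trans (sym ay) (trans (cong area (Maybe.just-injective (trans (sym e′) (trans (trans e (sym f)) f′)))) ay′))) (+1-1 _))

   stringLike : (∀ {x} → x ∈ dyckWords n → Dyck x × length x ≡ n) → StringLike n
   stringLike words = record
     { rises = λ p → let y , e , d , s , df , a , _ = image p in y , e , d , s , df , a
     ; nonspecial = λ p e sp → let y , e′ , _ , _ , _ , _ , h = image p in h (subst (SpecialSkeleton n) (Maybe.just-injective (trans (sym e) e′)) sp)
     ; injective = λ {x} p q e f → unique-injective up {xs = filter (λ z → area z ≟ area x) (sources n)}
         (All.lookup (fst (snd ok)) (∈-map⁺ (ofArea (sources n)) (fst (All.lookup (fst ok) (member p)))))
         (∈-filter⁺ (λ z → area z ≟ area x) (member p) refl)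
         (∈-filter⁺ (λ z → area z ≟ area x) (member q) (sym (same-area p q e f)))
         (trans e (sym f))
     ; reached = λ p → reach (All.lookup (snd (snd ok)) (member p)) }
     where
     reach : ∀ {y} → SpecialSkeleton n y ⊎ Any (Reaches y) (map (ofArea (sources n)) as) →
       SpecialSkeleton n y ⊎ ∃[ x ] (Domain n (+ 1) x × up x ≡ just y)
     reach (inl s) = inl s
     reach (inr any) with find any
     ... | g , g∈ , _ , y∈ with ∈-map⁻ (ofArea (sources n)) g∈
     ...   | a , _ , refl with ∈-map⁻ up y∈
     ...     | x , x∈ , eq with ∈-filter⁻ (λ z → area z ≟ a) {xs = sources n} x∈
     ...       | x∈S , _ with ∈-filter⁻ (within? n (+ 1)) {xs = dyckWords n} x∈S
     ...         | x∈D , _ = inr (x , found {j = + 1} x∈S (fst (words x∈D)) (snd (words x∈D)) , sym eq)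

 words? : ∀ n → Dec (All (λ x → Dyck x × length x ≡ n) (dyckWords n))
 words? n = All.all? (λ x → dyck? x ×-dec (length x ℕ.≟ n)) (dyckWords n)

 areas : List ℤ
 areas = map +_ (upTo 20)

 witness : ∀ {A : Set} (d : Dec A) → does d ≡ true → A
 witness (yes p) _ = p

 small : ∀ n → does (words? n) ≡ true → does (sound? n (sources n) areas) ≡ true →
   does (separated? n (targets n) (map (ofArea (sources n)) areas)) ≡ true → StringLike n
 small n ws s c = FromCheck.stringLike n areas (witness (sound? n _ _) s , witness (separated? n _ _) c)
   (All.lookup (witness (words? n) ws))

module Small9 where

 open Small
 open import Data.List.Base using (map)

 sound₉ : does (sound? 9 (sources 9) areas) ≡ true
 sound₉ = refl

 separated₉ : does (separated? 9 (targets 9) (map (ofArea (sources 9)) areas)) ≡ true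
 separated₉ = refl

 stringLike₄ : StringLike 4
 stringLike₄ = small 4 refl refl refl

 stringLike₅ : StringLike 5
 stringLike₅ = small 5 refl refl refl

 stringLike₆ : StringLike 6
 stringLike₆ = small 6 refl refl refl

 stringLike₇ : StringLike 7
 stringLike₇ = small 7 refl refl refl

 stringLike₈ : StringLike 8
 stringLike₈ = small 8 refl refl refl

 stringLike₉ : StringLike 9
 stringLike₉ = small 9 refl sound₉ separated₉

module Win where

 open Lia
 open Dbm
 open import Data.Bool.Base using (_∧_)
 open import Data.List.Base using (map; foldr)
 open import Data.Vec.Base using (lookup)

 -- x i ≤ x j + k
 le : ∀ {n} → Fin n → Fin n → ℤ → Form n
 le i j k = atom i (- k) j

 eq : ∀ {n} → Fin n → Fin n → ℤ → Form n
 eq i j k = le i j k and le j i (- k)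

 allᶠ anyᶠ : ∀ {n} → List (Form n) → Form n
 allᶠ = foldr _and_ (truth true)
 anyᶠ = foldr _or_ (truth false)

 -- Windows are indexed from x₋₃ to x₃.  Left (right) windows have four entries
 -- on the left (right) of the boundary.
 module _ {n} (ix : Vec (Fin n) 7) where

   private
     x : Fin 7 → Fin n
     x = lookup ix

   leftShape rightShape leftStuck rightStuck : Form n
   leftShape = le (x 1F) (x 0F) (+ 1) and le (x 2F) (x 1F) (+ 1) and le (x 3F) (x 2F) (+ 1)
           and le (x 4F) (x 5F) (+ 1) and le (x 5F) (x 6F) (+ 1)
   rightShape = le (x 1F) (x 0F) (+ 1) and le (x 2F) (x 1F) (+ 1)
           and le (x 3F) (x 4F) (+ 1) and le (x 4F) (x 5F) (+ 1) and le (x 5F) (x 6F) (+ 1)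
   leftStuck = le (x 4F) (x 3F) (-[1+ 1 ]) and
     (  (le (x 2F) (x 3F) (+ 1) and le (x 4F) (x 3F) (-[1+ 1 ]) and le (x 5F) (x 3F) (-[1+ 1 ]) and le (x 4F) (x 2F) (-[1+ 1 ]))
     or (le (x 3F) (x 2F) (-[1+ 1 ]) and le (x 5F) (x 2F) (-[1+ 1 ]))
     or (eq (x 2F) (x 5F) (+ 2) and eq (x 3F) (x 5F) (+ 3) and eq (x 4F) (x 5F) (+ 1)))
   rightStuck = le (x 2F) (x 3F) (-[1+ 1 ]) and
     (  (le (x 4F) (x 3F) (+ 1) and le (x 1F) (x 3F) (-[1+ 1 ]) and le (x 2F) (x 3F) (-[1+ 1 ]) and le (x 2F) (x 4F) (-[1+ 1 ]))
     or (le (x 3F) (x 4F) (-[1+ 1 ]) and le (x 1F) (x 4F) (-[1+ 1 ]))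
     or (eq (x 2F) (x 1F) (+ 1) and eq (x 3F) (x 1F) (+ 3) and eq (x 4F) (x 1F) (+ 2)))

 others : Fin 7 → List (Fin 7)
 others 0F = 1F ∷ 2F ∷ 3F ∷ 4F ∷ 5F ∷ 6F ∷ []
 others 1F = 0F ∷ 2F ∷ 3F ∷ 4F ∷ 5F ∷ 6F ∷ []
 others 2F = 0F ∷ 1F ∷ 3F ∷ 4F ∷ 5F ∷ 6F ∷ []
 others 3F = 0F ∷ 1F ∷ 2F ∷ 4F ∷ 5F ∷ 6F ∷ []
 others 4F = 0F ∷ 1F ∷ 2F ∷ 3F ∷ 5F ∷ 6F ∷ []
 others 5F = 0F ∷ 1F ∷ 2F ∷ 3F ∷ 4F ∷ 6F ∷ []
 others 6F = 0F ∷ 1F ∷ 2F ∷ 3F ∷ 4F ∷ 5F ∷ []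

 positions : List (Fin 7)
 positions = 0F ∷ 1F ∷ 2F ∷ 3F ∷ 4F ∷ 5F ∷ 6F ∷ []

 -- At least k further entries lie in {x i - 1, x i}.
 crowded : ∀ {n} → Vec (Fin n) 7 → ℤ → Fin 7 → Form n
 crowded ix k i = atLeast k (map (λ j → le (lookup ix j) (lookup ix i) (+ 0) and le (lookup ix i) (lookup ix j) (+ 1)) (others i))

 concentrated scattered : ∀ {n} → Vec (Fin n) 7 → Form n
 concentrated ix = anyᶠ (map (crowded ix (+ 4)) positions)
 scattered ix    = neg (concentrated ix)

 pairAtoms : ∀ {n k} → Fin n → Vec (Fin n) k → List (Form n)
 pairAtoms i []       = []
 pairAtoms i (j ∷ js) = atom j (+ 2) i ∷ atom i (+ 1) j ∷ pairAtoms i js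

 badAtoms : ∀ {n k} → Vec (Fin n) k → List (Form n)
 badAtoms []       = []
 badAtoms (i ∷ is) = pairAtoms i is ++ badAtoms is

 eachAtom : ∀ {n k} → (Fin n → List (Form n)) → Vec (Fin n) k → List (Form n)
 eachAtom f []       = []
 eachAtom f (i ∷ is) = f i ++ eachAtom f is

 ix8 : Vec (Fin 8) 7
 ix8 = 0F ∷ 1F ∷ 2F ∷ 3F ∷ 4F ∷ 5F ∷ 6F ∷ []

 -- The last index is the level M below the maximum of the entries before the
 -- window.
 levels tops : Fin 8 → List (Form 8)
 levels i = le i 7F (+ 2) ∷ le i 7F (+ 3) ∷ le i 7F (+ 4) ∷ le i 7F -[1+ 0 ] ∷ le i 7F -[1+ 1 ] ∷ []
 tops i   = atom 7F (+ 1) i ∷ atom 7F (+ 2) i ∷ []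

 dAtoms kAtoms : List (Form 8)
 dAtoms = badAtoms ix8 ++ eachAtom levels ix8
 kAtoms = badAtoms ix8 ++ eachAtom tops ix8

 sparse : Form 8
 sparse = allᶠ (map (λ i → atom 7F (+ 1) (lookup ix8 i) or neg (crowded ix8 (+ 3) i)) positions)

 bound : ℤ → ℤ → Form 8
 bound d k = atLeast (d + + 21) dAtoms and atLeast k kAtoms

 bounds : Form 8
 bounds = bound (+ 11) (+ 17) or bound (+ 12) (+ 15) or bound (+ 14) (+ 11)
       or (sparse and (bound (+ 7) (+ 25) or bound (+ 8) (+ 22) or bound (+ 10) (+ 19)))

 anchored : Form 8
 anchored = le 0F 7F (+ 2) and (le 6F 7F (+ 1) or le 6F 0F (+ 0))

 leftForm rightForm : Form 8
 leftForm = anchored and leftShape ix8 and leftStuck ix8 and scattered ix8 imp bounds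
 rightForm = anchored and rightShape ix8 and rightStuck ix8 and scattered ix8 imp bounds

 ix9 : Vec (Fin 9) 7
 ix9 = 0F ∷ 1F ∷ 2F ∷ 3F ∷ 4F ∷ 5F ∷ 6F ∷ []

 -- The last index is an earlier entry u.
 threeForm : Form 8
 threeForm = neg (atLeast (+ 3) (pairAtoms 7F ix8)) imp concentrated ix8

 sparse′ : Form 9
 sparse′ = allᶠ (map (λ i → atom 7F (+ 1) (lookup ix9 i) or neg (crowded ix9 (+ 3) i)) positions)

 fourForm : Form 9
 fourForm = neg (atLeast (+ 4) (pairAtoms 8F ix9)) and le 8F 7F (+ 0) imp neg sparse′

 -- The moves of the table, with the two unbounded families of Case 3 and the rows
 -- depending on o: a condition on the five middle entries and the positions from
 -- which the entries of the image are taken.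
 record Row : Set where
   constructor row
   field
     shape : ∀ {n} → Vec (Fin n) 5 → Form n
     source target : Vec (Fin 5) 5

 open Row public

 pattern five₅ a b c d e = a ∷ b ∷ c ∷ d ∷ e ∷ []

 exact : (a b c d : ℤ) → ∀ {n} → Vec (Fin n) 5 → Form n
 exact a b c d (five₅ x₁ x₂ x₃ x₄ x₅) = eq x₁ x₅ a and eq x₂ x₅ b and eq x₃ x₅ c and eq x₄ x₅ d

 lower : (a b c : ℤ) → ∀ {n} → Vec (Fin n) 5 → Form n
 lower a b c (five₅ x₁ x₂ x₃ x₄ x₅) = eq x₁ x₅ a and eq x₂ x₅ b and eq x₃ x₅ c and le x₄ x₅ -[1+ 1 ]

 high : ∀ {n} → Vec (Fin n) 5 → Form n
 high (five₅ x₁ x₂ x₃ x₄ x₅) =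
   le x₁ x₂ (+ 1) and le x₂ x₁ (+ 1) and le x₁ x₃ (+ 1) and le x₃ x₁ (+ 1) and le x₂ x₃ (+ 1) and le x₃ x₂ (+ 1)
   and le x₄ x₁ -[1+ 1 ] and le x₄ x₂ -[1+ 1 ] and le x₄ x₃ -[1+ 1 ]
   and le x₅ x₁ -[1+ 1 ] and le x₅ x₂ -[1+ 1 ] and le x₅ x₃ -[1+ 1 ]

 highLow highSwap : ∀ {n} → Vec (Fin n) 5 → Form n
 highLow  xs@(five₅ x₁ x₂ x₃ x₄ x₅) = high xs and le x₅ x₄ (+ 1) and le x₄ x₅ (+ 1)
 highSwap xs@(five₅ x₁ x₂ x₃ x₄ x₅) = high xs and le x₄ x₅ -[1+ 1 ]

 ecdab cdeab cedba cdeba dceab cedab dceba decab debac deacb decba debca deabc edabc edcab edbac edacb : Vec (Fin 5) 5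
 decab = five₅ 3F 4F 2F 0F 1F
 debac = five₅ 3F 4F 1F 0F 2F
 deacb = five₅ 3F 4F 0F 2F 1F
 decba = five₅ 3F 4F 2F 1F 0F
 debca = five₅ 3F 4F 1F 2F 0F
 deabc = five₅ 3F 4F 0F 1F 2F
 edabc = five₅ 4F 3F 0F 1F 2F
 edcab = five₅ 4F 3F 2F 0F 1F
 edbac = five₅ 4F 3F 1F 0F 2F
 edacb = five₅ 4F 3F 0F 2F 1F

 ecdab = five₅ 4F 2F 3F 0F 1F
 cdeab = five₅ 2F 3F 4F 0F 1F
 cedba = five₅ 2F 4F 3F 1F 0F
 cdeba = five₅ 2F 3F 4F 1F 0F
 dceab = five₅ 3F 2F 4F 0F 1F
 cedab = five₅ 2F 4F 3F 0F 1F
 dceba = five₅ 3F 2F 4F 1F 0F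

 rows : List Row
 rows =
     row (highLow) deabc cdeab ∷ row (highSwap) edabc cdeba
   ∷ row (exact (+ 1) (+ 1) (+ 2) -[1+ 0 ]) decab decab ∷ row (exact (+ 1) (+ 2) (+ 2) -[1+ 0 ]) debac dceab
   ∷ row (exact (+ 2) (+ 1) (+ 2) -[1+ 0 ]) deacb cedab ∷ row (exact (+ 0) (+ 1) (+ 2) -[1+ 0 ]) decba edcab
   ∷ row (exact (+ 2) (+ 2) (+ 3) (+ 1)) decab decab ∷ row (exact (+ 2) (+ 3) (+ 3) (+ 1)) debac dceab
   ∷ row (exact (+ 3) (+ 2) (+ 3) (+ 1)) deacb cedab ∷ row (exact (+ 1) (+ 2) (+ 3) (+ 1)) decba edcab
   ∷ row (exact (+ 1) (+ 2) (+ 2) (+ 0)) debca ecdab ∷ row (exact (+ 1) (+ 2) (+ 3) (+ 0)) decba edcab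
   ∷ row (lower (+ 1) (+ 1) (+ 2)) edcab decba ∷ row (lower (+ 1) (+ 2) (+ 2)) edbac dceba
   ∷ row (lower (+ 2) (+ 1) (+ 2)) edacb cedba ∷ row (lower (+ 0) (+ 1) (+ 2)) edacb cedba
   ∷ row (lower (+ 1) (+ 2) (+ 0)) edbac dceba ∷ []

 ix7 : Vec (Fin 7) 7
 ix7 = 0F ∷ 1F ∷ 2F ∷ 3F ∷ 4F ∷ 5F ∷ 6F ∷ []

 middle : ∀ {n} → Vec (Fin n) 7 → Vec (Fin n) 5
 middle (z ∷ a ∷ b ∷ c ∷ d ∷ e ∷ y ∷ []) = five₅ a b c d e

 permuted : ∀ {n} → Vec (Fin 5) 5 → Vec (Fin n) 7 → Vec (Fin n) 7
 permuted s (z ∷ a ∷ b ∷ c ∷ d ∷ e ∷ y ∷ []) = z ∷ (Vec.map (lookup (five₅ a b c d e)) s Vec.++ (y ∷ []))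

 forwardᶠ backwardᶠ : Form 7
 forwardᶠ = leftShape ix7 and leftStuck ix7 and concentrated ix7
   imp anyᶠ (map (λ r → shape r (middle ix7) and rightShape (permuted (source r) ix7) and rightStuck (permuted (source r) ix7)) rows)
 backwardᶠ = rightShape ix7 and rightStuck ix7 and concentrated ix7
   imp anyᶠ (map (λ r → shape r (middle (permuted (target r) ix7)) and leftShape (permuted (target r) ix7) and leftStuck (permuted (target r) ix7)) rows)

 ix5 : Vec (Fin 5) 5
 ix5 = five₅ 0F 1F 2F 3F 4F

 same : ∀ {n} → Vec (Fin n) 5 → Vec (Fin n) 5 → Form n
 same (five₅ a b c d e) (five₅ a′ b′ c′ d′ e′) =
   eq a a′ (+ 0) and eq b b′ (+ 0) and eq c c′ (+ 0) and eq d d′ (+ 0) and eq e e′ (+ 0)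

 allRows : (Row → Bool) → List Row → Bool
 allRows p []       = true
 allRows p (r ∷ rs) = p r ∧ allRows p rs

 unambiguous : Row → Row → Form 5
 unambiguous r r′ = shape r (target r) and shape r′ (target r′) imp same (target r) (target r′)

 leftForm-valid : valid leftForm ≡ true
 leftForm-valid = refl

 rightForm-valid : valid rightForm ≡ true
 rightForm-valid = refl

 three-valid : valid threeForm ≡ true
 three-valid = refl

 four-valid : valid fourForm ≡ true
 four-valid = refl

 forward-valid : valid forwardᶠ ≡ true
 forward-valid = refl

 backward-valid : valid backwardᶠ ≡ true
 backward-valid = refl

 unambiguous-valid : allRows (λ r → allRows (λ r′ → valid (unambiguous r r′)) rows) rows ≡ true
 unambiguous-valid = refl

module Fad where

 open Lia
 open Dbm using (Form; atom; atLeast; _and_; _or_; sumχ; prop; decideForm; prove; eval)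
 open Win
 open Stats
 open Facts
 open Words using (1≰0)
 open import Data.Product.Base using (_,_)
 open import Data.Sum.Base using (_⊎_)
 open import Data.Vec.Base using (lookup)

 sumχ-++ : ∀ {n} (fs gs : List (Form n)) ρ → sumχ (fs ++ gs) ρ ≡ sumχ fs ρ + sumχ gs ρ
 sumχ-++ []       gs ρ = sym (ℤ.+-identityˡ _)
 sumχ-++ (f ∷ fs) gs ρ = trans (cong (_+_ (χ (eval f ρ))) (sumχ-++ fs gs ρ)) (sym (ℤ.+-assoc (χ (eval f ρ)) _ _))

 module _ {n} (ρ : Vec ℤ n) where

   letters : ∀ {k} → Vec (Fin n) k → List ℤ
   letters []       = []
   letters (i ∷ is) = lookup ρ i ∷ letters is

   pairAtoms-sum : ∀ {k} i (is : Vec (Fin n) k) → sumχ (pairAtoms i is) ρ ≡ sumBy (bd (lookup ρ i)) (letters is)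
   pairAtoms-sum i []       = refl
   pairAtoms-sum i (j ∷ js) = trans (cong (λ s → (lookup ρ j + + 2 ≤χ lookup ρ i) + ((lookup ρ i + + 1 ≤χ lookup ρ j) + s)) (pairAtoms-sum i js))
     (sym (ℤ.+-assoc (lookup ρ j + + 2 ≤χ lookup ρ i) _ _))

   badAtoms-sum : ∀ {k} (is : Vec (Fin n) k) → sumχ (badAtoms is) ρ ≡ bad (letters is)
   badAtoms-sum []       = refl
   badAtoms-sum (i ∷ is) = trans (sumχ-++ (pairAtoms i is) (badAtoms is) ρ) (cong₂ _+_ (pairAtoms-sum i is) (badAtoms-sum is))

   eachAtom-≤ : ∀ {k} F f → (∀ i → f (lookup ρ i) ≤ sumχ (F i) ρ) → (is : Vec (Fin n) k) → sumBy f (letters is) ≤ sumχ (eachAtom F is) ρ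
   eachAtom-≤ F f h []       = ℤ.≤-refl
   eachAtom-≤ F f h (i ∷ is) = (lia ((f (lookup ρ i)) & (sumχ (F i) ρ) & (sumBy f (letters is)) & (sumχ (eachAtom F is) ρ) & (sumχ (F i ++ eachAtom F is) ρ) & []) (#0 <= #1 & #2 <= #3 & #4 == #1 +' #3 & []) (#0 +' #2 <= #4) ((h i) , (eachAtom-≤ F f h is) , (sumχ-++ (F i) (eachAtom F is) ρ) , tt))

   eachAtom-≥ : ∀ {k} F f → (∀ i → sumχ (F i) ρ ≤ f (lookup ρ i)) → (is : Vec (Fin n) k) → sumχ (eachAtom F is) ρ ≤ sumBy f (letters is)
   eachAtom-≥ F f h []       = ℤ.≤-refl
   eachAtom-≥ F f h (i ∷ is) = (lia ((sumχ (F i) ρ) & (f (lookup ρ i)) & (sumχ (eachAtom F is) ρ) & (sumBy f (letters is)) & (sumχ (F i ++ eachAtom F is) ρ) & []) (#0 <= #1 & #2 <= #3 & #4 == #0 +' #2 & []) (#4 <= #1 +' #3) ((h i) , (eachAtom-≥ F f h is) , (sumχ-++ (F i) (eachAtom F is) ρ) , tt))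

 sumBy-≤ : ∀ {f g} W {P : ℤ → Set} → All P W → (∀ v → P v → f v ≤ g v) → sumBy f W ≤ sumBy g W
 sumBy-≤ []      []       h = ℤ.≤-refl
 sumBy-≤ (v ∷ W) (p ∷ ps) h = ℤ.+-mono-≤ (h v p) (sumBy-≤ W ps h)

 -- The number of bad pairs that v forms with the letters 0, …, m before it.
 beforeRun : ℤ → ℤ → ℤ
 beforeRun m v = m - + 1 + ((m ≤χ v) + (m + + 1 ≤χ v))

 module Window {E : List ℤ} {m : ℤ} (c : Chain E m) (W : List ℤ) (seven : lenᶻ W ≡ + 7) (nn : All (+ 0 ≤_) W) where

   T = lenᶻ E - m - + 1
   B = bad W
   K = bad W + sumBy (λ v → (m ≤χ v) + (m + + 1 ≤χ v)) W

   0≤T : + 0 ≤ T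
   0≤T = (lia (m & (lenᶻ E) & []) (#0 +' !1 <= #1 & []) (!0 <= #1 -' #0 -' !1) ((chain-length c) , tt))

   run-base : sumBy (beforeRun (+ 0)) W ≤ sumBy (bd (+ 0)) W
   run-base = sumBy-≤ W nn λ v h → (lia (v & []) (!0 <= #0 & []) (!0 -' !1 +' ((!0 <=? #0) +' (!0 +' !1 <=? #0)) <= (#0 +' !2 <=? !0) +' (!0 +' !1 <=? #0)) (h , tt))

   run-step : ∀ p → sumBy (beforeRun (p + + 1)) W ≤ sumBy (beforeRun p) W + sumBy (bd (p + + 1)) W
   run-step p = subst (sumBy (beforeRun (p + + 1)) W ≤_) (sumBy-+ (beforeRun p) (bd (p + + 1)) W)
     (sumBy-≤ W nn λ v h → (lia (p & v & []) ([]) (#0 +' !1 -' !1 +' ((#0 +' !1 <=? #1) +' (#0 +' !1 +' !1 <=? #1)) <= #0 -' !1 +' ((#0 <=? #1) +' (#0 +' !1 <=? #1)) +' ((#1 +' !2 <=? #0 +' !1) +' (#0 +' !1 +' !1 <=? #1))) (tt)))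

   beforeRun-sum : bad W + sumBy (beforeRun m) W ≡ + 7 * m - + 7 + K
   beforeRun-sum = trans (cong (_+_ (bad W)) (go W))
     (subst (λ l → bad W + (l * (m - + 1) + A) ≡ + 7 * m - + 7 + K) (sym seven) (arith m (bad W) A))
     where
     A = sumBy (λ v → (m ≤χ v) + (m + + 1 ≤χ v)) W
     arith : ∀ m B A → B + (+ 7 * (m - + 1) + A) ≡ + 7 * m - + 7 + (B + A)
     arith = solve-∀
     distrib : ∀ q x → (+ 1 + q) * x ≡ q * x + x
     distrib = solve-∀
     go : ∀ W → sumBy (beforeRun m) W ≡ lenᶻ W * (m - + 1) + sumBy (λ v → (m ≤χ v) + (m + + 1 ≤χ v)) W
     go []      = refl
     go (v ∷ W) = (lia ((sumBy (beforeRun m) W) & (lenᶻ W * (m - + 1)) & (sumBy (λ v → (m ≤χ v) + (m + + 1 ≤χ v)) W) & (lenᶻ (v ∷ W) * (m - + 1)) & m & v & []) (#0 == #1 +' #2 & #3 == #1 +' (#4 -' !1) & []) ((#4 -' !1 +' ((#4 <=? #5) +' (#4 +' !1 <=? #5))) +' #0 == #3 +' (((#4 <=? #5) +' (#4 +' !1 <=? #5)) +' #2)) ((go W) , (distrib (lenᶻ W) (m - + 1)) , tt))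

   sumBy-shift : ∀ k (f : ℤ → ℤ) X → sumBy (λ u → f u - k) X ≡ sumBy f X - k * lenᶻ X
   sumBy-shift k f []      = sym (cong (λ z → + 0 - z) (ℤ.*-zeroʳ k))
   sumBy-shift k f (u ∷ X) = trans (cong (_+_ (f u - k)) (sumBy-shift k f X)) (arith (f u) (sumBy f X) k (lenᶻ X))
     where
     arith : ∀ a s k l → a - k + (s - k * l) ≡ a + s - k * (+ 1 + l)
     arith = solve-∀

   cross-rows : ∀ X → cross X W ≡ sumBy (λ u → sumBy (bd u) W) X
   cross-rows []      = refl
   cross-rows (u ∷ X) = cong (_+_ (sumBy (bd u) W)) (cross-rows X)

   -- Each entry other than the first occurrences of 0, …, m forms three bad pairs
   -- with the window.
   cross₃ : (∀ u → + 0 ≤ u → u ≤ m → + 3 ≤ sumBy (bd u) W) → + 3 * T + sumBy (beforeRun m) W ≤ cross E W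
   cross₃ three = (lia ((sumBy (beforeRun m) W) & m & (sumBy h E) & (sumBy (λ u → sumBy (bd u) W) E) & (lenᶻ E) & (cross E W) & []) (#0 -' + 3 *' (#1 +' !1) <= #2 & #2 == #3 -' + 3 *' #4 & #5 == #3 & []) (+ 3 *' (#4 -' #1 -' !1) +' #0 <= #5) ((chain-potential h Φ base step c ok) , (sumBy-shift (+ 3) (λ u → sumBy (bd u) W) E) , (cross-rows E) , tt))
     where
     h Φ : ℤ → ℤ
     h u = sumBy (bd u) W - + 3
     Φ p = sumBy (beforeRun p) W - + 3 * (p + + 1)
     base : Φ (+ 0) ≤ h (+ 0)
     base = (lia ((sumBy (beforeRun (+ 0)) W) & (sumBy (bd (+ 0)) W) & []) (#0 <= #1 & []) (#0 -' + 3 *' (!0 +' !1) <= #1 -' !3) (run-base , tt))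
     step : ∀ p → + 0 ≤ p → Φ (p + + 1) ≤ Φ p + h (p + + 1)
     step p _ = (lia ((sumBy (beforeRun (p + + 1)) W) & (sumBy (beforeRun p) W) & (sumBy (bd (p + + 1)) W) & p & []) (#0 <= #1 +' #2 & []) (#0 -' + 3 *' (#3 +' !1 +' !1) <= #1 -' + 3 *' (#3 +' !1) +' (#2 -' !3)) ((run-step p) , tt))
     ok : ∀ u → + 0 ≤ u → u ≤ m → + 0 ≤ h u
     ok u p q = (lia ((sumBy (bd u) W) & []) (!3 <= #0 & []) (!0 <= #0 -' !3) ((three u p q) , tt))

   cross₄ : (∀ u → + 0 ≤ u → u ≤ m → + 4 - (m ≤χ u) ≤ sumBy (bd u) W) → + 4 * T + + 1 - G m E + sumBy (beforeRun m) W ≤ cross E W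
   cross₄ four = (lia ((sumBy (beforeRun m) W) & m & (sumBy h E) & (sumBy (λ u → sumBy (bd u) W + (m ≤χ u)) E) & (lenᶻ E) & (sumBy (λ u → sumBy (bd u) W) E) & (G m E) & (cross E W) & []) (#0 -' + 4 *' (#1 +' !1) +' (#1 <=? #1) <= #2 & #2 == #3 -' + 4 *' #4 & #3 == #5 +' #6 & #7 == #5 & []) (+ 4 *' (#4 -' #1 -' !1) +' !1 -' #6 +' #0 <= #7) ((chain-potential h Φ base step c ok) , (sumBy-shift (+ 4) (λ u → sumBy (bd u) W + (m ≤χ u)) E) , (sumBy-+ (λ u → sumBy (bd u) W) (m ≤χ_) E) , (cross-rows E) , tt))
     where
     h Φ : ℤ → ℤ
     h u = sumBy (bd u) W + (m ≤χ u) - + 4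
     Φ p = sumBy (beforeRun p) W - + 4 * (p + + 1) + (m ≤χ p)
     base : Φ (+ 0) ≤ h (+ 0)
     base = (lia ((sumBy (beforeRun (+ 0)) W) & (sumBy (bd (+ 0)) W) & m & []) (#0 <= #1 & []) (#0 -' + 4 *' (!0 +' !1) +' (#2 <=? !0) <= #1 +' (#2 <=? !0) -' !4) (run-base , tt))
     step : ∀ p → + 0 ≤ p → Φ (p + + 1) ≤ Φ p + h (p + + 1)
     step p _ = (lia ((sumBy (beforeRun (p + + 1)) W) & (sumBy (beforeRun p) W) & (sumBy (bd (p + + 1)) W) & p & m & []) (#0 <= #1 +' #2 & []) (#0 -' + 4 *' (#3 +' !1 +' !1) +' (#4 <=? #3 +' !1) <= #1 -' + 4 *' (#3 +' !1) +' (#4 <=? #3) +' (#2 +' (#4 <=? #3 +' !1) -' !4)) ((run-step p) , tt))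
     ok : ∀ u → + 0 ≤ u → u ≤ m → + 0 ≤ h u
     ok u p q = (lia (m & u & (sumBy (bd u) W) & []) (!4 -' (#0 <=? #1) <= #2 & []) (!0 <= #2 +' (#0 <=? #1) -' !4) ((four u p q) , tt))

   module _ (three : ∀ u → + 0 ≤ u → u ≤ m → + 3 ≤ sumBy (bd u) W) (low : LowDeficit (E ++ W)) (few : FewBad (+ 4) (E ++ W)) where

     D = bad W + sumBy (λ v → (m ≤χ v) + (m + + 1 ≤χ v) + (m - + 1 - v)) W

     total-length : lenᶻ (E ++ W) ≡ T + m + + 8
     total-length = (lia ((lenᶻ (E ++ W)) & (lenᶻ E) & (lenᶻ W) & m & []) (#0 == #1 +' #2 & #2 == !7 & []) (#0 == #1 -' #3 -' !1 +' #3 +' !8) ((lenᶻ-++ E W) , seven , tt))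

     deficit-bound : T + D ≤ + 2 * m + + 8
     deficit-bound = (lia ((bad (E ++ W)) & (total (E ++ W)) & (lenᶻ (E ++ W)) & (bad E) & (cross E W) & (bad W) & (total E) & (total W) & (T) & m & (sumBy (beforeRun m) W) & (sumBy (λ v → (m ≤χ v) + (m + + 1 ≤χ v) + (m - + 1 - v)) W) & []) (#0 -' #1 <= + 2 *' #2 -' !8 & #0 == #3 +' #4 +' #5 & #1 == #6 +' #7 & #2 == #8 +' #9 +' !8 & + 3 *' #8 +' #10 <= #4 & #6 <= #3 & #11 == #10 -' #7 & []) (#8 +' (#5 +' #11) <= + 2 *' #9 +' !8) (low , (bad-++ E W) , (sumBy-++ (λ u → u) E W) , total-length , (cross₃ three) , (chain-total≤bad c) , (go W) , tt))
       where
       go : ∀ W → sumBy (λ v → (m ≤χ v) + (m + + 1 ≤χ v) + (m - + 1 - v)) W ≡ sumBy (beforeRun m) W - total W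
       go []      = refl
       go (v ∷ W) = (lia ((sumBy (λ v → (m ≤χ v) + (m + + 1 ≤χ v) + (m - + 1 - v)) W) & (sumBy (beforeRun m) W) & (total W) & m & v & []) (#0 == #1 -' #2 & []) (((#3 <=? #4) +' (#3 +' !1 <=? #4) +' (#3 -' !1 -' #4)) +' #0 == (#3 -' !1 +' ((#3 <=? #4) +' (#3 +' !1 <=? #4))) +' #1 -' (#4 +' #2)) ((go W) , tt))

     few′ : + 4 * bad (E ++ W) + + 16 ≤ T * T + + 2 * (m * T) + m * m + + 19 * T + + 19 * m + + 72
     few′ = subst (_ ≤_) (trans (cong (λ n → n * n + + 3 * n - + 16) total-length) (arith T m)) few
       where
       arith : ∀ T m → (T + m + + 8) * (T + m + + 8) + + 3 * (T + m + + 8) - + 16 ≡ T * T + + 2 * (m * T) + m * m + + 19 * T + + 19 * m + + 72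
       arith = solve-∀

     base-bad : m * m + + 2 * (m * T) + m - + 2 * T - + 2 + + 2 * G m E ≤ + 2 * bad E
     base-bad = subst (_≤ + 2 * bad E) (trans (cong (λ l → + 2 * (m * l) + + 2 * G m E + m - m * m - + 2 * l) length-E) (arith m T (G m E))) (chain-bad c)
       where
       length-E : lenᶻ E ≡ T + m + + 1
       length-E = (lia ((lenᶻ E) & m & []) ([]) (#0 == #0 -' #1 -' !1 +' #1 +' !1) (tt))
       arith : ∀ m T g → + 2 * (m * (T + m + + 1)) + + 2 * g + m - m * m - + 2 * (T + m + + 1) ≡ m * m + + 2 * (m * T) + m - + 2 * T - + 2 + + 2 * g
       arith = solve-∀

     top : + 1 ≤ G m E
     top = (lia (m & (G m E) & (G (m + + 1) E) & []) (#0 +' !1 -' #0 <= #1 -' #2 & !0 <= #2 & []) (!1 <= #1) ((chain-G c (0≤max c) (lia (m & []) ([]) (#0 <= #0 +' !1) (tt)) ℤ.≤-refl) , (0≤G (m + + 1) E) , tt))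

     few₃ : m * m + + 2 * (m * T) + + 11 * m - + 11 * T - + 84 + + 4 * K ≤ T * T
     few₃ = (lia ((bad (E ++ W)) & (T * T) & (m * T) & (m * m) & (T) & m & (G m E) & (bad E) & (cross E W) & (bad W) & (sumBy (beforeRun m) W) & (K) & []) (+ 4 *' #0 +' !16 <= #1 +' + 2 *' #2 +' #3 +' + 19 *' #4 +' + 19 *' #5 +' !72 & #3 +' + 2 *' #2 +' #5 -' + 2 *' #4 -' !2 +' + 2 *' #6 <= + 2 *' #7 & !1 <= #6 & #0 == #7 +' #8 +' #9 & + 3 *' #4 +' #10 <= #8 & #9 +' #10 == + 7 *' #5 -' !7 +' #11 & []) (#3 +' + 2 *' #2 +' + 11 *' #5 -' + 11 *' #4 -' !84 +' + 4 *' #11 <= #1) (few′ , base-bad , top , (bad-++ E W) , (cross₃ three) , beforeRun-sum , tt))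

     few₄ : (∀ u → + 0 ≤ u → u ≤ m → + 4 - (m ≤χ u) ≤ sumBy (bd u) W) →
       m * m + + 2 * (m * T) + + 11 * m - + 7 * T - + 84 + + 4 * K ≤ T * T
     few₄ four = (lia ((bad (E ++ W)) & (T * T) & (m * T) & (m * m) & (T) & m & (G m E) & (bad E) & (cross E W) & (bad W) & (sumBy (beforeRun m) W) & (K) & []) (+ 4 *' #0 +' !16 <= #1 +' + 2 *' #2 +' #3 +' + 19 *' #4 +' + 19 *' #5 +' !72 & #3 +' + 2 *' #2 +' #5 -' + 2 *' #4 -' !2 +' + 2 *' #6 <= + 2 *' #7 & #0 == #7 +' #8 +' #9 & + 4 *' #4 +' !1 -' #6 +' #10 <= #8 & #9 +' #10 == + 7 *' #5 -' !7 +' #11 & []) (#3 +' + 2 *' #2 +' + 11 *' #5 -' + 7 *' #4 -' !84 +' + 4 *' #11 <= #1) (few′ , base-bad , (bad-++ E W) , (cross₄ four) , beforeRun-sum , tt))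

     0≤m = 0≤max c

     -- T (2 m + 8 - d - T) is nonnegative.
     slack : ∀ d → d ≤ D → T * T + d * T ≤ + 2 * (m * T) + + 8 * T
     slack d h = subst₂ _≤_ (arith₁ T d) (arith₂ T m) (ℤ.*-monoˡ-≤-nonNeg T {{Data.Integer.Base.nonNegative 0≤T}}
       (lia ((T) & (D) & m & d & []) (#0 +' #1 <= + 2 *' #2 +' !8 & #3 <= #1 & []) (#0 +' #3 <= + 2 *' #2 +' !8) (deficit-bound , h , tt)))
       where
       arith₁ : ∀ T d → T * (T + d) ≡ T * T + d * T
       arith₁ = solve-∀
       arith₂ : ∀ T m → T * (+ 2 * m + + 8) ≡ + 2 * (m * T) + + 8 * T
       arith₂ = solve-∀

     square-above : ∀ k → (k + k + + 1) * m ≤ m * m + (k * k + k)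
     square-above k with split m k
     ... | inl h = subst₂ _≤_ (ℤ.+-identityˡ _) (arith m k) (ℤ.+-monoˡ-≤ ((k + k + + 1) * m) (ℤ.≤-trans (ℤ.≤-reflexive (sym (ℤ.*-zeroʳ (k - m))))
         (ℤ.*-monoˡ-≤-nonNeg (k - m) {{Data.Integer.Base.nonNegative (lia (m & k & []) (#0 <= #1 & []) (!0 <= #1 -' #0) (h , tt))}} (lia (m & k & []) (#0 <= #1 & []) (!0 <= #1 +' !1 -' #0) (h , tt)))))
       where
       arith : ∀ m k → (k - m) * (k + + 1 - m) + (k + k + + 1) * m ≡ m * m + (k * k + k)
       arith = solve-∀
     ... | inr h = subst₂ _≤_ (ℤ.+-identityˡ _) (arith m k) (ℤ.+-monoˡ-≤ ((k + k + + 1) * m) (ℤ.≤-trans (ℤ.≤-reflexive (sym (ℤ.*-zeroʳ (m - k))))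
         (ℤ.*-monoˡ-≤-nonNeg (m - k) {{Data.Integer.Base.nonNegative (lia (k & m & []) (#0 +' !1 <= #1 & []) (!0 <= #1 -' #0) (h , tt))}} (lia (k & m & []) (#0 +' !1 <= #1 & []) (!0 <= #1 -' (#0 +' !1)) (h , tt)))))
       where
       arith : ∀ m k → (m - k) * (m - (k + + 1)) + (k + k + + 1) * m ≡ m * m + (k * k + k)
       arith = solve-∀

     dense : (+ 11 ≤ D × + 17 ≤ K) ⊎ (+ 12 ≤ D × + 15 ≤ K) ⊎ (+ 14 ≤ D × + 11 ≤ K) → + 1 ≤ + 0
     dense (inl (d , k)) = (lia ((m * m) & (m * T) & m & (T) & (K) & (T * T) & (D) & []) (#0 +' + 2 *' #1 +' + 11 *' #2 -' + 11 *' #3 -' !84 +' + 4 *' #4 <= #5 & #3 +' #6 <= + 2 *' #2 +' !8 & !0 <= #3 & !0 <= #2 & !11 <= #6 & !17 <= #4 & #5 +' + 11 *' #3 <= + 2 *' #1 +' + 8 *' #3 & + 5 *' #2 <= #0 +' !6 & []) (!1 <= !0) (few₃ , deficit-bound , 0≤T , 0≤m , d , k , (slack (+ 11) d) , (square-above (+ 2)) , tt))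
     dense (inr (inl (d , k))) = (lia ((m * m) & (m * T) & m & (T) & (K) & (T * T) & (D) & []) (#0 +' + 2 *' #1 +' + 11 *' #2 -' + 11 *' #3 -' !84 +' + 4 *' #4 <= #5 & #3 +' #6 <= + 2 *' #2 +' !8 & !0 <= #3 & !0 <= #2 & !12 <= #6 & !15 <= #4 & #5 +' + 12 *' #3 <= + 2 *' #1 +' + 8 *' #3 & + 3 *' #2 <= #0 +' !2 & []) (!1 <= !0) (few₃ , deficit-bound , 0≤T , 0≤m , d , k , (slack (+ 12) d) , (square-above (+ 1)) , tt))
     dense (inr (inr (d , k))) = (lia ((m * m) & (m * T) & m & (T) & (K) & (T * T) & (D) & []) (#0 +' + 2 *' #1 +' + 11 *' #2 -' + 11 *' #3 -' !84 +' + 4 *' #4 <= #5 & #3 +' #6 <= + 2 *' #2 +' !8 & !0 <= #3 & !0 <= #2 & !14 <= #6 & !11 <= #4 & #5 +' + 14 *' #3 <= + 2 *' #1 +' + 8 *' #3 & + 5 *' #2 <= #0 +' !6 & []) (!1 <= !0) (few₃ , deficit-bound , 0≤T , 0≤m , d , k , (slack (+ 14) d) , (square-above (+ 2)) , tt))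

     thin : (∀ u → + 0 ≤ u → u ≤ m → + 4 - (m ≤χ u) ≤ sumBy (bd u) W) →
       (+ 7 ≤ D × + 25 ≤ K) ⊎ (+ 8 ≤ D × + 22 ≤ K) ⊎ (+ 10 ≤ D × + 19 ≤ K) → + 1 ≤ + 0
     thin four (inl (d , k)) = (lia ((m * m) & (m * T) & m & (T) & (K) & (T * T) & (D) & []) (#0 +' + 2 *' #1 +' + 11 *' #2 -' + 7 *' #3 -' !84 +' + 4 *' #4 <= #5 & #3 +' #6 <= + 2 *' #2 +' !8 & !0 <= #3 & !0 <= #2 & !7 <= #6 & !25 <= #4 & #5 +' + 7 *' #3 <= + 2 *' #1 +' + 8 *' #3 & + 5 *' #2 <= #0 +' !6 & []) (!1 <= !0) ((few₄ four) , deficit-bound , 0≤T , 0≤m , d , k , (slack (+ 7) d) , (square-above (+ 2)) , tt))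
     thin four (inr (inl (d , k))) = (lia ((m * m) & (m * T) & m & (T) & (K) & (T * T) & (D) & []) (#0 +' + 2 *' #1 +' + 11 *' #2 -' + 7 *' #3 -' !84 +' + 4 *' #4 <= #5 & #3 +' #6 <= + 2 *' #2 +' !8 & !0 <= #3 & !0 <= #2 & !8 <= #6 & !22 <= #4 & #5 +' + 8 *' #3 <= + 2 *' #1 +' + 8 *' #3 & + 3 *' #2 <= #0 +' !2 & []) (!1 <= !0) ((few₄ four) , deficit-bound , 0≤T , 0≤m , d , k , (slack (+ 8) d) , (square-above (+ 1)) , tt))
     thin four (inr (inr (d , k))) = (lia ((m * m) & (m * T) & m & (T) & (K) & (T * T) & (D) & []) (#0 +' + 2 *' #1 +' + 11 *' #2 -' + 7 *' #3 -' !84 +' + 4 *' #4 <= #5 & #3 +' #6 <= + 2 *' #2 +' !8 & !0 <= #3 & !0 <= #2 & !10 <= #6 & !19 <= #4 & #5 +' + 10 *' #3 <= + 2 *' #1 +' + 8 *' #3 & + 1 *' #2 <= #0 +' !0 & []) (!1 <= !0) ((few₄ four) , deficit-bound , 0≤T , 0≤m , d , k , (slack (+ 10) d) , (square-above (+ 0)) , tt))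

 level-sum : ∀ m v → v ≤ m - + 1 + + 5 →
   (v + -[1+ 1 ] ≤χ m - + 1) + ((v + -[1+ 2 ] ≤χ m - + 1) + ((v + -[1+ 3 ] ≤χ m - + 1) + ((v + + 1 ≤χ m - + 1) + ((v + + 2 ≤χ m - + 1) + + 0))))
     ≤ (m ≤χ v) + (m + + 1 ≤χ v) + (m - + 1 - v) + + 3
 level-sum m v h = (lia (v & m & []) (#0 <= #1 -' !1 +' !5 & []) ((#0 +' !-2 <=? #1 -' !1) +' ((#0 +' !-3 <=? #1 -' !1) +' ((#0 +' !-4 <=? #1 -' !1) +' ((#0 +' !1 <=? #1 -' !1) +' ((#0 +' !2 <=? #1 -' !1) +' !0)))) <= (#1 <=? #0) +' (#1 +' !1 <=? #0) +' (#1 -' !1 -' #0) +' !3) (h , tt))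

 top-sum : ∀ m v → (m - + 1 + + 1 ≤χ v) + ((m - + 1 + + 2 ≤χ v) + + 0) ≤ (m ≤χ v) + (m + + 1 ≤χ v)
 top-sum m v = (lia (m & v & []) ([]) ((#0 -' !1 +' !1 <=? #1) +' ((#0 -' !1 +' !2 <=? #1) +' !0) <= (#0 <=? #1) +' (#0 +' !1 <=? #1)) (tt))

 module Scattered {E : List ℤ} {m : ℤ} (c : Chain E m) (x₀ x₁ x₂ x₃ x₄ x₅ x₆ : ℤ) where

   W : List ℤ
   W = x₀ ∷ x₁ ∷ x₂ ∷ x₃ ∷ x₄ ∷ x₅ ∷ x₆ ∷ []

   at : ℤ → Vec ℤ 8
   at u = x₀ ∷ x₁ ∷ x₂ ∷ x₃ ∷ x₄ ∷ x₅ ∷ x₆ ∷ u ∷ []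

   ρ = at (m - + 1)

   module _ (nn : All (+ 0 ≤_) W) (bounded : ∀ i → lookup ρ i ≤ m - + 1 + + 5)
            (low : LowDeficit (E ++ W)) (few : FewBad (+ 4) (E ++ W)) (sc : prop (scattered ix8) ρ) where

     open Window c W refl nn

     three : ∀ u → + 0 ≤ u → u ≤ m → + 3 ≤ sumBy (bd u) W
     three u _ _ with decideForm (atLeast (+ 3) (pairAtoms 7F ix8)) (at u)
     ... | yes h = subst (+ 3 ≤_) (pairAtoms-sum (at u) 7F ix8) h
     ... | no ¬h = ⊥-elim (sc (prove threeForm three-valid (at u) ¬h))

     four : prop sparse ρ → ∀ u → + 0 ≤ u → u ≤ m → + 4 - (m ≤χ u) ≤ sumBy (bd u) W
     four sp u p q with decideForm (atLeast (+ 4) (pairAtoms 8F ix9)) (x₀ ∷ x₁ ∷ x₂ ∷ x₃ ∷ x₄ ∷ x₅ ∷ x₆ ∷ (m - + 1) ∷ u ∷ []) | split m u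
     ... | yes h | _ = (lia ((sumBy (bd u) W) & m & u & []) (!4 <= #0 & []) (!4 -' (#1 <=? #2) <= #0) ((subst (+ 4 ≤_) (pairAtoms-sum (x₀ ∷ x₁ ∷ x₂ ∷ x₃ ∷ x₄ ∷ x₅ ∷ x₆ ∷ (m - + 1) ∷ u ∷ []) 8F ix9) h) , tt))
     ... | no ¬h | inl k = (lia ((sumBy (bd u) W) & m & u & []) (!3 <= #0 & #1 <= #2 & []) (!4 -' (#1 <=? #2) <= #0) ((three u p q) , k , tt))
     ... | no ¬h | inr k = ⊥-elim (prove fourForm four-valid (x₀ ∷ x₁ ∷ x₂ ∷ x₃ ∷ x₄ ∷ x₅ ∷ x₆ ∷ (m - + 1) ∷ u ∷ []) (¬h , (lia (u & m & []) (#0 +' !1 <= #1 & []) (#0 +' !0 <= #1 -' !1) (k , tt))) sp)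

     bound-D : ∀ d → d + + 21 ≤ sumχ dAtoms ρ → d ≤ bad W + sumBy (λ v → (m ≤χ v) + (m + + 1 ≤χ v) + (m - + 1 - v)) W
     bound-D d h = (lia (d & (sumχ dAtoms ρ) & (sumχ (badAtoms ix8) ρ) & (sumχ (eachAtom levels ix8) ρ) & (bad W) & (sumBy g W) & (sumBy f W) & []) (#0 +' !21 <= #1 & #1 == #2 +' #3 & #2 == #4 & #3 <= #5 & #5 == #6 +' !21 & []) (#0 <= #4 +' #6) (h , (sumχ-++ (badAtoms ix8) (eachAtom levels ix8) ρ) , (badAtoms-sum ρ ix8) , (eachAtom-≥ ρ levels g (λ i → level-sum m (lookup ρ i) (bounded i)) ix8) , (sumBy-+ f (λ _ → + 3) W) , tt))
       where
       f g : ℤ → ℤ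
       f v = (m ≤χ v) + (m + + 1 ≤χ v) + (m - + 1 - v)
       g v = f v + + 3

     bound-K : ∀ k → k ≤ sumχ kAtoms ρ → k ≤ K
     bound-K k h = (lia (k & (sumχ kAtoms ρ) & (sumχ (badAtoms ix8) ρ) & (sumχ (eachAtom tops ix8) ρ) & (bad W) & (sumBy f W) & []) (#0 <= #1 & #1 == #2 +' #3 & #2 == #4 & #3 <= #5 & []) (#0 <= #4 +' #5) (h , (sumχ-++ (badAtoms ix8) (eachAtom tops ix8) ρ) , (badAtoms-sum ρ ix8) , (eachAtom-≥ ρ tops f (λ i → top-sum m (lookup ρ i)) ix8) , tt))
       where
       f : ℤ → ℤ
       f v = (m ≤χ v) + (m + + 1 ≤χ v)

     impossible : prop bounds ρ → + 1 ≤ + 0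
     impossible (inl (d , k)) = dense three low few (inl (bound-D (+ 11) d , bound-K (+ 17) k))
     impossible (inr (inl (d , k))) = dense three low few (inr (inl (bound-D (+ 12) d , bound-K (+ 15) k)))
     impossible (inr (inr (inl (d , k)))) = dense three low few (inr (inr (bound-D (+ 14) d , bound-K (+ 11) k)))
     impossible (inr (inr (inr (sp , inl (d , k))))) = thin three low few (four sp) (inl (bound-D (+ 7) d , bound-K (+ 25) k))
     impossible (inr (inr (inr (sp , inr (inl (d , k)))))) = thin three low few (four sp) (inr (inl (bound-D (+ 8) d , bound-K (+ 22) k)))
     impossible (inr (inr (inr (sp , inr (inr (d , k)))))) = thin three low few (four sp) (inr (inr (bound-D (+ 10) d , bound-K (+ 19) k)))

   Left Right Crowded : Set
   Left    = prop (leftShape ix7 and leftStuck ix7) (x₀ ∷ x₁ ∷ x₂ ∷ x₃ ∷ x₄ ∷ x₅ ∷ x₆ ∷ [])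
   Right   = prop (rightShape ix7 and rightStuck ix7) (x₀ ∷ x₁ ∷ x₂ ∷ x₃ ∷ x₄ ∷ x₅ ∷ x₆ ∷ [])
   Crowded = prop (concentrated ix7) (x₀ ∷ x₁ ∷ x₂ ∷ x₃ ∷ x₄ ∷ x₅ ∷ x₆ ∷ [])

   module _ (nn : All (+ 0 ≤_) W) (x₀≤ : x₀ ≤ m + + 1) (x₆≤ : x₆ ≤ m ⊎ x₆ ≤ x₀)
            (low : LowDeficit (E ++ W)) (few : FewBad (+ 4) (E ++ W)) where

     anchor : prop anchored ρ
     anchor = (lia (x₀ & m & []) (#0 <= #1 +' !1 & []) (#0 +' !-2 <= #1 -' !1) (x₀≤ , tt)) , last x₆≤
       where
       last : x₆ ≤ m ⊎ x₆ ≤ x₀ → prop (le 6F 7F (+ 1) or le 6F 0F (+ 0)) ρ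
       last (inl h) = inl (lia (x₆ & m & []) (#0 <= #1 & []) (#0 +' !-1 <= #1 -' !1) (h , tt))
       last (inr h) = inr (lia (x₆ & x₀ & []) (#0 <= #1 & []) (#0 +' !0 <= #1) (h , tt))

     x₆≤m+1 : x₆ ≤ m + + 1
     x₆≤m+1 = from x₆≤
       where
       from : x₆ ≤ m ⊎ x₆ ≤ x₀ → x₆ ≤ m + + 1
       from (inl h) = (lia (x₆ & m & []) (#0 <= #1 & []) (#0 <= #1 +' !1) (h , tt))
       from (inr h) = ℤ.≤-trans h x₀≤

     left-crowded : Left → Crowded
     left-crowded ((a , b , d , e , f) , st) with decideForm (concentrated ix8) ρ
     ... | yes h = h
     ... | no ¬h = ⊥-elim (1≰0 (impossible nn bounded low few ¬h
             (prove leftForm leftForm-valid ρ (anchor , (a , b , d , e , f) , st , ¬h))))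
       where
       bounded : ∀ i → lookup ρ i ≤ m - + 1 + + 5
       bounded 0F = (lia (x₀ & m & []) (#0 <= #1 +' !1 & []) (#0 <= #1 -' !1 +' !5) (x₀≤ , tt))
       bounded 1F = (lia (x₀ & m & x₁ & []) (#0 <= #1 +' !1 & #2 +' !-1 <= #0 & []) (#2 <= #1 -' !1 +' !5) (x₀≤ , a , tt))
       bounded 2F = (lia (x₀ & m & x₁ & x₂ & []) (#0 <= #1 +' !1 & #2 +' !-1 <= #0 & #3 +' !-1 <= #2 & []) (#3 <= #1 -' !1 +' !5) (x₀≤ , a , b , tt))
       bounded 3F = (lia (x₀ & m & x₁ & x₂ & x₃ & []) (#0 <= #1 +' !1 & #2 +' !-1 <= #0 & #3 +' !-1 <= #2 & #4 +' !-1 <= #3 & []) (#4 <= #1 -' !1 +' !5) (x₀≤ , a , b , d , tt))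
       bounded 4F = (lia (x₆ & m & x₄ & x₅ & []) (#0 <= #1 +' !1 & #2 +' !-1 <= #3 & #3 +' !-1 <= #0 & []) (#2 <= #1 -' !1 +' !5) (x₆≤m+1 , e , f , tt))
       bounded 5F = (lia (x₆ & m & x₅ & []) (#0 <= #1 +' !1 & #2 +' !-1 <= #0 & []) (#2 <= #1 -' !1 +' !5) (x₆≤m+1 , f , tt))
       bounded 6F = (lia (x₆ & m & []) (#0 <= #1 +' !1 & []) (#0 <= #1 -' !1 +' !5) (x₆≤m+1 , tt))
       bounded 7F = (lia (m & []) ([]) (#0 -' !1 <= #0 -' !1 +' !5) (tt))

     right-crowded : Right → Crowded
     right-crowded ((a , b , d , e , f) , st) with decideForm (concentrated ix8) ρ
     ... | yes h = h
     ... | no ¬h = ⊥-elim (1≰0 (impossible nn bounded low few ¬h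
             (prove rightForm rightForm-valid ρ (anchor , (a , b , d , e , f) , st , ¬h))))
       where
       bounded : ∀ i → lookup ρ i ≤ m - + 1 + + 5
       bounded 0F = (lia (x₀ & m & []) (#0 <= #1 +' !1 & []) (#0 <= #1 -' !1 +' !5) (x₀≤ , tt))
       bounded 1F = (lia (x₀ & m & x₁ & []) (#0 <= #1 +' !1 & #2 +' !-1 <= #0 & []) (#2 <= #1 -' !1 +' !5) (x₀≤ , a , tt))
       bounded 2F = (lia (x₀ & m & x₁ & x₂ & []) (#0 <= #1 +' !1 & #2 +' !-1 <= #0 & #3 +' !-1 <= #2 & []) (#3 <= #1 -' !1 +' !5) (x₀≤ , a , b , tt))
       bounded 3F = (lia (x₆ & m & x₃ & x₄ & x₅ & []) (#0 <= #1 +' !1 & #2 +' !-1 <= #3 & #3 +' !-1 <= #4 & #4 +' !-1 <= #0 & []) (#2 <= #1 -' !1 +' !5) (x₆≤m+1 , d , e , f , tt))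
       bounded 4F = (lia (x₆ & m & x₄ & x₅ & []) (#0 <= #1 +' !1 & #2 +' !-1 <= #3 & #3 +' !-1 <= #0 & []) (#2 <= #1 -' !1 +' !5) (x₆≤m+1 , e , f , tt))
       bounded 5F = (lia (x₆ & m & x₅ & []) (#0 <= #1 +' !1 & #2 +' !-1 <= #0 & []) (#2 <= #1 -' !1 +' !5) (x₆≤m+1 , f , tt))
       bounded 6F = (lia (x₆ & m & []) (#0 <= #1 +' !1 & []) (#0 <= #1 -' !1 +' !5) (x₆≤m+1 , tt))
       bounded 7F = (lia (m & []) ([]) (#0 -' !1 <= #0 -' !1 +' !5) (tt))

module East where

 open Lia
 open Dbm using (Form; atom; atLeast; _and_; _or_; sumχ; prop; eval)
 open Win
 open Stats
 open Words using (1≰0)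
 open Moves using (if-true; if-false; +1-1)
 open import Defs hiding (maximum)
 import Defs
 open import Data.Bool.Base using (_∧_)
 open import Data.Integer.Base using (_<_; _⊔_; ∣_∣; -≤+; -≤-)
 open import Data.Integer.Properties using (≤-totalOrder)
 open import Data.List.Base using (filter; map; head)
 open import Data.List.Extrema ≤-totalOrder using (min; min≤⊤; min≤xs; v≤min⁺)
 open import Data.List.Relation.Unary.Linked using ([]; _∷_)
 open import Data.Nat.Base using (_∸_)
 open import Data.Product.Base using (_,_)
 open import Data.Sum.Base using (_⊎_)
 open import Data.Vec.Base using (lookup; removeAt)
 open import Relation.Nullary.Decidable using (dec-false; _⊎-dec_; ¬?)

 -- Two entries at distance at least 2 are not both in {k - 1, k}.
 near : ℤ → ℤ → ℤ
 near k v = χ (does (v + + 0 ≤? k) ∧ does (k + -[1+ 0 ] ≤? v))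

 χ-∧ : ∀ b c → (χ (b ∧ c) ≤ χ b) × (χ (b ∧ c) ≤ χ c) × (χ b + χ c - + 1 ≤ χ (b ∧ c))
 χ-∧ true  true  = ℤ.≤-refl , ℤ.≤-refl , ℤ.≤-refl
 χ-∧ true  false = +≤+ ℕ.z≤n , ℤ.≤-refl , ℤ.≤-refl
 χ-∧ false true  = ℤ.≤-refl , +≤+ ℕ.z≤n , ℤ.≤-refl
 χ-∧ false false = ℤ.≤-refl , ℤ.≤-refl , -≤+

 near-bounds : ∀ k v → (near k v ≤ (v + + 0 ≤χ k)) × (near k v ≤ (k + -[1+ 0 ] ≤χ v)) × ((v + + 0 ≤χ k) + (k + -[1+ 0 ] ≤χ v) - + 1 ≤ near k v)
 near-bounds k v = χ-∧ (does (v + + 0 ≤? k)) (does (k + -[1+ 0 ] ≤? v))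

 near-self : ∀ k → near k k ≡ + 1
 near-self k with near-bounds k k
 ... | p , _ , r = (lia ((near k k) & k & []) (#0 <= (#1 +' !0 <=? #1) & (#1 +' !0 <=? #1) +' (#1 +' !-1 <=? #1) -' !1 <= #0 & []) (#0 == !1) (p , r , tt))

 far-cases : ∀ z → 2 ℕ.≤ ∣ z ∣ → + 2 ≤ z ⊎ z ≤ -[1+ 1 ]
 far-cases (+ n)      h         = inl (+≤+ h)
 far-cases -[1+ suc n ] (ℕ.s≤s h) = inr (-≤- (ℕ.s≤s ℕ.z≤n))
 far-cases -[1+ 0 ] (ℕ.s≤s ())

 near-far : ∀ k a b → 2 ℕ.≤ ∣ a - b ∣ → near k a + near k b ≤ + 1
 near-far k a b h = conclude (far-cases (a - b) h) (near-bounds k a) (near-bounds k b)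
   where
   conclude : + 2 ≤ a - b ⊎ a - b ≤ -[1+ 1 ] → (near k a ≤ (a + + 0 ≤χ k)) × (near k a ≤ (k + -[1+ 0 ] ≤χ a)) × _ →
     (near k b ≤ (b + + 0 ≤χ k)) × (near k b ≤ (k + -[1+ 0 ] ≤χ b)) × _ → near k a + near k b ≤ + 1
   conclude (inl l) (p , p′ , _) (q , q′ , _) = (lia ((near k a) & a & k & (near k b) & b & []) (#0 <= (#1 +' !0 <=? #2) & #0 <= (#2 +' !-1 <=? #1) & #3 <= (#4 +' !0 <=? #2) & #3 <= (#2 +' !-1 <=? #4) & !2 <= #1 -' #4 & []) (#0 +' #3 <= !1) (p , p′ , q , q′ , l , tt))
   conclude (inr l) (p , p′ , _) (q , q′ , _) = (lia ((near k a) & a & k & (near k b) & b & []) (#0 <= (#1 +' !0 <=? #2) & #0 <= (#2 +' !-1 <=? #1) & #3 <= (#4 +' !0 <=? #2) & #3 <= (#2 +' !-1 <=? #4) & #1 -' #4 <= !-2 & []) (#0 +' #3 <= !1) (p , p′ , q , q′ , l , tt))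

 nearby : ∀ {n} → ℤ → Vec ℤ n → ℤ
 nearby k []       = + 0
 nearby k (v ∷ vs) = near k v + nearby k vs

 nearby-removeAt : ∀ {n} k (vs : Vec ℤ (suc n)) i → nearby k vs ≡ near k (lookup vs i) + nearby k (removeAt vs i)
 nearby-removeAt k (v ∷ vs)     zero    = refl
 nearby-removeAt k (v ∷ u ∷ vs) (suc i) =
   (lia ((nearby k (u ∷ vs)) & (near k (lookup (u ∷ vs) i)) & (nearby k (removeAt (u ∷ vs) i)) & (near k v) & []) (#0 == #1 +' #2 & []) (#3 +' #0 == #1 +' (#3 +' #2)) ((nearby-removeAt k (u ∷ vs) i) , tt))

 pairs-nearby : ∀ k m vs → FarApartPairs m vs → nearby k vs ≤ + m
 pairs-nearby k zero    []       _           = ℤ.≤-refl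
 pairs-nearby k (suc m) (v ∷ vs) (j , far , p) =
   (lia ((near k v) & (near k (lookup vs j)) & (nearby k (removeAt vs j)) & (+ m) & (nearby k vs) & []) (#0 +' #1 <= !1 & #2 <= #3 & #4 == #1 +' #2 & []) (#0 +' #4 <= !1 +' #3) ((near-far k v (lookup vs j) far) , (pairs-nearby k m (removeAt vs j) p) , (nearby-removeAt k vs j) , tt))

 near≤1 : ∀ k v → near k v ≤ + 1
 near≤1 k v with near-bounds k v
 ... | p , _ = (lia ((near k v) & v & k & []) (#0 <= (#1 +' !0 <=? #2) & []) (#0 <= !1) (p , tt))

 decomposable-nearby : ∀ k x → FarApartDecomposable x → nearby k x ≤ + 4
 decomposable-nearby k x (i , p) =
   (lia ((nearby k x) & (near k (lookup x i)) & (nearby k (removeAt x i)) & []) (#0 == #1 +' #2 & #1 <= !1 & #2 <= !3 & []) (#0 <= !4) ((nearby-removeAt k x i) , (near≤1 k (lookup x i)) , (pairs-nearby k 3 (removeAt x i) p) , tt))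

 module _ (a b c d e f g : ℤ) where

   private
     x : Vec ℤ 7
     x = a ∷ b ∷ c ∷ d ∷ e ∷ f ∷ g ∷ []

   crowded⇒nearby : prop (concentrated ix7) x → ∃[ k ] (+ 5 ≤ nearby k x)
   crowded⇒nearby p = go p
     where
     go : prop (concentrated ix7) x → ∃[ k ] (+ 5 ≤ nearby k x)
     go (inl h) = a , (lia ((near a b) & (near a c) & (near a d) & (near a e) & (near a f) & (near a g) & (near a a) & []) (!4 <= #0 +' (#1 +' (#2 +' (#3 +' (#4 +' (#5 +' !0))))) & #6 == !1 & []) (!5 <= #6 +' (#0 +' (#1 +' (#2 +' (#3 +' (#4 +' (#5 +' !0))))))) (h , (near-self a) , tt))
     go (inr (inl h)) = b , (lia ((near b a) & (near b c) & (near b d) & (near b e) & (near b f) & (near b g) & (near b b) & []) (!4 <= #0 +' (#1 +' (#2 +' (#3 +' (#4 +' (#5 +' !0))))) & #6 == !1 & []) (!5 <= #0 +' (#6 +' (#1 +' (#2 +' (#3 +' (#4 +' (#5 +' !0))))))) (h , (near-self b) , tt))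
     go (inr (inr (inl h))) = c , (lia ((near c a) & (near c b) & (near c d) & (near c e) & (near c f) & (near c g) & (near c c) & []) (!4 <= #0 +' (#1 +' (#2 +' (#3 +' (#4 +' (#5 +' !0))))) & #6 == !1 & []) (!5 <= #0 +' (#1 +' (#6 +' (#2 +' (#3 +' (#4 +' (#5 +' !0))))))) (h , (near-self c) , tt))
     go (inr (inr (inr (inl h)))) = d , (lia ((near d a) & (near d b) & (near d c) & (near d e) & (near d f) & (near d g) & (near d d) & []) (!4 <= #0 +' (#1 +' (#2 +' (#3 +' (#4 +' (#5 +' !0))))) & #6 == !1 & []) (!5 <= #0 +' (#1 +' (#2 +' (#6 +' (#3 +' (#4 +' (#5 +' !0))))))) (h , (near-self d) , tt))
     go (inr (inr (inr (inr (inl h))))) = e , (lia ((near e a) & (near e b) & (near e c) & (near e d) & (near e f) & (near e g) & (near e e) & []) (!4 <= #0 +' (#1 +' (#2 +' (#3 +' (#4 +' (#5 +' !0))))) & #6 == !1 & []) (!5 <= #0 +' (#1 +' (#2 +' (#3 +' (#6 +' (#4 +' (#5 +' !0))))))) (h , (near-self e) , tt))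
     go (inr (inr (inr (inr (inr (inl h)))))) = f , (lia ((near f a) & (near f b) & (near f c) & (near f d) & (near f e) & (near f g) & (near f f) & []) (!4 <= #0 +' (#1 +' (#2 +' (#3 +' (#4 +' (#5 +' !0))))) & #6 == !1 & []) (!5 <= #0 +' (#1 +' (#2 +' (#3 +' (#4 +' (#6 +' (#5 +' !0))))))) (h , (near-self f) , tt))
     go (inr (inr (inr (inr (inr (inr (inl h))))))) = g , (lia ((near g a) & (near g b) & (near g c) & (near g d) & (near g e) & (near g f) & (near g g) & []) (!4 <= #0 +' (#1 +' (#2 +' (#3 +' (#4 +' (#5 +' !0))))) & #6 == !1 & []) (!5 <= #0 +' (#1 +' (#2 +' (#3 +' (#4 +' (#5 +' (#6 +' !0))))))) (h , (near-self g) , tt))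

 abs-shift : ∀ {v m} → m ≤ v → + ∣ v - m ∣ + m ≡ v
 abs-shift {v} {m} h = trans (cong (_+ m) (ℤ.0≤i⇒+∣i∣≡i (lia (m & v & []) (#0 <= #1 & []) (!0 <= #1 -' #0) (h , tt)))) (lia (v & m & []) ([]) (#0 -' #1 +' #1 == #0) (tt))

 module _ (reinsert : ℕ → List ℕ → List ℕ → List ℕ) where

   -- No letter of a word over two consecutive letters is moved.
   translated-near : ∀ lo x → All (λ v → lo ≤ v × v ≤ lo + + 1) x → translated (λ y → rebuild reinsert (Defs.maximum y ∸ 1) y) x ≡ x
   translated-near lo []         _ = refl
   translated-near lo x@(a ∷ as) h =
     trans (cong (λ k → map (λ b → + b + m) (rebuild reinsert k w)) (ℕ.m≤n⇒m∸n≡0 (small x h)))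
       (trans (sym (List.map-∘ x)) (restore x (min≤⊤ a as ∷ min≤xs a as)))
     where
     m = min a as
     w = map (λ b → ∣ b - m ∣) x
     lo≤m : lo ≤ m
     lo≤m = v≤min⁺ (fst (All.head h)) (All.map fst (All.tail h))
     m≤hi : m ≤ lo + + 1
     m≤hi = ℤ.≤-trans (min≤⊤ a as) (snd (All.head h))
     small : ∀ y → All (λ v → lo ≤ v × v ≤ lo + + 1) y → Defs.maximum (map (λ b → ∣ b - m ∣) y) ℕ.≤ 1
     small []      []              = ℕ.z≤n
     small (v ∷ y) ((p , q) ∷ h) = ℕ.⊔-lub (abs≤1 (v - m) (lia (lo & (m) & v & []) (#0 <= #1 & #2 <= #0 +' !1 & []) (#2 -' #1 <= !1) (lo≤m , q , tt)) (lia ((m) & lo & v & []) (#0 <= #1 +' !1 & #1 <= #2 & []) (!-1 <= #2 -' #0) (m≤hi , p , tt))) (small y h)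
       where
       abs≤1 : ∀ z → z ≤ + 1 → -[1+ 0 ] ≤ z → ∣ z ∣ ℕ.≤ 1
       abs≤1 (+ n)    (+≤+ p) _       = p
       abs≤1 -[1+ n ] _       (-≤- p) = ℕ.s≤s p
     restore : ∀ y → All (m ≤_) y → map (λ v → + ∣ v - m ∣ + m) y ≡ y
     restore []      []      = refl
     restore (v ∷ y) (h ∷ hs) = cong₂ _∷_ (abs-shift h) (restore y hs)

   rebuild-zero : (∀ k z → reinsert k [] z ≡ z) → ∀ j → rebuild reinsert j (0 ∷ []) ≡ 0 ∷ []
   rebuild-zero h zero    = refl
   rebuild-zero h (suc j) = trans (h (suc j) _) (rebuild-zero h j)

   -- The word contains 0 and 2 + j.
   rebuild-two : (∀ k z → reinsert k [] z ≡ z) → ∀ j y → restrict (suc j) y ≡ suc (suc j) ∷ [] →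
     filter (λ a → ¬? (a ℕ.≟ suc (suc j))) y ≡ 0 ∷ [] → rebuild reinsert (suc j) y ≡ reinsert (suc j) (0 ∷ []) (0 ∷ [])
   rebuild-two h j y eq₁ eq₂ = cong₂ (reinsert (suc j))
     (trans (cong (ranks (suc j)) eq₁) (if-false (dec-false (suc (suc j) ℕ.≟ suc j) (ℕ.<⇒≢ (ℕ.n<1+n (suc j)) ∘ sym))))
     (trans (cong (rebuild reinsert j) eq₂) (rebuild-zero h j))
     where open import Function.Base using (_∘_)

 top-only : ∀ j → restrict (suc j) (suc (suc j) ∷ 0 ∷ []) ≡ suc (suc j) ∷ [] × restrict (suc j) (0 ∷ suc (suc j) ∷ []) ≡ suc (suc j) ∷ []
 top-only j = List.filter-accept (λ a → (a ℕ.≟ suc j) ⊎-dec (a ℕ.≟ suc (suc j))) (inr refl) ,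
              List.filter-accept (λ a → (a ℕ.≟ suc j) ⊎-dec (a ℕ.≟ suc (suc j))) {xs = []} (inr refl)

 zero-only : ∀ j → filter (λ a → ¬? (a ℕ.≟ suc (suc j))) (suc (suc j) ∷ 0 ∷ []) ≡ 0 ∷ [] ×
   filter (λ a → ¬? (a ℕ.≟ suc (suc j))) (0 ∷ suc (suc j) ∷ []) ≡ 0 ∷ []
 zero-only j = List.filter-reject (λ a → ¬? (a ℕ.≟ suc (suc j))) (λ ne → ne refl) ,
               cong (0 ∷_) (List.filter-reject (λ a → ¬? (a ℕ.≟ suc (suc j))) {xs = []} (λ ne → ne refl))

 difference : ∀ {a b} → b + + 2 ≤ a → ∃[ j ] (∣ a - b ∣ ≡ suc (suc j))
 difference {a} {b} h with ∣ a - b ∣ | ℤ.0≤i⇒+∣i∣≡i {a - b} (lia (b & a & []) (#0 +' !2 <= #1 & []) (!0 <= #1 -' #0) (h , tt))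
 ... | zero        | eq = ⊥-elim (1≰0 (lia (a & b & []) (!0 == #0 -' #1 & #1 +' !2 <= #0 & []) (!1 <= !0) (eq , h , tt)))
 ... | suc zero    | eq = ⊥-elim (1≰0 (lia (a & b & []) (!1 == #0 -' #1 & #1 +' !2 <= #0 & []) (!1 <= !0) (eq , h , tt)))
 ... | suc (suc j) | eq = j , refl

 abs-self : ∀ b → ∣ b - b ∣ ≡ 0
 abs-self b = cong ∣_∣ (ℤ.+-inverseʳ b)

 bk-swap : ∀ {a b} → b + + 2 ≤ a → bk (a ∷ b ∷ []) ≡ b ∷ a ∷ []
 bk-swap {a} {b} h with difference h
 ... | j , eq = trans (cong word (ℤ.≤-antisym (All.head (min≤xs a (b ∷ []))) (v≤min⁺ (lia (b & a & []) (#0 +' !2 <= #1 & []) (#0 <= #1) (h , tt)) (ℤ.≤-refl ∷ []))))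
     (trans (cong₂ (λ p q → map (λ v → + v + b) (back (p ∷ q ∷ []))) eq (abs-self b))
     (trans (cong (map (λ v → + v + b)) (rebuild-two (λ k rs z → Data.List.Base.foldr (insertRightmost k) z rs) (λ _ _ → refl) j (suc (suc j) ∷ 0 ∷ []) (fst (top-only j)) (fst (zero-only j))))
     (cong₂ (λ u v → u ∷ v ∷ []) (ℤ.+-identityˡ b) (trans (cong (λ n → + n + b) (sym eq)) (abs-shift (lia (b & a & []) (#0 +' !2 <= #1 & []) (#0 <= #1) (h , tt)))))))
   where
   back : List ℕ → List ℕ
   back y = rebuild (λ k rs z → Data.List.Base.foldr (insertRightmost k) z rs) (Defs.maximum y ∸ 1) y
   word : ℤ → List ℤ
   word m = map (λ v → + v + m) (back (map (λ v → ∣ v - m ∣) (a ∷ b ∷ [])))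

 fw-swap : ∀ {a b} → a + + 2 ≤ b → fw (a ∷ b ∷ []) ≡ b ∷ a ∷ []
 fw-swap {a} {b} h with difference h
 ... | j , eq = trans (cong word (ℤ.≤-antisym (min≤⊤ a (b ∷ [])) (v≤min⁺ ℤ.≤-refl ((lia (a & b & []) (#0 +' !2 <= #1 & []) (#0 <= #1) (h , tt)) ∷ []))))
     (trans (cong₂ (λ p q → map (λ v → + v + a) (forth (p ∷ q ∷ []))) (abs-self a) eq)
     (trans (cong (map (λ v → + v + a)) (rebuild-two (λ k rs z → Data.List.Base.foldl (insertLeftmost k) z rs) (λ _ _ → refl) j (0 ∷ suc (suc j) ∷ []) (snd (top-only j)) (snd (zero-only j))))
     (cong₂ (λ u v → u ∷ v ∷ []) (trans (cong (λ n → + n + a) (sym eq)) (abs-shift (lia (a & b & []) (#0 +' !2 <= #1 & []) (#0 <= #1) (h , tt)))) (ℤ.+-identityˡ a))))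
   where
   forth : List ℕ → List ℕ
   forth y = rebuild (λ k rs z → Data.List.Base.foldl (insertLeftmost k) z rs) (Defs.maximum y ∸ 1) y
   word : ℤ → List ℤ
   word m = map (λ v → + v + m) (forth (map (λ v → ∣ v - m ∣) (a ∷ b ∷ [])))

 two-near : ∀ {a b} → a ≤ b + + 1 → b ≤ a + + 1 → ∃[ lo ] All (λ v → lo ≤ v × v ≤ lo + + 1) (a ∷ b ∷ [])
 two-near {a} {b} h k with split a b
 ... | inl l = a , (ℤ.≤-refl , (lia (a & []) ([]) (#0 <= #0 +' !1) (tt))) ∷ (l , k) ∷ []
 ... | inr l = b , ((lia (b & a & []) (#0 +' !1 <= #1 & []) (#0 <= #1) (l , tt)) , h) ∷ (ℤ.≤-refl , (lia (b & []) ([]) (#0 <= #0 +' !1) (tt))) ∷ []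

 bk-keep : ∀ {a b} → a ≤ b + + 1 → b ≤ a + + 1 → bk (a ∷ b ∷ []) ≡ a ∷ b ∷ []
 bk-keep h k with two-near h k
 ... | lo , p = translated-near (λ k rs z → Data.List.Base.foldr (insertRightmost k) z rs) lo _ p

 fw-keep : ∀ {a b} → a ≤ b + + 1 → b ≤ a + + 1 → fw (a ∷ b ∷ []) ≡ a ∷ b ∷ []
 fw-keep h k with two-near h k
 ... | lo , p = translated-near (λ k rs z → Data.List.Base.foldl (insertLeftmost k) z rs) lo _ p

 bk-keep₃ : ∀ {a b c} → a ≤ b + + 1 → b ≤ a + + 1 → a ≤ c + + 1 → c ≤ a + + 1 → b ≤ c + + 1 → c ≤ b + + 1 → bk (a ∷ b ∷ c ∷ []) ≡ a ∷ b ∷ c ∷ []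
 bk-keep₃ {a} {b} {c} h₁ h₂ h₃ h₄ h₅ h₆ = conclude (split a b) (split a c) (split b c)
   where
   keep : ∀ lo → lo ≤ a → a ≤ lo + + 1 → lo ≤ b → b ≤ lo + + 1 → lo ≤ c → c ≤ lo + + 1 → bk (a ∷ b ∷ c ∷ []) ≡ a ∷ b ∷ c ∷ []
   keep lo p q r s t u = translated-near (λ k rs z → Data.List.Base.foldr (insertRightmost k) z rs) lo _ ((p , q) ∷ (r , s) ∷ (t , u) ∷ [])
   self : ∀ v → v ≤ v + + 1
   self v = (lia (v & []) ([]) (#0 <= #0 +' !1) (tt))
   conclude : a ≤ b ⊎ b + + 1 ≤ a → a ≤ c ⊎ c + + 1 ≤ a → b ≤ c ⊎ c + + 1 ≤ b → bk (a ∷ b ∷ c ∷ []) ≡ a ∷ b ∷ c ∷ []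
   conclude (inl p) (inl q) _        = keep a ℤ.≤-refl (self a) p h₂ q h₄
   conclude (inr p) _        (inl r) = keep b (≤-drop p) h₁ ℤ.≤-refl (self b) r h₆
   conclude _        (inr q) (inr r) = keep c (≤-drop q) h₃ (≤-drop r) h₅ ℤ.≤-refl (self c)
   conclude (inl p) (inr q) (inl r) = ⊥-elim (1≰0 (lia (a & b & c & []) (#0 <= #1 & #2 +' !1 <= #0 & #1 <= #2 & []) (!1 <= !0) (p , q , r , tt)))
   conclude (inr p) (inl q) (inr r) = ⊥-elim (1≰0 (lia (b & a & c & []) (#0 +' !1 <= #1 & #1 <= #2 & #2 +' !1 <= #0 & []) (!1 <= !0) (p , q , r , tt)))

module Rows where

 open East
 open Lia
 open Dbm using (Form; atom; atLeast; _and_; _or_; _imp_; sumχ; prove; valid; prop; eval)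
 open Win
 open Stats
 open Words using (1≰0)
 open Moves using (if-true; if-false; +1-1)
 open import Defs hiding (maximum)
 open import Data.Integer.Base using (_<_; _⊔_; _⊓_)
 open import Data.Integer.Properties using (_<?_; ≤-totalOrder)
 open import Data.List.Base using (map)
 open import Data.List.Extrema ≤-totalOrder using (min; min≤⊤; min≤xs; v≤min⁺)
 open import Data.List.Relation.Unary.Any as Any using (Any; here; there)
 open import Data.List.Membership.Propositional using (_∈_)
 open import Data.List.Relation.Unary.Linked using ([]; _∷_)
 open import Data.Product.Base using (_,_)
 open import Data.Sum.Base using (_⊎_; [_,_]′)
 open import Data.Vec.Base using (lookup)
 open import Relation.Nullary.Decidable using (dec-true; dec-false)
 open import Relation.Nullary.Decidable using (True; toWitness)

 ≡ᵇ-refl : ∀ n → (n ℕ.≡ᵇ n) ≡ true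
 ≡ᵇ-refl zero    = refl
 ≡ᵇ-refl (suc n) = ≡ᵇ-refl n

 -- A list of the same entries, with the same number of bad pairs.
 Rearranged : List ℤ → List ℤ → Set
 Rearranged xs ys = bad ys ≡ bad xs × (∀ f → sumBy f ys ≡ sumBy f xs)

 Good : (a b c d e : ℤ) → List ℤ → Set
 Good a b c d e img = eastMiddle₃₋₄ a b c d e ≡ just img × Rearranged (five a b c d e) img

 bad-shift : ∀ t xs → bad (map (_+ t) xs) ≡ bad xs
 bad-shift t []       = refl
 bad-shift t (x ∷ xs) = cong₂ _+_ (heads xs) (bad-shift t xs)
   where
   heads : ∀ ys → sumBy (bd (x + t)) (map (_+ t) ys) ≡ sumBy (bd x) ys
   heads []       = refl
   heads (y ∷ ys) = cong₂ _+_ (lia (y & t & x & []) ([]) ((#0 +' #1 +' !2 <=? #2 +' #1) +' (#2 +' #1 +' !1 <=? #0 +' #1) == (#0 +' !2 <=? #2) +' (#2 +' !1 <=? #0)) (tt)) (heads ys)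

 shift-back : ∀ A t → A + t - t ≡ A
 shift-back A t = (lia (A & t & []) ([]) (#0 +' #1 -' #1 == #0) (tt))

 table-image : ∀ A B C D E {img} → (D ≤ E × E ≡ + 2) ⊎ (E ≤ D × D ≡ + 2) → A ≤ + 3 ⊎ B ≤ + 3 → lookupTable A B C D E ≡ just img →
   ∀ t → eastMiddle₃₋₄ (A + t) (B + t) (C + t) (D + t) (E + t) ≡ just (map (_+ t) img)
 table-image A B C D E {img} top low eq t =
   trans (if-false (dec-false (((D + t) ⊔ (E + t)) + + 1 <? (A + t) ⊓ (B + t) ⊓ (C + t)) λ h →
           1≰0 (low-case low (ℤ.i<j⇒suc[i]≤j h))))
     (trans (cong (λ s → Maybe.map (map (_+ s)) (lookupTable (A + t - s) (B + t - s) (C + t - s) (D + t - s) (E + t - s))) scale)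
       (trans (cong (λ f → Maybe.map (map (_+ t)) f) (trans cancel eq)) refl))
   where
   max≡ : (D + t) ⊔ (E + t) ≡ t + + 2
   max≡ = [ (λ { (l , refl) → trans (ℤ.i≤j⇒i⊔j≡j (ℤ.+-monoˡ-≤ t l)) (ℤ.+-comm (+ 2) t) }) , (λ { (l , refl) → trans (ℤ.i≥j⇒i⊔j≡i (ℤ.+-monoˡ-≤ t l)) (ℤ.+-comm (+ 2) t) }) ]′ top
   scale : ((D + t) ⊔ (E + t)) - + 2 ≡ t
   scale = (lia (((D + t) ⊔ (E + t)) & t & []) (#0 == #1 +' !2 & []) (#0 -' !2 == #1) (max≡ , tt))
   cancel : lookupTable (A + t - t) (B + t - t) (C + t - t) (D + t - t) (E + t - t) ≡ lookupTable A B C D E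
   cancel rewrite shift-back A t | shift-back B t | shift-back C t | shift-back D t | shift-back E t = refl
   low-case : A ≤ + 3 ⊎ B ≤ + 3 → + 1 + (((D + t) ⊔ (E + t)) + + 1) ≤ (A + t) ⊓ (B + t) ⊓ (C + t) → + 1 ≤ + 0
   low-case (inl l) h = (lia (((D + t) ⊔ (E + t)) & ((A + t) ⊓ (B + t) ⊓ (C + t)) & t & A & []) (!1 +' (#0 +' !1) <= #1 & #0 == #2 +' !2 & #3 <= !3 & #1 <= #3 +' #2 & []) (!1 <= !0) (h , max≡ , l , (ℤ.≤-trans (ℤ.i⊓j≤i ((A + t) ⊓ (B + t)) (C + t)) (ℤ.i⊓j≤i (A + t) (B + t))) , tt))
   low-case (inr l) h = (lia (((D + t) ⊔ (E + t)) & ((A + t) ⊓ (B + t) ⊓ (C + t)) & t & B & []) (!1 +' (#0 +' !1) <= #1 & #0 == #2 +' !2 & #3 <= !3 & #1 <= #3 +' #2 & []) (!1 <= !0) (h , max≡ , l , (ℤ.≤-trans (ℤ.i⊓j≤i ((A + t) ⊓ (B + t)) (C + t)) (ℤ.i⊓j≤j (A + t) (B + t))) , tt))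

 far-bad : ∀ x y → y + + 2 ≤ x → bd x y ≡ + 1
 far-bad x y h = (lia (y & x & []) (#0 +' !2 <= #1 & []) ((#0 +' !2 <=? #1) +' (#1 +' !1 <=? #0) == !1) (h , tt))

 far-bad′ : ∀ x y → y + + 2 ≤ x → bd y x ≡ + 1
 far-bad′ x y h = (lia (y & x & []) (#0 +' !2 <= #1 & []) ((#1 +' !2 <=? #0) +' (#0 +' !1 <=? #1) == !1) (h , tt))

 low-bad : ∀ v {D} → D ≤ + 0 → {_ : True (+ 2 ≤? + v)} → bd (+ v) D ≡ + 1
 low-bad v {D} h {p} = far-bad (+ v) D (ℤ.+-mono-≤ h (toWitness p))

 low-bad′ : ∀ v {D} → D ≤ + 0 → {_ : True (+ 2 ≤? + v)} → bd D (+ v) ≡ + 1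
 low-bad′ v {D} h {p} = far-bad′ (+ v) D (ℤ.+-mono-≤ h (toWitness p))

 high-image : ∀ {a b c d e} → d + + 2 ≤ a → d + + 2 ≤ b → d + + 2 ≤ c → e + + 2 ≤ a → e + + 2 ≤ b → e + + 2 ≤ c →
   eastMiddle₃₋₄ a b c d e ≡ just (fw (d ∷ e ∷ []) ++ bk (a ∷ b ∷ c ∷ []))
 high-image {a} {b} {c} {d} {e} h₁ h₂ h₃ h₄ h₅ h₆ = if-true (dec-true ((d ⊔ e) + + 1 <? a ⊓ b ⊓ c)
   (ℤ.suc[i]≤j⇒i<j (ℤ.⊓-glb (ℤ.⊓-glb (under a h₁ h₄) (under b h₂ h₅)) (under c h₃ h₆))))
   where
   under : ∀ v → d + + 2 ≤ v → e + + 2 ≤ v → + 1 + ((d ⊔ e) + + 1) ≤ v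
   under v p q = (lia ((d ⊔ e) & v & []) (#0 <= #1 -' !2 & []) (!1 +' (#0 +' !1) <= #1) ((ℤ.⊔-lub {v - + 2} {d} {e} (lia (d & v & []) (#0 +' !2 <= #1 & []) (#0 <= #1 -' !2) (p , tt)) (lia (e & v & []) (#0 +' !2 <= #1 & []) (#0 <= #1 -' !2) (q , tt))) , tt))

 good₀ : ∀ a b c d e → prop (highLow ix5) (a ∷ b ∷ c ∷ d ∷ e ∷ []) → Good a b c d e (d ∷ e ∷ a ∷ b ∷ c ∷ [])
 good₀ a b c d e ((ab , ba , ac , ca , bc , cb , da , db , dc , ea , eb , ec) , ed , de) =
   trans (high-image {a} {b} {c} {d} {e} da db dc ea eb ec) (cong just (cong₂ _++_ (fw-keep (lia (d & e & []) (#0 +' !-1 <= #1 & []) (#0 <= #1 +' !1) (de , tt)) (lia (e & d & []) (#0 +' !-1 <= #1 & []) (#0 <= #1 +' !1) (ed , tt))) (bk-keep₃ (lia (a & b & []) (#0 +' !-1 <= #1 & []) (#0 <= #1 +' !1) (ab , tt)) (lia (b & a & []) (#0 +' !-1 <= #1 & []) (#0 <= #1 +' !1) (ba , tt)) (lia (a & c & []) (#0 +' !-1 <= #1 & []) (#0 <= #1 +' !1) (ac , tt)) (lia (c & a & []) (#0 +' !-1 <= #1 & []) (#0 <= #1 +' !1) (ca , tt)) (lia (b & c & []) (#0 +' !-1 <= #1 & []) (#0 <= #1 +' !1) (bc , tt)) (lia (c & b & []) (#0 +' !-1 <= #1 & []) (#0 <= #1 +' !1) (cb , tt))))) ,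
   (lia ((bd a d) & (bd d a) & (bd b d) & (bd d b) & (bd c d) & (bd d c) & (bd a e) & (bd e a) & (bd b e) & (bd e b) & (bd c e) & (bd e c) & (bd d e) & (bd a b) & (bd a c) & (bd b c) & []) (#0 == !1 & #1 == !1 & #2 == !1 & #3 == !1 & #4 == !1 & #5 == !1 & #6 == !1 & #7 == !1 & #8 == !1 & #9 == !1 & #10 == !1 & #11 == !1 & []) (((#12 +' (#1 +' (#3 +' (#5 +' !0)))) +' ((#7 +' (#9 +' (#11 +' !0))) +' ((#13 +' (#14 +' !0)) +' ((#15 +' !0) +' (!0 +' !0))))) == ((#13 +' (#14 +' (#0 +' (#6 +' !0)))) +' ((#15 +' (#2 +' (#8 +' !0))) +' ((#4 +' (#10 +' !0)) +' ((#12 +' !0) +' (!0 +' !0)))))) ((far-bad a d da) , (far-bad′ a d da) , (far-bad b d db) , (far-bad′ b d db) , (far-bad c d dc) , (far-bad′ c d dc) , (far-bad a e ea) , (far-bad′ a e ea) , (far-bad b e eb) , (far-bad′ b e eb) , (far-bad c e ec) , (far-bad′ c e ec) , tt)) , λ f → (lia ((f d) & (f e) & (f a) & (f b) & (f c) & []) ([]) ((#0 +' (#1 +' (#2 +' (#3 +' (#4 +' !0))))) == (#2 +' (#3 +' (#4 +' (#0 +' (#1 +' !0)))))) (tt))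

 good₁ : ∀ a b c d e → prop (highSwap ix5) (a ∷ b ∷ c ∷ d ∷ e ∷ []) → Good a b c d e (e ∷ d ∷ a ∷ b ∷ c ∷ [])
 good₁ a b c d e ((ab , ba , ac , ca , bc , cb , da , db , dc , ea , eb , ec) , swap) =
   trans (high-image {a} {b} {c} {d} {e} da db dc ea eb ec) (cong just (cong₂ _++_ (fw-swap swap) (bk-keep₃ (lia (a & b & []) (#0 +' !-1 <= #1 & []) (#0 <= #1 +' !1) (ab , tt)) (lia (b & a & []) (#0 +' !-1 <= #1 & []) (#0 <= #1 +' !1) (ba , tt)) (lia (a & c & []) (#0 +' !-1 <= #1 & []) (#0 <= #1 +' !1) (ac , tt)) (lia (c & a & []) (#0 +' !-1 <= #1 & []) (#0 <= #1 +' !1) (ca , tt)) (lia (b & c & []) (#0 +' !-1 <= #1 & []) (#0 <= #1 +' !1) (bc , tt)) (lia (c & b & []) (#0 +' !-1 <= #1 & []) (#0 <= #1 +' !1) (cb , tt))))) ,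
   (lia ((bd a d) & (bd d a) & (bd b d) & (bd d b) & (bd c d) & (bd d c) & (bd a e) & (bd e a) & (bd b e) & (bd e b) & (bd c e) & (bd e c) & (bd e d) & (bd d e) & (bd a b) & (bd a c) & (bd b c) & []) (#0 == !1 & #1 == !1 & #2 == !1 & #3 == !1 & #4 == !1 & #5 == !1 & #6 == !1 & #7 == !1 & #8 == !1 & #9 == !1 & #10 == !1 & #11 == !1 & #12 == !1 & #13 == !1 & []) (((#12 +' (#7 +' (#9 +' (#11 +' !0)))) +' ((#1 +' (#3 +' (#5 +' !0))) +' ((#14 +' (#15 +' !0)) +' ((#16 +' !0) +' (!0 +' !0))))) == ((#14 +' (#15 +' (#0 +' (#6 +' !0)))) +' ((#16 +' (#2 +' (#8 +' !0))) +' ((#4 +' (#10 +' !0)) +' ((#13 +' !0) +' (!0 +' !0)))))) ((far-bad a d da) , (far-bad′ a d da) , (far-bad b d db) , (far-bad′ b d db) , (far-bad c d dc) , (far-bad′ c d dc) , (far-bad a e ea) , (far-bad′ a e ea) , (far-bad b e eb) , (far-bad′ b e eb) , (far-bad c e ec) , (far-bad′ c e ec) , (far-bad e d swap) , (far-bad′ e d swap) , tt)) , λ f → (lia ((f e) & (f d) & (f a) & (f b) & (f c) & []) ([]) ((#0 +' (#1 +' (#2 +' (#3 +' (#4 +' !0))))) == (#2 +' (#3 +' (#4 +' (#1 +' (#0 +' !0)))))) (tt))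

 good₂ : ∀ a b c d e → prop (exact (+ 1) (+ 1) (+ 2) (-[1+ 0 ]) ix5) (a ∷ b ∷ c ∷ d ∷ e ∷ []) → Good a b c d e (d ∷ e ∷ c ∷ a ∷ b ∷ [])
 good₂ a b c d e ((p , p′) , (q , q′) , (r , r′) , (s , s′)) = at (e - + 2) (lia (a & e & []) (#0 +' !-1 <= #1 & #1 +' !1 <= #0 & []) (#0 == !3 +' (#1 -' !2)) (p , p′ , tt)) (lia (b & e & []) (#0 +' !-1 <= #1 & #1 +' !1 <= #0 & []) (#0 == !3 +' (#1 -' !2)) (q , q′ , tt)) (lia (c & e & []) (#0 +' !-2 <= #1 & #1 +' !2 <= #0 & []) (#0 == !4 +' (#1 -' !2)) (r , r′ , tt)) (lia (d & e & []) (#0 +' !1 <= #1 & #1 +' !-1 <= #0 & []) (#0 == !1 +' (#1 -' !2)) (s , s′ , tt)) (lia (e & []) ([]) (#0 == !2 +' (#0 -' !2)) (tt))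
   where
   at : ∀ t {a b c d e} → a ≡ + 3 + t → b ≡ + 3 + t → c ≡ + 4 + t → d ≡ + 1 + t → e ≡ + 2 + t → Good a b c d e (d ∷ e ∷ c ∷ a ∷ b ∷ [])
   at t {a} {b} {c} {d} {e} refl refl refl refl refl = table-image (+ 3) (+ 3) (+ 4) (+ 1) (+ 2) (inl (ℤ.≤ᵇ⇒≤ tt , refl)) (inl (ℤ.≤ᵇ⇒≤ tt)) refl t ,
     trans (bad-shift t (+ 1 ∷ + 2 ∷ + 4 ∷ + 3 ∷ + 3 ∷ [])) (sym (bad-shift t (+ 3 ∷ + 3 ∷ + 4 ∷ + 1 ∷ + 2 ∷ []))) , λ f → (lia ((f d) & (f e) & (f c) & (f a) & (f b) & []) ([]) ((#0 +' (#1 +' (#2 +' (#3 +' (#4 +' !0))))) == (#3 +' (#4 +' (#2 +' (#0 +' (#1 +' !0)))))) (tt))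

 good₃ : ∀ a b c d e → prop (exact (+ 1) (+ 2) (+ 2) (-[1+ 0 ]) ix5) (a ∷ b ∷ c ∷ d ∷ e ∷ []) → Good a b c d e (d ∷ e ∷ b ∷ a ∷ c ∷ [])
 good₃ a b c d e ((p , p′) , (q , q′) , (r , r′) , (s , s′)) = at (e - + 2) (lia (a & e & []) (#0 +' !-1 <= #1 & #1 +' !1 <= #0 & []) (#0 == !3 +' (#1 -' !2)) (p , p′ , tt)) (lia (b & e & []) (#0 +' !-2 <= #1 & #1 +' !2 <= #0 & []) (#0 == !4 +' (#1 -' !2)) (q , q′ , tt)) (lia (c & e & []) (#0 +' !-2 <= #1 & #1 +' !2 <= #0 & []) (#0 == !4 +' (#1 -' !2)) (r , r′ , tt)) (lia (d & e & []) (#0 +' !1 <= #1 & #1 +' !-1 <= #0 & []) (#0 == !1 +' (#1 -' !2)) (s , s′ , tt)) (lia (e & []) ([]) (#0 == !2 +' (#0 -' !2)) (tt))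
   where
   at : ∀ t {a b c d e} → a ≡ + 3 + t → b ≡ + 4 + t → c ≡ + 4 + t → d ≡ + 1 + t → e ≡ + 2 + t → Good a b c d e (d ∷ e ∷ b ∷ a ∷ c ∷ [])
   at t {a} {b} {c} {d} {e} refl refl refl refl refl = table-image (+ 3) (+ 4) (+ 4) (+ 1) (+ 2) (inl (ℤ.≤ᵇ⇒≤ tt , refl)) (inl (ℤ.≤ᵇ⇒≤ tt)) refl t ,
     trans (bad-shift t (+ 1 ∷ + 2 ∷ + 4 ∷ + 3 ∷ + 4 ∷ [])) (sym (bad-shift t (+ 3 ∷ + 4 ∷ + 4 ∷ + 1 ∷ + 2 ∷ []))) , λ f → (lia ((f d) & (f e) & (f b) & (f a) & (f c) & []) ([]) ((#0 +' (#1 +' (#2 +' (#3 +' (#4 +' !0))))) == (#3 +' (#2 +' (#4 +' (#0 +' (#1 +' !0)))))) (tt))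

 good₄ : ∀ a b c d e → prop (exact (+ 2) (+ 1) (+ 2) (-[1+ 0 ]) ix5) (a ∷ b ∷ c ∷ d ∷ e ∷ []) → Good a b c d e (d ∷ e ∷ a ∷ c ∷ b ∷ [])
 good₄ a b c d e ((p , p′) , (q , q′) , (r , r′) , (s , s′)) = at (e - + 2) (lia (a & e & []) (#0 +' !-2 <= #1 & #1 +' !2 <= #0 & []) (#0 == !4 +' (#1 -' !2)) (p , p′ , tt)) (lia (b & e & []) (#0 +' !-1 <= #1 & #1 +' !1 <= #0 & []) (#0 == !3 +' (#1 -' !2)) (q , q′ , tt)) (lia (c & e & []) (#0 +' !-2 <= #1 & #1 +' !2 <= #0 & []) (#0 == !4 +' (#1 -' !2)) (r , r′ , tt)) (lia (d & e & []) (#0 +' !1 <= #1 & #1 +' !-1 <= #0 & []) (#0 == !1 +' (#1 -' !2)) (s , s′ , tt)) (lia (e & []) ([]) (#0 == !2 +' (#0 -' !2)) (tt))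
   where
   at : ∀ t {a b c d e} → a ≡ + 4 + t → b ≡ + 3 + t → c ≡ + 4 + t → d ≡ + 1 + t → e ≡ + 2 + t → Good a b c d e (d ∷ e ∷ a ∷ c ∷ b ∷ [])
   at t {a} {b} {c} {d} {e} refl refl refl refl refl = table-image (+ 4) (+ 3) (+ 4) (+ 1) (+ 2) (inl (ℤ.≤ᵇ⇒≤ tt , refl)) (inr (ℤ.≤ᵇ⇒≤ tt)) refl t ,
     trans (bad-shift t (+ 1 ∷ + 2 ∷ + 4 ∷ + 4 ∷ + 3 ∷ [])) (sym (bad-shift t (+ 4 ∷ + 3 ∷ + 4 ∷ + 1 ∷ + 2 ∷ []))) , λ f → (lia ((f d) & (f e) & (f a) & (f c) & (f b) & []) ([]) ((#0 +' (#1 +' (#2 +' (#3 +' (#4 +' !0))))) == (#2 +' (#4 +' (#3 +' (#0 +' (#1 +' !0)))))) (tt))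

 good₅ : ∀ a b c d e → prop (exact (+ 0) (+ 1) (+ 2) (-[1+ 0 ]) ix5) (a ∷ b ∷ c ∷ d ∷ e ∷ []) → Good a b c d e (d ∷ e ∷ c ∷ b ∷ a ∷ [])
 good₅ a b c d e ((p , p′) , (q , q′) , (r , r′) , (s , s′)) = at (e - + 2) (lia (a & e & []) (#0 +' !0 <= #1 & #1 +' !0 <= #0 & []) (#0 == !2 +' (#1 -' !2)) (p , p′ , tt)) (lia (b & e & []) (#0 +' !-1 <= #1 & #1 +' !1 <= #0 & []) (#0 == !3 +' (#1 -' !2)) (q , q′ , tt)) (lia (c & e & []) (#0 +' !-2 <= #1 & #1 +' !2 <= #0 & []) (#0 == !4 +' (#1 -' !2)) (r , r′ , tt)) (lia (d & e & []) (#0 +' !1 <= #1 & #1 +' !-1 <= #0 & []) (#0 == !1 +' (#1 -' !2)) (s , s′ , tt)) (lia (e & []) ([]) (#0 == !2 +' (#0 -' !2)) (tt))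
   where
   at : ∀ t {a b c d e} → a ≡ + 2 + t → b ≡ + 3 + t → c ≡ + 4 + t → d ≡ + 1 + t → e ≡ + 2 + t → Good a b c d e (d ∷ e ∷ c ∷ b ∷ a ∷ [])
   at t {a} {b} {c} {d} {e} refl refl refl refl refl = table-image (+ 2) (+ 3) (+ 4) (+ 1) (+ 2) (inl (ℤ.≤ᵇ⇒≤ tt , refl)) (inl (ℤ.≤ᵇ⇒≤ tt)) refl t ,
     trans (bad-shift t (+ 1 ∷ + 2 ∷ + 4 ∷ + 3 ∷ + 2 ∷ [])) (sym (bad-shift t (+ 2 ∷ + 3 ∷ + 4 ∷ + 1 ∷ + 2 ∷ []))) , λ f → (lia ((f d) & (f e) & (f c) & (f b) & (f a) & []) ([]) ((#0 +' (#1 +' (#2 +' (#3 +' (#4 +' !0))))) == (#4 +' (#3 +' (#2 +' (#0 +' (#1 +' !0)))))) (tt))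

 good₆ : ∀ a b c d e → prop (exact (+ 2) (+ 2) (+ 3) (+ 1) ix5) (a ∷ b ∷ c ∷ d ∷ e ∷ []) → Good a b c d e (d ∷ e ∷ c ∷ a ∷ b ∷ [])
 good₆ a b c d e ((p , p′) , (q , q′) , (r , r′) , (s , s′)) = at (e - + 1) (lia (a & e & []) (#0 +' !-2 <= #1 & #1 +' !2 <= #0 & []) (#0 == !3 +' (#1 -' !1)) (p , p′ , tt)) (lia (b & e & []) (#0 +' !-2 <= #1 & #1 +' !2 <= #0 & []) (#0 == !3 +' (#1 -' !1)) (q , q′ , tt)) (lia (c & e & []) (#0 +' !-3 <= #1 & #1 +' !3 <= #0 & []) (#0 == !4 +' (#1 -' !1)) (r , r′ , tt)) (lia (d & e & []) (#0 +' !-1 <= #1 & #1 +' !1 <= #0 & []) (#0 == !2 +' (#1 -' !1)) (s , s′ , tt)) (lia (e & []) ([]) (#0 == !1 +' (#0 -' !1)) (tt))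
   where
   at : ∀ t {a b c d e} → a ≡ + 3 + t → b ≡ + 3 + t → c ≡ + 4 + t → d ≡ + 2 + t → e ≡ + 1 + t → Good a b c d e (d ∷ e ∷ c ∷ a ∷ b ∷ [])
   at t {a} {b} {c} {d} {e} refl refl refl refl refl = table-image (+ 3) (+ 3) (+ 4) (+ 2) (+ 1) (inr (ℤ.≤ᵇ⇒≤ tt , refl)) (inl (ℤ.≤ᵇ⇒≤ tt)) refl t ,
     trans (bad-shift t (+ 2 ∷ + 1 ∷ + 4 ∷ + 3 ∷ + 3 ∷ [])) (sym (bad-shift t (+ 3 ∷ + 3 ∷ + 4 ∷ + 2 ∷ + 1 ∷ []))) , λ f → (lia ((f d) & (f e) & (f c) & (f a) & (f b) & []) ([]) ((#0 +' (#1 +' (#2 +' (#3 +' (#4 +' !0))))) == (#3 +' (#4 +' (#2 +' (#0 +' (#1 +' !0)))))) (tt))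

 good₇ : ∀ a b c d e → prop (exact (+ 2) (+ 3) (+ 3) (+ 1) ix5) (a ∷ b ∷ c ∷ d ∷ e ∷ []) → Good a b c d e (d ∷ e ∷ b ∷ a ∷ c ∷ [])
 good₇ a b c d e ((p , p′) , (q , q′) , (r , r′) , (s , s′)) = at (e - + 1) (lia (a & e & []) (#0 +' !-2 <= #1 & #1 +' !2 <= #0 & []) (#0 == !3 +' (#1 -' !1)) (p , p′ , tt)) (lia (b & e & []) (#0 +' !-3 <= #1 & #1 +' !3 <= #0 & []) (#0 == !4 +' (#1 -' !1)) (q , q′ , tt)) (lia (c & e & []) (#0 +' !-3 <= #1 & #1 +' !3 <= #0 & []) (#0 == !4 +' (#1 -' !1)) (r , r′ , tt)) (lia (d & e & []) (#0 +' !-1 <= #1 & #1 +' !1 <= #0 & []) (#0 == !2 +' (#1 -' !1)) (s , s′ , tt)) (lia (e & []) ([]) (#0 == !1 +' (#0 -' !1)) (tt))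
   where
   at : ∀ t {a b c d e} → a ≡ + 3 + t → b ≡ + 4 + t → c ≡ + 4 + t → d ≡ + 2 + t → e ≡ + 1 + t → Good a b c d e (d ∷ e ∷ b ∷ a ∷ c ∷ [])
   at t {a} {b} {c} {d} {e} refl refl refl refl refl = table-image (+ 3) (+ 4) (+ 4) (+ 2) (+ 1) (inr (ℤ.≤ᵇ⇒≤ tt , refl)) (inl (ℤ.≤ᵇ⇒≤ tt)) refl t ,
     trans (bad-shift t (+ 2 ∷ + 1 ∷ + 4 ∷ + 3 ∷ + 4 ∷ [])) (sym (bad-shift t (+ 3 ∷ + 4 ∷ + 4 ∷ + 2 ∷ + 1 ∷ []))) , λ f → (lia ((f d) & (f e) & (f b) & (f a) & (f c) & []) ([]) ((#0 +' (#1 +' (#2 +' (#3 +' (#4 +' !0))))) == (#3 +' (#2 +' (#4 +' (#0 +' (#1 +' !0)))))) (tt))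

 good₈ : ∀ a b c d e → prop (exact (+ 3) (+ 2) (+ 3) (+ 1) ix5) (a ∷ b ∷ c ∷ d ∷ e ∷ []) → Good a b c d e (d ∷ e ∷ a ∷ c ∷ b ∷ [])
 good₈ a b c d e ((p , p′) , (q , q′) , (r , r′) , (s , s′)) = at (e - + 1) (lia (a & e & []) (#0 +' !-3 <= #1 & #1 +' !3 <= #0 & []) (#0 == !4 +' (#1 -' !1)) (p , p′ , tt)) (lia (b & e & []) (#0 +' !-2 <= #1 & #1 +' !2 <= #0 & []) (#0 == !3 +' (#1 -' !1)) (q , q′ , tt)) (lia (c & e & []) (#0 +' !-3 <= #1 & #1 +' !3 <= #0 & []) (#0 == !4 +' (#1 -' !1)) (r , r′ , tt)) (lia (d & e & []) (#0 +' !-1 <= #1 & #1 +' !1 <= #0 & []) (#0 == !2 +' (#1 -' !1)) (s , s′ , tt)) (lia (e & []) ([]) (#0 == !1 +' (#0 -' !1)) (tt))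
   where
   at : ∀ t {a b c d e} → a ≡ + 4 + t → b ≡ + 3 + t → c ≡ + 4 + t → d ≡ + 2 + t → e ≡ + 1 + t → Good a b c d e (d ∷ e ∷ a ∷ c ∷ b ∷ [])
   at t {a} {b} {c} {d} {e} refl refl refl refl refl = table-image (+ 4) (+ 3) (+ 4) (+ 2) (+ 1) (inr (ℤ.≤ᵇ⇒≤ tt , refl)) (inr (ℤ.≤ᵇ⇒≤ tt)) refl t ,
     trans (bad-shift t (+ 2 ∷ + 1 ∷ + 4 ∷ + 4 ∷ + 3 ∷ [])) (sym (bad-shift t (+ 4 ∷ + 3 ∷ + 4 ∷ + 2 ∷ + 1 ∷ []))) , λ f → (lia ((f d) & (f e) & (f a) & (f c) & (f b) & []) ([]) ((#0 +' (#1 +' (#2 +' (#3 +' (#4 +' !0))))) == (#2 +' (#4 +' (#3 +' (#0 +' (#1 +' !0)))))) (tt))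

 good₉ : ∀ a b c d e → prop (exact (+ 1) (+ 2) (+ 3) (+ 1) ix5) (a ∷ b ∷ c ∷ d ∷ e ∷ []) → Good a b c d e (d ∷ e ∷ c ∷ b ∷ a ∷ [])
 good₉ a b c d e ((p , p′) , (q , q′) , (r , r′) , (s , s′)) = at (e - + 1) (lia (a & e & []) (#0 +' !-1 <= #1 & #1 +' !1 <= #0 & []) (#0 == !2 +' (#1 -' !1)) (p , p′ , tt)) (lia (b & e & []) (#0 +' !-2 <= #1 & #1 +' !2 <= #0 & []) (#0 == !3 +' (#1 -' !1)) (q , q′ , tt)) (lia (c & e & []) (#0 +' !-3 <= #1 & #1 +' !3 <= #0 & []) (#0 == !4 +' (#1 -' !1)) (r , r′ , tt)) (lia (d & e & []) (#0 +' !-1 <= #1 & #1 +' !1 <= #0 & []) (#0 == !2 +' (#1 -' !1)) (s , s′ , tt)) (lia (e & []) ([]) (#0 == !1 +' (#0 -' !1)) (tt))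
   where
   at : ∀ t {a b c d e} → a ≡ + 2 + t → b ≡ + 3 + t → c ≡ + 4 + t → d ≡ + 2 + t → e ≡ + 1 + t → Good a b c d e (d ∷ e ∷ c ∷ b ∷ a ∷ [])
   at t {a} {b} {c} {d} {e} refl refl refl refl refl = table-image (+ 2) (+ 3) (+ 4) (+ 2) (+ 1) (inr (ℤ.≤ᵇ⇒≤ tt , refl)) (inl (ℤ.≤ᵇ⇒≤ tt)) refl t ,
     trans (bad-shift t (+ 2 ∷ + 1 ∷ + 4 ∷ + 3 ∷ + 2 ∷ [])) (sym (bad-shift t (+ 2 ∷ + 3 ∷ + 4 ∷ + 2 ∷ + 1 ∷ []))) , λ f → (lia ((f d) & (f e) & (f c) & (f b) & (f a) & []) ([]) ((#0 +' (#1 +' (#2 +' (#3 +' (#4 +' !0))))) == (#4 +' (#3 +' (#2 +' (#0 +' (#1 +' !0)))))) (tt))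

 good₁₀ : ∀ a b c d e → prop (exact (+ 1) (+ 2) (+ 2) (+ 0) ix5) (a ∷ b ∷ c ∷ d ∷ e ∷ []) → Good a b c d e (d ∷ e ∷ b ∷ c ∷ a ∷ [])
 good₁₀ a b c d e ((p , p′) , (q , q′) , (r , r′) , (s , s′)) = at (e - + 2) (lia (a & e & []) (#0 +' !-1 <= #1 & #1 +' !1 <= #0 & []) (#0 == !3 +' (#1 -' !2)) (p , p′ , tt)) (lia (b & e & []) (#0 +' !-2 <= #1 & #1 +' !2 <= #0 & []) (#0 == !4 +' (#1 -' !2)) (q , q′ , tt)) (lia (c & e & []) (#0 +' !-2 <= #1 & #1 +' !2 <= #0 & []) (#0 == !4 +' (#1 -' !2)) (r , r′ , tt)) (lia (d & e & []) (#0 +' !0 <= #1 & #1 +' !0 <= #0 & []) (#0 == !2 +' (#1 -' !2)) (s , s′ , tt)) (lia (e & []) ([]) (#0 == !2 +' (#0 -' !2)) (tt))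
   where
   at : ∀ t {a b c d e} → a ≡ + 3 + t → b ≡ + 4 + t → c ≡ + 4 + t → d ≡ + 2 + t → e ≡ + 2 + t → Good a b c d e (d ∷ e ∷ b ∷ c ∷ a ∷ [])
   at t {a} {b} {c} {d} {e} refl refl refl refl refl = table-image (+ 3) (+ 4) (+ 4) (+ 2) (+ 2) (inl (ℤ.≤ᵇ⇒≤ tt , refl)) (inl (ℤ.≤ᵇ⇒≤ tt)) refl t ,
     trans (bad-shift t (+ 2 ∷ + 2 ∷ + 4 ∷ + 4 ∷ + 3 ∷ [])) (sym (bad-shift t (+ 3 ∷ + 4 ∷ + 4 ∷ + 2 ∷ + 2 ∷ []))) , λ f → (lia ((f d) & (f e) & (f b) & (f c) & (f a) & []) ([]) ((#0 +' (#1 +' (#2 +' (#3 +' (#4 +' !0))))) == (#4 +' (#2 +' (#3 +' (#0 +' (#1 +' !0)))))) (tt))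

 good₁₁ : ∀ a b c d e → prop (exact (+ 1) (+ 2) (+ 3) (+ 0) ix5) (a ∷ b ∷ c ∷ d ∷ e ∷ []) → Good a b c d e (d ∷ e ∷ c ∷ b ∷ a ∷ [])
 good₁₁ a b c d e ((p , p′) , (q , q′) , (r , r′) , (s , s′)) = at (e - + 2) (lia (a & e & []) (#0 +' !-1 <= #1 & #1 +' !1 <= #0 & []) (#0 == !3 +' (#1 -' !2)) (p , p′ , tt)) (lia (b & e & []) (#0 +' !-2 <= #1 & #1 +' !2 <= #0 & []) (#0 == !4 +' (#1 -' !2)) (q , q′ , tt)) (lia (c & e & []) (#0 +' !-3 <= #1 & #1 +' !3 <= #0 & []) (#0 == !5 +' (#1 -' !2)) (r , r′ , tt)) (lia (d & e & []) (#0 +' !0 <= #1 & #1 +' !0 <= #0 & []) (#0 == !2 +' (#1 -' !2)) (s , s′ , tt)) (lia (e & []) ([]) (#0 == !2 +' (#0 -' !2)) (tt))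
   where
   at : ∀ t {a b c d e} → a ≡ + 3 + t → b ≡ + 4 + t → c ≡ + 5 + t → d ≡ + 2 + t → e ≡ + 2 + t → Good a b c d e (d ∷ e ∷ c ∷ b ∷ a ∷ [])
   at t {a} {b} {c} {d} {e} refl refl refl refl refl = table-image (+ 3) (+ 4) (+ 5) (+ 2) (+ 2) (inl (ℤ.≤ᵇ⇒≤ tt , refl)) (inl (ℤ.≤ᵇ⇒≤ tt)) refl t ,
     trans (bad-shift t (+ 2 ∷ + 2 ∷ + 5 ∷ + 4 ∷ + 3 ∷ [])) (sym (bad-shift t (+ 3 ∷ + 4 ∷ + 5 ∷ + 2 ∷ + 2 ∷ []))) , λ f → (lia ((f d) & (f e) & (f c) & (f b) & (f a) & []) ([]) ((#0 +' (#1 +' (#2 +' (#3 +' (#4 +' !0))))) == (#4 +' (#3 +' (#2 +' (#0 +' (#1 +' !0)))))) (tt))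

 good₁₂ : ∀ a b c d e → prop (lower (+ 1) (+ 1) (+ 2) ix5) (a ∷ b ∷ c ∷ d ∷ e ∷ []) → Good a b c d e (e ∷ d ∷ c ∷ a ∷ b ∷ [])
 good₁₂ a b c d e ((p , p′) , (q , q′) , (r , r′) , s) = at (e - + 2) (d - (e - + 2)) (lia (d & e & []) (#0 +' !2 <= #1 & []) (#0 -' (#1 -' !2) <= !0) (s , tt)) (lia (a & e & []) (#0 +' !-1 <= #1 & #1 +' !1 <= #0 & []) (#0 == !3 +' (#1 -' !2)) (p , p′ , tt)) (lia (b & e & []) (#0 +' !-1 <= #1 & #1 +' !1 <= #0 & []) (#0 == !3 +' (#1 -' !2)) (q , q′ , tt)) (lia (c & e & []) (#0 +' !-2 <= #1 & #1 +' !2 <= #0 & []) (#0 == !4 +' (#1 -' !2)) (r , r′ , tt)) (lia (d & e & []) ([]) (#0 == #0 -' (#1 -' !2) +' (#1 -' !2)) (tt)) (lia (e & []) ([]) (#0 == !2 +' (#0 -' !2)) (tt))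
   where
   look : ∀ D → D ≤ + 0 → lookupTable (+ 3) (+ 3) (+ 4) D (+ 2) ≡ just (+ 2 ∷ D ∷ + 4 ∷ + 3 ∷ + 3 ∷ [])
   look (+ 0) _ = refl
   look +[1+ n ] (+≤+ ())
   look -[1+ n ] _ rewrite ≡ᵇ-refl n = refl
   at : ∀ t D → D ≤ + 0 → ∀ {a b c d e} → a ≡ + 3 + t → b ≡ + 3 + t → c ≡ + 4 + t → d ≡ D + t → e ≡ + 2 + t → Good a b c d e (e ∷ d ∷ c ∷ a ∷ b ∷ [])
   at t D D≤0 {a} {b} {c} {d} {e} refl refl refl refl refl = table-image (+ 3) (+ 3) (+ 4) D (+ 2) (inl (ℤ.≤-trans D≤0 (ℤ.≤ᵇ⇒≤ tt) , refl)) (inl (ℤ.≤ᵇ⇒≤ tt)) (look D D≤0) t ,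
     trans (bad-shift t (+ 2 ∷ D ∷ + 4 ∷ + 3 ∷ + 3 ∷ [])) (trans (lia ((bd D (+ 2)) & (bd D (+ 3)) & (bd D (+ 4)) & (bd (+ 2) D) & (bd (+ 3) D) & (bd (+ 4) D) & []) (#0 == !1 & #1 == !1 & #2 == !1 & #3 == !1 & #4 == !1 & #5 == !1 & []) (((#3 +' (!1 +' (!1 +' (!1 +' !0)))) +' ((#2 +' (#1 +' (#1 +' !0))) +' ((!0 +' (!0 +' !0)) +' ((!0 +' !0) +' (!0 +' !0))))) == ((!0 +' (!1 +' (#4 +' (!0 +' !0)))) +' ((!1 +' (#4 +' (!0 +' !0))) +' ((#5 +' (!1 +' !0)) +' ((#0 +' !0) +' (!0 +' !0)))))) ((low-bad′ 2 D≤0) , (low-bad′ 3 D≤0) , (low-bad′ 4 D≤0) , (low-bad 2 D≤0) , (low-bad 3 D≤0) , (low-bad 4 D≤0) , tt)) (sym (bad-shift t (+ 3 ∷ + 3 ∷ + 4 ∷ D ∷ + 2 ∷ [])))) , λ f → (lia ((f e) & (f d) & (f c) & (f a) & (f b) & []) ([]) ((#0 +' (#1 +' (#2 +' (#3 +' (#4 +' !0))))) == (#3 +' (#4 +' (#2 +' (#1 +' (#0 +' !0)))))) (tt))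

 good₁₃ : ∀ a b c d e → prop (lower (+ 1) (+ 2) (+ 2) ix5) (a ∷ b ∷ c ∷ d ∷ e ∷ []) → Good a b c d e (e ∷ d ∷ b ∷ a ∷ c ∷ [])
 good₁₃ a b c d e ((p , p′) , (q , q′) , (r , r′) , s) = at (e - + 2) (d - (e - + 2)) (lia (d & e & []) (#0 +' !2 <= #1 & []) (#0 -' (#1 -' !2) <= !0) (s , tt)) (lia (a & e & []) (#0 +' !-1 <= #1 & #1 +' !1 <= #0 & []) (#0 == !3 +' (#1 -' !2)) (p , p′ , tt)) (lia (b & e & []) (#0 +' !-2 <= #1 & #1 +' !2 <= #0 & []) (#0 == !4 +' (#1 -' !2)) (q , q′ , tt)) (lia (c & e & []) (#0 +' !-2 <= #1 & #1 +' !2 <= #0 & []) (#0 == !4 +' (#1 -' !2)) (r , r′ , tt)) (lia (d & e & []) ([]) (#0 == #0 -' (#1 -' !2) +' (#1 -' !2)) (tt)) (lia (e & []) ([]) (#0 == !2 +' (#0 -' !2)) (tt))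
   where
   look : ∀ D → D ≤ + 0 → lookupTable (+ 3) (+ 4) (+ 4) D (+ 2) ≡ just (+ 2 ∷ D ∷ + 4 ∷ + 3 ∷ + 4 ∷ [])
   look (+ 0) _ = refl
   look +[1+ n ] (+≤+ ())
   look -[1+ n ] _ rewrite ≡ᵇ-refl n = refl
   at : ∀ t D → D ≤ + 0 → ∀ {a b c d e} → a ≡ + 3 + t → b ≡ + 4 + t → c ≡ + 4 + t → d ≡ D + t → e ≡ + 2 + t → Good a b c d e (e ∷ d ∷ b ∷ a ∷ c ∷ [])
   at t D D≤0 {a} {b} {c} {d} {e} refl refl refl refl refl = table-image (+ 3) (+ 4) (+ 4) D (+ 2) (inl (ℤ.≤-trans D≤0 (ℤ.≤ᵇ⇒≤ tt) , refl)) (inl (ℤ.≤ᵇ⇒≤ tt)) (look D D≤0) t ,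
     trans (bad-shift t (+ 2 ∷ D ∷ + 4 ∷ + 3 ∷ + 4 ∷ [])) (trans (lia ((bd D (+ 2)) & (bd D (+ 3)) & (bd D (+ 4)) & (bd (+ 2) D) & (bd (+ 3) D) & (bd (+ 4) D) & []) (#0 == !1 & #1 == !1 & #2 == !1 & #3 == !1 & #4 == !1 & #5 == !1 & []) (((#3 +' (!1 +' (!1 +' (!1 +' !0)))) +' ((#2 +' (#1 +' (#2 +' !0))) +' ((!0 +' (!0 +' !0)) +' ((!1 +' !0) +' (!0 +' !0))))) == ((!1 +' (!1 +' (#4 +' (!0 +' !0)))) +' ((!0 +' (#5 +' (!1 +' !0))) +' ((#5 +' (!1 +' !0)) +' ((#0 +' !0) +' (!0 +' !0)))))) ((low-bad′ 2 D≤0) , (low-bad′ 3 D≤0) , (low-bad′ 4 D≤0) , (low-bad 2 D≤0) , (low-bad 3 D≤0) , (low-bad 4 D≤0) , tt)) (sym (bad-shift t (+ 3 ∷ + 4 ∷ + 4 ∷ D ∷ + 2 ∷ [])))) , λ f → (lia ((f e) & (f d) & (f b) & (f a) & (f c) & []) ([]) ((#0 +' (#1 +' (#2 +' (#3 +' (#4 +' !0))))) == (#3 +' (#2 +' (#4 +' (#1 +' (#0 +' !0)))))) (tt))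

 good₁₄ : ∀ a b c d e → prop (lower (+ 2) (+ 1) (+ 2) ix5) (a ∷ b ∷ c ∷ d ∷ e ∷ []) → Good a b c d e (e ∷ d ∷ a ∷ c ∷ b ∷ [])
 good₁₄ a b c d e ((p , p′) , (q , q′) , (r , r′) , s) = at (e - + 2) (d - (e - + 2)) (lia (d & e & []) (#0 +' !2 <= #1 & []) (#0 -' (#1 -' !2) <= !0) (s , tt)) (lia (a & e & []) (#0 +' !-2 <= #1 & #1 +' !2 <= #0 & []) (#0 == !4 +' (#1 -' !2)) (p , p′ , tt)) (lia (b & e & []) (#0 +' !-1 <= #1 & #1 +' !1 <= #0 & []) (#0 == !3 +' (#1 -' !2)) (q , q′ , tt)) (lia (c & e & []) (#0 +' !-2 <= #1 & #1 +' !2 <= #0 & []) (#0 == !4 +' (#1 -' !2)) (r , r′ , tt)) (lia (d & e & []) ([]) (#0 == #0 -' (#1 -' !2) +' (#1 -' !2)) (tt)) (lia (e & []) ([]) (#0 == !2 +' (#0 -' !2)) (tt))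
   where
   look : ∀ D → D ≤ + 0 → lookupTable (+ 4) (+ 3) (+ 4) D (+ 2) ≡ just (+ 2 ∷ D ∷ + 4 ∷ + 4 ∷ + 3 ∷ [])
   look (+ 0) _ = refl
   look +[1+ n ] (+≤+ ())
   look -[1+ n ] _ rewrite ≡ᵇ-refl n = refl
   at : ∀ t D → D ≤ + 0 → ∀ {a b c d e} → a ≡ + 4 + t → b ≡ + 3 + t → c ≡ + 4 + t → d ≡ D + t → e ≡ + 2 + t → Good a b c d e (e ∷ d ∷ a ∷ c ∷ b ∷ [])
   at t D D≤0 {a} {b} {c} {d} {e} refl refl refl refl refl = table-image (+ 4) (+ 3) (+ 4) D (+ 2) (inl (ℤ.≤-trans D≤0 (ℤ.≤ᵇ⇒≤ tt) , refl)) (inr (ℤ.≤ᵇ⇒≤ tt)) (look D D≤0) t ,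
     trans (bad-shift t (+ 2 ∷ D ∷ + 4 ∷ + 4 ∷ + 3 ∷ [])) (trans (lia ((bd D (+ 2)) & (bd D (+ 3)) & (bd D (+ 4)) & (bd (+ 2) D) & (bd (+ 3) D) & (bd (+ 4) D) & []) (#0 == !1 & #1 == !1 & #2 == !1 & #3 == !1 & #4 == !1 & #5 == !1 & []) (((#3 +' (!1 +' (!1 +' (!1 +' !0)))) +' ((#2 +' (#2 +' (#1 +' !0))) +' ((!0 +' (!0 +' !0)) +' ((!0 +' !0) +' (!0 +' !0))))) == ((!0 +' (!0 +' (#5 +' (!1 +' !0)))) +' ((!1 +' (#4 +' (!0 +' !0))) +' ((#5 +' (!1 +' !0)) +' ((#0 +' !0) +' (!0 +' !0)))))) ((low-bad′ 2 D≤0) , (low-bad′ 3 D≤0) , (low-bad′ 4 D≤0) , (low-bad 2 D≤0) , (low-bad 3 D≤0) , (low-bad 4 D≤0) , tt)) (sym (bad-shift t (+ 4 ∷ + 3 ∷ + 4 ∷ D ∷ + 2 ∷ [])))) , λ f → (lia ((f e) & (f d) & (f a) & (f c) & (f b) & []) ([]) ((#0 +' (#1 +' (#2 +' (#3 +' (#4 +' !0))))) == (#2 +' (#4 +' (#3 +' (#1 +' (#0 +' !0)))))) (tt))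

 good₁₅ : ∀ a b c d e → prop (lower (+ 0) (+ 1) (+ 2) ix5) (a ∷ b ∷ c ∷ d ∷ e ∷ []) → Good a b c d e (e ∷ d ∷ a ∷ c ∷ b ∷ [])
 good₁₅ a b c d e ((p , p′) , (q , q′) , (r , r′) , s) = at (e - + 2) (d - (e - + 2)) (lia (d & e & []) (#0 +' !2 <= #1 & []) (#0 -' (#1 -' !2) <= !0) (s , tt)) (lia (a & e & []) (#0 +' !0 <= #1 & #1 +' !0 <= #0 & []) (#0 == !2 +' (#1 -' !2)) (p , p′ , tt)) (lia (b & e & []) (#0 +' !-1 <= #1 & #1 +' !1 <= #0 & []) (#0 == !3 +' (#1 -' !2)) (q , q′ , tt)) (lia (c & e & []) (#0 +' !-2 <= #1 & #1 +' !2 <= #0 & []) (#0 == !4 +' (#1 -' !2)) (r , r′ , tt)) (lia (d & e & []) ([]) (#0 == #0 -' (#1 -' !2) +' (#1 -' !2)) (tt)) (lia (e & []) ([]) (#0 == !2 +' (#0 -' !2)) (tt))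
   where
   look : ∀ D → D ≤ + 0 → lookupTable (+ 2) (+ 3) (+ 4) D (+ 2) ≡ just (+ 2 ∷ D ∷ + 2 ∷ + 4 ∷ + 3 ∷ [])
   look (+ 0) _ = refl
   look +[1+ n ] (+≤+ ())
   look -[1+ n ] _ rewrite ≡ᵇ-refl n = refl
   at : ∀ t D → D ≤ + 0 → ∀ {a b c d e} → a ≡ + 2 + t → b ≡ + 3 + t → c ≡ + 4 + t → d ≡ D + t → e ≡ + 2 + t → Good a b c d e (e ∷ d ∷ a ∷ c ∷ b ∷ [])
   at t D D≤0 {a} {b} {c} {d} {e} refl refl refl refl refl = table-image (+ 2) (+ 3) (+ 4) D (+ 2) (inl (ℤ.≤-trans D≤0 (ℤ.≤ᵇ⇒≤ tt) , refl)) (inl (ℤ.≤ᵇ⇒≤ tt)) (look D D≤0) t ,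
     trans (bad-shift t (+ 2 ∷ D ∷ + 2 ∷ + 4 ∷ + 3 ∷ [])) (trans (lia ((bd D (+ 2)) & (bd D (+ 3)) & (bd D (+ 4)) & (bd (+ 2) D) & (bd (+ 3) D) & (bd (+ 4) D) & []) (#0 == !1 & #1 == !1 & #2 == !1 & #3 == !1 & #4 == !1 & #5 == !1 & []) (((#3 +' (!0 +' (!1 +' (!1 +' !0)))) +' ((#0 +' (#2 +' (#1 +' !0))) +' ((!1 +' (!1 +' !0)) +' ((!0 +' !0) +' (!0 +' !0))))) == ((!1 +' (!1 +' (#3 +' (!0 +' !0)))) +' ((!1 +' (#4 +' (!0 +' !0))) +' ((#5 +' (!1 +' !0)) +' ((#0 +' !0) +' (!0 +' !0)))))) ((low-bad′ 2 D≤0) , (low-bad′ 3 D≤0) , (low-bad′ 4 D≤0) , (low-bad 2 D≤0) , (low-bad 3 D≤0) , (low-bad 4 D≤0) , tt)) (sym (bad-shift t (+ 2 ∷ + 3 ∷ + 4 ∷ D ∷ + 2 ∷ [])))) , λ f → (lia ((f e) & (f d) & (f a) & (f c) & (f b) & []) ([]) ((#0 +' (#1 +' (#2 +' (#3 +' (#4 +' !0))))) == (#2 +' (#4 +' (#3 +' (#1 +' (#0 +' !0)))))) (tt))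

 good₁₆ : ∀ a b c d e → prop (lower (+ 1) (+ 2) (+ 0) ix5) (a ∷ b ∷ c ∷ d ∷ e ∷ []) → Good a b c d e (e ∷ d ∷ b ∷ a ∷ c ∷ [])
 good₁₆ a b c d e ((p , p′) , (q , q′) , (r , r′) , s) = at (e - + 2) (d - (e - + 2)) (lia (d & e & []) (#0 +' !2 <= #1 & []) (#0 -' (#1 -' !2) <= !0) (s , tt)) (lia (a & e & []) (#0 +' !-1 <= #1 & #1 +' !1 <= #0 & []) (#0 == !3 +' (#1 -' !2)) (p , p′ , tt)) (lia (b & e & []) (#0 +' !-2 <= #1 & #1 +' !2 <= #0 & []) (#0 == !4 +' (#1 -' !2)) (q , q′ , tt)) (lia (c & e & []) (#0 +' !0 <= #1 & #1 +' !0 <= #0 & []) (#0 == !2 +' (#1 -' !2)) (r , r′ , tt)) (lia (d & e & []) ([]) (#0 == #0 -' (#1 -' !2) +' (#1 -' !2)) (tt)) (lia (e & []) ([]) (#0 == !2 +' (#0 -' !2)) (tt))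
   where
   look : ∀ D → D ≤ + 0 → lookupTable (+ 3) (+ 4) (+ 2) D (+ 2) ≡ just (+ 2 ∷ D ∷ + 4 ∷ + 3 ∷ + 2 ∷ [])
   look (+ 0) _ = refl
   look +[1+ n ] (+≤+ ())
   look -[1+ n ] _ rewrite ≡ᵇ-refl n = refl
   at : ∀ t D → D ≤ + 0 → ∀ {a b c d e} → a ≡ + 3 + t → b ≡ + 4 + t → c ≡ + 2 + t → d ≡ D + t → e ≡ + 2 + t → Good a b c d e (e ∷ d ∷ b ∷ a ∷ c ∷ [])
   at t D D≤0 {a} {b} {c} {d} {e} refl refl refl refl refl = table-image (+ 3) (+ 4) (+ 2) D (+ 2) (inl (ℤ.≤-trans D≤0 (ℤ.≤ᵇ⇒≤ tt) , refl)) (inl (ℤ.≤ᵇ⇒≤ tt)) (look D D≤0) t ,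
     trans (bad-shift t (+ 2 ∷ D ∷ + 4 ∷ + 3 ∷ + 2 ∷ [])) (trans (lia ((bd D (+ 2)) & (bd D (+ 3)) & (bd D (+ 4)) & (bd (+ 2) D) & (bd (+ 3) D) & (bd (+ 4) D) & []) (#0 == !1 & #1 == !1 & #2 == !1 & #3 == !1 & #4 == !1 & #5 == !1 & []) (((#3 +' (!1 +' (!1 +' (!0 +' !0)))) +' ((#2 +' (#1 +' (#0 +' !0))) +' ((!0 +' (!1 +' !0)) +' ((!0 +' !0) +' (!0 +' !0))))) == ((!1 +' (!0 +' (#4 +' (!0 +' !0)))) +' ((!1 +' (#5 +' (!1 +' !0))) +' ((#3 +' (!0 +' !0)) +' ((#0 +' !0) +' (!0 +' !0)))))) ((low-bad′ 2 D≤0) , (low-bad′ 3 D≤0) , (low-bad′ 4 D≤0) , (low-bad 2 D≤0) , (low-bad 3 D≤0) , (low-bad 4 D≤0) , tt)) (sym (bad-shift t (+ 3 ∷ + 4 ∷ + 2 ∷ D ∷ + 2 ∷ [])))) , λ f → (lia ((f e) & (f d) & (f b) & (f a) & (f c) & []) ([]) ((#0 +' (#1 +' (#2 +' (#3 +' (#4 +' !0))))) == (#3 +' (#2 +' (#4 +' (#1 +' (#0 +' !0)))))) (tt))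

 record Move₇ (z a b c d e y p q r s t : ℤ) : Set where
   constructor move
   field
     i       : Row
     i∈rows  : i ∈ rows
     shaped  : prop (shape i (target i)) (p ∷ q ∷ r ∷ s ∷ t ∷ [])
     back    : a ∷ b ∷ c ∷ d ∷ e ∷ [] ≡ Vec.map (lookup (p ∷ q ∷ r ∷ s ∷ t ∷ [])) (target i)
     good    : Good a b c d e (p ∷ q ∷ r ∷ s ∷ t ∷ [])
     left    : prop (leftShape ix7 and leftStuck ix7) (z ∷ a ∷ b ∷ c ∷ d ∷ e ∷ y ∷ [])
     right   : prop (rightShape ix7 and rightStuck ix7) (z ∷ p ∷ q ∷ r ∷ s ∷ t ∷ y ∷ [])

 Forward Backward : Row → Set
 Forward i = ∀ z a b c d e y → let ρ = z ∷ a ∷ b ∷ c ∷ d ∷ e ∷ y ∷ [] in prop (leftShape ix7 and leftStuck ix7) ρ →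
   prop (shape i (middle ix7) and rightShape (permuted (source i) ix7) and rightStuck (permuted (source i) ix7)) ρ →
   ∃[ p ] ∃[ q ] ∃[ r ] ∃[ s ] ∃[ t ] Move₇ z a b c d e y p q r s t
 Backward i = ∀ z p q r s t y → let ρ = z ∷ p ∷ q ∷ r ∷ s ∷ t ∷ y ∷ [] in prop (rightShape ix7 and rightStuck ix7) ρ →
   prop (shape i (middle (permuted (target i) ix7)) and leftShape (permuted (target i) ix7) and leftStuck (permuted (target i) ix7)) ρ →
   ∃[ a ] ∃[ b ] ∃[ c ] ∃[ d ] ∃[ e ] Move₇ z a b c d e y p q r s t

 forwards : All Forward rows
 forwards =
     (λ z a b c d e y l (h , rt) → d , e , a , b , c , move _ (here refl) h refl (good₀ a b c d e h) l rt)
   ∷ (λ z a b c d e y l (h , rt) → e , d , a , b , c , move _ (there (here refl)) h refl (good₁ a b c d e h) l rt)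
   ∷ (λ z a b c d e y l (h , rt) → d , e , c , a , b , move _ (there (there (here refl))) h refl (good₂ a b c d e h) l rt)
   ∷ (λ z a b c d e y l (h , rt) → d , e , b , a , c , move _ (there (there (there (here refl)))) h refl (good₃ a b c d e h) l rt)
   ∷ (λ z a b c d e y l (h , rt) → d , e , a , c , b , move _ (there (there (there (there (here refl))))) h refl (good₄ a b c d e h) l rt)
   ∷ (λ z a b c d e y l (h , rt) → d , e , c , b , a , move _ (there (there (there (there (there (here refl)))))) h refl (good₅ a b c d e h) l rt)
   ∷ (λ z a b c d e y l (h , rt) → d , e , c , a , b , move _ (there (there (there (there (there (there (here refl))))))) h refl (good₆ a b c d e h) l rt)
   ∷ (λ z a b c d e y l (h , rt) → d , e , b , a , c , move _ (there (there (there (there (there (there (there (here refl)))))))) h refl (good₇ a b c d e h) l rt)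
   ∷ (λ z a b c d e y l (h , rt) → d , e , a , c , b , move _ (there (there (there (there (there (there (there (there (here refl))))))))) h refl (good₈ a b c d e h) l rt)
   ∷ (λ z a b c d e y l (h , rt) → d , e , c , b , a , move _ (there (there (there (there (there (there (there (there (there (here refl)))))))))) h refl (good₉ a b c d e h) l rt)
   ∷ (λ z a b c d e y l (h , rt) → d , e , b , c , a , move _ (there (there (there (there (there (there (there (there (there (there (here refl))))))))))) h refl (good₁₀ a b c d e h) l rt)
   ∷ (λ z a b c d e y l (h , rt) → d , e , c , b , a , move _ (there (there (there (there (there (there (there (there (there (there (there (here refl)))))))))))) h refl (good₁₁ a b c d e h) l rt)
   ∷ (λ z a b c d e y l (h , rt) → e , d , c , a , b , move _ (there (there (there (there (there (there (there (there (there (there (there (there (here refl))))))))))))) h refl (good₁₂ a b c d e h) l rt)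
   ∷ (λ z a b c d e y l (h , rt) → e , d , b , a , c , move _ (there (there (there (there (there (there (there (there (there (there (there (there (there (here refl)))))))))))))) h refl (good₁₃ a b c d e h) l rt)
   ∷ (λ z a b c d e y l (h , rt) → e , d , a , c , b , move _ (there (there (there (there (there (there (there (there (there (there (there (there (there (there (here refl))))))))))))))) h refl (good₁₄ a b c d e h) l rt)
   ∷ (λ z a b c d e y l (h , rt) → e , d , a , c , b , move _ (there (there (there (there (there (there (there (there (there (there (there (there (there (there (there (here refl)))))))))))))))) h refl (good₁₅ a b c d e h) l rt)
   ∷ (λ z a b c d e y l (h , rt) → e , d , b , a , c , move _ (there (there (there (there (there (there (there (there (there (there (there (there (there (there (there (there (here refl))))))))))))))))) h refl (good₁₆ a b c d e h) l rt)
   ∷ []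

 backwards : All Backward rows
 backwards =
     (λ z p q r s t y rt (h , l) → r , s , t , p , q , move _ (here refl) h refl (good₀ r s t p q h) l rt)
   ∷ (λ z p q r s t y rt (h , l) → r , s , t , q , p , move _ (there (here refl)) h refl (good₁ r s t q p h) l rt)
   ∷ (λ z p q r s t y rt (h , l) → s , t , r , p , q , move _ (there (there (here refl))) h refl (good₂ s t r p q h) l rt)
   ∷ (λ z p q r s t y rt (h , l) → s , r , t , p , q , move _ (there (there (there (here refl)))) h refl (good₃ s r t p q h) l rt)
   ∷ (λ z p q r s t y rt (h , l) → r , t , s , p , q , move _ (there (there (there (there (here refl))))) h refl (good₄ r t s p q h) l rt)
   ∷ (λ z p q r s t y rt (h , l) → t , s , r , p , q , move _ (there (there (there (there (there (here refl)))))) h refl (good₅ t s r p q h) l rt)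
   ∷ (λ z p q r s t y rt (h , l) → s , t , r , p , q , move _ (there (there (there (there (there (there (here refl))))))) h refl (good₆ s t r p q h) l rt)
   ∷ (λ z p q r s t y rt (h , l) → s , r , t , p , q , move _ (there (there (there (there (there (there (there (here refl)))))))) h refl (good₇ s r t p q h) l rt)
   ∷ (λ z p q r s t y rt (h , l) → r , t , s , p , q , move _ (there (there (there (there (there (there (there (there (here refl))))))))) h refl (good₈ r t s p q h) l rt)
   ∷ (λ z p q r s t y rt (h , l) → t , s , r , p , q , move _ (there (there (there (there (there (there (there (there (there (here refl)))))))))) h refl (good₉ t s r p q h) l rt)
   ∷ (λ z p q r s t y rt (h , l) → t , r , s , p , q , move _ (there (there (there (there (there (there (there (there (there (there (here refl))))))))))) h refl (good₁₀ t r s p q h) l rt)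
   ∷ (λ z p q r s t y rt (h , l) → t , s , r , p , q , move _ (there (there (there (there (there (there (there (there (there (there (there (here refl)))))))))))) h refl (good₁₁ t s r p q h) l rt)
   ∷ (λ z p q r s t y rt (h , l) → s , t , r , q , p , move _ (there (there (there (there (there (there (there (there (there (there (there (there (here refl))))))))))))) h refl (good₁₂ s t r q p h) l rt)
   ∷ (λ z p q r s t y rt (h , l) → s , r , t , q , p , move _ (there (there (there (there (there (there (there (there (there (there (there (there (there (here refl)))))))))))))) h refl (good₁₃ s r t q p h) l rt)
   ∷ (λ z p q r s t y rt (h , l) → r , t , s , q , p , move _ (there (there (there (there (there (there (there (there (there (there (there (there (there (there (here refl))))))))))))))) h refl (good₁₄ r t s q p h) l rt)
   ∷ (λ z p q r s t y rt (h , l) → r , t , s , q , p , move _ (there (there (there (there (there (there (there (there (there (there (there (there (there (there (there (here refl)))))))))))))))) h refl (good₁₅ r t s q p h) l rt)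
   ∷ (λ z p q r s t y rt (h , l) → s , r , t , q , p , move _ (there (there (there (there (there (there (there (there (there (there (there (there (there (there (there (there (here refl))))))))))))))))) h refl (good₁₆ s r t q p h) l rt)
   ∷ []

 anyᶠ-rows : ∀ {n} (f : Row → Form n) rs ρ → prop (anyᶠ (map f rs)) ρ → Any (λ r → prop (f r) ρ) rs
 anyᶠ-rows f []       ρ ()
 anyᶠ-rows f (r ∷ rs) ρ (inl h) = here h
 anyᶠ-rows f (r ∷ rs) ρ (inr h) = there (anyᶠ-rows f rs ρ h)

 east-forward : ∀ z a b c d e y → let ρ = z ∷ a ∷ b ∷ c ∷ d ∷ e ∷ y ∷ [] in prop (leftShape ix7 and leftStuck ix7) ρ → prop (concentrated ix7) ρ →
   ∃[ p ] ∃[ q ] ∃[ r ] ∃[ s ] ∃[ t ] Move₇ z a b c d e y p q r s t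
 east-forward z a b c d e y l@((l₁ , l₂ , l₃ , l₄ , l₅) , st) cr = All.lookupWith (λ f → f z a b c d e y l) forwards
   (anyᶠ-rows (λ i → shape i (middle ix7) and rightShape (permuted (source i) ix7) and rightStuck (permuted (source i) ix7)) rows (z ∷ a ∷ b ∷ c ∷ d ∷ e ∷ y ∷ []) (prove forwardᶠ forward-valid (z ∷ a ∷ b ∷ c ∷ d ∷ e ∷ y ∷ []) ((l₁ , l₂ , l₃ , l₄ , l₅) , st , cr)))

 east-backward : ∀ z p q r s t y → let ρ = z ∷ p ∷ q ∷ r ∷ s ∷ t ∷ y ∷ [] in prop (rightShape ix7 and rightStuck ix7) ρ → prop (concentrated ix7) ρ →
   ∃[ a ] ∃[ b ] ∃[ c ] ∃[ d ] ∃[ e ] Move₇ z a b c d e y p q r s t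
 east-backward z p q r s t y rt@((l₁ , l₂ , l₃ , l₄ , l₅) , st) cr = All.lookupWith (λ f → f z p q r s t y rt) backwards
   (anyᶠ-rows (λ i → shape i (middle (permuted (target i) ix7)) and leftShape (permuted (target i) ix7) and leftStuck (permuted (target i) ix7)) rows (z ∷ p ∷ q ∷ r ∷ s ∷ t ∷ y ∷ []) (prove backwardᶠ backward-valid (z ∷ p ∷ q ∷ r ∷ s ∷ t ∷ y ∷ []) ((l₁ , l₂ , l₃ , l₄ , l₅) , st , cr)))

 allRows-lookup : ∀ p rs → allRows p rs ≡ true → ∀ {r} → r ∈ rs → p r ≡ true
 allRows-lookup p (r ∷ rs) eq (here refl) with p r
 ... | true = refl
 allRows-lookup p (r ∷ rs) eq (there m) with p r
 ... | true = allRows-lookup p rs eq m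

 same-map : ∀ {n} (u w : Vec (Fin n) 5) ρ → prop (same u w) ρ → Vec.map (lookup ρ) u ≡ Vec.map (lookup ρ) w
 same-map (five₅ _ _ _ _ _) (five₅ _ _ _ _ _) ρ ((p , p′) , (q , q′) , (r , r′) , (s , s′) , (t , t′)) =
   cong₂ _∷_ (both p p′) (cong₂ _∷_ (both q q′) (cong₂ _∷_ (both r r′) (cong₂ _∷_ (both s s′) (cong (_∷ []) (both t t′)))))
   where
   both : ∀ {x y} → x + + 0 ≤ y → y + + 0 ≤ x → x ≡ y
   both {x} {y} h k = (lia (x & y & []) (#0 +' !0 <= #1 & #1 +' !0 <= #0 & []) (#0 == #1) (h , k , tt))

 move₇-unique : ∀ {z a b c d e y p q r s t a′ b′ c′ d′ e′} → Move₇ z a b c d e y p q r s t → Move₇ z a′ b′ c′ d′ e′ y p q r s t →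
   _≡_ {A = Vec ℤ 5} (a ∷ b ∷ c ∷ d ∷ e ∷ []) (a′ ∷ b′ ∷ c′ ∷ d′ ∷ e′ ∷ [])
 move₇-unique {p = p} {q} {r} {s} {t} (move i i∈ sh bk _ _ _) (move j j∈ sh′ bk′ _ _ _) =
   trans bk (trans (same-map (target i) (target j) (p ∷ q ∷ r ∷ s ∷ t ∷ [])
     (prove (unambiguous i j) (allRows-lookup (λ r′ → valid (unambiguous i r′)) rows (allRows-lookup (λ r → allRows (λ r′ → valid (unambiguous r r′)) rows) rows unambiguous-valid i∈) j∈) (p ∷ q ∷ r ∷ s ∷ t ∷ []) (sh , sh′))) (sym bk′))

module Local where

 open East
 open Rows
 open Lia
 open Dbm using (Form; atom; atLeast; _and_; _or_; _imp_; sumχ; prove; valid; prop; eval)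
 open Win
 open Stats
 open Words using (1≰0)
 open Moves using (if-true; if-false; +1-1)
 open import Defs hiding (maximum)
 open import Data.Bool.Base using (if_then_else_)
 open import Data.Integer.Base using (_<_)
 open import Data.Integer.Properties using (_<?_; ≤-totalOrder)
 open import Data.List.Extrema ≤-totalOrder using (min; min≤⊤; min≤xs; v≤min⁺)
 open import Data.List.Relation.Unary.Linked using ([]; _∷_)
 open import Data.Product.Base using (_,_)
 open import Data.Sum.Base using (_⊎_)
 open import Relation.Nullary.Decidable using (dec-true; dec-false; _×-dec_)

 -- A local move, from the letters after the first to the letters of the image;
 -- the boundary is before the last two (three) letters.
 data Move₅ (a b c d e : ℤ) : ℤ → ℤ → Set where
   keep : b ≤ c + + 1 → d + + 2 ≤ b → c ≤ e + + 1 → Move₅ a b c d e b c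
   swap : b ≤ e + + 1 → c + + 2 ≤ b ⊎ b ≤ d + + 1 → Move₅ a b c d e c b

 east₅-with : ∀ a b c d e p q → bk (b ∷ c ∷ []) ≡ p ∷ q ∷ [] → East₅ (a ∷ b ∷ c ∷ d ∷ e ∷ []) ≡
   (if does ((d + + 1 <? b) ×-dec (q ≤? e + + 1)) then just (a ∷ d ∷ p ∷ q ∷ e ∷ [])
    else if does ((b ≤? d + + 1) ×-dec (b ≤? e + + 1)) then just (a ∷ d ∷ c ∷ b ∷ e ∷ []) else nothing)
 east₅-with a b c d e p q eq rewrite eq = refl

 apart : ∀ d b → d + + 2 ≤ b → d + + 1 < b
 apart d b h = ℤ.suc[i]≤j⇒i<j (lia (d & b & []) (#0 +' !2 <= #1 & []) (!1 +' (#0 +' !1) <= #1) (h , tt))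

 ¬apart : ∀ d b → b ≤ d + + 1 → ¬ d + + 1 < b
 ¬apart d b h k = 1≰0 (lia (d & b & []) (!1 +' (#0 +' !1) <= #1 & #1 <= #0 +' !1 & []) (!1 <= !0) ((ℤ.i<j⇒suc[i]≤j k) , h , tt))

 ¬≤ : ∀ {x y} → y + + 1 ≤ x → ¬ x ≤ y
 ¬≤ {x} {y} h k = 1≰0 (lia (y & x & []) (#0 +' !1 <= #1 & #1 <= #0 & []) (!1 <= !0) (h , k , tt))

 east₅-move : ∀ {a b c d e p q} → c ≤ b + + 1 → d + + 2 ≤ c → Move₅ a b c d e p q →
   East₅ (a ∷ b ∷ c ∷ d ∷ e ∷ []) ≡ just (a ∷ d ∷ p ∷ q ∷ e ∷ [])
 east₅-move {a} {b} {c} {d} {e} h k (keep p q r) = trans (east₅-with a b c d e b c (bk-keep p h)) (if-true (dec-true ((d + + 1 <? b) ×-dec (c ≤? e + + 1)) (apart d b q , r)))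
 east₅-move {a} {b} {c} {d} {e} h k (swap p (inl q)) = trans (east₅-with a b c d e c b (bk-swap q))
   (if-true (dec-true ((d + + 1 <? b) ×-dec (b ≤? e + + 1)) (apart d b (lia (c & b & d & []) (#0 +' !2 <= #1 & #2 +' !2 <= #0 & []) (#2 +' !2 <= #1) (q , k , tt)) , p)))
 east₅-move {a} {b} {c} {d} {e} h k (swap p (inr q)) = trans (east₅-with a b c d e b c (bk-keep (lia (b & d & c & []) (#0 <= #1 +' !1 & #1 +' !2 <= #2 & []) (#0 <= #2 +' !1) (q , k , tt)) h))
   (trans (if-false (dec-false ((d + + 1 <? b) ×-dec (c ≤? e + + 1)) λ l → ¬apart d b q (fst l)))
     (if-true (dec-true ((b ≤? d + + 1) ×-dec (b ≤? e + + 1)) (q , p))))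

 Stuck₅ : (b c d e : ℤ) → Set
 Stuck₅ b c d e = (b ≤ c + + 1 × e + + 2 ≤ c × d + + 2 ≤ b) ⊎ (c + + 2 ≤ b × e + + 2 ≤ b) ⊎ (b ≡ e + + 2 × c ≡ e + + 3 × d ≡ e + + 1)

 east₅-stuck : ∀ {a b c d e} → c ≤ b + + 1 → d + + 2 ≤ c → Stuck₅ b c d e → East₅ (a ∷ b ∷ c ∷ d ∷ e ∷ []) ≡ nothing
 east₅-stuck {a} {b} {c} {d} {e} h k (inl (p , q , r)) = trans (east₅-with a b c d e b c (bk-keep p h))
   (trans (if-false (dec-false ((d + + 1 <? b) ×-dec (c ≤? e + + 1)) λ l → ¬≤ (lia (e & c & []) (#0 +' !2 <= #1 & []) (#0 +' !1 +' !1 <= #1) (q , tt)) (snd l)))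
     (if-false (dec-false ((b ≤? d + + 1) ×-dec (b ≤? e + + 1)) λ l → ¬≤ (lia (d & b & []) (#0 +' !2 <= #1 & []) (#0 +' !1 +' !1 <= #1) (r , tt)) (fst l))))
 east₅-stuck {a} {b} {c} {d} {e} h k (inr (inl (p , q))) = trans (east₅-with a b c d e c b (bk-swap p))
   (trans (if-false (dec-false ((d + + 1 <? b) ×-dec (b ≤? e + + 1)) λ l → ¬≤ (lia (e & b & []) (#0 +' !2 <= #1 & []) (#0 +' !1 +' !1 <= #1) (q , tt)) (snd l)))
     (if-false (dec-false ((b ≤? d + + 1) ×-dec (b ≤? e + + 1)) λ l → ¬≤ (lia (e & b & []) (#0 +' !2 <= #1 & []) (#0 +' !1 +' !1 <= #1) (q , tt)) (snd l))))
 east₅-stuck {a} {b} {c} {d} {e} h k (inr (inr (p , q , r))) = trans (east₅-with a b c d e b c (bk-keep (lia (b & e & c & []) (#0 == #1 +' !2 & #2 == #1 +' !3 & []) (#0 <= #2 +' !1) (p , q , tt)) h))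
   (trans (if-false (dec-false ((d + + 1 <? b) ×-dec (c ≤? e + + 1)) λ l → ¬≤ (lia (c & e & []) (#0 == #1 +' !3 & []) (#1 +' !1 +' !1 <= #0) (q , tt)) (snd l)))
     (if-false (dec-false ((b ≤? d + + 1) ×-dec (b ≤? e + + 1)) λ l → ¬≤ (lia (b & e & []) (#0 == #1 +' !2 & []) (#1 +' !1 +' !1 <= #0) (p , tt)) (snd l))))

 east₅-total : ∀ {a b c d e} → c ≤ b + + 1 → d + + 2 ≤ c → d ≤ e + + 1 → Stuck₅ b c d e ⊎ ∃[ p ] ∃[ q ] Move₅ a b c d e p q
 east₅-total {a} {b} {c} {d} {e} h k l with split b (c + + 1) | split b (e + + 1) | split b (d + + 1) | split c (e + + 1)
 ... | inr p | inl q | _      | _      = inr (c , b , swap q (inl (lia (c & b & []) (#0 +' !1 +' !1 <= #1 & []) (#0 +' !2 <= #1) (p , tt))))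
 ... | inr p | inr q | _      | _      = inl (inr (inl ((lia (c & b & []) (#0 +' !1 +' !1 <= #1 & []) (#0 +' !2 <= #1) (p , tt)) , (lia (e & b & []) (#0 +' !1 +' !1 <= #1 & []) (#0 +' !2 <= #1) (q , tt)))))
 ... | inl p | inl q | inl r | _      = inr (c , b , swap q (inr r))
 ... | inl p | inr q | inl r | _      = inl (inr (inr ((lia (e & b & d & []) (#0 +' !1 +' !1 <= #1 & #1 <= #2 +' !1 & #2 <= #0 +' !1 & []) (#1 == #0 +' !2) (q , r , l , tt)) ,
     (lia (e & b & d & c & []) (#0 +' !1 +' !1 <= #1 & #1 <= #2 +' !1 & #2 <= #0 +' !1 & #3 <= #1 +' !1 & #2 +' !2 <= #3 & []) (#3 == #0 +' !3) (q , r , l , h , k , tt)) , (lia (e & b & d & []) (#0 +' !1 +' !1 <= #1 & #1 <= #2 +' !1 & #2 <= #0 +' !1 & []) (#2 == #0 +' !1) (q , r , l , tt)))))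
 ... | inl p | _      | inr r | inl s = inr (b , c , keep p (lia (d & b & []) (#0 +' !1 +' !1 <= #1 & []) (#0 +' !2 <= #1) (r , tt)) s)
 ... | inl p | _      | inr r | inr s = inl (inl (p , (lia (e & c & []) (#0 +' !1 +' !1 <= #1 & []) (#0 +' !2 <= #1) (s , tt)) , (lia (d & b & []) (#0 +' !1 +' !1 <= #1 & []) (#0 +' !2 <= #1) (r , tt))))

 -- The five-letter windows z, d | p, q, e that are not images.
 Blocked₅ : (a d p q : ℤ) → Set
 Blocked₅ a d p q = (q ≤ p + + 1 × a + + 2 ≤ p × d + + 2 ≤ q) ⊎ (p + + 2 ≤ q × a + + 2 ≤ q) ⊎ (d ≡ a + + 1 × p ≡ a + + 3 × q ≡ a + + 2)

 record Unmoved (a d p q e : ℤ) : Set where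
   constructor unmoved
   field
     {b c}  : ℤ
     moved  : Move₅ a b c d e p q
     b≤a+1  : b ≤ a + + 1
     c≤b+1  : c ≤ b + + 1
     d+2≤c  : d + + 2 ≤ c
     d≤e+1  : d ≤ e + + 1

 unmove₅ : ∀ {a d p q e} → d ≤ a + + 1 → d + + 2 ≤ p → p ≤ q + + 1 → q ≤ e + + 1 → Blocked₅ a d p q ⊎ Unmoved a d p q e
 unmove₅ {a} {d} {p} {q} {e} g h k l with split q (p + + 1) | split q (d + + 1) | split p (a + + 1) | split q (a + + 1)
 ... | inr r | _      | _      | inl u = inr (unmoved (swap l (inl (lia (p & q & []) (#0 +' !1 +' !1 <= #1 & []) (#0 +' !2 <= #1) (r , tt)))) u (lia (p & q & []) (#0 +' !1 +' !1 <= #1 & []) (#0 <= #1 +' !1) (r , tt)) h (lia (d & p & q & e & []) (#0 +' !2 <= #1 & #1 <= #2 +' !1 & #2 <= #3 +' !1 & []) (#0 <= #3 +' !1) (h , k , l , tt)))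
 ... | inr r | _      | _      | inr u = inl (inr (inl ((lia (p & q & []) (#0 +' !1 +' !1 <= #1 & []) (#0 +' !2 <= #1) (r , tt)) , (lia (a & q & []) (#0 +' !1 +' !1 <= #1 & []) (#0 +' !2 <= #1) (u , tt)))))
 ... | inl r | inr s | inl t | _      = inr (unmoved (keep k h l) t r (lia (d & q & []) (#0 +' !1 +' !1 <= #1 & []) (#0 +' !2 <= #1) (s , tt)) (lia (d & p & q & e & []) (#0 +' !2 <= #1 & #1 <= #2 +' !1 & #2 <= #3 +' !1 & []) (#0 <= #3 +' !1) (h , k , l , tt)))
 ... | inl r | inr s | inr t | _      = inl (inl (r , (lia (a & p & []) (#0 +' !1 +' !1 <= #1 & []) (#0 +' !2 <= #1) (t , tt)) , (lia (d & q & []) (#0 +' !1 +' !1 <= #1 & []) (#0 +' !2 <= #1) (s , tt))))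
 ... | inl r | inl s | _      | inl u = inr (unmoved (swap l (inr s)) u k h (lia (d & p & q & e & []) (#0 +' !2 <= #1 & #1 <= #2 +' !1 & #2 <= #3 +' !1 & []) (#0 <= #3 +' !1) (h , k , l , tt)))
 ... | inl r | inl s | _      | inr u = inl (inr (inr ((lia (q & d & a & []) (#0 <= #1 +' !1 & #2 +' !1 +' !1 <= #0 & #1 <= #2 +' !1 & []) (#1 == #2 +' !1) (s , u , g , tt)) ,
     (lia (q & d & a & p & []) (#0 <= #1 +' !1 & #2 +' !1 +' !1 <= #0 & #1 <= #2 +' !1 & #1 +' !2 <= #3 & #3 <= #0 +' !1 & []) (#3 == #2 +' !3) (s , u , g , h , k , tt)) , (lia (q & d & a & []) (#0 <= #1 +' !1 & #2 +' !1 +' !1 <= #0 & #1 <= #2 +' !1 & []) (#0 == #2 +' !2) (s , u , g , tt)))))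

 move₅-unique : ∀ {a b c d e p q b′ c′} → c ≤ b + + 1 → c′ ≤ b′ + + 1 → d + + 2 ≤ c → d + + 2 ≤ c′ → Move₅ a b c d e p q → Move₅ a b′ c′ d e p q → b ≡ b′ × c ≡ c′
 move₅-unique _ _ _ _ (keep _ _ _) (keep _ _ _) = refl , refl
 move₅-unique _ _ _ _ (swap _ _)   (swap _ _)   = refl , refl
 move₅-unique {a} {b} {c} {d} f g h k (keep p q r) (swap s (inl t)) = ⊥-elim (1≰0 (lia (b & c & []) (#0 +' !2 <= #1 & #1 <= #0 +' !1 & []) (!1 <= !0) (t , f , tt)))
 move₅-unique {a} {b} {c} {d} f g h k (keep p q r) (swap s (inr t)) = ⊥-elim (1≰0 (lia (c & d & []) (#0 <= #1 +' !1 & #1 +' !2 <= #0 & []) (!1 <= !0) (t , h , tt)))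
 move₅-unique {a} {b} {c} {d} f g h k (swap p (inl q)) (keep r s t) = ⊥-elim (1≰0 (lia (c & b & []) (#0 +' !2 <= #1 & #1 <= #0 +' !1 & []) (!1 <= !0) (q , g , tt)))
 move₅-unique {a} {b} {c} {d} f g h k (swap p (inr q)) (keep r s t) = ⊥-elim (1≰0 (lia (b & d & []) (#0 <= #1 +' !1 & #1 +' !2 <= #0 & []) (!1 <= !0) (q , k , tt)))

module Steps where

 open East
 open Rows
 open Local
 open Words
 open Extract hiding (mid)
 open Moves
 open Lia
 open Dbm using (Form; atom; atLeast; _and_; _or_; _imp_; sumχ; prove; valid; prop; eval)
 open Win
 open Stats
 open import Defs hiding (maximum)
 open import Data.Bool.Base using (if_then_else_)
 open import Data.Integer.Base using (_<_)
 open import Data.Integer.Properties using (≤-totalOrder)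
 open import Data.List.Base using (map; head)
 open import Data.List.Extrema ≤-totalOrder using (min; min≤⊤; min≤xs; v≤min⁺)
 open import Data.List.Relation.Unary.Linked using ([]; [-]; _∷_)
 open import Data.Maybe.Base using (maybe′)
 open import Data.Product.Base using (_,_)
 open import Data.Sum.Base using (_⊎_)
 open import Relation.Nullary.Decidable using (dec-true; dec-false)
 open import Data.Maybe.Properties using (just-injective)
 import Data.List.Relation.Unary.All.Properties as All

 ins-++ : ∀ {w C x} V → Ins w C x → Ins w (C ++ V) (x ++ V)
 ins-++ {w} V (ins P R refl refl lt bl h) = ins P (R ++ V) (List.++-assoc P (w ∷ R) V) (List.++-assoc P (w ∷ w + + 1 ∷ R) V) lt bl h

 inserted-++ : ∀ {us C y} V → Inserted us C y → Dyck (C ++ V) → Inserted us (C ++ V) (y ++ V)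
 inserted-++ V ([] _)  d = [] d
 inserted-++ V (i ∷ r) d = ins-++ V i ∷ inserted-++ V r d

 inserted-unique : ∀ {us C y y′} → Inserted us C y → Inserted us C y′ → y ≡ y′
 inserted-unique r r′ = just-injective (trans (sym (inserted-inject r)) (inserted-inject r′))

 -- Lists that can be injected from right to left into C so that the leftmost
 -- extractable element is always the one injected last.
 data Pushable (C : List ℤ) : List ℤ → Set where
   last : ∀ {u} → Adm u C → Pushable C (u ∷ [])
   push : ∀ {u v us} → + 0 ≤ u → u ≤ v + + 1 → Pushable C (v ∷ us) → Pushable C (u ∷ v ∷ us)

 pushable⇒inserted : ∀ {us C} → Dyck C → Pushable C us → ∃[ y ] Inserted us C y
 pushable⇒inserted d (last a) with adm⇒ins a
 ... | y , i = y , i ∷ [] d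
 pushable⇒inserted d (push h k p) with pushable⇒inserted d p
 ... | z , i ∷ r with adm⇒ins (adm-push (inserted-dyck r) i h k)
 ...   | y , j = y , j ∷ i ∷ r

 inserted⇒pushable : ∀ {u us C y} → Inserted (u ∷ us) C y → Pushable C (u ∷ us)
 inserted⇒pushable (i ∷ [] _)     = last (ins⇒adm i)
 inserted⇒pushable (i ∷ r@(j ∷ q)) = push (Ins.0≤w i) (adm-pop (inserted-dyck q) j (ins⇒adm i)) (inserted⇒pushable r)

 inserted-∷ʳ : ∀ {us C C′ y w} → Inserted us C y → Ins w C′ C → Dyck C′ → Inserted (us ∷ʳ w) C′ y
 inserted-∷ʳ ([] _)  i d = i ∷ [] d
 inserted-∷ʳ (j ∷ r) i d = j ∷ inserted-∷ʳ r i d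

 rebase : ∀ us {w C C′} → Pushable C (us ∷ʳ w) → Adm w C′ → Pushable C′ (us ∷ʳ w)
 rebase []           _              a = last a
 rebase (u ∷ [])     (push h k p)   a = push h k (last a)
 rebase (u ∷ v ∷ us) (push h k p)   a = push h k (rebase (v ∷ us) p a)

 affine-prefix : ∀ C V → AffineDyck (C ++ V) → AffineDyck C
 affine-prefix []          V l       = []
 affine-prefix (c ∷ [])    V l       = [-]
 affine-prefix (c ∷ d ∷ C) V (h ∷ l) = h ∷ affine-prefix (d ∷ C) V l

 dyck-++ˡ : ∀ D {v} V → Dyck ((D ∷ʳ v) ++ V) → Dyck (D ∷ʳ v)
 dyck-++ˡ D {v} V (h , l , nn) = trans (same-head D) h , affine-prefix (D ∷ʳ v) V l , All.++⁻ˡ (D ∷ʳ v) nn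
   where
   same-head : ∀ D → head (D ∷ʳ v) ≡ head ((D ∷ʳ v) ++ V)
   same-head []      = refl
   same-head (x ∷ D) = refl

 -- If the extractions take place before V, then V is merely carried along.
 localize : ∀ us D {v w V x} → Inserted (us ∷ʳ w) ((D ∷ʳ v) ++ V) x → Adm w (D ∷ʳ v) →
   ∃[ X ] (x ≡ X ++ V × Inserted (us ∷ʳ w) (D ∷ʳ v) X)
 localize us D {v} {w} {V} r a with pushable⇒inserted (dyck-++ˡ D V (inserted-base r)) (rebase us (pushed us r) a)
   where
   pushed : ∀ us {x C} → Inserted (us ∷ʳ w) C x → Pushable C (us ∷ʳ w)
   pushed []       r = inserted⇒pushable r
   pushed (u ∷ us) r = inserted⇒pushable r
 ... | X , q = X , inserted-unique r (inserted-++ V q (inserted-base r)) , q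

 rearranged-refl : ∀ xs → Rearranged xs xs
 rearranged-refl xs = refl , λ _ → refl

 cross-rows : ∀ X W → cross X W ≡ sumBy (λ u → sumBy (bd u) W) X
 cross-rows []      W = refl
 cross-rows (u ∷ X) W = cong (_+_ (sumBy (bd u) W)) (cross-rows X W)

 rearranged-bad : ∀ {xs ys} A → Rearranged xs ys → bad (A ++ ys) ≡ bad (A ++ xs)
 rearranged-bad {xs} {ys} A (b , s) = trans (bad-++ A ys) (trans (cong₂ _+_ (cong (_+_ (bad A)) same-cross) b) (sym (bad-++ A xs)))
   where
   same-cross : cross A ys ≡ cross A xs
   same-cross = trans (cross-rows A ys) (trans (sumBy-cong A (λ u → s (bd u))) (sym (cross-rows A xs)))

 rearranged-∷ʳ : ∀ {xs ys} y → Rearranged xs ys → Rearranged (xs ∷ʳ y) (ys ∷ʳ y)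
 rearranged-∷ʳ {xs} {ys} y (b , s) =
   trans (bad-++ ys (y ∷ [])) (trans (cong₂ (λ p q → p + q + + 0) b same-cross) (sym (bad-++ xs (y ∷ [])))) ,
   λ f → trans (sumBy-∷ʳ f ys y) (trans (cong (_+ f y) (s f)) (sym (sumBy-∷ʳ f xs y)))
   where
   same-cross : cross ys (y ∷ []) ≡ cross xs (y ∷ [])
   same-cross = trans (cross-rows ys (y ∷ [])) (trans (s (λ u → sumBy (bd u) (y ∷ []))) (sym (cross-rows xs (y ∷ []))))

 -- Replacing the letters V ++ ws after C by V′ ++ us turns one more letter into
 -- an injected one.
 record Raised (x y : List ℤ) : Set where
   constructor raised
   field
     dyck   : Dyck y
     length≡ : lenᶻ y ≡ lenᶻ x
     bad≡   : bad y ≡ bad x + + 1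
     total≡ : total y ≡ total x + + 1

 raise : ∀ {C V V′ ws us X Y} → Rearranged (V ++ ws) (V′ ++ us) → lenᶻ us ≡ lenᶻ ws + + 1 → Inserted ws C X → Inserted us C Y →
   Dyck (C ++ V′) → Raised (X ++ V) (Y ++ V′)
 raise {C} {V} {V′} {ws} {us} {X} {Y} re len p q d = raised (inserted-dyck (inserted-++ V′ q d))
   (lia ((lenᶻ (Y ++ V′)) & (lenᶻ Y) & (lenᶻ V′) & (lenᶻ (X ++ V)) & (lenᶻ X) & (lenᶻ V) & (lenᶻ (C ++ ws)) & (lenᶻ (C ++ us)) & (lenᶻ C) & (lenᶻ ws) & (lenᶻ us) & (sumBy (λ _ → + 1) (V ++ ws)) & (sumBy (λ _ → + 1) (V′ ++ us)) & []) (#0 == #1 +' #2 & #3 == #4 +' #5 & #4 == #6 & #1 == #7 & #6 == #8 +' #9 & #7 == #8 +' #10 & #11 == #5 +' #9 & #12 == #2 +' #10 & #12 == #11 & []) (#0 == #3) ((lenᶻ-++ Y V′) , (lenᶻ-++ X V) , (inserted-length p) , (inserted-length q) , (lenᶻ-++ C ws) , (lenᶻ-++ C us) , (counted V ws) , (counted V′ us) , (snd re (λ _ → + 1)) , tt))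
   (lia ((bad (X ++ V)) & (bad (C ++ V ++ ws)) & (lenᶻ ws) & (bad (Y ++ V′)) & (bad (C ++ V′ ++ us)) & (lenᶻ us) & []) (#0 == #1 +' #2 & #3 == #4 +' #5 & #4 == #1 & #5 == #2 +' !1 & []) (#3 == #0 +' !1) ((inserted-bad V p) , (inserted-bad V′ q) , (rearranged-bad C re) , len , tt))
   (lia ((total (Y ++ V′)) & (total Y) & (total V′) & (total (X ++ V)) & (total X) & (total V) & (total (C ++ ws)) & (lenᶻ ws) & (total (C ++ us)) & (lenᶻ us) & (total C) & (total ws) & (total us) & (total (V ++ ws)) & (total (V′ ++ us)) & []) (#0 == #1 +' #2 & #3 == #4 +' #5 & #4 == #6 +' #7 & #1 == #8 +' #9 & #6 == #10 +' #11 & #8 == #10 +' #12 & #13 == #5 +' #11 & #14 == #2 +' #12 & #14 == #13 & #9 == #7 +' !1 & []) (#0 == #3 +' !1) ((total-++ Y V′) , (total-++ X V) , (inserted-total p) , (inserted-total q) , (total-++ C ws) , (total-++ C us) , (total-++ V ws) , (total-++ V′ us) , (snd re (λ u → u)) , len , tt))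
   where
   counted : ∀ A B → sumBy (λ _ → + 1) (A ++ B) ≡ lenᶻ A + lenᶻ B
   counted A B = trans (ones (A ++ B)) (lenᶻ-++ A B)
     where
     ones : ∀ xs → sumBy (λ _ → + 1) xs ≡ lenᶻ xs
     ones []       = refl
     ones (x ∷ xs) = cong (_+_ (+ 1)) (ones xs)

 move₅-rearranged : ∀ {a b c d e p q} → c ≤ b + + 1 → d + + 2 ≤ c → Move₅ a b c d e p q → Rearranged (b ∷ c ∷ d ∷ e ∷ []) (d ∷ p ∷ q ∷ e ∷ [])
 move₅-rearranged {a} {b} {c} {d} {e} h k (keep p q r) =
   (lia ((bd b d) & (bd d b) & (bd c d) & (bd d c) & (bd d e) & (bd b c) & (bd b e) & (bd c e) & []) (#0 == !1 & #1 == !1 & #2 == !1 & #3 == !1 & []) ((#1 +' (#3 +' (#4 +' !0))) +' ((#5 +' (#6 +' !0)) +' ((#7 +' !0) +' (!0 +' !0))) == (#5 +' (#0 +' (#6 +' !0))) +' ((#2 +' (#7 +' !0)) +' ((#4 +' !0) +' (!0 +' !0)))) ((far-bad b d q) , (far-bad′ b d q) , (far-bad c d k) , (far-bad′ c d k) , tt)) ,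
   λ f → (lia ((f d) & (f b) & (f c) & (f e) & []) ([]) (#0 +' (#1 +' (#2 +' (#3 +' !0))) == #1 +' (#2 +' (#0 +' (#3 +' !0)))) (tt))
 move₅-rearranged {a} {b} {c} {d} {e} h k (swap p q) =
   (lia ((bd d c) & (bd d b) & (bd c b) & (bd b c) & (bd b d) & (bd c d) & (bd d e) & (bd c e) & (bd b e) & []) (#0 +' #1 +' #2 == #3 +' #4 +' #5 & []) ((#0 +' (#1 +' (#6 +' !0))) +' ((#2 +' (#7 +' !0)) +' ((#8 +' !0) +' (!0 +' !0))) == (#3 +' (#4 +' (#8 +' !0))) +' ((#5 +' (#7 +' !0)) +' ((#6 +' !0) +' (!0 +' !0)))) ((three q) , tt)) ,
   λ f → (lia ((f d) & (f c) & (f b) & (f e) & []) ([]) (#0 +' (#1 +' (#2 +' (#3 +' !0))) == #2 +' (#1 +' (#0 +' (#3 +' !0)))) (tt))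
   where
   three : c + + 2 ≤ b ⊎ b ≤ d + + 1 → bd d c + bd d b + bd c b ≡ bd b c + bd b d + bd c d
   three (inl l) = (lia (c & b & d & []) (#0 +' !2 <= #1 & #2 +' !2 <= #0 & []) (((#0 +' !2 <=? #2) +' (#2 +' !1 <=? #0)) +' ((#1 +' !2 <=? #2) +' (#2 +' !1 <=? #1)) +' ((#1 +' !2 <=? #0) +' (#0 +' !1 <=? #1)) == ((#0 +' !2 <=? #1) +' (#1 +' !1 <=? #0)) +' ((#2 +' !2 <=? #1) +' (#1 +' !1 <=? #2)) +' ((#2 +' !2 <=? #0) +' (#0 +' !1 <=? #2))) (l , k , tt))
   three (inr l) = (lia (b & d & c & []) (#0 <= #1 +' !1 & #1 +' !2 <= #2 & #2 <= #0 +' !1 & []) (((#2 +' !2 <=? #1) +' (#1 +' !1 <=? #2)) +' ((#0 +' !2 <=? #1) +' (#1 +' !1 <=? #0)) +' ((#0 +' !2 <=? #2) +' (#2 +' !1 <=? #0)) == ((#2 +' !2 <=? #0) +' (#0 +' !1 <=? #2)) +' ((#1 +' !2 <=? #0) +' (#0 +' !1 <=? #1)) +' ((#1 +' !2 <=? #2) +' (#2 +' !1 <=? #1))) (l , k , h , tt))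

 move₅-not-blocked : ∀ {a b c d e p q} → b ≤ a + + 1 → c ≤ b + + 1 → d + + 2 ≤ c → Move₅ a b c d e p q → ¬ Blocked₅ a d p q
 move₅-not-blocked {a} {b} {c} {d} g h k (keep p q r) (inl (s , t , u)) = 1≰0 (lia (b & a & []) (#0 <= #1 +' !1 & #1 +' !2 <= #0 & []) (!1 <= !0) (g , t , tt))
 move₅-not-blocked {a} {b} {c} {d} g h k (keep p q r) (inr (inl (s , t))) = 1≰0 (lia (b & c & []) (#0 +' !2 <= #1 & #1 <= #0 +' !1 & []) (!1 <= !0) (s , h , tt))
 move₅-not-blocked {a} {b} {c} {d} g h k (keep p q r) (inr (inr (s , t , u))) = 1≰0 (lia (b & a & []) (#0 <= #1 +' !1 & #0 == #1 +' !3 & []) (!1 <= !0) (g , t , tt))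
 move₅-not-blocked {a} {b} {c} {d} g h k (swap p (inl q)) (inl (s , t , u)) = 1≰0 (lia (c & b & []) (#0 +' !2 <= #1 & #1 <= #0 +' !1 & []) (!1 <= !0) (q , s , tt))
 move₅-not-blocked {a} {b} {c} {d} g h k (swap p (inr q)) (inl (s , t , u)) = 1≰0 (lia (b & d & []) (#0 <= #1 +' !1 & #1 +' !2 <= #0 & []) (!1 <= !0) (q , u , tt))
 move₅-not-blocked {a} {b} {c} {d} g h k (swap p q) (inr (inl (s , t))) = 1≰0 (lia (b & a & []) (#0 <= #1 +' !1 & #1 +' !2 <= #0 & []) (!1 <= !0) (g , t , tt))
 move₅-not-blocked {a} {b} {c} {d} g h k (swap p q) (inr (inr (s , t , u))) = 1≰0 (lia (b & a & []) (#0 <= #1 +' !1 & #0 == #1 +' !2 & []) (!1 <= !0) (g , u , tt))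

 Dense : Vec ℤ 7 → Set
 Dense x = ∃[ k ] + 5 ≤ nearby k x

 module Move₇Facts {z a b c d e y p q r s t : ℤ} (mv : Move₇ z a b c d e y p q r s t) where

   open Move₇ mv

   drop₇ : d + + 2 ≤ c
   drop₇ = fst (snd left)

   b≤a+1 : b ≤ a + + 1
   b≤a+1 = (lia (b & a & []) (#0 +' !-1 <= #1 & []) (#0 <= #1 +' !1) ((fst (snd (fst left))) , tt))

   c≤b+1 : c ≤ b + + 1
   c≤b+1 = (lia (c & b & []) (#0 +' !-1 <= #1 & []) (#0 <= #1 +' !1) ((fst (snd (snd (fst left)))) , tt))

   stuck₅ : Stuck₅ b c d e
   stuck₅ = go (snd (snd left))
     where
     go : _ → Stuck₅ b c d e
     go (inl (p , _ , q , r)) = inl ((lia (b & c & []) (#0 +' !-1 <= #1 & []) (#0 <= #1 +' !1) (p , tt)) , q , r)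
     go (inr (inl h)) = inr (inl h)
     go (inr (inr ((p , p′) , (q , q′) , (r , r′)))) = inr (inr ((lia (b & e & []) (#0 +' !-2 <= #1 & #1 +' !2 <= #0 & []) (#0 == #1 +' !2) (p , p′ , tt)) , (lia (c & e & []) (#0 +' !-3 <= #1 & #1 +' !3 <= #0 & []) (#0 == #1 +' !3) (q , q′ , tt)) , (lia (d & e & []) (#0 +' !-1 <= #1 & #1 +' !1 <= #0 & []) (#0 == #1 +' !1) (r , r′ , tt))))

   image-drop : q + + 2 ≤ r
   image-drop = fst (snd right)

   blocked₅ : Blocked₅ p q r s
   blocked₅ = go (snd (snd right))
     where
     go : _ → Blocked₅ p q r s
     go (inl (f , g , _ , h)) = inl ((lia (s & r & []) (#0 +' !-1 <= #1 & []) (#0 <= #1 +' !1) (f , tt)) , g , h)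
     go (inr (inl h)) = inr (inl h)
     go (inr (inr ((f , f′) , (g , g′) , (h , h′)))) = inr (inr ((lia (q & p & []) (#0 +' !-1 <= #1 & #1 +' !1 <= #0 & []) (#0 == #1 +' !1) (f , f′ , tt)) , (lia (r & p & []) (#0 +' !-3 <= #1 & #1 +' !3 <= #0 & []) (#0 == #1 +' !3) (g , g′ , tt)) , (lia (s & p & []) (#0 +' !-2 <= #1 & #1 +' !2 <= #0 & []) (#0 == #1 +' !2) (h , h′ , tt))))

   east₇ : Dense (z ∷ a ∷ b ∷ c ∷ d ∷ e ∷ y ∷ []) → East (z ∷ a ∷ b ∷ c ∷ d ∷ e ∷ y ∷ []) ≡ just (z ∷ p ∷ q ∷ r ∷ s ∷ t ∷ y ∷ [])
   east₇ (k , h) = trans (if-true (dec-true (eastDomain? (z ∷ a ∷ b ∷ c ∷ d ∷ e ∷ y ∷ [])) (far , affine , reverse)))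
     (cong (Maybe.map (λ w → z ∷ w ++ y ∷ [])) middle-image)
     where
     far : ¬ FarApartDecomposable (z ∷ a ∷ b ∷ c ∷ d ∷ e ∷ y ∷ [])
     far q = 1≰0 (lia ((nearby k (z ∷ a ∷ b ∷ c ∷ d ∷ e ∷ y ∷ [])) & []) (!5 <= #0 & #0 <= !4 & []) (!1 <= !0) (h , (decomposable-nearby k _ q) , tt))
     affine : AffineDyck (z ∷ a ∷ b ∷ c ∷ [])
     affine = (lia (a & z & []) (#0 +' !-1 <= #1 & []) (#0 <= #1 +' !1) ((fst (fst left)) , tt)) ∷ b≤a+1 ∷ c≤b+1 ∷ [-]
     reverse : ReverseDyck (d ∷ e ∷ y ∷ [])
     reverse = fst (snd (snd (snd (fst left)))) ∷ snd (snd (snd (snd (fst left)))) ∷ [-]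
     middle-image : eastMiddle a b c d e ≡ just (p ∷ q ∷ r ∷ s ∷ t ∷ [])
     middle-image = trans (if-false (dec-false (c ≤? d + + 1) (¬≤ (lia (d & c & []) (#0 +' !2 <= #1 & []) (#0 +' !1 +' !1 <= #1) (drop₇ , tt)))))
       (trans (cong (maybe′ just (eastMiddle₃₋₄ a b c d e)) (east₅-stuck c≤b+1 drop₇ stuck₅)) (fst good))

module Pre where

 open Steps
 open East
 open Rows
 open Local
 open Words
 open Extract hiding (mid)
 open Moves
 open Lia
 open Dbm using (Form; atom; atLeast; _and_; _or_; _imp_; sumχ; prove; valid; prop; eval)
 open Win
 open Stats
 open import Defs hiding (maximum)
 open import Data.Bool.Base using (if_then_else_)
 open import Data.Integer.Base using (_<_)
 open import Data.Integer.Properties using (≤-totalOrder)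
 open import Data.List.Base using (map)
 open import Data.List.Extrema ≤-totalOrder using (min; min≤⊤; min≤xs; v≤min⁺)
 open import Data.List.Relation.Unary.Linked using ([]; [-]; _∷_)
 open import Data.Maybe.Base using (maybe′)
 open import Data.Product.Base using (_,_)
 open import Relation.Nullary.Decidable using (dec-true; dec-false)
 open import Data.Maybe.Base using (_>>=_)
 open import Data.List.Base using (replicate)
 import Data.List.Relation.Unary.All.Properties as All

 zeroes : ℕ → List ℤ
 zeroes k = replicate k (+ 0)

 Sk-zeroes : ∀ k {E} → Sk E → Sk (E ++ zeroes k)
 Sk-zeroes zero    {E} s = subst Sk (sym (List.++-identityʳ E)) s
 Sk-zeroes (suc k) {E} s = subst Sk (++-∷ʳ-assoc E (+ 0) (zeroes k)) (Sk-zeroes k (snoc s ℤ.≤-refl λ v h l → ⊥-elim (1≰0 (lia (v & []) (!0 <= #0 & #0 +' !1 <= !0 & []) (!1 <= !0) (h , l , tt)))))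

 -- Two initial zeroes allow any later entry 1.
 Sk-∷ʳ1 : ∀ E → Sk (+ 0 ∷ + 0 ∷ E) → Sk ((+ 0 ∷ + 0 ∷ E) ∷ʳ + 1)
 Sk-∷ʳ1 E s = snoc s (+≤+ ℕ.z≤n) double
   where
   double : Doubled (+ 1) (+ 0 ∷ + 0 ∷ E)
   double v h k with ℤ.≤-antisym h (lia (v & []) (#0 +' !1 <= !1 & []) (#0 <= !0) (k , tt))
   ... | refl = (lia ((cntAt (+ 0) E) & (G (+ 0) E) & (G (+ 0 + + 1) E) & []) (!0 <= #0 & #0 == #1 -' #2 & []) (!2 <= (!0 <=? !0) +' ((!0 <=? !0) +' #1) -' ((!1 <=? !0) +' ((!1 <=? !0) +' #2))) ((0≤cntAt (+ 0) E) , refl , tt))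

 Sk-ω : ∀ k → Sk (ω (4 ℕ.+ k))
 Sk-ω k = Sk-∷ʳ1 (zeroes (suc k)) (Sk-zeroes (3 ℕ.+ k) nil)

 Sk-ε : ∀ k → Sk (ε (4 ℕ.+ k))
 Sk-ε k = Sk-∷ʳ1 (+ 1 ∷ zeroes k) (Sk-zeroes k (Sk-∷ʳ1 [] (Sk-zeroes 2 nil)))

 affine-zeroes : ∀ k {a} → + 0 ≤ a → AffineDyck (a ∷ zeroes k ++ + 1 ∷ [])
 affine-zeroes zero    {a} h = (lia (a & []) (!0 <= #0 & []) (!1 <= #0 +' !1) (h , tt)) ∷ [-]
 affine-zeroes (suc k) {a} h = (lia (a & []) (!0 <= #0 & []) (!0 <= #0 +' !1) (h , tt)) ∷ affine-zeroes k ℤ.≤-refl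

 nonneg-zeroes : ∀ k → All (+ 0 ≤_) (zeroes k ++ + 1 ∷ [])
 nonneg-zeroes zero    = +≤+ ℕ.z≤n ∷ []
 nonneg-zeroes (suc k) = ℤ.≤-refl ∷ nonneg-zeroes k

 dyck-ω : ∀ k → Dyck (ω (4 ℕ.+ k))
 dyck-ω k = refl , affine-zeroes (2 ℕ.+ k) ℤ.≤-refl , nonneg-zeroes (3 ℕ.+ k)

 dyck-ε : ∀ k → Dyck (ε (4 ℕ.+ k))
 dyck-ε k = refl , +≤+ ℕ.z≤n ∷ ℤ.≤-refl ∷ affine-zeroes k (+≤+ ℕ.z≤n) ,
   ℤ.≤-refl ∷ ℤ.≤-refl ∷ +≤+ ℕ.z≤n ∷ nonneg-zeroes k

 -- The image of a Dyck sequence x of length n under up, in terms of the windows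
 -- that are rearranged.
 data Image (n : ℕ) : List ℤ → List ℤ → Set where
   top   : Image n (ω n) (ε n)
   move₁ : ∀ {D u y} → D ∷ʳ u ≢ ω n → Sk (D ∷ʳ u) → Dyck (D ∷ʳ u) → Inserted (u ∷ []) D y → Image n (D ∷ʳ u) y
   move₃ : ∀ {D v u w X y} → u ≤ w + + 1 → Inserted (w ∷ []) (D ∷ʳ v) X → Dyck ((D ∷ʳ v) ++ u ∷ []) → Inserted (u ∷ w ∷ []) (D ∷ʳ v) y →
     Image n (X ++ u ∷ []) y
   move₅ : ∀ {D a b c d e p q X Y} → b ≤ a + + 1 → c ≤ b + + 1 → d + + 2 ≤ c → Move₅ a b c d e p q →
     Inserted (d ∷ e ∷ []) (D ∷ʳ a) X → Dyck ((D ∷ʳ a) ++ b ∷ c ∷ []) →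
     Inserted (p ∷ q ∷ e ∷ []) (D ∷ʳ a) Y → Dyck ((D ∷ʳ a) ++ d ∷ []) → Image n (X ++ b ∷ c ∷ []) (Y ++ d ∷ [])
   move₇ : ∀ {D z a b c d e f p q r s t X Y} → Move₇ z a b c d e f p q r s t → Dense (z ∷ a ∷ b ∷ c ∷ d ∷ e ∷ f ∷ []) →
     Inserted (d ∷ e ∷ f ∷ []) (D ∷ʳ z) X → Dyck ((D ∷ʳ z) ++ a ∷ b ∷ c ∷ []) →
     Inserted (r ∷ s ∷ t ∷ f ∷ []) (D ∷ʳ z) Y → Dyck ((D ∷ʳ z) ++ p ∷ q ∷ []) → Image n (X ++ a ∷ b ∷ c ∷ []) (Y ++ p ∷ q ∷ [])

 ends-raised : ∀ k → Raised (ω (4 ℕ.+ k)) (ε (4 ℕ.+ k))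
 ends-raised k = raised (dyck-ε k) refl
   (lia ((bad (zeroes k ++ + 1 ∷ [])) & (+ k) & (sumBy (bd (+ 0)) (zeroes k ++ + 1 ∷ [])) & (sumBy (bd (+ 1)) (zeroes k ++ + 1 ∷ [])) & []) (#0 == #1 & #2 == !1 & #3 == !0 & []) ((!0 +' (!1 +' #2)) +' ((!1 +' #2) +' (#3 +' #0)) == ((!0 +' (!0 +' #2)) +' ((!0 +' #2) +' (#2 +' #0))) +' !1) ((sums k) , (zero-row k) , (row₁ k) , tt))
   (lia ((total (zeroes k ++ + 1 ∷ [])) & []) ([]) (!0 +' (!0 +' (!1 +' #0)) == (!0 +' (!0 +' (!0 +' #0))) +' !1) (tt))
   where
   zero-row : ∀ k → sumBy (bd (+ 0)) (zeroes k ++ + 1 ∷ []) ≡ + 1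
   zero-row zero    = refl
   zero-row (suc k) = trans (ℤ.+-identityˡ _) (zero-row k)
   row₁ : ∀ k → sumBy (bd (+ 1)) (zeroes k ++ + 1 ∷ []) ≡ + 0
   row₁ zero    = refl
   row₁ (suc k) = trans (ℤ.+-identityˡ _) (row₁ k)
   sums : ∀ k → bad (zeroes k ++ + 1 ∷ []) ≡ + k
   sums zero    = refl
   sums (suc k) = cong₂ _+_ (zero-row k) (sums k)

 module _ (k : ℕ) where

   private
     n = 4 ℕ.+ k

   image-raised : ∀ {x y} → Image n x y → Raised x y
   image-raised top = ends-raised k
   image-raised {y = y} (move₁ {D} {u} ne s d r) = subst (Raised (D ∷ʳ u)) (List.++-identityʳ y)
     (raise {V = u ∷ []} {V′ = []} {ws = []} {us = u ∷ []} (rearranged-refl (u ∷ [])) refl ([] (inserted-base r)) r (subst Dyck (sym (List.++-identityʳ D)) (inserted-base r)))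
   image-raised {x} {y} (move₃ {u = u} {w} h i d r) = subst (Raised x) (List.++-identityʳ y)
     (raise {V = u ∷ []} {V′ = []} {ws = w ∷ []} {us = u ∷ w ∷ []} (rearranged-refl (u ∷ w ∷ [])) refl i r (subst Dyck (sym (List.++-identityʳ _)) (inserted-base r)))
   image-raised (move₅ {a = a} {b} {c} {d} {e} {p} {q} g h k m i dy r d′) = raise {V = b ∷ c ∷ []} {V′ = d ∷ []} {ws = d ∷ e ∷ []} {us = p ∷ q ∷ e ∷ []} (move₅-rearranged {a} h k m) refl i r d′
   image-raised (move₇ {a = a} {b} {c} {d} {e} {f} {p} {q} {r} {s} {t} m dn i dy rr d′) = raise {V = a ∷ b ∷ c ∷ []} {V′ = p ∷ q ∷ []} {ws = d ∷ e ∷ f ∷ []} {us = r ∷ s ∷ t ∷ f ∷ []} (rearranged-∷ʳ {five a b c d e} {five p q r s t} f (snd (Move₇.good m))) refl i rr d′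

   -- The body of up after the test for skeletons.
   third : ℤ → ℤ → List ℤ → Maybe (List ℤ)
   third e₁ e₂ c₂ = extract c₂ >>= λ (e₃ , c₃) → onFinal 7 East (c₃ ++ (e₁ - + 1) ∷ (e₂ - + 1) ∷ (e₃ - + 1) ∷ []) >>= reinjectFinal 4

   second : ℤ → List ℤ → Maybe (List ℤ)
   second e₁ c₁ = extract c₁ >>= λ (e₂ , c₂) → maybe′ (reinjectFinal 3) (third e₁ e₂ c₂) (onFinal 5 East₅ (c₂ ++ (e₁ - + 1) ∷ (e₂ - + 1) ∷ []))

   up-extract : ∀ {w C x} → length x ≡ n → Ins w C x → Dyck C →
     up x ≡ maybe′ (reinjectFinal 2) (second (w + + 1) C) (onFinal 3 East₃ (C ++ w ∷ []))
   up-extract {w} {C} {x} len i d =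
     trans (if-false (dec-false (x ≟ᴸ ω (length x)) λ eq → ins-not-Sk i d (subst FullSkeleton (sym (trans eq (cong ω len))) (Sk⇒full (dyck-ω k) (Sk-ω k)))))
     (trans (if-false (dec-false (fullSkeleton? x) (ins-not-Sk i d)))
     (trans (cong (_>>= λ (e₁ , c₁) → maybe′ (reinjectFinal 2) (second e₁ c₁) (onFinal 3 East₃ (c₁ ++ (e₁ - + 1) ∷ []))) (extract-ins i d))
     (cong (λ v → maybe′ (reinjectFinal 2) (second (w + + 1) C) (onFinal 3 East₃ (C ++ v ∷ []))) (+1-1 w))))

   second-extract : ∀ {w₁ w C x} → Ins w C x → Dyck C →
     second (w₁ + + 1) x ≡ maybe′ (reinjectFinal 3) (third (w₁ + + 1) (w + + 1) C) (onFinal 5 East₅ (C ++ w₁ ∷ w ∷ []))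
   second-extract {w₁} {w} {C} {x} i d =
     trans (cong (_>>= λ (e₂ , c₂) → maybe′ (reinjectFinal 3) (third (w₁ + + 1) e₂ c₂) (onFinal 5 East₅ (c₂ ++ (w₁ + + 1 - + 1) ∷ (e₂ - + 1) ∷ []))) (extract-ins i d))
     (cong₂ (λ u v → maybe′ (reinjectFinal 3) (third (w₁ + + 1) (w + + 1) C) (onFinal 5 East₅ (C ++ u ∷ v ∷ []))) (+1-1 w₁) (+1-1 w))

   third-extract : ∀ {w₁ w₂ w C x} → Ins w C x → Dyck C →
     third (w₁ + + 1) (w₂ + + 1) x ≡ (onFinal 7 East (C ++ w₁ ∷ w₂ ∷ w ∷ []) >>= reinjectFinal 4)
   third-extract {w₁} {w₂} {w} {C} {x} i d =
     trans (cong (_>>= λ (e₃ , c₃) → onFinal 7 East (c₃ ++ (w₁ + + 1 - + 1) ∷ (w₂ + + 1 - + 1) ∷ (e₃ - + 1) ∷ []) >>= reinjectFinal 4) (extract-ins i d))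
     (trans (cong₂ (λ u v → onFinal 7 East (C ++ u ∷ v ∷ (w + + 1 - + 1) ∷ []) >>= reinjectFinal 4) (+1-1 w₁) (+1-1 w₂))
       (cong (λ v → onFinal 7 East (C ++ w₁ ∷ w₂ ∷ v ∷ []) >>= reinjectFinal 4) (+1-1 w)))

   east₃-fails : ∀ C b {c d} → d + + 2 ≤ c → onFinal 3 East₃ (C ++ b ∷ c ∷ d ∷ []) ≡ nothing
   east₃-fails C b {c} {d} h = trans (onFinal-++ East₃ C (b ∷ c ∷ d ∷ []))
     (cong (Maybe.map (C ++_)) (if-false (dec-false (c ≤? d + + 1) (¬≤ (lia (d & c & []) (#0 +' !2 <= #1 & []) (#0 +' !1 +' !1 <= #1) (h , tt))))))

   image-up : ∀ {x y} → length x ≡ n → Image n x y → up x ≡ just y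
   image-up len top = trans (if-true (dec-true (ω n ≟ᴸ ω (length (ω n))) (cong ω (sym len)))) (cong (λ l → just (ε l)) len)
   image-up {y = y} len (move₁ {D} {u} ne s d r) =
     trans (if-false (dec-false ((D ∷ʳ u) ≟ᴸ ω (length (D ∷ʳ u))) λ eq → ne (trans eq (cong ω len))))
     (trans (if-true (dec-true (fullSkeleton? (D ∷ʳ u)) (Sk⇒full d s))) (reinject-inserted r))
   image-up len (move₃ {D} {v} {u} {w} {X} h (i ∷ [] _) d r) =
     trans (up-extract len (ins-++ (u ∷ []) i) d)
     (trans (cong (maybe′ (reinjectFinal 2) _) east)
     (trans (cong (reinjectFinal 2) (sym (++-∷ʳ-assoc D v (u ∷ w ∷ [])))) (reinject-inserted r)))
     where
     east : onFinal 3 East₃ (((D ∷ʳ v) ++ u ∷ []) ++ w ∷ []) ≡ just (D ++ v ∷ u ∷ w ∷ [])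
     east = trans (cong (onFinal 3 East₃) (trans (List.++-assoc (D ∷ʳ v) (u ∷ []) (w ∷ [])) (++-∷ʳ-assoc D v (u ∷ w ∷ []))))
       (trans (onFinal-++ East₃ D (v ∷ u ∷ w ∷ [])) (cong (Maybe.map (D ++_)) (if-true (dec-true (u ≤? w + + 1) h))))
   image-up len (move₅ {D} {a} {b} {c} {d} {e} {p} {q} {X} {Y} g h l m (_∷_ {z = X₁} i₁ (i₂ ∷ [] dC)) dy r d′) =
     trans (up-extract len (ins-++ (b ∷ c ∷ []) i₁) dX₁)
     (trans (cong (maybe′ (reinjectFinal 2) _) (trans (cong (onFinal 3 East₃) (List.++-assoc X₁ (b ∷ c ∷ []) (d ∷ []))) (east₃-fails X₁ b l)))
     (trans (second-extract (ins-++ (b ∷ c ∷ []) i₂) dy)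
     (trans (cong (maybe′ (reinjectFinal 3) _) east)
     (trans (cong (reinjectFinal 3) (sym (trans (List.++-assoc (D ∷ʳ a) (d ∷ []) _) (++-∷ʳ-assoc D a (d ∷ p ∷ q ∷ e ∷ [])))))
       (reinject-inserted (inserted-++ (d ∷ []) r d′))))))
     where
     dX₁ : Dyck (X₁ ++ b ∷ c ∷ [])
     dX₁ = ins-dyck (ins-++ (b ∷ c ∷ []) i₂) dy
     east : onFinal 5 East₅ (((D ∷ʳ a) ++ b ∷ c ∷ []) ++ d ∷ e ∷ []) ≡ just (D ++ a ∷ d ∷ p ∷ q ∷ e ∷ [])
     east = trans (cong (onFinal 5 East₅) (trans (List.++-assoc (D ∷ʳ a) (b ∷ c ∷ []) (d ∷ e ∷ [])) (++-∷ʳ-assoc D a (b ∷ c ∷ d ∷ e ∷ []))))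
       (trans (onFinal-++ East₅ D (a ∷ b ∷ c ∷ d ∷ e ∷ [])) (cong (Maybe.map (D ++_)) (east₅-move h l m)))
   image-up len (move₇ {D} {z} {a} {b} {c} {d} {e} {f} {p} {q} {r} {s} {t} {X} {Y} m dn (_∷_ {z = X₁} i₁ (_∷_ {z = X₂} i₂ (i₃ ∷ [] dC))) dy rr d′) =
     trans (up-extract len (ins-++ V i₁) dX₁)
     (trans (cong (maybe′ (reinjectFinal 2) _) (trans (cong (onFinal 3 East₃) (trans (List.++-assoc X₁ V (d ∷ [])) (sym (++-∷ʳ-assoc X₁ a (b ∷ c ∷ d ∷ []))))) (east₃-fails (X₁ ∷ʳ a) b drop₇)))
     (trans (second-extract (ins-++ V i₂) dX₂)
     (trans (cong (maybe′ (reinjectFinal 3) _) (trans (cong (onFinal 5 East₅) (List.++-assoc X₂ V (d ∷ e ∷ []))) (trans (onFinal-++ East₅ X₂ (a ∷ b ∷ c ∷ d ∷ e ∷ [])) (cong (Maybe.map (X₂ ++_)) (east₅-stuck c≤b+1 drop₇ stuck₅)))))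
     (trans (third-extract (ins-++ V i₃) dy)
     (trans (cong (_>>= reinjectFinal 4) east)
     (trans (cong (reinjectFinal 4) (sym (trans (List.++-assoc (D ∷ʳ z) (p ∷ q ∷ []) _) (++-∷ʳ-assoc D z (p ∷ q ∷ r ∷ s ∷ t ∷ f ∷ [])))))
       (reinject-inserted (inserted-++ (p ∷ q ∷ []) rr d′))))))))
     where
     open Move₇Facts m
     V : List ℤ
     V = a ∷ b ∷ c ∷ []
     dX₂ : Dyck (X₂ ++ V)
     dX₂ = ins-dyck (ins-++ V i₃) dy
     dX₁ : Dyck (X₁ ++ V)
     dX₁ = ins-dyck (ins-++ V i₂) dX₂
     east : onFinal 7 East (((D ∷ʳ z) ++ V) ++ d ∷ e ∷ f ∷ []) ≡ just (D ++ z ∷ p ∷ q ∷ r ∷ s ∷ t ∷ f ∷ [])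
     east = trans (cong (onFinal 7 East) (trans (List.++-assoc (D ∷ʳ z) V (d ∷ e ∷ f ∷ [])) (++-∷ʳ-assoc D z (a ∷ b ∷ c ∷ d ∷ e ∷ f ∷ []))))
       (trans (onFinal-++ East D (z ∷ a ∷ b ∷ c ∷ d ∷ e ∷ f ∷ [])) (cong (Maybe.map (D ++_)) (east₇ dn)))

   image-nonspecial : ∀ {x y} → Image n x y → ¬ SpecialSkeleton n y
   image-nonspecial top (_ , _ , ne) = ne refl
   image-nonspecial (move₁ ne s d (i ∷ r)) (f , _) = ins-not-Sk i (inserted-dyck r) f
   image-nonspecial (move₃ h i d (j ∷ r)) (f , _) = ins-not-Sk j (inserted-dyck r) f
   image-nonspecial (move₅ {d = d} g h l m i dy (j ∷ r) d′) (f , _) = ins-not-Sk (ins-++ (d ∷ []) j) (inserted-dyck (inserted-++ (d ∷ []) r d′)) f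
   image-nonspecial (move₇ {p = p} {q} m dn i dy (j ∷ r) d′) (f , _) = ins-not-Sk (ins-++ (p ∷ q ∷ []) j) (inserted-dyck (inserted-++ (p ∷ q ∷ []) r d′)) f

module Uniq where

 open Pre
 open Steps
 open East
 open Rows
 open Local
 open Words
 open Extract hiding (mid)
 open Moves
 open Lia
 open Dbm using (Form; atom; atLeast; _and_; _or_; _imp_; sumχ; prove; valid; prop; eval)
 open Win
 open Stats
 open import Defs hiding (maximum)
 open import Data.Bool.Base using (if_then_else_)
 open import Data.Integer.Base using (_<_)
 open import Data.Integer.Properties using (≤-totalOrder)
 open import Data.List.Extrema ≤-totalOrder using (min; min≤⊤; min≤xs; v≤min⁺)
 open import Data.List.Relation.Unary.Linked using ([]; _∷_)
 open import Data.Product.Base using (_,_)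
 open import Data.Maybe.Properties using (just-injective)

 record Peeled (us C V y : List ℤ) : Set where
   constructor peeled
   field
     {Y} : List ℤ
     y≡  : y ≡ Y ++ V
     inserted : Inserted us C Y
     base : Dyck (C ++ V)

 peeled-split : ∀ {u us C V u′ us′ C′ V′ y} → Peeled (u ∷ us) C V y → Peeled (u′ ∷ us′) C′ V′ y →
   u ≡ u′ × ∃[ z ] (Peeled us C V z × Peeled us′ C′ V′ z)
 peeled-split {u} {V = V} {u′} {V′ = V′} (peeled refl (_∷_ {z = Z} i r) d) (peeled eq (_∷_ {z = Z′} j q) d′) =
   trans (sym (+1-1 u)) (trans (cong (λ p → fst p - + 1) pair) (+1-1 u′)) , Z ++ V , peeled refl r d , peeled (cong snd pair) q d′
   where
   pair : (u + + 1 , Z ++ V) ≡ (u′ + + 1 , Z′ ++ V′)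
   pair = just-injective (trans (sym (extract-ins (ins-++ V i) (inserted-dyck (inserted-++ V r d))))
     (trans (cong extract eq) (extract-ins (ins-++ V′ j) (inserted-dyck (inserted-++ V′ q d′)))))

 peeled-end : ∀ {C V y} → Peeled [] C V y → y ≡ C ++ V
 peeled-end (peeled refl ([] _) d) = refl

 peeled-not-Sk : ∀ {u us C V y} → Peeled (u ∷ us) C V y → Dyck y → ¬ Sk y
 peeled-not-Sk {V = V} (peeled refl (i ∷ r) d) dy s = ins-not-Sk (ins-++ V i) (inserted-dyck (inserted-++ V r d)) (Sk⇒full dy s)

 data View (n : ℕ) (x y : List ℤ) : Set where
   view₀ : x ≡ ω n → y ≡ ε n → View n x y
   view₁ : ∀ {D u} → x ≡ D ∷ʳ u → Sk D → Peeled (u ∷ []) D [] y → View n x y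
   view₃ : ∀ {D v u w X} → x ≡ X ++ u ∷ [] → u ≤ v + + 1 → Inserted (w ∷ []) (D ∷ʳ v) X → Peeled (u ∷ w ∷ []) (D ∷ʳ v) [] y → View n x y
   view₅ : ∀ {D a b c d e p q X} → x ≡ X ++ b ∷ c ∷ [] → b ≤ a + + 1 → c ≤ b + + 1 → d + + 2 ≤ c → d + + 2 ≤ p → Move₅ a b c d e p q →
     Inserted (d ∷ e ∷ []) (D ∷ʳ a) X → Peeled (p ∷ q ∷ e ∷ []) (D ∷ʳ a) (d ∷ []) y → View n x y
   view₇ : ∀ {D z a b c d e f p q r s t X} → x ≡ X ++ a ∷ b ∷ c ∷ [] → Move₇ z a b c d e f p q r s t →
     Inserted (d ∷ e ∷ f ∷ []) (D ∷ʳ z) X → Peeled (r ∷ s ∷ t ∷ f ∷ []) (D ∷ʳ z) (p ∷ q ∷ []) y → View n x y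

 append-[] : ∀ {C} → Dyck C → Dyck (C ++ [])
 append-[] {C} = subst Dyck (sym (List.++-identityʳ C))

 last-step : ∀ D {v u} → AffineDyck ((D ∷ʳ v) ++ u ∷ []) → u ≤ v + + 1
 last-step D {v} {u} l with affine-right D (subst AffineDyck (++-∷ʳ-assoc D v (u ∷ [])) l)
 ... | h ∷ _ = h

 image-view : ∀ {n x y} → Image n x y → View n x y
 image-view top = view₀ refl refl
 image-view {y = y} (move₁ {D} ne s d r) = view₁ refl (fst (Sk-init D s)) (peeled (sym (List.++-identityʳ y)) r (append-[] (inserted-base r)))
 image-view {y = y} (move₃ {D} h i d r) = view₃ refl (last-step D (fst (snd d))) i (peeled (sym (List.++-identityʳ y)) r (append-[] (inserted-base r)))
 image-view (move₅ {a = a} {b} {c} {d} g h l m i dy r d′) = view₅ refl g h l (first m) m i (peeled refl r d′)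
   where
   first : ∀ {p q} → Move₅ a b c d _ p q → d + + 2 ≤ p
   first (keep _ q _) = q
   first (swap _ _)   = l
 image-view (move₇ m dn i dy r d′) = view₇ refl m i (peeled refl r d′)

 clash₁ : ∀ {D u y u′ w us C V} → Sk D → Peeled (u ∷ []) D [] y → Peeled (u′ ∷ w ∷ us) C V y → ⊥
 clash₁ {D} s p q with peeled-split p q
 ... | _ , z , p′ , q′ with trans (peeled-end p′) (List.++-identityʳ D)
 ...   | refl = peeled-not-Sk q′ (inserted-base (Peeled.inserted p)) s

 clash₃ : ∀ {D u v w y p q e es C d} V → u ≤ v + + 1 → d + + 2 ≤ p → Peeled (u ∷ w ∷ []) (D ∷ʳ v) [] y → Peeled (p ∷ q ∷ e ∷ es) C (V ∷ʳ d) y → ⊥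
 clash₃ {D} {u} {v} {p = p} {d = d} V h k P Q with peeled-split P Q
 ... | refl , z , P′ , Q′ with peeled-split P′ Q′
 ...   | _ , z′ , P″ , peeled {Y} eq _ _ with List.∷ʳ-injective D (Y ++ V) (trans (trans (sym (List.++-identityʳ _)) (trans (sym (peeled-end P″)) eq)) (sym (List.++-assoc Y V (d ∷ []))))
 ...     | _ , refl = 1≰0 (lia (u & v & []) (#0 <= #1 +' !1 & #1 +' !2 <= #0 & []) (!1 <= !0) (h , k , tt))

 clash₅ : ∀ {D D′ z a b c d e p q a′ b′ c′ d′ e′ f p′ q′ r s t y} → b ≤ a + + 1 → c ≤ b + + 1 → d + + 2 ≤ c → Move₅ a b c d e p q →
   Peeled (p ∷ q ∷ e ∷ []) (D ∷ʳ a) (d ∷ []) y → Move₇ z a′ b′ c′ d′ e′ f p′ q′ r s t → Peeled (r ∷ s ∷ t ∷ f ∷ []) (D′ ∷ʳ z) (p′ ∷ q′ ∷ []) y → ⊥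
 clash₅ {D} {a = a} {d = d} {p′ = p′} {q′} g h k m P m′ Q with peeled-split P Q
 ... | refl , _ , P₁ , Q₁ with peeled-split P₁ Q₁
 ...   | refl , _ , P₂ , Q₂ with peeled-split P₂ Q₂
 ...     | _ , _ , P₃ , peeled {Y} eq _ _ with List.∷ʳ-injective (D ∷ʳ a) (Y ∷ʳ p′) (trans (sym (peeled-end P₃)) (trans eq (sym (++-∷ʳ-assoc Y p′ (q′ ∷ [])))))
 ...       | eq′ , refl with List.∷ʳ-injective D Y eq′
 ...         | _ , refl = move₅-not-blocked g h k m (Move₇Facts.blocked₅ m′)

 module _ (k : ℕ) where

   private
     n = 4 ℕ.+ k

   clash₀ : ∀ {u us C V y} → y ≡ ε n → Peeled (u ∷ us) C V y → ⊥
   clash₀ refl p = peeled-not-Sk p (dyck-ε k) (Sk-ε k)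

   view-unique : ∀ {x x′ y} → View n x y → View n x′ y → x ≡ x′
   view-unique (view₀ p _) (view₀ q _) = trans p (sym q)
   view-unique (view₀ _ p) (view₁ _ _ q) = ⊥-elim (clash₀ p q)
   view-unique (view₀ _ p) (view₃ _ _ _ q) = ⊥-elim (clash₀ p q)
   view-unique (view₀ _ p) (view₅ _ _ _ _ _ _ _ q) = ⊥-elim (clash₀ p q)
   view-unique (view₀ _ p) (view₇ _ _ _ q) = ⊥-elim (clash₀ p q)
   view-unique (view₁ _ _ q) (view₀ _ p) = ⊥-elim (clash₀ p q)
   view-unique (view₃ _ _ _ q) (view₀ _ p) = ⊥-elim (clash₀ p q)
   view-unique (view₅ _ _ _ _ _ _ _ q) (view₀ _ p) = ⊥-elim (clash₀ p q)
   view-unique (view₇ _ _ _ q) (view₀ _ p) = ⊥-elim (clash₀ p q)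
   view-unique (view₁ {D} {u} refl s p) (view₁ {D′} refl s′ q) with peeled-split p q
   ... | refl , _ , p′ , q′ = cong (_∷ʳ u) (trans (sym (List.++-identityʳ D)) (trans (sym (peeled-end p′)) (trans (peeled-end q′) (List.++-identityʳ D′))))
   view-unique (view₁ _ s p) (view₃ _ _ _ q) = ⊥-elim (clash₁ s p q)
   view-unique (view₁ _ s p) (view₅ _ _ _ _ _ _ _ q) = ⊥-elim (clash₁ s p q)
   view-unique (view₁ _ s p) (view₇ _ _ _ q) = ⊥-elim (clash₁ s p q)
   view-unique (view₃ _ _ _ q) (view₁ _ s p) = ⊥-elim (clash₁ s p q)
   view-unique (view₅ _ _ _ _ _ _ _ q) (view₁ _ s p) = ⊥-elim (clash₁ s p q)
   view-unique (view₇ _ _ _ q) (view₁ _ s p) = ⊥-elim (clash₁ s p q)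
   view-unique (view₃ {D} {v} refl _ i p) (view₃ {D′} {v′} refl _ j q) with peeled-split p q
   ... | refl , _ , p₁ , q₁ with peeled-split p₁ q₁
   ...   | refl , _ , p₂ , q₂ with List.∷ʳ-injective D D′ (trans (sym (List.++-identityʳ (D ∷ʳ v))) (trans (trans (sym (peeled-end p₂)) (peeled-end q₂)) (List.++-identityʳ (D′ ∷ʳ v′))))
   ...     | refl , refl = cong (_++ _) (inserted-unique i j)
   view-unique (view₃ _ h _ p) (view₅ _ _ _ _ l _ _ q) = ⊥-elim (clash₃ [] h l p q)
   view-unique (view₃ _ h _ p) (view₇ {p = p′} _ m _ q) = ⊥-elim (clash₃ (p′ ∷ []) h (Move₇Facts.image-drop m) p q)
   view-unique (view₅ _ _ _ _ l _ _ q) (view₃ _ h _ p) = ⊥-elim (clash₃ [] h l p q)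
   view-unique (view₇ {p = p′} _ m _ q) (view₃ _ h _ p) = ⊥-elim (clash₃ (p′ ∷ []) h (Move₇Facts.image-drop m) p q)
   view-unique (view₅ {D} {a} refl _ h l _ m i p) (view₅ {D′} {a′} refl _ h′ l′ _ m′ j q) with peeled-split p q
   ... | refl , _ , p₁ , q₁ with peeled-split p₁ q₁
   ...   | refl , _ , p₂ , q₂ with peeled-split p₂ q₂
   ...     | refl , _ , p₃ , q₃ with List.∷ʳ-injective (D ∷ʳ a) (D′ ∷ʳ a′) (trans (sym (peeled-end p₃)) (peeled-end q₃))
   ...       | eq , refl with List.∷ʳ-injective D D′ eq
   ...         | refl , refl with move₅-unique h h′ l l′ m m′
   ...           | refl , refl = cong (_++ _) (inserted-unique i j)
   view-unique (view₅ _ g h l _ m _ p) (view₇ _ m′ _ q) = ⊥-elim (clash₅ g h l m p m′ q)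
   view-unique (view₇ _ m′ _ q) (view₅ _ g h l _ m _ p) = ⊥-elim (clash₅ g h l m p m′ q)
   view-unique (view₇ {D} {z} refl m i P) (view₇ {D′} {z′} refl m′ j Q) with peeled-split P Q
   ... | refl , _ , p₁ , q₁ with peeled-split p₁ q₁
   ...   | refl , _ , p₂ , q₂ with peeled-split p₂ q₂
   ...     | refl , _ , p₃ , q₃ with peeled-split p₃ q₃
   ...       | refl , _ , p₄ , q₄ with window D D′ (trans (sym (peeled-end p₄)) (peeled-end q₄))
     where
     window : ∀ D D′ {z z′ p p′ q q′} → (D ∷ʳ z) ++ p ∷ q ∷ [] ≡ (D′ ∷ʳ z′) ++ p′ ∷ q′ ∷ [] → D ≡ D′ × z ≡ z′ × p ≡ p′ × q ≡ q′
     window D D′ {z} {z′} {p} {p′} {q} {q′} eq with List.∷ʳ-injective ((D ∷ʳ z) ∷ʳ p) ((D′ ∷ʳ z′) ∷ʳ p′) (trans (++-∷ʳ-assoc (D ∷ʳ z) p (q ∷ [])) (trans eq (sym (++-∷ʳ-assoc (D′ ∷ʳ z′) p′ (q′ ∷ [])))))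
     ... | eq′ , eq₁ with List.∷ʳ-injective (D ∷ʳ z) (D′ ∷ʳ z′) eq′
     ...   | eq″ , eq₂ with List.∷ʳ-injective D D′ eq″
     ...     | eq₃ , eq₄ = eq₃ , eq₄ , eq₂ , eq₁
   ...         | refl , refl , refl , refl with move₇-unique m m′
   ...           | refl = cong (_++ _) (inserted-unique i j)

   image-unique : ∀ {x x′ y} → Image n x y → Image n x′ y → x ≡ x′
   image-unique p q = view-unique (image-view p) (image-view q)

module Runs where

 open Uniq
 open Pre
 open Steps
 open East
 open Rows
 open Local
 open Words
 open Extract hiding (mid)
 open Moves
 open Lia
 open Dbm using (Form; atom; atLeast; _and_; _or_; _imp_; sumχ; prove; valid; prop; eval)
 open Win
 open Stats
 open import Defs hiding (maximum)
 open import Data.Bool.Base using (if_then_else_)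
 open import Data.Integer.Base using (_<_)
 open import Data.Integer.Properties using (≤-totalOrder)
 open import Data.List.Base using (map)
 open import Data.List.Extrema ≤-totalOrder using (min; min≤⊤; min≤xs; v≤min⁺)
 open import Data.List.Relation.Unary.Linked using ([]; _∷_)
 open import Data.Product.Base using (_,_)
 import Data.List.Relation.Unary.All.Properties as All
 open Facts
 open Small using (Domain; domain; StringLike)
 open import Data.Nat.Combinatorics using (nC1≡n; nCk+nC[k+1]≡[n+1]C[k+1]) renaming (_C_ to _choose_)

 twice-choose : ∀ n → + 2 * + (n choose 2) ≡ + n * + n - + n
 twice-choose zero    = refl
 twice-choose (suc n) = trans (cong (λ c → + 2 * + c) (trans (sym (nCk+nC[k+1]≡[n+1]C[k+1] n 1)) (cong (ℕ._+ n choose 2) (nC1≡n n))))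
   (trans (ℤ.*-distribˡ-+ (+ 2) (+ n) (+ (n choose 2))) (trans (cong (_+_ (+ 2 * + n)) (twice-choose n)) (arith (+ n))))
   where
   arith : ∀ n → + 2 * n + (n * n - n) ≡ (+ 1 + n) * (+ 1 + n) - (+ 1 + n)
   arith = solve-∀

 Tight : ℤ → List ℤ → Set
 Tight j σ = + 10 ≤ lenᶻ σ × LowDeficit σ × FewBad j σ

 tight : ∀ {n i x ws C σ} → 10 ℕ.≤ n → Domain n i x → Inserted ws C x → C ++ ws ≡ σ → Tight (i + lenᶻ ws) σ
 tight {n} {i} {x} {ws} {C} big (domain d refl df lo) r refl =
   subst (+ 10 ≤_) len (+≤+ big) ,
   (lia ((defc x) & (+ (2 ℕ.* n)) & (+ n) & (lenᶻ (C ++ ws)) & (bad x) & (total x) & (bad (C ++ ws)) & (lenᶻ ws) & (total (C ++ ws)) & []) (#0 <= #1 -' !8 & #1 == + 2 *' #2 & #2 == #3 & #0 == #4 -' #5 & #4 == #6 +' #7 & #5 == #8 +' #7 & []) (#6 -' #8 <= + 2 *' #3 -' !8) (df , (ℤ.pos-* 2 n) , len , (defc-bad x) , (inserted-bad₀ r) , (inserted-total r) , tt)) ,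
   subst (λ N → + 4 * bad (C ++ ws) + + 4 * (i + lenᶻ ws) ≤ N * N + + 3 * N - + 16) len
     (lia ((defc x) & (+ (2 ℕ.* n)) & (+ n) & (bad x) & (total x) & (area x) & i & (+ (n choose 2)) & (+ n * + n) & (bad (C ++ ws)) & (lenᶻ ws) & []) (#0 <= #1 -' !8 & #1 == + 2 *' #2 & #0 == #3 -' #4 & #5 == #4 & #5 +' #5 +' (#6 +' #6) +' #0 <= #7 & + 2 *' #7 == #8 -' #2 & #3 == #9 +' #10 & []) (+ 4 *' #9 +' + 4 *' (#6 +' #10) <= #8 +' + 3 *' #2 -' !16) (df , (ℤ.pos-* 2 n) , (defc-bad x) , (area-total x) , lo , (twice-choose n) , (inserted-bad₀ r) , tt))
   where
   len : + n ≡ lenᶻ (C ++ ws)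
   len = inserted-length r

 inserted-nonneg : ∀ {us C y} → Inserted us C y → All (+ 0 ≤_) us
 inserted-nonneg ([] _)  = []
 inserted-nonneg (i ∷ r) = Ins.0≤w i ∷ inserted-nonneg r

 -- Words after a run that ends at h and is preceded by a skeleton.
 module ShortRun {S : List ℤ} {m : ℤ} (k : ℕ) (s : Sk S) (0≤m : + 0 ≤ m) (dd : Doubled m S) (lt : All (λ u → u + + 1 ≤ m) S)
   {R : List ℤ} (dER : Dyck ((S ++ run m (suc k)) ++ R)) where

   h = m + + suc k
   E = S ++ run m (suc k)

   open RunFacts s 0≤m dd lt

   E≡ : E ≡ (S ++ run m k) ∷ʳ h
   E≡ = sym (List.++-assoc S (run m k) _)

   dE : Dyck ((S ++ run m k) ∷ʳ h)
   dE = dyck-++ˡ (S ++ run m k) R (subst (λ E → Dyck (E ++ R)) E≡ dER)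

   below : All (λ u → u + + 1 ≤ h) (S ++ run m k)
   below = run-below k lt

   G-top : G h E ≡ + 1
   G-top = trans (cong (G h) E≡) (lia ((G h ((S ++ run m k) ∷ʳ h)) & (G h (S ++ run m k)) & (h) & []) (#0 == #1 +' (#2 <=? #2) & #1 == !0 & []) (#0 == !1) ((G-∷ʳ h (S ++ run m k) h) , (G-high (S ++ run m k) below) , tt))

   all≤h : All (_≤ h) E
   all≤h = subst (All (_≤ h)) (sym E≡) (∷ʳ⁺ (All.map (λ {u} p → ≤-drop p) below) ℤ.≤-refl)

   chainE : Chain E h
   chainE = subst (λ X → Chain X h) (sym E≡) (go (path-chain (dyck-path (S ++ run m k) dE)))
     where
     go : ∃[ m′ ] (Chain ((S ++ run m k) ∷ʳ h) m′ × h ≤ m′) → Chain ((S ++ run m k) ∷ʳ h) h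
     go (m′ , c , h≤m′) with split m′ h
     ... | inl m′≤h = subst (Chain _) (ℤ.≤-antisym m′≤h h≤m′) c
     ... | inr h<m′ = ⊥-elim (1≰0 (lia (m′ & (G m′ ((S ++ run m k) ∷ʳ h)) & (G (m′ + + 1) ((S ++ run m k) ∷ʳ h)) & []) (#0 +' !1 -' #0 <= #1 -' #2 & !0 <= #2 & #1 == !0 & []) (!1 <= !0) ((chain-G c (0≤max c) (lia (m′ & []) ([]) (#0 <= #0 +' !1) (tt)) ℤ.≤-refl) , (0≤G (m′ + + 1) ((S ++ run m k) ∷ʳ h)) , (G-high ((S ++ run m k) ∷ʳ h) (subst (All _) E≡ (All.map (λ {u} p → (lia (u & (h) & m′ & []) (#0 <= #1 & #1 +' !1 <= #2 & []) (#0 +' !1 <= #2) (p , h<m′ , tt))) all≤h))) , tt)))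

   L≡ : lenᶻ E ≡ T + h + + 1
   L≡ = (lia ((lenᶻ E) & (lenᶻ S) & (+ k) & m & []) (#0 == #1 +' (!1 +' (!1 +' #2)) & []) (#0 == #1 -' #3 +' (#3 +' (!1 +' #2)) +' !1) ((run-length (suc k)) , tt))

   0≤h : + 0 ≤ h
   0≤h = 0≤max chainE

   open ChainFacts chainE

   short : ∀ W j → All (+ 0 ≤_) W → length W ℕ.≤ 4 → + 0 ≤ j → (length W ≡ 4 → + 3 ≤ j × + 1 ≤ bad W) → Tight j (E ++ W) →
     (+ 2 ≤ T → + 2 * lenᶻ W ≤ sumBy (κ E) W + bad W + + 1) → ⊥
   short W j nn q 0≤j f (big , low , few) sums with split (+ 2) T
   ... | inl 2≤T = 1≰0 (lia ((sumBy (κ E) W) & (bad W) & (lenᶻ W) & []) (#0 +' #1 <= + 2 *' #2 -' !2 & + 2 *' #2 <= #0 +' #1 +' !1 & []) (!1 <= !0) ((after-run k 2≤T W low) , (sums 2≤T) , tt))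
   ... | inr T<2 with ≤⇒≡+ (ℤ.≤-trans 0≤m m≤T)
   ...   | t , T≡t = Tiny.Tiny.tiny chainE W nn t (length W) (ℤ.drop‿+≤+ t≤1) q length≡ refl big j 0≤j f few
     where
     t≤1 : + t ≤ + 1
     t≤1 = (lia ((T) & (+ t) & []) (#0 == !0 +' #1 & #0 +' !1 <= !2 & []) (#1 <= !1) (T≡t , T<2 , tt))
     length≡ : lenᶻ E ≡ h + + suc t
     length≡ = (lia ((T) & (+ t) & (lenᶻ E) & (h) & []) (#0 == !0 +' #1 & #2 == #0 +' #3 +' !1 & []) (#2 == #3 +' (!1 +' #1)) (T≡t , L≡ , tt))

   far : ∀ {a b} → + 2 ≤ T → + 0 ≤ b → b + + 2 ≤ a → a ≤ h + + 1 → h + + 1 - b ≤ κ E a + κ E b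
   far {a} {b} 2≤T p q r = (lia ((lenᶻ E) & b & (κ E a) & (κ E b) & (T) & (h) & []) (#0 -' !2 -' #1 <= #2 +' #3 & #0 == #4 +' #5 +' !1 & !2 <= #4 & []) (#5 +' !1 -' #1 <= #2 +' #3) ((κ-far p q r) , L≡ , 2≤T , tt))

   low₀ : ∀ {v} → + 0 ≤ v → v ≤ h → h - + 1 - v ≤ κ E v
   low₀ {v} p q = (lia ((h) & v & (κ E v) & []) (#0 -' !1 -' #1 +' (#0 <=? #1) <= #2 & []) (#0 -' !1 -' #1 <= #2) ((κ-low p q) , tt))

   no-letters : ∀ {j} → + 0 ≤ j → Tight j (E ++ []) → ⊥
   no-letters {j} 0≤j t = short [] j [] ℕ.z≤n 0≤j (λ ()) t λ _ → (lia ([]) ([]) (+ 2 *' !0 <= !0 +' !0 +' !1) (tt))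

   drop₀ : ∀ {w j} → + 0 ≤ w → + 0 ≤ j → w + + 2 ≤ h → Tight j (E ++ w ∷ []) → ⊥
   drop₀ {w} {j} 0≤w 0≤j p t = short (w ∷ []) j (0≤w ∷ []) (ℕ.s≤s ℕ.z≤n) 0≤j (λ ()) t λ _ →
     (lia ((h) & w & (κ E w) & []) (#0 -' !1 -' #1 <= #2 & #1 +' !2 <= #0 & []) (+ 2 *' (!1 +' !0) <= (#2 +' !0) +' (!0 +' !0) +' !1) ((low₀ 0≤w (lia (w & (h) & []) (#0 +' !2 <= #1 & []) (#0 <= #1) (p , tt))) , p , tt))

   drop₁ : ∀ {c w j} → + 0 ≤ c → + 0 ≤ w → + 0 ≤ j → w + + 2 ≤ c → c ≤ h → Tight j (E ++ c ∷ w ∷ []) → ⊥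
   drop₁ {c} {w} {j} 0≤c 0≤w 0≤j p q t = short (c ∷ w ∷ []) j (0≤c ∷ 0≤w ∷ []) (ℕ.s≤s (ℕ.s≤s ℕ.z≤n)) 0≤j (λ ()) t λ 2≤T →
     (lia ((h) & w & (κ E c) & (κ E w) & c & (bd c w) & []) (#0 +' !1 -' #1 <= #2 +' #3 & #1 +' !2 <= #4 & #4 <= #0 & !0 <= #5 & []) (+ 2 *' (!1 +' (!1 +' !0)) <= (#2 +' (#3 +' !0)) +' ((#5 +' !0) +' (!0 +' !0)) +' !1) ((far 2≤T 0≤w p (lia (c & (h) & []) (#0 <= #1 & []) (#0 <= #1 +' !1) (q , tt))) , p , q , (0≤bd c w) , tt))

   stuck₀ : ∀ {b d e j} → + 0 ≤ d → + 0 ≤ e → + 0 ≤ j → b + + 1 ≡ h → d + + 2 ≤ h → Stuck₅ b h d e → Tight j (E ++ d ∷ e ∷ []) → ⊥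
   stuck₀ {b} {d} {e} {j} 0≤d 0≤e 0≤j b≡ p st t = short (d ∷ e ∷ []) j (0≤d ∷ 0≤e ∷ []) (ℕ.s≤s (ℕ.s≤s ℕ.z≤n)) 0≤j (λ ()) t λ _ → sums st
     where
     e≤h : Stuck₅ b h d e → e ≤ h
     e≤h (inl (_ , q , _))        = (lia (e & (h) & []) (#0 +' !2 <= #1 & []) (#0 <= #1) (q , tt))
     e≤h (inr (inl (q , _)))     = ⊥-elim (1≰0 (lia ((h) & b & []) (#0 +' !2 <= #1 & #1 +' !1 == #0 & []) (!1 <= !0) (q , b≡ , tt)))
     e≤h (inr (inr (_ , q , _))) = (lia ((h) & e & []) (#0 == #1 +' !3 & []) (#1 <= #0) (q , tt))
     sums : Stuck₅ b h d e → + 2 * + 2 ≤ sumBy (κ E) (d ∷ e ∷ []) + bad (d ∷ e ∷ []) + + 1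
     sums (inl (_ , q , r)) = (lia ((h) & d & (κ E d) & e & (κ E e) & (bd d e) & b & []) (#0 -' !1 -' #1 <= #2 & #0 -' !1 -' #3 <= #4 & !0 <= #5 & #3 +' !2 <= #0 & #1 +' !2 <= #6 & #6 +' !1 == #0 & []) (+ 2 *' !2 <= (#2 +' (#4 +' !0)) +' ((#5 +' !0) +' (!0 +' !0)) +' !1) ((low₀ 0≤d (lia (d & (h) & []) (#0 +' !2 <= #1 & []) (#0 <= #1) (p , tt))) , (low₀ 0≤e (e≤h st)) , (0≤bd d e) , q , r , b≡ , tt))
     sums (inr (inl (q , _))) = ⊥-elim (1≰0 (lia ((h) & b & []) (#0 +' !2 <= #1 & #1 +' !1 == #0 & []) (!1 <= !0) (q , b≡ , tt)))
     sums (inr (inr (_ , q , r))) = (lia ((h) & d & (κ E d) & e & (κ E e) & (bd d e) & []) (#0 -' !1 -' #1 <= #2 & #0 -' !1 -' #3 <= #4 & !0 <= #5 & #0 == #3 +' !3 & #1 == #3 +' !1 & []) (+ 2 *' !2 <= (#2 +' (#4 +' !0)) +' ((#5 +' !0) +' (!0 +' !0)) +' !1) ((low₀ 0≤d (lia (d & (h) & []) (#0 +' !2 <= #1 & []) (#0 <= #1) (p , tt))) , (low₀ 0≤e (e≤h st)) , (0≤bd d e) , q , r , tt))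

   stuck₁ : ∀ {c d e j} → + 0 ≤ c → + 0 ≤ d → + 0 ≤ e → + 0 ≤ j → c ≤ h → d + + 2 ≤ c → Stuck₅ h c d e → Tight j (E ++ c ∷ d ∷ e ∷ []) → ⊥
   stuck₁ {c} {d} {e} {j} 0≤c 0≤d 0≤e 0≤j c≤h p st t = short (c ∷ d ∷ e ∷ []) j (0≤c ∷ 0≤d ∷ 0≤e ∷ []) (ℕ.s≤s (ℕ.s≤s (ℕ.s≤s ℕ.z≤n))) 0≤j (λ ()) t λ 2≤T → sums 2≤T st
     where
     c≤h+1 : c ≤ h + + 1
     c≤h+1 = (lia (c & (h) & []) (#0 <= #1 & []) (#0 <= #1 +' !1) (c≤h , tt))
     sums : + 2 ≤ T → Stuck₅ h c d e → + 2 * + 3 ≤ sumBy (κ E) (c ∷ d ∷ e ∷ []) + bad (c ∷ d ∷ e ∷ []) + + 1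
     sums 2≤T (inl (_ , q , r)) = (lia ((h) & e & (κ E c) & (κ E e) & d & (κ E d) & (bd c d) & (bd c e) & (bd d e) & c & []) (#0 +' !1 -' #1 <= #2 +' #3 & #0 -' !1 -' #4 <= #5 & #6 == !1 & #7 == !1 & !0 <= #8 & #1 +' !2 <= #9 & #4 +' !2 <= #0 & #9 <= #0 & []) (+ 2 *' !3 <= (#2 +' (#5 +' (#3 +' !0))) +' ((#6 +' (#7 +' !0)) +' ((#8 +' !0) +' (!0 +' !0))) +' !1) ((far 2≤T 0≤e q c≤h+1) , (low₀ 0≤d (lia (d & (h) & []) (#0 +' !2 <= #1 & []) (#0 <= #1) (r , tt))) , (far-bad c d p) , (far-bad c e q) , (0≤bd d e) , q , r , c≤h , tt))
     sums 2≤T (inr (inl (q , r))) = (lia ((h) & d & (κ E c) & (κ E d) & e & (κ E e) & (bd c d) & (bd c e) & (bd d e) & c & []) (#0 +' !1 -' #1 <= #2 +' #3 & #0 -' !1 -' #4 <= #5 & !0 <= #6 & !0 <= #7 & !0 <= #8 & #1 +' !2 <= #9 & #9 +' !2 <= #0 & #4 +' !2 <= #0 & []) (+ 2 *' !3 <= (#2 +' (#3 +' (#5 +' !0))) +' ((#6 +' (#7 +' !0)) +' ((#8 +' !0) +' (!0 +' !0))) +' !1) ((far 2≤T 0≤d p c≤h+1) , (low₀ 0≤e (lia (e & (h) & []) (#0 +' !2 <= #1 & []) (#0 <= #1) (r , tt))) , (0≤bd c d) , (0≤bd c e) , (0≤bd d e) , p , q , r , tt))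
     sums 2≤T (inr (inr (q , r , _))) = ⊥-elim (1≰0 (lia ((h) & e & c & []) (#0 == #1 +' !2 & #2 == #1 +' !3 & #2 <= #0 & []) (!1 <= !0) (q , r , c≤h , tt)))

   stuck₂ : ∀ {b c d e j} → + 0 ≤ b → + 0 ≤ c → + 0 ≤ d → + 0 ≤ e → + 3 ≤ j → b ≤ h → c ≤ b + + 1 → d + + 2 ≤ c → Stuck₅ b c d e → Tight j (E ++ b ∷ c ∷ d ∷ e ∷ []) → ⊥
   stuck₂ {b} {c} {d} {e} {j} 0≤b 0≤c 0≤d 0≤e 3≤j b≤h g p st t = short (b ∷ c ∷ d ∷ e ∷ []) j (0≤b ∷ 0≤c ∷ 0≤d ∷ 0≤e ∷ []) (ℕ.s≤s (ℕ.s≤s (ℕ.s≤s (ℕ.s≤s ℕ.z≤n))))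
       (ℤ.≤-trans (+≤+ ℕ.z≤n) 3≤j) (λ _ → 3≤j , one-bad) t λ 2≤T → sums 2≤T st
     where
     b≤h+1 : b ≤ h + + 1
     b≤h+1 = (lia (b & (h) & []) (#0 <= #1 & []) (#0 <= #1 +' !1) (b≤h , tt))
     c≤h+1 : c ≤ h + + 1
     c≤h+1 = (lia (b & (h) & c & []) (#0 <= #1 & #2 <= #0 +' !1 & []) (#2 <= #1 +' !1) (b≤h , g , tt))
     one-bad : + 1 ≤ bad (b ∷ c ∷ d ∷ e ∷ [])
     one-bad = (lia ((bd b c) & (bd b d) & (bd b e) & (bd c e) & (bd d e) & (bd c d) & []) (!0 <= #0 & !0 <= #1 & !0 <= #2 & !0 <= #3 & !0 <= #4 & #5 == !1 & []) (!1 <= (#0 +' (#1 +' (#2 +' !0))) +' ((#5 +' (#3 +' !0)) +' ((#4 +' !0) +' (!0 +' !0)))) ((0≤bd b c) , (0≤bd b d) , (0≤bd b e) , (0≤bd c e) , (0≤bd d e) , (far-bad c d p) , tt))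
     sums : + 2 ≤ T → Stuck₅ b c d e → + 2 * + 4 ≤ sumBy (κ E) (b ∷ c ∷ d ∷ e ∷ []) + bad (b ∷ c ∷ d ∷ e ∷ []) + + 1
     sums 2≤T (inl (_ , q , r)) = (lia ((bd b c) & (bd b d) & (bd b e) & (bd c e) & (bd d e) & (bd c d) & (h) & d & (κ E b) & (κ E d) & e & (κ E c) & (κ E e) & c & b & []) (!0 <= #0 & !0 <= #1 & !0 <= #2 & !0 <= #3 & !0 <= #4 & #5 == !1 & #6 +' !1 -' #7 <= #8 +' #9 & #6 +' !1 -' #10 <= #11 +' #12 & #1 == !1 & #3 == !1 & #10 +' !2 <= #13 & #7 +' !2 <= #14 & #14 <= #6 & #13 <= #14 +' !1 & []) (+ 2 *' !4 <= (#8 +' (#11 +' (#9 +' (#12 +' !0)))) +' ((#0 +' (#1 +' (#2 +' !0))) +' ((#5 +' (#3 +' !0)) +' ((#4 +' !0) +' (!0 +' !0)))) +' !1) ((0≤bd b c) , (0≤bd b d) , (0≤bd b e) , (0≤bd c e) , (0≤bd d e) , (far-bad c d p) , (far 2≤T 0≤d r b≤h+1) , (far 2≤T 0≤e q c≤h+1) , (far-bad b d r) , (far-bad c e q) , q , r , b≤h , g , tt))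
     sums 2≤T (inr (inl (q , r))) = (lia ((bd b c) & (bd b d) & (bd b e) & (bd c e) & (bd d e) & (bd c d) & (h) & e & (κ E b) & (κ E e) & d & (κ E c) & (κ E d) & c & b & []) (!0 <= #0 & !0 <= #1 & !0 <= #2 & !0 <= #3 & !0 <= #4 & #5 == !1 & #6 +' !1 -' #7 <= #8 +' #9 & #6 +' !1 -' #10 <= #11 +' #12 & #13 +' !2 <= #14 & #7 +' !2 <= #14 & #14 <= #6 & #10 +' !2 <= #13 & []) (+ 2 *' !4 <= (#8 +' (#11 +' (#12 +' (#9 +' !0)))) +' ((#0 +' (#1 +' (#2 +' !0))) +' ((#5 +' (#3 +' !0)) +' ((#4 +' !0) +' (!0 +' !0)))) +' !1) ((0≤bd b c) , (0≤bd b d) , (0≤bd b e) , (0≤bd c e) , (0≤bd d e) , (far-bad c d p) , (far 2≤T 0≤e r b≤h+1) , (far 2≤T 0≤d p c≤h+1) , q , r , b≤h , p , tt))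
     sums 2≤T (inr (inr (q , r , v))) = (lia ((bd b c) & (bd b d) & (bd b e) & (bd c e) & (bd d e) & (bd c d) & (h) & e & (κ E b) & (κ E e) & d & (κ E c) & (κ E d) & b & c & []) (!0 <= #0 & !0 <= #1 & !0 <= #2 & !0 <= #3 & !0 <= #4 & #5 == !1 & #6 +' !1 -' #7 <= #8 +' #9 & #6 +' !1 -' #10 <= #11 +' #12 & #2 == !1 & #3 == !1 & #13 == #7 +' !2 & #14 == #7 +' !3 & #10 == #7 +' !1 & #13 <= #6 & []) (+ 2 *' !4 <= (#8 +' (#11 +' (#12 +' (#9 +' !0)))) +' ((#0 +' (#1 +' (#2 +' !0))) +' ((#5 +' (#3 +' !0)) +' ((#4 +' !0) +' (!0 +' !0)))) +' !1) ((0≤bd b c) , (0≤bd b d) , (0≤bd b e) , (0≤bd c e) , (0≤bd d e) , (far-bad c d p) , (far 2≤T 0≤e (lia (b & e & []) (#0 == #1 +' !2 & []) (#1 +' !2 <= #0) (q , tt)) b≤h+1) , (far 2≤T 0≤d p c≤h+1) , (far-bad b e (lia (b & e & []) (#0 == #1 +' !2 & []) (#1 +' !2 <= #0) (q , tt))) , (far-bad c e (lia (c & e & []) (#0 == #1 +' !3 & []) (#1 +' !2 <= #0) (r , tt))) , q , r , v , b≤h , tt))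

   κ-top : κ E h ≡ T + G (h + + 2) E
   κ-top = (lia ((lenᶻ E) & (T) & (h) & (G h E) & (G (h + + 2) E) & []) (#0 == #1 +' #2 +' !1 & #3 == !1 & []) (#0 -' #3 +' #4 -' #2 == #1 +' #4) (L≡ , G-top , tt))

   climb : + 2 ≤ T → + 5 ≤ κ E (h + + 2) + κ E (h + + 1) + κ E h
   climb 2≤T = (lia ((κ E h) & (T) & (G (h + + 2) E) & (lenᶻ E) & (h) & (κ E (h + + 2)) & (κ E (h + + 1)) & []) (#0 == #1 +' #2 & !0 <= #2 & #3 == #1 +' #4 +' !1 & !2 <= #1 & #3 -' (#4 +' !2) <= #5 & #3 -' (#4 +' !1) <= #6 & []) (!5 <= #5 +' #6 +' #0) (κ-top , (0≤G (h + + 2) E) , L≡ , 2≤T , (κ-high {h + + 2} (lia ((h) & []) ([]) (#0 +' !1 <= #0 +' !2) (tt))) , (κ-high {h + + 1} ℤ.≤-refl) , tt))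

   climb₀ : ∀ {j} → + 0 ≤ j → Tight j (E ++ h + + 2 ∷ h + + 1 ∷ h ∷ []) → ⊥
   climb₀ {j} 0≤j t = short W j ((lia ((h) & []) (!0 <= #0 & []) (!0 <= #0 +' !2) (0≤h , tt)) ∷ (lia ((h) & []) (!0 <= #0 & []) (!0 <= #0 +' !1) (0≤h , tt)) ∷ 0≤h ∷ []) (ℕ.s≤s (ℕ.s≤s (ℕ.s≤s ℕ.z≤n))) 0≤j (λ ()) t λ 2≤T →
     (lia ((κ E (h + + 2)) & (κ E (h + + 1)) & (κ E h) & (bad W) & []) (!5 <= #0 +' #1 +' #2 & !0 <= #3 & []) (+ 2 *' !3 <= (#0 +' (#1 +' (#2 +' !0))) +' #3 +' !1) ((climb 2≤T) , (0≤bad W) , tt))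
     where
     W : List ℤ
     W = h + + 2 ∷ h + + 1 ∷ h ∷ []

   climb₁ : ∀ {c j} → + 0 ≤ c → + 3 ≤ j → c + + 1 ≤ h → Tight j (E ++ c ∷ h + + 2 ∷ h + + 1 ∷ h ∷ []) → ⊥
   climb₁ {c} {j} 0≤c 3≤j p t = short (c ∷ W) j (0≤c ∷ (lia ((h) & []) (!0 <= #0 & []) (!0 <= #0 +' !2) (0≤h , tt)) ∷ (lia ((h) & []) (!0 <= #0 & []) (!0 <= #0 +' !1) (0≤h , tt)) ∷ 0≤h ∷ []) (ℕ.s≤s (ℕ.s≤s (ℕ.s≤s (ℕ.s≤s ℕ.z≤n))))
     (ℤ.≤-trans (+≤+ ℕ.z≤n) 3≤j) (λ _ → 3≤j , (lia ((bad (c ∷ W)) & []) (!3 <= #0 & []) (!1 <= #0) (bads , tt))) t λ 2≤T →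
     (lia ((κ E (h + + 2)) & (κ E (h + + 1)) & (κ E h) & (bad (c ∷ W)) & (h) & c & (κ E c) & []) (!5 <= #0 +' #1 +' #2 & !3 <= #3 & #4 -' !1 -' #5 <= #6 & #5 +' !1 <= #4 & []) (+ 2 *' !4 <= (#6 +' (#0 +' (#1 +' (#2 +' !0)))) +' #3 +' !1) ((climb 2≤T) , bads , (low₀ 0≤c (lia (c & (h) & []) (#0 +' !1 <= #1 & []) (#0 <= #1) (p , tt))) , p , tt))
     where
     W : List ℤ
     W = h + + 2 ∷ h + + 1 ∷ h ∷ []
     bads : + 3 ≤ bad (c ∷ W)
     bads = (lia ((bad W) & c & (h) & []) (!0 <= #0 & #1 +' !1 <= #2 & []) (!3 <= (((#2 +' !2 +' !2 <=? #1) +' (#1 +' !1 <=? #2 +' !2)) +' (((#2 +' !1 +' !2 <=? #1) +' (#1 +' !1 <=? #2 +' !1)) +' (((#2 +' !2 <=? #1) +' (#1 +' !1 <=? #2)) +' !0))) +' #0) ((0≤bad W) , p , tt))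

module Exist where

 open Runs
 open Uniq
 open Pre
 open Steps
 open East
 open Rows
 open Local
 open Words
 open Extract hiding (mid)
 open Moves
 open Lia
 open Dbm using (Form; atom; atLeast; _and_; _or_; _imp_; sumχ; prove; valid; prop; eval)
 open Win hiding (shape)
 open Stats
 open import Defs hiding (maximum)
 open import Data.Bool.Base using (if_then_else_)
 open import Data.Integer.Base using (_<_)
 open import Data.Integer.Properties using (≤-totalOrder)
 open import Data.List.Base using (head)
 open import Data.List.Extrema ≤-totalOrder using (min; min≤⊤; min≤xs; v≤min⁺)
 open import Data.List.Relation.Unary.Linked using ([]; _∷_)
 open import Data.Product.Base using (_,_)
 open import Data.Sum.Base using (_⊎_)
 import Data.List.Relation.Unary.All.Properties as All
 open Facts
 open Small using (Domain; domain; StringLike)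
 open import Data.List.Base using (initLast; _∷ʳ′_)
 open import Data.Nat.Combinatorics using (nC1≡n; nCk+nC[k+1]≡[n+1]C[k+1]) renaming (_C_ to _choose_)
 open Fad using (module Scattered)

 shape-of : ∀ {x} → Dyck x → Shape x
 shape-of d with toPath d
 ... | E , a , refl , p = shape p

 snoc-form : ∀ S m k R → ∃[ D ] ∃[ v ] (S ++ run m k) ++ R ≡ D ∷ʳ v
 snoc-form S m k R with initLast R
 ... | []      with run-init S m k
 ...   | P , eq = P , m + + k , trans (List.++-identityʳ _) eq
 snoc-form S m k .(R ∷ʳ v) | R ∷ʳ′ v = (S ++ run m k) ++ R , v , sym (List.++-assoc (S ++ run m k) R (v ∷ []))

 -- One more extraction, from a word whose last letters V are not touched.
 record Stage (us C V x : List ℤ) (w : ℤ) : Set where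
   field
     {D X}  : List ℤ
     {v}    : ℤ
     x≡     : x ≡ X ++ V
     inside : Inserted (us ∷ʳ w) (D ∷ʳ v) X
     whole  : Inserted (us ∷ʳ w) ((D ∷ʳ v) ++ V) x
     admits : Adm w (D ∷ʳ v)
     {Z}    : List ℤ
     C≡     : C ≡ Z ++ V

 stage : ∀ us {C x S m} k R V → Inserted us C x → Sk S → + 0 ≤ m → All (λ u → u + + 1 ≤ m) S → Head≤ (m + + suc k) (R ++ V) →
   C ≡ (S ++ run m (suc k)) ++ R ++ V → Stage us C V x (m + + k)
 stage us {C} {x} {S} {m} k R V r s 0≤m lt hd eq with snoc-form S m k R
 ... | D , v , form with localize us D (subst (λ C′ → Inserted (us ∷ʳ (m + + k)) C′ x) C′≡ whole′) (subst (Adm (m + + k)) form (ins⇒adm (run-ins k R s 0≤m lt)))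
   where
   whole′ : Inserted (us ∷ʳ (m + + k)) ((S ++ run m k) ++ R ++ V) x
   whole′ = inserted-∷ʳ r (subst (Ins _ _) (sym eq) (run-ins k (R ++ V) s 0≤m lt)) (running-dyck {S} {m} k (R ++ V) hd (subst Dyck eq (inserted-base r)))
   C′≡ : (S ++ run m k) ++ R ++ V ≡ (D ∷ʳ v) ++ V
   C′≡ = trans (sym (List.++-assoc (S ++ run m k) R V)) (cong (_++ V) form)
 ...   | X , x≡ , q = record
   { x≡ = x≡ ; inside = q
   ; whole = subst (Inserted _ _) (sym x≡) (inserted-++ V q (subst Dyck (trans (sym (List.++-assoc (S ++ run m k) R V)) (cong (_++ V) form)) (running-dyck {S} {m} k (R ++ V) hd (subst Dyck eq (inserted-base r)))))
   ; admits = subst (Adm (m + + k)) form (ins⇒adm (run-ins k R s 0≤m lt))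
   ; C≡ = trans eq (sym (List.++-assoc (S ++ run m (suc k)) R V)) }

 chained : ∀ {us u v C x} → Inserted (u ∷ v ∷ us) C x → u ≤ v + + 1
 chained r with inserted⇒pushable r
 ... | push _ k _ = k

 inserted-tail : ∀ {us u C x} → Inserted (u ∷ us) C x → ∃[ z ] Inserted us C z
 inserted-tail (i ∷ r) = _ , r

 dyck-∷ʳ : ∀ D {a b} → Dyck (D ∷ʳ a) → + 0 ≤ b → b ≤ a + + 1 → Dyck ((D ∷ʳ a) ++ b ∷ [])
 dyck-∷ʳ D d h k = fromPath (step (dyck-path D d) h k)

 nonneg-last : ∀ D {v} → Dyck (D ∷ʳ v) → + 0 ≤ v
 nonneg-last D (_ , _ , nn) = All.head (All.++⁻ʳ D nn)

 Sk-prefix : ∀ X B → Sk (X ++ B) → Sk X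
 Sk-prefix X []      s = subst Sk (List.++-identityʳ X) s
 Sk-prefix X (b ∷ B) s = fst (Sk-init X (Sk-prefix (X ∷ʳ b) B (subst Sk (sym (++-∷ʳ-assoc X b B)) s)))

 doubled-++ : ∀ {p} A B → Doubled p A → Doubled p (A ++ B)
 doubled-++ A []      d = subst (Doubled _) (sym (List.++-identityʳ A)) d
 doubled-++ A (b ∷ B) d = subst (Doubled _) (++-∷ʳ-assoc A b B) (doubled-++ (A ∷ʳ b) B (doubled-∷ʳ A b d))

 record Top (D : List ℤ) : Set where
   constructor topped
   field
     {m}     : ℤ
     chain   : Chain D m
     doubled : Doubled m D

 top-of : ∀ {D} → Dyck D → Sk D → Top D
 top-of d s with shape-of d
 ... | skeleton m _ c dd = topped c dd
 ... | running S m k R s′ h dd lt hd refl = ⊥-elim (ins-not-Sk (run-ins k R s′ h lt) (running-dyck {S} {m} k R hd d) (Sk⇒full d s))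

 -- An occurring letter may be injected after a skeleton.
 Sk-adm : ∀ {D m u} → Sk D → Chain D m → + 0 ≤ u → u ≤ m → Adm u D
 Sk-adm {D} {u = u} s c h k with first-occurrence c u h k
 ... | X , B , refl , lt = adm X B refl lt (Sk-blocked u (Sk-prefix X (u ∷ B) s)) h

 adm-doubled : ∀ {D u} → Sk D → Adm u D → Doubled u D
 adm-doubled {u = u} s (adm P R refl _ _ _) =
   doubled-++ P (u ∷ R) (snd (snd (Sk-init P (Sk-prefix (P ∷ʳ u) R (subst Sk (sym (++-∷ʳ-assoc P u R)) s)))))

 adm-max : ∀ {D m u} → All (_≤ m) D → Adm u D → u ≤ m
 adm-max h (adm P R refl _ _ _) = All.head (All.++⁻ʳ P h)

 all-zero : ∀ D → All (λ u → + 0 ≤ u × u ≤ + 0) D → D ≡ zeroes (length D)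
 all-zero []      []              = refl
 all-zero (u ∷ D) ((p , q) ∷ h) = cong₂ _∷_ (ℤ.≤-antisym q p) (all-zero D h)

 ends₁ : ∀ {D u} Z {c : ℤ} → D ∷ʳ u ≡ Z ++ c ∷ [] → D ≡ Z × u ≡ c
 ends₁ {D} Z eq = List.∷ʳ-injective D Z eq

 ends₂ : ∀ {D u v} Z {b c : ℤ} → (D ∷ʳ u) ∷ʳ v ≡ Z ++ b ∷ c ∷ [] → D ≡ Z × u ≡ b × v ≡ c
 ends₂ {D} {u} Z {b} {c} eq with List.∷ʳ-injective (D ∷ʳ u) (Z ∷ʳ b) (trans eq (sym (++-∷ʳ-assoc Z b (c ∷ []))))
 ... | eq₁ , eq₂ with List.∷ʳ-injective D Z eq₁
 ...   | p , q = p , q , eq₂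

 -- R seen from its end.
 data Tail₁ : List ℤ → Set where
   none : Tail₁ []
   some : ∀ R c → Tail₁ (R ++ c ∷ [])

 data Tail₂ : List ℤ → Set where
   none : Tail₂ []
   one  : ∀ c → Tail₂ (c ∷ [])
   some : ∀ R b c → Tail₂ (R ++ b ∷ c ∷ [])

 data Tail₃ : List ℤ → Set where
   none : Tail₃ []
   one  : ∀ c → Tail₃ (c ∷ [])
   two  : ∀ b c → Tail₃ (b ∷ c ∷ [])
   some : ∀ R a b c → Tail₃ (R ++ a ∷ b ∷ c ∷ [])

 tail₁ : ∀ R → Tail₁ R
 tail₁ R with initLast R
 ... | []      = none
 ... | R ∷ʳ′ c = some R c

 tail₂ : ∀ R → Tail₂ R
 tail₂ R with tail₁ R
 ... | none     = none
 ... | some R c with tail₁ R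
 ...   | none     = one c
 ...   | some R b = subst Tail₂ (sym (List.++-assoc R (b ∷ []) (c ∷ []))) (some R b c)

 tail₃ : ∀ R → Tail₃ R
 tail₃ R with tail₂ R
 ... | none       = none
 ... | one c      = one c
 ... | some R b c with tail₁ R
 ...   | none     = two b c
 ...   | some R a = subst Tail₃ (sym (List.++-assoc R (a ∷ []) (b ∷ c ∷ []))) (some R a b c)

 nonneg-image : ∀ {a b c d e p q r s t} → Rearranged (five a b c d e) (five p q r s t) → All (+ 0 ≤_) (five a b c d e) → All (+ 0 ≤_) (five p q r s t)
 nonneg-image {a} {b} {c} {d} {e} {p} {q} {r} {s} {t} (_ , sums) (ha ∷ hb ∷ hc ∷ hd ∷ he ∷ []) =
   (lia (p & q & r & s & t & []) ((#0 +' !1 <=? !0) +' ((#1 +' !1 <=? !0) +' ((#2 +' !1 <=? !0) +' ((#3 +' !1 <=? !0) +' ((#4 +' !1 <=? !0) +' !0)))) == !0 & []) (!0 <= #0) (none-negative , tt)) ∷ (lia (p & q & r & s & t & []) ((#0 +' !1 <=? !0) +' ((#1 +' !1 <=? !0) +' ((#2 +' !1 <=? !0) +' ((#3 +' !1 <=? !0) +' ((#4 +' !1 <=? !0) +' !0)))) == !0 & []) (!0 <= #1) (none-negative , tt)) ∷ (lia (p & q & r & s & t & []) ((#0 +' !1 <=? !0) +' ((#1 +' !1 <=? !0) +' ((#2 +' !1 <=? !0) +' ((#3 +' !1 <=? !0) +' ((#4 +' !1 <=? !0) +' !0)))) == !0 & []) (!0 <= #2) (none-negative , tt)) ∷ (lia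 (p & q & r & s & t & []) ((#0 +' !1 <=? !0) +' ((#1 +' !1 <=? !0) +' ((#2 +' !1 <=? !0) +' ((#3 +' !1 <=? !0) +' ((#4 +' !1 <=? !0) +' !0)))) == !0 & []) (!0 <= #3) (none-negative , tt)) ∷ (lia (p & q & r & s & t & []) ((#0 +' !1 <=? !0) +' ((#1 +' !1 <=? !0) +' ((#2 +' !1 <=? !0) +' ((#3 +' !1 <=? !0) +' ((#4 +' !1 <=? !0) +' !0)))) == !0 & []) (!0 <= #4) (none-negative , tt)) ∷ []
   where
   none-negative : (p + + 1 ≤χ + 0) + ((q + + 1 ≤χ + 0) + ((r + + 1 ≤χ + 0) + ((s + + 1 ≤χ + 0) + ((t + + 1 ≤χ + 0) + + 0)))) ≡ + 0
   none-negative = trans (sums (λ u → u + + 1 ≤χ + 0))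
     (lia (a & b & c & d & e & []) (!0 <= #0 & !0 <= #1 & !0 <= #2 & !0 <= #3 & !0 <= #4 & []) ((#0 +' !1 <=? !0) +' ((#1 +' !1 <=? !0) +' ((#2 +' !1 <=? !0) +' ((#3 +' !1 <=? !0) +' ((#4 +' !1 <=? !0) +' !0)))) == !0) (ha , hb , hc , hd , he , tt))

 dense-image : ∀ {z a b c d e y p q r s t} → Rearranged (five a b c d e) (five p q r s t) →
   Dense (z ∷ p ∷ q ∷ r ∷ s ∷ t ∷ y ∷ []) → Dense (z ∷ a ∷ b ∷ c ∷ d ∷ e ∷ y ∷ [])
 dense-image {z} {a} {b} {c} {d} {e} {y} {p} {q} {r} {s} {t} (_ , sums) (k , h) = k ,
   (lia ((near k z) & (near k p) & (near k q) & (near k r) & (near k s) & (near k t) & (near k y) & (near k a) & (near k b) & (near k c) & (near k d) & (near k e) & []) (!5 <= #0 +' (#1 +' (#2 +' (#3 +' (#4 +' (#5 +' (#6 +' !0)))))) & #1 +' (#2 +' (#3 +' (#4 +' (#5 +' !0)))) == #7 +' (#8 +' (#9 +' (#10 +' (#11 +' !0)))) & []) (!5 <= #0 +' (#7 +' (#8 +' (#9 +' (#10 +' (#11 +' (#6 +' !0))))))) (h , (sums (near k)) , tt))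

 -- The anchoring of a window of seven letters: D precedes it, and its first
 -- letter z and its last letter f are close to D.
 anchoring : ∀ {j} D {z W f} → Tight j ((D ∷ʳ z) ++ W) → length W ≡ 6 → Dyck (D ∷ʳ z) → Adm f (D ∷ʳ z) →
   ∃[ m ] (Chain D m × z ≤ m + + 1 × (f ≤ m ⊎ f ≤ z))
 anchoring D {z} {W} {f} (big , _) len d a with initLast D
 ... | [] = ⊥-elim (1≰0 (lia ((lenᶻ (z ∷ W)) & (lenᶻ W) & []) (!10 <= #0 & #1 == !6 & #0 == !1 +' #1 & []) (!1 <= !0) (big , (cong +_ len) , refl , tt)))
 ... | D′ ∷ʳ′ v with path-chain (dyck-path D′ (dyck-++ˡ D′ (z ∷ []) d))
 ...   | m , c , v≤m = m , c , (lia (z & v & m & []) (#0 <= #1 +' !1 & #1 <= #2 & []) (#0 <= #2 +' !1) ((last-step D′ (fst (snd d))) , v≤m , tt)) , near-end a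
   where
   near-end : Adm f ((D′ ∷ʳ v) ∷ʳ z) → f ≤ m ⊎ f ≤ z
   near-end (adm P R eq _ _ _) with snoc-split (D′ ∷ʳ v) z P f R eq
   ... | inl (_ , refl , _)    = inr ℤ.≤-refl
   ... | inr (B , eq′ , _) = inl (All.head (All.++⁻ʳ P (subst (All (_≤ m)) eq′ (chain-max c))))

module Find where

 open Exist
 open Runs
 open Uniq
 open Pre
 open Steps
 open East
 open Rows
 open Local
 open Words
 open Extract hiding (mid)
 open Moves
 open Lia
 open Dbm using (Form; atom; atLeast; _and_; _or_; _imp_; sumχ; prove; valid; prop; eval)
 open Win hiding (shape)
 open Stats
 open import Defs hiding (maximum)
 open import Data.Bool.Base using (if_then_else_)
 open import Data.Integer.Base using (_<_)
 open import Data.Integer.Properties using (≤-totalOrder)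
 open import Data.List.Base using (head)
 open import Data.List.Extrema ≤-totalOrder using (min; min≤⊤; min≤xs; v≤min⁺)
 open import Data.List.Relation.Unary.Linked using ([]; [-]; _∷_)
 open import Data.Product.Base using (_,_)
 open import Data.Sum.Base using (_⊎_)
 import Data.List.Relation.Unary.All.Properties as All
 open Facts
 open Small using (Domain; domain; StringLike)
 open import Data.List.Base using (initLast; _∷ʳ′_)
 open import Data.Nat.Combinatorics using (nC1≡n; nCk+nC[k+1]≡[n+1]C[k+1]) renaming (_C_ to _choose_)
 open Fad using (module Scattered)

 ends₃ : ∀ {D u v w} Z {a b c : ℤ} → (D ∷ʳ u) ++ v ∷ w ∷ [] ≡ Z ++ a ∷ b ∷ c ∷ [] → u ≡ a × v ≡ b × w ≡ c
 ends₃ {D} {u} {v} {w} Z {a} {b} {c} eq with ends₂ {D ∷ʳ u} (Z ∷ʳ a) (trans (++-∷ʳ-assoc (D ∷ʳ u) v (w ∷ [])) (trans eq (sym (++-∷ʳ-assoc Z a (b ∷ c ∷ [])))))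
 ... | p , q , r = snd (List.∷ʳ-injective D Z p) , q , r

 -- The last two entries of a run.
 run-ends : ∀ {D u v} S m k → (D ∷ʳ u) ∷ʳ v ≡ S ++ run m (suc k) → v ≡ m + + suc k × u ≡ m + + k
 run-ends {D} {u} S m k eq with List.∷ʳ-injective (D ∷ʳ u) (S ++ run m k) (trans eq (sym (List.++-assoc S (run m k) _))) | run-init S m k
 ... | p , q | P , e = q , snd (List.∷ʳ-injective D P (trans p e))

 run-end : ∀ {D v} S m k → D ∷ʳ v ≡ S ++ run m (suc k) → v ≡ m + + suc k
 run-end {D} S m k eq = snd (List.∷ʳ-injective D (S ++ run m k) (trans eq (sym (List.++-assoc S (run m k) _))))

 extract-once : ∀ us {C x S m} k R → Inserted us C x → Sk S → + 0 ≤ m → All (λ u → u + + 1 ≤ m) S → Head≤ (m + + suc k) R →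
   C ≡ (S ++ run m (suc k)) ++ R → Inserted (us ∷ʳ (m + + k)) ((S ++ run m k) ++ R) x
 extract-once us {S = S} {m} k R r s 0≤m lt hd refl = inserted-∷ʳ r (run-ins k R s 0≤m lt) (running-dyck {S} {m} k R hd (inserted-base r))

 affine-letters : ∀ D {v} W → AffineDyck ((D ∷ʳ v) ++ W) → AffineDyck (v ∷ W)
 affine-letters D {v} W l = affine-right D (subst AffineDyck (++-∷ʳ-assoc D v W) l)

 dyck-∷ʳ₂ : ∀ D {a b c} → Dyck (D ∷ʳ a) → + 0 ≤ b → b ≤ a + + 1 → + 0 ≤ c → c ≤ b + + 1 → Dyck ((D ∷ʳ a) ++ b ∷ c ∷ [])
 dyck-∷ʳ₂ D {a} {b} {c} d h k h′ k′ = subst Dyck (++-∷ʳ-assoc (D ∷ʳ a) b (c ∷ [])) (dyck-∷ʳ (D ∷ʳ a) (dyck-∷ʳ D d h k) h′ k′)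

 dyck-∷ʳ₃ : ∀ D {a b c d} → Dyck (D ∷ʳ a) → + 0 ≤ b → b ≤ a + + 1 → + 0 ≤ c → c ≤ b + + 1 → + 0 ≤ d → d ≤ c + + 1 → Dyck ((D ∷ʳ a) ++ b ∷ c ∷ d ∷ [])
 dyck-∷ʳ₃ D {a} {b} {c} {d} dy h k h′ k′ h″ k″ = subst Dyck (++-∷ʳ-assoc (D ∷ʳ a) b (c ∷ d ∷ [])) (dyck-∷ʳ₂ (D ∷ʳ a) (dyck-∷ʳ D dy h k) h′ k′ h″ k″)

 move₅-facts : ∀ {a b c d e p q} → Move₅ a b c d e p q → + 0 ≤ b → + 0 ≤ c → c ≤ b + + 1 → + 0 ≤ p × + 0 ≤ q × p ≤ q + + 1 × q ≤ e + + 1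
 move₅-facts (keep p _ r) hb hc g = hb , hc , p , r
 move₅-facts (swap p _)   hb hc g = hc , hb , g , p

 move₅-source : ∀ {a b c d e p q} → Move₅ a b c d e p q → + 0 ≤ p → + 0 ≤ q → + 0 ≤ b × + 0 ≤ c
 move₅-source (keep _ _ _) hp hq = hp , hq
 move₅-source (swap _ _)   hp hq = hq , hp

 chain-init : ∀ {X m} D {v} → Chain X m → X ≡ D ∷ʳ v → D ≡ [] ⊎ Chain D m ⊎ (Chain D (m - + 1) × v ≡ m)
 chain-init D start eq with List.∷ʳ-injective [] D eq
 ... | refl , _ = inl refl
 chain-init D (new {E} {m} c) eq with List.∷ʳ-injective E D eq
 ... | refl , refl = inr (inr (subst (Chain E) (sym (+1-1 m)) c , refl))
 chain-init D (old {E} c _ _) eq with List.∷ʳ-injective E D eq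
 ... | refl , _ = inr (inl c)

 plus-two : ∀ w u → w + + 1 + + 1 ≤ u → w + + 2 ≤ u
 plus-two w u h = (lia (w & u & []) (#0 +' !1 +' !1 <= #1 & []) (#0 +' !2 <= #1) (h , tt))

 module _ (k : ℕ) where

   private
     n = 4 ℕ.+ k

   module Ascend {x : List ℤ} (big : 10 ℕ.≤ n) (dom : Domain n (+ 1) x) where

     Found : Set
     Found = ∃[ y ] Image n x y

     seven : ∀ {D z a b c d e f X} → x ≡ X ++ a ∷ b ∷ c ∷ [] → Inserted (d ∷ e ∷ f ∷ []) (D ∷ʳ z) X →
       Inserted (d ∷ e ∷ f ∷ []) ((D ∷ʳ z) ++ a ∷ b ∷ c ∷ []) x → Adm f (D ∷ʳ z) → d + + 2 ≤ c → Stuck₅ b c d e → Found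
     seven {D} {z} {a} {b} {c} {d} {e} {f} {X} x≡ inside whole adm-f drop-d st
       with affine-letters D (a ∷ b ∷ c ∷ []) (fst (snd (inserted-base whole))) | All.++⁻ʳ D (subst (All (+ 0 ≤_)) (++-∷ʳ-assoc D z (a ∷ b ∷ c ∷ [])) (snd (snd (inserted-base whole))))
          | inserted-nonneg whole | chained whole | chained (snd (inserted-tail whole))
     ... | a≤ ∷ b≤ ∷ c≤ ∷ [-] | hz ∷ ha ∷ hb ∷ hc ∷ [] | hd ∷ he ∷ hf ∷ [] | d≤ | e≤ =
       finish (east-forward z a b c d e f left crowd₇)
       where
       dDz : Dyck (D ∷ʳ z)
       dDz = inserted-base inside
       σ≡ : ((D ∷ʳ z) ++ a ∷ b ∷ c ∷ []) ++ d ∷ e ∷ f ∷ [] ≡ (D ∷ʳ z) ++ a ∷ b ∷ c ∷ d ∷ e ∷ f ∷ []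
       σ≡ = List.++-assoc (D ∷ʳ z) (a ∷ b ∷ c ∷ []) (d ∷ e ∷ f ∷ [])
       T₁ : Tight (+ 4) ((D ∷ʳ z) ++ a ∷ b ∷ c ∷ d ∷ e ∷ f ∷ [])
       T₁ = tight big dom whole σ≡
       T₂ : Tight (+ 4) (D ++ z ∷ a ∷ b ∷ c ∷ d ∷ e ∷ f ∷ [])
       T₂ = tight big dom whole (trans σ≡ (++-∷ʳ-assoc D z (a ∷ b ∷ c ∷ d ∷ e ∷ f ∷ [])))
       st′ : Stuck₅ b c d e → prop (le 2F 3F (+ 1) and le 4F 3F (-[1+ 1 ]) and le 5F 3F (-[1+ 1 ]) and le 4F 2F (-[1+ 1 ])
         or le 3F 2F (-[1+ 1 ]) and le 5F 2F (-[1+ 1 ]) or eq 2F 5F (+ 2) and eq 3F 5F (+ 3) and eq 4F 5F (+ 1)) (z ∷ a ∷ b ∷ c ∷ d ∷ e ∷ f ∷ [])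
       st′ (inl (p , q , r)) = inl ((lia (b & c & []) (#0 <= #1 +' !1 & []) (#0 +' !-1 <= #1) (p , tt)) , drop-d , q , r)
       st′ (inr (inl p)) = inr (inl p)
       st′ (inr (inr (p , q , r))) = inr (inr (((lia (b & e & []) (#0 == #1 +' !2 & []) (#0 +' !-2 <= #1) (p , tt)) , (lia (b & e & []) (#0 == #1 +' !2 & []) (#1 +' !2 <= #0) (p , tt))) , ((lia (c & e & []) (#0 == #1 +' !3 & []) (#0 +' !-3 <= #1) (q , tt)) , (lia (c & e & []) (#0 == #1 +' !3 & []) (#1 +' !3 <= #0) (q , tt))) ,
         ((lia (d & e & []) (#0 == #1 +' !1 & []) (#0 +' !-1 <= #1) (r , tt)) , (lia (d & e & []) (#0 == #1 +' !1 & []) (#1 +' !1 <= #0) (r , tt)))))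
       left : prop (leftShape ix7 and leftStuck ix7) (z ∷ a ∷ b ∷ c ∷ d ∷ e ∷ f ∷ [])
       left = ((lia (a & z & []) (#0 <= #1 +' !1 & []) (#0 +' !-1 <= #1) (a≤ , tt)) , (lia (b & a & []) (#0 <= #1 +' !1 & []) (#0 +' !-1 <= #1) (b≤ , tt)) , (lia (c & b & []) (#0 <= #1 +' !1 & []) (#0 +' !-1 <= #1) (c≤ , tt)) , (lia (d & e & []) (#0 <= #1 +' !1 & []) (#0 +' !-1 <= #1) (d≤ , tt)) , (lia (e & f & []) (#0 <= #1 +' !1 & []) (#0 +' !-1 <= #1) (e≤ , tt))) ,
         (drop-d , st′ st)
       crowd₇ : prop (concentrated ix7) (z ∷ a ∷ b ∷ c ∷ d ∷ e ∷ f ∷ [])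
       crowd₇ with anchoring {+ 4} D T₁ refl dDz adm-f
       ... | m , ch , z≤ , f≤ = Scattered.left-crowded ch z a b c d e f (hz ∷ ha ∷ hb ∷ hc ∷ hd ∷ he ∷ hf ∷ []) z≤ f≤ (fst (snd T₂)) (snd (snd T₂)) left
       finish : ∃[ p ] ∃[ q ] ∃[ r ] ∃[ s ] ∃[ t ] Move₇ z a b c d e f p q r s t → Found
       finish (p , q , r , s , t , mv) with Move₇.right mv | nonneg-image (snd (Move₇.good mv)) (ha ∷ hb ∷ hc ∷ hd ∷ he ∷ [])
       ... | (p≤ , q≤ , r≤ , s≤ , t≤) , _ | hp ∷ hq ∷ hr ∷ hs ∷ ht ∷ []
         with pushable⇒inserted dDz (push hr (lia (r & s & []) (#0 +' !-1 <= #1 & []) (#0 <= #1 +' !1) (r≤ , tt)) (push hs (lia (s & t & []) (#0 +' !-1 <= #1 & []) (#0 <= #1 +' !1) (s≤ , tt)) (push ht (lia (t & f & []) (#0 +' !-1 <= #1 & []) (#0 <= #1 +' !1) (t≤ , tt)) (last adm-f))))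
       ...   | Y , rY = Y ++ p ∷ q ∷ [] , subst (λ x → Image n x (Y ++ p ∷ q ∷ [])) (sym x≡) (move₇ mv (crowded⇒nearby z a b c d e f crowd₇) inside (inserted-base whole) rY
           (dyck-∷ʳ₂ D dDz hp (lia (p & z & []) (#0 +' !-1 <= #1 & []) (#0 <= #1 +' !1) (p≤ , tt)) hq (lia (q & p & []) (#0 +' !-1 <= #1 & []) (#0 <= #1 +' !1) (q≤ , tt))))

     third-run : ∀ {D a b c d e S m k R} → Inserted (d ∷ e ∷ []) ((D ∷ʳ a) ++ b ∷ c ∷ []) x → + 0 ≤ b → + 0 ≤ c → + 0 ≤ d → + 0 ≤ e → c ≤ b + + 1 → d + + 2 ≤ c → Stuck₅ b c d e →
       Sk S → + 0 ≤ m → Doubled m S → All (λ u → u + + 1 ≤ m) S → Head≤ (m + + suc k) R → (D ∷ʳ a) ++ b ∷ c ∷ [] ≡ (S ++ run m (suc k)) ++ R → Tail₃ R → Found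
     third-run {D} {a} {b} {c} {d} {e} {S} {m} {k} r hb hc hd he g drop-d st s 0≤m dd lt hd≤ eq none
       with run-ends {D ∷ʳ a} {b} {c} S m k (trans (++-∷ʳ-assoc (D ∷ʳ a) b (c ∷ [])) (trans eq (List.++-identityʳ _)))
     ... | refl , refl = ⊥-elim (ShortRun.stuck₀ k s 0≤m dd lt (subst Dyck eq (inserted-base r)) {j = + 3} hd he (+≤+ ℕ.z≤n) (lia (m & (+ k) & []) ([]) (#0 +' #1 +' !1 == #0 +' (!1 +' #1)) (tt)) drop-d st
           (tight big dom r (cong (_++ d ∷ e ∷ []) (trans eq (List.++-identityʳ _)))))
     third-run {D} {a} {b} {c} {d} {e} {S} {m} {k} r hb hc hd he g drop-d st s 0≤m dd lt hd≤ eq (one c′)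
       with List.∷ʳ-injective ((D ∷ʳ a) ∷ʳ b) (S ++ run m (suc k)) (trans (++-∷ʳ-assoc (D ∷ʳ a) b (c ∷ [])) eq)
     ... | eq′ , refl with run-end {D ∷ʳ a} S m k eq′
     ...   | refl = ⊥-elim (ShortRun.stuck₁ k s 0≤m dd lt (subst Dyck eq (inserted-base r)) {j = + 3} hc hd he (+≤+ ℕ.z≤n) hd≤ drop-d st
           (tight big dom r (trans (cong (_++ d ∷ e ∷ []) eq) (List.++-assoc (S ++ run m (suc k)) (c ∷ []) (d ∷ e ∷ [])))))
     third-run {D} {a} {b} {c} {d} {e} {S} {m} {k} r hb hc hd he g drop-d st s 0≤m dd lt hd≤ eq (two b′ c′)
       with ends₂ {D ∷ʳ a} (S ++ run m (suc k)) (trans (++-∷ʳ-assoc (D ∷ʳ a) b (c ∷ [])) eq)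
     ... | _ , refl , refl = ⊥-elim (ShortRun.stuck₂ k s 0≤m dd lt (subst Dyck eq (inserted-base r)) {j = + 3} hb hc hd he ℤ.≤-refl hd≤ g drop-d st
           (tight big dom r (trans (cong (_++ d ∷ e ∷ []) eq) (List.++-assoc (S ++ run m (suc k)) (b ∷ c ∷ []) (d ∷ e ∷ [])))))
     third-run {D} {a} {b} {c} {d} {e} {S} {m} {k} r hb hc hd he g drop-d st s 0≤m dd lt hd≤ eq (some R a′ b′ c′)
       with stage (d ∷ e ∷ []) k R (a′ ∷ b′ ∷ c′ ∷ []) r s 0≤m lt hd≤ eq
     ... | record { x≡ = x≡ ; inside = inside ; whole = whole ; admits = admits ; Z = Z ; C≡ = C≡ } with ends₃ {D} Z C≡
     ...   | refl , refl , refl = seven x≡ inside whole admits drop-d st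

     third-stage : ∀ {D a b c d e} → Inserted (d ∷ e ∷ []) ((D ∷ʳ a) ++ b ∷ c ∷ []) x → + 0 ≤ b → + 0 ≤ c → + 0 ≤ d → + 0 ≤ e → c ≤ b + + 1 → d + + 2 ≤ c → Stuck₅ b c d e → Found
     third-stage {D} {a} {b} {c} {d} {e} r hb hc hd he g drop-d st with shape-of (inserted-base r)
     ... | running S m k R s h dd lt hd≤ eq = third-run r hb hc hd he g drop-d st s h dd lt hd≤ eq (tail₃ R)
     ... | skeleton m s c′ dd = ⊥-elim (stuck-after-skeleton {D ∷ʳ a} {b} {c} {d} {e} (subst Sk (sym (++-∷ʳ-assoc (D ∷ʳ a) b (c ∷ []))) s) g hd he drop-d st
           (fst (snd (tight big dom r (List.++-assoc (D ∷ʳ a) (b ∷ c ∷ []) (d ∷ e ∷ []))))))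

     five-letters : ∀ {D a b c d e X} → x ≡ X ++ b ∷ c ∷ [] → Inserted (d ∷ e ∷ []) (D ∷ʳ a) X →
       Inserted (d ∷ e ∷ []) ((D ∷ʳ a) ++ b ∷ c ∷ []) x → Adm e (D ∷ʳ a) → d + + 2 ≤ c → Found
     five-letters {D} {a} {b} {c} {d} {e} {X} x≡ inside whole adm-e drop-d
       with affine-letters D (b ∷ c ∷ []) (fst (snd (inserted-base whole))) | All.++⁻ʳ (D ∷ʳ a) (snd (snd (inserted-base whole))) | inserted-nonneg whole
     ... | b≤ ∷ c≤ ∷ [-] | hb ∷ hc ∷ [] | hd ∷ he ∷ [] with east₅-total {a} {b} {c} {d} {e} c≤ drop-d (chained whole)
     ...   | inl st = third-stage whole hb hc hd he c≤ drop-d st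
     ...   | inr (p , q , mv) with move₅-facts mv hb hc c≤
     ...     | hp , hq , p≤ , q≤ with pushable⇒inserted (inserted-base inside) (push hp p≤ (push hq q≤ (last adm-e)))
     ...       | Y , rY = Y ++ d ∷ [] , subst (λ x → Image n x (Y ++ d ∷ [])) (sym x≡) (move₅ b≤ c≤ drop-d mv inside (inserted-base whole) rY
           (dyck-∷ʳ D (inserted-base inside) hd (lia (d & c & b & a & []) (#0 +' !2 <= #1 & #1 <= #2 +' !1 & #2 <= #3 +' !1 & []) (#0 <= #3 +' !1) (drop-d , c≤ , b≤ , tt))))

     second-run : ∀ {D v u w S m k R} → Inserted (w ∷ []) ((D ∷ʳ v) ++ u ∷ []) x → + 0 ≤ u → + 0 ≤ w → w + + 2 ≤ u →
       Sk S → + 0 ≤ m → Doubled m S → All (λ u → u + + 1 ≤ m) S → Head≤ (m + + suc k) R → (D ∷ʳ v) ++ u ∷ [] ≡ (S ++ run m (suc k)) ++ R → Tail₂ R → Found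
     second-run {D} {v} {u} {w} {S} {m} {k} r hu hw drop-w s 0≤m dd lt hd≤ eq none with run-end {D ∷ʳ v} {u} S m k (trans eq (List.++-identityʳ _))
     ... | refl = ⊥-elim (ShortRun.drop₀ k s 0≤m dd lt (subst Dyck eq (inserted-base r)) {j = + 2} hw (+≤+ ℕ.z≤n) drop-w (tight big dom r (cong (_++ w ∷ []) (trans eq (List.++-identityʳ _)))))
     second-run {D} {v} {u} {w} {S} {m} {k} r hu hw drop-w s 0≤m dd lt hd≤ eq (one c) with ends₁ {D ∷ʳ v} (S ++ run m (suc k)) eq
     ... | _ , refl = ⊥-elim (ShortRun.drop₁ k s 0≤m dd lt (subst Dyck eq (inserted-base r)) {j = + 2} hu hw (+≤+ ℕ.z≤n) drop-w hd≤
           (tight big dom r (trans (cong (_++ w ∷ []) eq) (List.++-assoc (S ++ run m (suc k)) (u ∷ []) (w ∷ [])))))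
     second-run {D} {v} {u} {w} {S} {m} {k} r hu hw drop-w s 0≤m dd lt hd≤ eq (some R b c) with stage (w ∷ []) k R (b ∷ c ∷ []) r s 0≤m lt hd≤ eq
     ... | record { x≡ = x≡ ; inside = inside ; whole = whole ; admits = admits ; Z = Z ; C≡ = C≡ } with ends₂ {D} Z C≡
     ...   | _ , refl , refl = five-letters x≡ inside whole admits drop-w

     second-stage : ∀ {D v u w} → Inserted (w ∷ []) ((D ∷ʳ v) ++ u ∷ []) x → w + + 2 ≤ u → Found
     second-stage {D} {v} {u} {w} r drop-w with shape-of (inserted-base r) | All.++⁻ʳ (D ∷ʳ v) (snd (snd (inserted-base r))) | inserted-nonneg r
     ... | running S m k R s h dd lt hd≤ eq | hu ∷ [] | hw ∷ [] = second-run r hu hw drop-w s h dd lt hd≤ eq (tail₂ R)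
     ... | skeleton m s c dd | _ | hw ∷ [] = ⊥-elim (drop-after-skeleton {D} {v} {u} {w} s (last-step D (fst (snd (inserted-base r)))) hw drop-w
           (fst (snd (tight big dom r (trans (List.++-assoc (D ∷ʳ v) (u ∷ []) (w ∷ [])) (++-∷ʳ-assoc D v (u ∷ w ∷ [])))))))

     dx : Dyck x
     dx = Domain.dyck dom

     first-run : ∀ {S m k R} → Sk S → + 0 ≤ m → Doubled m S → All (λ u → u + + 1 ≤ m) S → Head≤ (m + + suc k) R → x ≡ (S ++ run m (suc k)) ++ R → Tail₁ R → Found
     first-run {k = k} s 0≤m dd lt hd≤ eq none = ⊥-elim (ShortRun.no-letters k s 0≤m dd lt (subst Dyck eq dx) {+ 1} (+≤+ ℕ.z≤n) (tight big dom ([] dx) (trans (List.++-identityʳ x) eq)))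
     first-run {m = m} {k} s 0≤m dd lt hd≤ eq (some R u) with stage [] k R (u ∷ []) ([] dx) s 0≤m lt hd≤ eq
     ... | record { D = D ; X = X ; v = v ; x≡ = x≡ ; inside = inside ; whole = whole ; admits = admits } with split u (m + + k + + 1)
     ...   | inr h = second-stage whole (plus-two (m + + k) u h)
     ...   | inl h with All.++⁻ʳ (D ∷ʳ v) (snd (snd (inserted-base whole)))
     ...     | hu ∷ [] with pushable⇒inserted (inserted-base inside) (push hu h (last admits))
     ...       | y , ry = y , subst (λ x → Image n x y) (sym x≡) (move₃ h inside (inserted-base whole) ry)

     first-skeleton : ∀ D′ v u → x ≡ (D′ ∷ʳ v) ∷ʳ u → x ≢ ω n → Sk x → Found
     first-skeleton D′ v u refl ne s = go (top-of dD (fst init))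
       where
       D = D′ ∷ʳ v
       init = Sk-init D s
       dD : Dyck D
       dD = dyck-++ˡ D′ (u ∷ []) dx
       go : Top D → Found
       go (topped {m} c dd) with split u m | split m (+ 0)
       ... | inl u≤m | _ with adm⇒ins (Sk-adm (fst init) c (fst (snd init)) u≤m)
       ...   | y , i = y , move₁ ne s dx (i ∷ [] dD)
       go (topped {m} c dd) | inr m<u | inl m≤0 = ⊥-elim (ne (cong₂ _∷ʳ_ (trans (all-zero D (zero-entries D (chain-nonneg c) (chain-max c))) (cong zeroes length-D)) u≡1))
         where
         v≤m : v ≤ m
         v≤m = All.head (All.++⁻ʳ D′ (chain-max c))
         u≤v+1 : u ≤ v + + 1
         u≤v+1 = last-step D′ (fst (snd dx))
         u≡1 : u ≡ + 1
         u≡1 = (lia (m & u & v & []) (#0 +' !1 <= #1 & #0 <= !0 & !0 <= #0 & #2 <= #0 & #1 <= #2 +' !1 & []) (#1 == !1) (m<u , m≤0 , (0≤max c) , v≤m , u≤v+1 , tt))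
         zero-entries : ∀ D → All (+ 0 ≤_) D → All (_≤ m) D → All (λ u → + 0 ≤ u × u ≤ + 0) D
         zero-entries []      []       []       = []
         zero-entries (w ∷ D) (p ∷ ps) (q ∷ qs) = (p , ℤ.≤-trans q m≤0) ∷ zero-entries D ps qs
         length-D : length D ≡ 3 ℕ.+ k
         length-D = ℕ.suc-injective (trans (sym (trans (List.length-++ D) (ℕ.+-comm (length D) 1))) (Domain.size dom))
       go (topped {m} c dd) | inr m<u | inr 0<m = ⊥-elim (grow (chain-init D′ c refl))
         where
         v≤m : v ≤ m
         v≤m = All.head (All.++⁻ʳ D′ (chain-max c))
         u≤v+1 : u ≤ v + + 1
         u≤v+1 = last-step D′ (fst (snd dx))
         v≡m : v ≡ m
         v≡m = (lia (m & u & v & []) (#0 +' !1 <= #1 & #2 <= #0 & #1 <= #2 +' !1 & []) (#2 == #0) (m<u , v≤m , u≤v+1 , tt))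
         u≡m+1 : u ≡ m + + 1
         u≡m+1 = (lia (m & u & v & []) (#0 +' !1 <= #1 & #2 <= #0 & #1 <= #2 +' !1 & []) (#1 == #0 +' !1) (m<u , v≤m , u≤v+1 , tt))
         init′ = Sk-init D′ (fst init)
         grow : D′ ≡ [] ⊎ Chain D′ m ⊎ (Chain D′ (m - + 1) × v ≡ m) → ⊥
         grow (inl refl) with Domain.size dom
         ... | ()
         grow (inr (inl c′)) = SkeletonFacts.new-maximum (fst init′) c′ (subst (λ w → Doubled w D′) v≡m (snd (snd init′))) (lia (m & []) (!0 +' !1 <= #0 & []) (!1 <= #0) (0<m , tt))
           (fst (snd (tight big dom ([] dx) (trans (List.++-identityʳ _) (trans (cong₂ (λ p q → (D′ ∷ʳ p) ∷ʳ q) v≡m u≡m+1) (++-∷ʳ-assoc D′ m (m + + 1 ∷ [])))))))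
         grow (inr (inr (c′ , _))) = 1≰0 (lia ((cntAt m D) & (cntAt m D′) & m & v & (G m D′) & (G (m + + 1) D′) & []) (!2 <= #0 & #0 == #1 +' ((#2 <=? #3) -' (#2 +' !1 <=? #3)) & #1 == #4 -' #5 & #4 == !0 & !0 <= #5 & []) (!1 <= !0) ((snd (snd init) m (0≤max c) m<u) , (cntAt-∷ʳ m D′ v) , refl , (chain-G-above m c′ (lia (m & []) ([]) (#0 -' !1 +' !1 <= #0) (tt))) , (0≤G (m + + 1) D′) , tt))

     ascend : Found
     ascend with x ≟ᴸ ω n | shape-of dx
     ... | yes eq | _ = ε n , subst (λ x → Image n x (ε n)) (sym eq) top
     ... | no ne | running S m k R s h dd lt hd≤ eq = first-run s h dd lt hd≤ eq (tail₁ R)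
     ... | no ne | skeleton m s c dd with initLast x
     ...   | [] with Domain.size dom
     ...     | ()
     ascend | no ne | skeleton m s c dd | D ∷ʳ′ u with initLast D
     ...   | [] with Domain.size dom
     ...     | ()
     ascend | no ne | skeleton m s c dd | .(D ∷ʳ v) ∷ʳ′ u | D ∷ʳ′ v = first-skeleton D v u refl ne s

module Back where

 open Find
 open Exist
 open Runs
 open Uniq
 open Pre
 open Steps
 open East
 open Rows
 open Local
 open Words
 open Extract hiding (mid)
 open Moves
 open Lia
 open Dbm using (Form; atom; atLeast; _and_; _or_; _imp_; sumχ; prove; valid; prop; eval)
 open Win hiding (shape)
 open Stats
 open import Defs hiding (maximum)
 open import Data.Bool.Base using (if_then_else_)
 open import Data.Integer.Base using (_<_)
 open import Data.Integer.Properties using (≤-totalOrder)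
 open import Data.List.Extrema ≤-totalOrder using (min; min≤⊤; min≤xs; v≤min⁺)
 open import Data.List.Relation.Unary.Linked using ([]; [-]; _∷_)
 open import Data.Product.Base using (_,_)
 open import Data.Sum.Base using (_⊎_)
 open import Data.Maybe.Properties using (just-injective)
 import Data.List.Relation.Unary.All.Properties as All
 open Facts
 open Small using (Domain; domain; StringLike)
 open import Data.Nat.Combinatorics using (nC1≡n; nCk+nC[k+1]≡[n+1]C[k+1]) renaming (_C_ to _choose_)
 open Fad using (module Scattered)

 rearranged-sym : ∀ {xs ys} → Rearranged xs ys → Rearranged ys xs
 rearranged-sym (b , s) = sym b , λ f → sym (s f)

 last-form : ∀ {C} → Dyck C → ∃[ D ] ∃[ v ] C ≡ D ∷ʳ v
 last-form {C} d with toPath d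
 ... | E , a , eq , _ = E , a , eq

 module _ (k : ℕ) where

   private
     n = 4 ℕ.+ k

   ω-avoids-1 : ∀ {C u} → Adm u C → C ∷ʳ u ≢ ω n
   ω-avoids-1 {C} a eq with List.∷ʳ-injective C (zeroes (3 ℕ.+ k)) eq
   ... | refl , refl = 1≰0 (adm-max (bounded (3 ℕ.+ k)) a)
     where
     bounded : ∀ j → All (_≤ + 0) (zeroes j)
     bounded zero    = []
     bounded (suc j) = ℤ.≤-refl ∷ bounded j

   module Descend {y : List ℤ} (big : 10 ℕ.≤ n) (dom : Domain n (+ 0) y) where

     Reached : Set
     Reached = ∃[ x ] Image n x y

     seven : ∀ {D z a d p q e f Y} → y ≡ Y ++ a ∷ d ∷ [] → Inserted (p ∷ q ∷ e ∷ f ∷ []) (D ∷ʳ z) Y →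
       Inserted (p ∷ q ∷ e ∷ f ∷ []) ((D ∷ʳ z) ++ a ∷ d ∷ []) y → Adm f (D ∷ʳ z) → d + + 2 ≤ p → Blocked₅ a d p q → Reached
     seven {D} {z} {a} {d} {p} {q} {e} {f} {Y} y≡ inside whole adm-f drop-p bl
       with affine-letters D (a ∷ d ∷ []) (fst (snd (inserted-base whole))) | All.++⁻ʳ D (subst (All (+ 0 ≤_)) (++-∷ʳ-assoc D z (a ∷ d ∷ [])) (snd (snd (inserted-base whole))))
          | inserted-nonneg whole | chained whole | chained (snd (inserted-tail whole)) | chained (snd (inserted-tail (snd (inserted-tail whole))))
     ... | a≤ ∷ d≤ ∷ [-] | hz ∷ ha ∷ hd ∷ [] | hp ∷ hq ∷ he ∷ hf ∷ [] | p≤ | q≤ | e≤ =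
       finish (east-backward z a d p q e f right crowd₇)
       where
       dDz : Dyck (D ∷ʳ z)
       dDz = inserted-base inside
       σ≡ : ((D ∷ʳ z) ++ a ∷ d ∷ []) ++ p ∷ q ∷ e ∷ f ∷ [] ≡ (D ∷ʳ z) ++ a ∷ d ∷ p ∷ q ∷ e ∷ f ∷ []
       σ≡ = List.++-assoc (D ∷ʳ z) (a ∷ d ∷ []) (p ∷ q ∷ e ∷ f ∷ [])
       T₁ : Tight (+ 4) ((D ∷ʳ z) ++ a ∷ d ∷ p ∷ q ∷ e ∷ f ∷ [])
       T₁ = tight big dom whole σ≡
       T₂ : Tight (+ 4) (D ++ z ∷ a ∷ d ∷ p ∷ q ∷ e ∷ f ∷ [])
       T₂ = tight big dom whole (trans σ≡ (++-∷ʳ-assoc D z (a ∷ d ∷ p ∷ q ∷ e ∷ f ∷ [])))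
       bl′ : Blocked₅ a d p q → prop (le 4F 3F (+ 1) and le 1F 3F (-[1+ 1 ]) and le 2F 3F (-[1+ 1 ]) and le 2F 4F (-[1+ 1 ])
         or le 3F 4F (-[1+ 1 ]) and le 1F 4F (-[1+ 1 ]) or eq 2F 1F (+ 1) and eq 3F 1F (+ 3) and eq 4F 1F (+ 2)) (z ∷ a ∷ d ∷ p ∷ q ∷ e ∷ f ∷ [])
       bl′ (inl (s , t , u)) = inl ((lia (q & p & []) (#0 <= #1 +' !1 & []) (#0 +' !-1 <= #1) (s , tt)) , t , drop-p , u)
       bl′ (inr (inl s)) = inr (inl s)
       bl′ (inr (inr (s , t , u))) = inr (inr (((lia (d & a & []) (#0 == #1 +' !1 & []) (#0 +' !-1 <= #1) (s , tt)) , (lia (d & a & []) (#0 == #1 +' !1 & []) (#1 +' !1 <= #0) (s , tt))) , ((lia (p & a & []) (#0 == #1 +' !3 & []) (#0 +' !-3 <= #1) (t , tt)) , (lia (p & a & []) (#0 == #1 +' !3 & []) (#1 +' !3 <= #0) (t , tt))) ,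
         ((lia (q & a & []) (#0 == #1 +' !2 & []) (#0 +' !-2 <= #1) (u , tt)) , (lia (q & a & []) (#0 == #1 +' !2 & []) (#1 +' !2 <= #0) (u , tt)))))
       right : prop (rightShape ix7 and rightStuck ix7) (z ∷ a ∷ d ∷ p ∷ q ∷ e ∷ f ∷ [])
       right = ((lia (a & z & []) (#0 <= #1 +' !1 & []) (#0 +' !-1 <= #1) (a≤ , tt)) , (lia (d & a & []) (#0 <= #1 +' !1 & []) (#0 +' !-1 <= #1) (d≤ , tt)) , (lia (p & q & []) (#0 <= #1 +' !1 & []) (#0 +' !-1 <= #1) (p≤ , tt)) , (lia (q & e & []) (#0 <= #1 +' !1 & []) (#0 +' !-1 <= #1) (q≤ , tt)) , (lia (e & f & []) (#0 <= #1 +' !1 & []) (#0 +' !-1 <= #1) (e≤ , tt))) ,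
         (drop-p , bl′ bl)
       crowd₇ : prop (concentrated ix7) (z ∷ a ∷ d ∷ p ∷ q ∷ e ∷ f ∷ [])
       crowd₇ with anchoring {+ 4} D T₁ refl dDz adm-f
       ... | m , ch , z≤ , f≤ = Scattered.right-crowded ch z a d p q e f (hz ∷ ha ∷ hd ∷ hp ∷ hq ∷ he ∷ hf ∷ []) z≤ f≤ (fst (snd T₂)) (snd (snd T₂)) right
       finish : ∃[ a₁ ] ∃[ b₁ ] ∃[ c₁ ] ∃[ d₁ ] ∃[ e₁ ] Move₇ z a₁ b₁ c₁ d₁ e₁ f a d p q e → Reached
       finish (a₁ , b₁ , c₁ , d₁ , e₁ , mv) with Move₇.left mv | nonneg-image {a} {d} {p} {q} {e} {a₁} {b₁} {c₁} {d₁} {e₁} (rearranged-sym {five a₁ b₁ c₁ d₁ e₁} {five a d p q e} (snd (Move₇.good mv))) (ha ∷ hd ∷ hp ∷ hq ∷ he ∷ [])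
       ... | (a₁≤ , b₁≤ , c₁≤ , d₁≤ , e₁≤) , _ | ha₁ ∷ hb₁ ∷ hc₁ ∷ hd₁ ∷ he₁ ∷ []
         with pushable⇒inserted dDz (push hd₁ (lia (d₁ & e₁ & []) (#0 +' !-1 <= #1 & []) (#0 <= #1 +' !1) (d₁≤ , tt)) (push he₁ (lia (e₁ & f & []) (#0 +' !-1 <= #1 & []) (#0 <= #1 +' !1) (e₁≤ , tt)) (last adm-f)))
       ...   | X , rX = X ++ a₁ ∷ b₁ ∷ c₁ ∷ [] , subst (Image n _) (sym y≡) (move₇ mv
           (dense-image {z} {a₁} {b₁} {c₁} {d₁} {e₁} {f} {a} {d} {p} {q} {e} (snd (Move₇.good mv)) (crowded⇒nearby z a d p q e f crowd₇)) rX
           (dyck-∷ʳ₃ D dDz ha₁ (lia (a₁ & z & []) (#0 +' !-1 <= #1 & []) (#0 <= #1 +' !1) (a₁≤ , tt)) hb₁ (lia (b₁ & a₁ & []) (#0 +' !-1 <= #1 & []) (#0 <= #1 +' !1) (b₁≤ , tt)) hc₁ (lia (c₁ & b₁ & []) (#0 +' !-1 <= #1 & []) (#0 <= #1 +' !1) (c₁≤ , tt))) inside (inserted-base whole))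

     low : ∀ {ws C σ} → Inserted ws C y → C ++ ws ≡ σ → LowDeficit σ
     low r eq = fst (snd (tight big dom r eq))

     third-run : ∀ {D a d p q e S m k R} → Inserted (p ∷ q ∷ e ∷ []) ((D ∷ʳ a) ++ d ∷ []) y → + 0 ≤ d → d + + 2 ≤ p → Blocked₅ a d p q →
       Sk S → + 0 ≤ m → Doubled m S → All (λ u → u + + 1 ≤ m) S → Head≤ (m + + suc k) R → (D ∷ʳ a) ++ d ∷ [] ≡ (S ++ run m (suc k)) ++ R → Tail₂ R → Reached
     third-run {D} {a} {d} {p} {q} {e} {S} {m} {k} r hd drop-p bl s 0≤m dd lt hd≤ eq none
       with run-end {D ∷ʳ a} {d} S m k (trans eq (List.++-identityʳ _)) | extract-once (p ∷ q ∷ e ∷ []) {m = m} k [] r s 0≤m lt hd≤ eq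
     ... | refl | whole = ⊥-elim (climbed p q e (chained whole) (chained (snd (inserted-tail whole))) (chained (snd (inserted-tail (snd (inserted-tail whole))))) drop-p
           (λ { refl refl refl → ShortRun.climb₀ k s 0≤m dd lt (subst Dyck eq (inserted-base r)) {+ 3} (+≤+ ℕ.z≤n) (tight big dom r (cong (_++ p ∷ q ∷ e ∷ []) (trans eq (List.++-identityʳ _)))) }))
       where
       h = m + + suc k
       climbed : ∀ p q e → p ≤ q + + 1 → q ≤ e + + 1 → e ≤ m + + k + + 1 → m + + suc k + + 2 ≤ p → (p ≡ h + + 2 → q ≡ h + + 1 → e ≡ h → ⊥) → ⊥
       climbed p q e p≤ q≤ e≤ l f = f (lia (p & q & e & m & (+ k) & []) (#0 <= #1 +' !1 & #1 <= #2 +' !1 & #2 <= #3 +' #4 +' !1 & #3 +' (!1 +' #4) +' !2 <= #0 & []) (#0 == #3 +' (!1 +' #4) +' !2) (p≤ , q≤ , e≤ , l , tt))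
         (lia (p & q & e & m & (+ k) & []) (#0 <= #1 +' !1 & #1 <= #2 +' !1 & #2 <= #3 +' #4 +' !1 & #3 +' (!1 +' #4) +' !2 <= #0 & []) (#1 == #3 +' (!1 +' #4) +' !1) (p≤ , q≤ , e≤ , l , tt))
         (lia (p & q & e & m & (+ k) & []) (#0 <= #1 +' !1 & #1 <= #2 +' !1 & #2 <= #3 +' #4 +' !1 & #3 +' (!1 +' #4) +' !2 <= #0 & []) (#2 == #3 +' (!1 +' #4)) (p≤ , q≤ , e≤ , l , tt))
     third-run {D} {a} {d} {p} {q} {e} {S} {m} {k} r hd drop-p bl s 0≤m dd lt hd≤ eq (one d′)
       with ends₁ {D ∷ʳ a} (S ++ run m (suc k)) eq | extract-once (p ∷ q ∷ e ∷ []) {m = m} k (d′ ∷ []) r s 0≤m lt hd≤ eq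
     ... | eq′ , refl | whole with run-end {D} S m k eq′
     ...   | refl = ⊥-elim (climbed p q e (chained whole) (chained (snd (inserted-tail whole))) (chained (snd (inserted-tail (snd (inserted-tail whole))))) bl
           (λ { refl refl refl below → ShortRun.climb₁ k s 0≤m dd lt (subst Dyck eq (inserted-base r)) {j = + 3} hd ℤ.≤-refl below
             (tight big dom r (trans (cong (_++ p ∷ q ∷ e ∷ []) eq) (List.++-assoc (S ++ run m (suc k)) (d ∷ []) (p ∷ q ∷ e ∷ [])))) }))
       where
       h = m + + suc k
       climbed : ∀ p q e → p ≤ q + + 1 → q ≤ e + + 1 → e ≤ m + + k + + 1 → Blocked₅ h d p q → (p ≡ h + + 2 → q ≡ h + + 1 → e ≡ h → d + + 1 ≤ h → ⊥) → ⊥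
       climbed p q e p≤ q≤ e≤ (inl (_ , l , u)) f = f (lia (p & q & e & m & (+ k) & []) (#0 <= #1 +' !1 & #1 <= #2 +' !1 & #2 <= #3 +' #4 +' !1 & #3 +' (!1 +' #4) +' !2 <= #0 & []) (#0 == #3 +' (!1 +' #4) +' !2) (p≤ , q≤ , e≤ , l , tt))
         (lia (p & q & e & m & (+ k) & []) (#0 <= #1 +' !1 & #1 <= #2 +' !1 & #2 <= #3 +' #4 +' !1 & #3 +' (!1 +' #4) +' !2 <= #0 & []) (#1 == #3 +' (!1 +' #4) +' !1) (p≤ , q≤ , e≤ , l , tt))
         (lia (p & q & e & m & (+ k) & []) (#0 <= #1 +' !1 & #1 <= #2 +' !1 & #2 <= #3 +' #4 +' !1 & #3 +' (!1 +' #4) +' !2 <= #0 & []) (#2 == #3 +' (!1 +' #4)) (p≤ , q≤ , e≤ , l , tt))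
         (lia (q & e & m & (+ k) & d & []) (#0 <= #1 +' !1 & #1 <= #2 +' #3 +' !1 & #4 +' !2 <= #0 & []) (#4 +' !1 <= #2 +' (!1 +' #3)) (q≤ , e≤ , u , tt))
       climbed p q e p≤ q≤ e≤ (inr (inl (_ , l))) f = 1≰0 (lia (q & e & m & (+ k) & []) (#0 <= #1 +' !1 & #1 <= #2 +' #3 +' !1 & #2 +' (!1 +' #3) +' !2 <= #0 & []) (!1 <= !0) (q≤ , e≤ , l , tt))
       climbed p q e p≤ q≤ e≤ (inr (inr (l , _))) f = 1≰0 (lia (d & m & (+ k) & []) (#0 == #1 +' (!1 +' #2) +' !1 & #0 <= #1 +' (!1 +' #2) & []) (!1 <= !0) (l , hd≤ , tt))
     third-run {D} {a} {d} {p} {q} {e} {S} {m} {k} r hd drop-p bl s 0≤m dd lt hd≤ eq (some R a′ d′) with stage (p ∷ q ∷ e ∷ []) k R (a′ ∷ d′ ∷ []) r s 0≤m lt hd≤ eq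
     ... | record { x≡ = y≡ ; inside = inside ; whole = whole ; admits = admits ; Z = Z ; C≡ = C≡ } with ends₂ {D} Z C≡
     ...   | _ , refl , refl = seven y≡ inside whole admits drop-p bl

     third-stage : ∀ {D a d p q e} → Inserted (p ∷ q ∷ e ∷ []) ((D ∷ʳ a) ++ d ∷ []) y → Adm e ((D ∷ʳ a) ++ d ∷ []) → + 0 ≤ d → d + + 2 ≤ p → Blocked₅ a d p q → Reached
     third-stage {D} {a} {d} {p} {q} {e} r adm-e hd drop-p bl with shape-of (inserted-base r)
     ... | running S m k R s h dd lt hd≤ eq = third-run r hd drop-p bl s h dd lt hd≤ eq (tail₂ R)
     ... | skeleton m s c dd = ⊥-elim (SkeletonFacts.three-letters s c dd four (lia (d & p & []) (#0 +' !2 <= #1 & !0 <= #0 & []) (!2 <= #1) (drop-p , hd , tt)) (2≤q bl) (chained r) (chained (snd (inserted-tail r)))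
           (adm-max (chain-max c) adm-e) (low r refl))
       where
       ha : + 0 ≤ a
       ha = nonneg-last D (dyck-++ˡ D (d ∷ []) (inserted-base r))
       2≤q : Blocked₅ a d p q → + 2 ≤ q
       2≤q (inl (_ , _ , u))        = (lia (d & q & []) (#0 +' !2 <= #1 & !0 <= #0 & []) (!2 <= #1) (u , hd , tt))
       2≤q (inr (inl (_ , u)))     = (lia (a & q & []) (#0 +' !2 <= #1 & !0 <= #0 & []) (!2 <= #1) (u , ha , tt))
       2≤q (inr (inr (_ , _ , u))) = (lia (q & a & []) (#0 == #1 +' !2 & !0 <= #1 & []) (!2 <= #0) (u , ha , tt))
       C : List ℤ
       C = (D ∷ʳ a) ++ d ∷ []
       four : + 4 ≤ lenᶻ C
       four = (lia ((lenᶻ (C ++ p ∷ q ∷ e ∷ [])) & (lenᶻ C) & []) (!10 <= #0 & #0 == #1 +' !3 & []) (!4 <= #1) ((fst (tight big dom r refl)) , (lenᶻ-++ C (p ∷ q ∷ e ∷ [])) , tt))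

     five-letters : ∀ {D a d p q e Y} → y ≡ Y ++ d ∷ [] → Inserted (p ∷ q ∷ e ∷ []) (D ∷ʳ a) Y → Inserted (p ∷ q ∷ e ∷ []) ((D ∷ʳ a) ++ d ∷ []) y →
       Adm e (D ∷ʳ a) → d + + 2 ≤ p → Reached
     five-letters {D} {a} {d} {p} {q} {e} {Y} y≡ inside whole adm-e drop-p
       with All.++⁻ʳ (D ∷ʳ a) (snd (snd (inserted-base whole))) | inserted-nonneg whole | unmove₅ (last-step D (fst (snd (inserted-base whole)))) drop-p (chained whole) (chained (snd (inserted-tail whole)))
     ... | hd ∷ [] | hp ∷ hq ∷ he ∷ [] | inl bl = third-stage whole (adm-++ (d ∷ []) adm-e) hd drop-p bl
     ... | hd ∷ [] | hp ∷ hq ∷ he ∷ [] | inr (unmoved {b} {c} mv b≤ c≤ drop-c d≤) with move₅-source mv hp hq | pushable⇒inserted (inserted-base inside) (push hd d≤ (last adm-e))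
     ...   | hb , hc | X , rX = X ++ b ∷ c ∷ [] , subst (Image n _) (sym y≡) (move₅ b≤ c≤ drop-c mv rX (dyck-∷ʳ₂ D (inserted-base inside) hb b≤ hc c≤) inside (inserted-base whole))

     second-run : ∀ {D v p q S m k R} → Inserted (p ∷ q ∷ []) (D ∷ʳ v) y → v + + 2 ≤ p →
       Sk S → + 0 ≤ m → Doubled m S → All (λ u → u + + 1 ≤ m) S → Head≤ (m + + suc k) R → D ∷ʳ v ≡ (S ++ run m (suc k)) ++ R → Tail₁ R → Reached
     second-run {D} {v} {p} {q} {S} {m} {k} r drop-p s 0≤m dd lt hd≤ eq none with run-end {D} {v} S m k (trans eq (List.++-identityʳ _)) | extract-once (p ∷ q ∷ []) {m = m} k [] r s 0≤m lt hd≤ eq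
     ... | refl | whole = ⊥-elim (1≰0 (lia (p & q & m & (+ k) & []) (#0 <= #1 +' !1 & #1 <= #2 +' #3 +' !1 & #2 +' (!1 +' #3) +' !2 <= #0 & []) (!1 <= !0) ((chained whole) , (chained (snd (inserted-tail whole))) , drop-p , tt)))
     second-run {D} {v} {p} {q} {S} {m} {k} r drop-p s 0≤m dd lt hd≤ eq (some R d) with stage (p ∷ q ∷ []) k R (d ∷ []) r s 0≤m lt hd≤ eq
     ... | record { x≡ = y≡ ; inside = inside ; whole = whole ; admits = admits ; Z = Z ; C≡ = C≡ } with ends₁ {D} Z C≡
     ...   | _ , refl = five-letters y≡ inside whole admits drop-p

     second-stage : ∀ D v {p q} → Inserted (p ∷ q ∷ []) (D ∷ʳ v) y → Adm q (D ∷ʳ v) → Reached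
     second-stage D v {p} {q} r adm-q with split p (v + + 1) | inserted-nonneg r
     ... | inl h | hp ∷ _ with adm⇒ins adm-q
     ...   | X , i = X ++ p ∷ [] , move₃ (chained r) (i ∷ [] (inserted-base r)) (dyck-∷ʳ D (inserted-base r) hp h) r
     second-stage D v {p} {q} r adm-q | inr h | hp ∷ _ with shape-of (inserted-base r)
     ... | running S m k R s 0≤m dd lt hd≤ eq = second-run r (plus-two v p h) s 0≤m dd lt hd≤ eq (tail₁ R)
     ... | skeleton m s c dd = ⊥-elim (SkeletonFacts.two-letters s c dd (lia (v & p & []) (#0 +' !1 +' !1 <= #1 & !0 <= #0 & []) (!2 <= #1) (h , (nonneg-last D (inserted-base r)) , tt)) (chained r) (adm-max (chain-max c) adm-q) (low r refl))

     first-stage : ∀ {C u} → Inserted (u ∷ []) C y → Adm u C → Reached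
     first-stage {C} {u} r adm-u with last-form (inserted-base r) | inserted-nonneg r
     ... | D , v , refl | hu ∷ [] with shape-of (inserted-base r)
     ...   | running S m k R s 0≤m dd lt hd≤ eq = onwards (snoc-form S m k R)
       where
       onwards : ∃[ D′ ] ∃[ v′ ] (S ++ run m k) ++ R ≡ D′ ∷ʳ v′ → Reached
       onwards (D′ , v′ , form) = second-stage D′ v′ (subst (λ C → Inserted _ C y) form (extract-once (u ∷ []) {m = m} k R r s 0≤m lt hd≤ eq)) (subst (Adm _) form (ins⇒adm (run-ins k R s 0≤m lt)))
     ...   | skeleton m s c dd with split u (v + + 1)
     ...     | inl h = (D ∷ʳ v) ∷ʳ u , move₁ (ω-avoids-1 adm-u) (snoc s hu (adm-doubled s adm-u)) (dyck-∷ʳ D (inserted-base r) hu h) r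
     ...     | inr h = ⊥-elim (SkeletonFacts.one-letter s c dd (lia (v & u & []) (#0 +' !1 +' !1 <= #1 & !0 <= #0 & []) (!2 <= #1) (h , (nonneg-last D (inserted-base r)) , tt)) (adm-max (chain-max c) adm-u) (low r refl))

     descend : SpecialSkeleton n y ⊎ Reached
     descend with shape-of (Domain.dyck dom)
     ... | running S m k R s 0≤m dd lt hd≤ eq = inr (first-stage (extract-once [] {m = m} k R ([] (Domain.dyck dom)) s 0≤m lt hd≤ eq) (ins⇒adm (run-ins k R s 0≤m lt)))
     ... | skeleton m s c dd with y ≟ᴸ ε n
     ...   | yes eq = inr (ω n , subst (Image n (ω n)) (sym eq) top)
     ...   | no ne  = inl (Sk⇒full (Domain.dyck dom) s , Domain.size dom , ne)

   image-domain : ∀ {x y} → Dyck x → Image n x y → Domain n (+ 0) y → Domain n (+ 1) x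
   image-domain {x} {y} dx im (domain d sz df lo) with image-raised k im
   ... | raised _ len b t = domain dx (trans (ℤ.+-injective (sym len)) sz)
     (lia ((defc y) & (+ (2 ℕ.* n)) & (bad y) & (total y) & (defc x) & (bad x) & (total x) & []) (#0 <= #1 -' !8 & #0 == #2 -' #3 & #4 == #5 -' #6 & #2 == #5 +' !1 & #3 == #6 +' !1 & []) (#4 <= #1 -' !8) (df , (defc-bad y) , (defc-bad x) , b , t , tt))
     (lia ((area y) & (defc y) & (+ (n choose 2)) & (area x) & (total x) & (total y) & (bad y) & (defc x) & (bad x) & []) (#0 +' #0 +' !0 +' #1 <= #2 & #3 == #4 & #0 == #5 & #1 == #6 -' #5 & #7 == #8 -' #4 & #6 == #8 +' !1 & #5 == #4 +' !1 & []) (#3 +' #3 +' !2 +' #7 <= #2) (lo , (area-total x) , (area-total y) , (defc-bad y) , (defc-bad x) , b , t , tt))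

   image-source : ∀ {x y} → Image n x y → Dyck x
   image-source top = dyck-ω k
   image-source (move₁ _ _ d _) = d
   image-source (move₃ {u = u} _ i d _) = inserted-dyck (inserted-++ (u ∷ []) i d)
   image-source (move₅ {b = b} {c} _ _ _ _ i d _ _) = inserted-dyck (inserted-++ (b ∷ c ∷ []) i d)
   image-source (move₇ {a = a} {b} {c} _ _ i d _ _) = inserted-dyck (inserted-++ (a ∷ b ∷ c ∷ []) i d)

   string-like : 10 ℕ.≤ n → StringLike n
   string-like big = record
     { rises = λ dom → let y , im = Ascend.ascend k big dom in rise dom im
     ; injective = λ p q e f → image-unique k (image-of p e) (image-of q f)
     ; nonspecial = λ p e → image-nonspecial k (image-of p e)
     ; reached = λ dom → reach dom (Descend.descend big dom) }
     where
     rise : ∀ {x y} → Domain n (+ 1) x → Image n x y → ∃[ y ] (up x ≡ just y × Dyck y × length y ≡ n × defc y ≡ defc x × area y ≡ area x + + 1)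
     rise {x} {y} dom im with image-raised k im
     ... | raised d len b t = y , image-up k (Domain.size dom) im , d , trans (ℤ.+-injective len) (Domain.size dom) ,
       (lia ((defc y) & (bad y) & (total y) & (defc x) & (bad x) & (total x) & []) (#0 == #1 -' #2 & #3 == #4 -' #5 & #1 == #4 +' !1 & #2 == #5 +' !1 & []) (#0 == #3) ((defc-bad y) , (defc-bad x) , b , t , tt)) ,
       (lia ((area x) & (total x) & (area y) & (total y) & []) (#0 == #1 & #2 == #3 & #3 == #1 +' !1 & []) (#2 == #0 +' !1) ((area-total x) , (area-total y) , t , tt))
     image-of : ∀ {x y} → Domain n (+ 1) x → up x ≡ just y → Image n x y
     image-of {x} dom e with Ascend.ascend k big dom
     ... | y , im = subst (Image n x) (just-injective (trans (sym (image-up k (Domain.size dom) im)) e)) im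
     reach : ∀ {y} → Domain n (+ 0) y → SpecialSkeleton n y ⊎ ∃[ x ] Image n x y → SpecialSkeleton n y ⊎ ∃[ x ] (Domain n (+ 1) x × up x ≡ just y)
     reach dom (inl s) = inl s
     reach dom (inr (x , im)) = inr (x , dx , image-up k (Domain.size dx) im)
       where
       dx : Domain n (+ 1) x
       dx = image-domain (image-source im) im dom

module Final where

 open Lia
 open Stats
 open Words using (1≰0)
 open Small
 open Small9
 open Back
 open import Defs
 open import Data.Integer.Base using (_/ℕ_; _%ℕ_; ∣_∣)
 import Data.Integer.DivMod as ℤ
 open import Data.Maybe.Base using (_>>=_)
 open import Data.Maybe.Properties using (just-injective)
 open import Data.Nat.Combinatorics using () renaming (_C_ to _choose_)
 open import Data.Product.Base using (_,_)

 stringLike : ∀ n → 4 ℕ.≤ n → StringLike n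
 stringLike (suc (suc (suc (suc k)))) (ℕ.s≤s (ℕ.s≤s (ℕ.s≤s (ℕ.s≤s ℕ.z≤n)))) = from k
   where
   from : ∀ k → StringLike (4 ℕ.+ k)
   from 0 = stringLike₄
   from 1 = stringLike₅
   from 2 = stringLike₆
   from 3 = stringLike₇
   from 4 = stringLike₈
   from 5 = stringLike₉
   from (suc (suc (suc (suc (suc (suc k)))))) = string-like (6 ℕ.+ k) (ℕ.m≤m+n 10 k)

 nonneg-area : ∀ {x} → All (+ 0 ≤_) x → + 0 ≤ area x
 nonneg-area []       = ℤ.≤-refl
 nonneg-area (h ∷ hs) = ℤ.+-mono-≤ h (nonneg-area hs)

 halves : ∀ z → + 2 * (z /ℕ 2) ≤ z × z ≤ + 2 * (z /ℕ 2) + + 1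
 halves z =
   (lia (z & (+ (z %ℕ 2)) & ((z /ℕ 2) * + 2) & (z /ℕ 2) & []) (#0 == #1 +' #2 & !0 <= #1 & #2 == + 2 *' #3 & []) (+ 2 *' #3 <= #0) (eq , (+≤+ ℕ.z≤n) , (ℤ.*-comm (z /ℕ 2) (+ 2)) , tt)) ,
   (lia (z & (+ (z %ℕ 2)) & ((z /ℕ 2) * + 2) & (z /ℕ 2) & []) (#0 == #1 +' #2 & #1 <= !1 & #2 == + 2 *' #3 & []) (#0 <= + 2 *' #3 +' !1) (eq , rest , (ℤ.*-comm (z /ℕ 2) (+ 2)) , tt))
   where
   eq : z ≡ + (z %ℕ 2) + (z /ℕ 2) * + 2
   eq = ℤ.a≡a%ℕn+[a/ℕn]*n z 2
   rest : + (z %ℕ 2) ≤ + 1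
   rest = +≤+ (ℕ.≤-pred (ℤ.n%ℕd<d z 2))

 module Strings (n : ℕ) (like : StringLike n) (d : ℤ) (d≤ : d ≤ + (2 ℕ.* n) - + 8) where

   open StringLike like

   ℓ : ℤ
   ℓ = (+ (n choose 2) - d) /ℕ 2

   record Level (i : ℤ) (x : List ℤ) : Set where
     constructor level
     field
       dyck   : Dyck x
       size   : length x ≡ n
       defect : defc x ≡ d
       area≡  : area x ≡ i

   in-domain : ∀ {i x} j → Level i x → i + j ≤ ℓ → Domain n j x
   in-domain {i} {x} j (level dy s df a) h = domain dy s (subst (_≤ + (2 ℕ.* n) - + 8) (sym df) d≤)
     (lia ((ℓ) & (+ (n choose 2)) & d & i & j & (defc x) & (area x) & []) (+ 2 *' #0 <= #1 -' #2 & #3 +' #4 <= #0 & #5 == #2 & #6 == #3 & []) (#6 +' #6 +' (#4 +' #4) +' #5 <= #1) ((fst (halves (+ (n choose 2) - d))) , h , df , a , tt))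

   up-level : ∀ {i x} → Level i x → i + + 1 ≤ ℓ → ∃[ y ] (up x ≡ just y × Level (i + + 1) y)
   up-level {i} lv@(level dy s df a) h with rises (in-domain (+ 1) lv h)
   ... | y , e , dy′ , s′ , df′ , a′ = y , e , level dy′ s′ (trans df′ df) (trans a′ (cong (_+ + 1) a))

   module Orbit {s : List ℤ} (special : BoundedSpecial n d ℓ s) where

     initial : Level (area s) s
     initial = level (fst (fst (fst special))) (fst (snd (fst special))) (fst (snd special)) refl

     orbit : ∀ i → + i ≤ ℓ - area s → ∃[ x ] (up^ i s ≡ just x × Level (area s + + i) x)
     orbit zero    h = s , refl , subst (λ a → Level a s) (sym (ℤ.+-identityʳ _)) initial
     orbit (suc i) h with orbit i (lia ((+ i) & (ℓ) & (area s) & []) (!1 +' #0 <= #1 -' #2 & []) (#0 <= #1 -' #2) (h , tt))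
     ... | x , e , lv with up-level lv (lia ((+ i) & (ℓ) & (area s) & []) (!1 +' #0 <= #1 -' #2 & []) (#2 +' #0 +' !1 <= #1) (h , tt))
     ...   | y , e′ , lv′ = y , trans (cong (_>>= up) e) e′ , subst (λ a → Level a y) (lia ((area s) & (+ i) & []) ([]) (#0 +' #1 +' !1 == #0 +' (!1 +' #1)) (tt)) lv′

     at : ∀ {i x} → + i ≤ ℓ - area s → up^ i s ≡ just x → Level (area s + + i) x
     at {i} h e with orbit i h
     ... | x′ , e′ , lv = subst (Level _) (just-injective (trans (sym e′) e)) lv

   -- The term before the last one.
   previous : ∀ {s x} → BoundedSpecial n d ℓ s → ∀ i → + suc i ≤ ℓ - area s → up^ (suc i) s ≡ just x →
     ∃[ p ] (+ i ≤ ℓ - area s × up^ i s ≡ just p × Domain n (+ 1) p × up p ≡ just x)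
   previous {s} {x} sp i h e = go (Orbit.orbit sp i h′)
     where
     h′ : + i ≤ ℓ - area s
     h′ = (lia ((+ i) & (ℓ) & (area s) & []) (!1 +' #0 <= #1 -' #2 & []) (#0 <= #1 -' #2) (h , tt))
     go : ∃[ p ] (up^ i s ≡ just p × Level (area s + + i) p) → ∃[ p ] (+ i ≤ ℓ - area s × up^ i s ≡ just p × Domain n (+ 1) p × up p ≡ just x)
     go (p , e′ , lv) = p , h′ , e′ , in-domain (+ 1) lv (lia ((+ i) & (ℓ) & (area s) & []) (!1 +' #0 <= #1 -' #2 & []) (#2 +' #0 +' !1 <= #1) (h , tt)) , trans (sym (cong (_>>= up) e′)) e

   disjoint : ∀ {s t x} → BoundedSpecial n d ℓ s → BoundedSpecial n d ℓ t → ∀ i j → + i ≤ ℓ - area s → + j ≤ ℓ - area t →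
     up^ i s ≡ just x → up^ j t ≡ just x → s ≡ t
   disjoint sp tp zero    zero    h k e f = just-injective (trans e (sym f))
   disjoint sp tp zero    (suc j) h k e f with previous tp j k f
   ... | q , _ , _ , dq , eq = ⊥-elim (nonspecial dq eq (subst (SpecialSkeleton n) (just-injective e) (fst sp)))
   disjoint sp tp (suc i) zero    h k e f with previous sp i h e
   ... | p , _ , _ , dp , ep = ⊥-elim (nonspecial dp ep (subst (SpecialSkeleton n) (just-injective f) (fst tp)))
   disjoint sp tp (suc i) (suc j) h k e f with previous sp i h e | previous tp j k f
   ... | p , h′ , e′ , dp , ep | q , k′ , f′ , dq , eq with injective dp dq ep eq
   ...   | refl = disjoint sp tp i j h′ k′ e′ f′

   covers : ∀ a {x} → area x ≤ + a → Bounded n d ℓ x → ∃[ s ] (BoundedSpecial n d ℓ s × String ℓ s x)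
   covers a {x} x≤a (dy , sz , df , ax) with reached (in-domain (+ 0) (level dy sz df refl) (subst (_≤ ℓ) (sym (ℤ.+-identityʳ (area x))) ax))
   ... | inl special = x , (special , df , ax) , 0 , (lia ((area x) & (ℓ) & []) (#0 <= #1 & []) (!0 <= #1 -' #0) (ax , tt)) , refl
   ... | inr (p , dp , e) with rises dp
   ...   | y , e′ , _ , _ , df′ , a′ with just-injective (trans (sym e′) e)
   ...     | refl = below a x≤a
     where
     df-p : defc p ≡ d
     df-p = trans (sym df′) df
     bounded-p : Bounded n d ℓ p
     bounded-p = Domain.dyck dp , Domain.size dp , df-p , (lia ((area x) & (area p) & (ℓ) & []) (#0 == #1 +' !1 & #0 <= #2 & []) (#1 <= #2) (a′ , ax , tt))
     below : ∀ a → area x ≤ + a → ∃[ s ] (BoundedSpecial n d ℓ s × String ℓ s x)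
     below zero    h = ⊥-elim (1≰0 (lia ((area x) & (area p) & []) (#0 == #1 +' !1 & #0 <= !0 & !0 <= #1 & []) (!1 <= !0) (a′ , h , (nonneg-area (snd (snd (Domain.dyck dp)))) , tt)))
     below (suc a) h with covers a {p} (lia ((area x) & (area p) & (+ a) & []) (#0 == #1 +' !1 & #0 <= !1 +' #2 & []) (#1 <= #2) (a′ , h , tt)) bounded-p
     ... | s , sp , i , hi , ei = s , sp , suc i ,
       (lia ((area p) & (area s) & (+ i) & (area x) & (ℓ) & []) (#0 == #1 +' #2 & #3 == #0 +' !1 & #3 <= #4 & []) (!1 +' #2 <= #4 -' #1) ((Level.area≡ (Orbit.at sp hi ei)) , a′ , ax , tt)) ,
       trans (cong (_>>= up) ei) e

   partition : IsPartition (Bounded n d ℓ) (BoundedSpecial n d ℓ) (String ℓ)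
   partition = record
     { nonempty = λ {s} sp → s , 0 , (lia ((area s) & (ℓ) & []) (#0 <= #1 & []) (!0 <= #1 -' #0) ((snd (snd sp)) , tt)) , refl
     ; within   = λ {s} sp {x} (i , h , e) → inside sp h (Orbit.at sp h e)
     ; covers   = λ {x} b → covers ∣ area x ∣ (ℤ.≤-reflexive (sym (ℤ.0≤i⇒+∣i∣≡i (nonneg-area (snd (snd (fst b))))))) b
     ; disjoint = λ sp tp (i , h , e) (j , k , f) → disjoint sp tp i j h k e f }
     where
     inside : ∀ {s x i} → BoundedSpecial n d ℓ s → + i ≤ ℓ - area s → Level (area s + + i) x → Bounded n d ℓ x
     inside {s} {x} {i} sp h (level dy sz df a) = dy , sz , df , (lia ((area x) & (area s) & (+ i) & (ℓ) & []) (#0 == #1 +' #2 & #2 <= #3 -' #1 & []) (#0 <= #3) (a , h , tt))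

open import Defs
open import Data.Nat using (ℕ)
open import Data.Nat.Combinatorics using (_C_)
open import Data.Integer using (ℤ; +_; _-_; _≤_; _/ℕ_)
open import Data.Product using (_×_; _,_)
open Final using (stringLike; module Strings)

proposition5p34 : (n : ℕ) → 4 Data.Nat.≤ n → (d : ℤ) → d ≤ + (2 Data.Nat.* n) - + 8 →
    let ℓ = (+ (n C 2) - d) /ℕ 2 in
    (∀ s → BoundedSpecial n d ℓ s → StringDefined ℓ s)
    × IsPartition (Bounded n d ℓ) (BoundedSpecial n d ℓ) (String ℓ)
proposition5p34 n 4≤n d d≤ = (λ s sp i h → let x , e , _ = Orbit.orbit sp i h in x , e) , partition
  where open Strings n (stringLike n 4≤n) d d≤
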